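{- For any Turing degree $\mathbf d$ with $\mathbf 0<\mathbf d<\mathbf 0'$, there is a theory $U$ such that $\mathsf{G1}$ holds for $U$, $U$ is interpretable in $\mathbf R$, and $U$ has Turing degree $\mathbf d$.
   Context: Theories are identified with the sets of Gödel numbers of their sentences, so they have Turing degrees. $\mathbf R$ is Robinson's theory in language $\{\mathbf 0,\mathbf S,+,\cdot,\le\}$ ($\le$ primitive, $\overline n=\mathbf S^n\mathbf 0$) with schemes $\overline m+\overline n=\overline{m+n}$; $\overline m\cdot\overline n=\overline{m\cdot n}$; $\overline m\neq\overline n$ for $m\neq n$; $\forall x(x\le\overline n\to x=\overline 0\vee\dots\vee x=\overline n)$; $\forall x(x\le\overline n\vee\overline n\le x)$. Interpretability is the usual relative interpretation of theories. "$\mathsf{G1}$ holds for $U$": $U$ is recursively axiomatizable and consistent, and for every recursively axiomatizable consistent theory $S$, if $U$ is interpretable in $S$ then $S$ is incomplete.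
   Formalization: If d is an r.e. degree, U is closed under deduction and its set of theorems has degree d; for other d (where a recursively axiomatizable closed theory, being r.e., cannot have degree d) U is only a set of sentences, not required to be closed, having degree d. -}

module Defs where

open import Level using (0ℓ)
open import Data.Bool using (Bool; true; false; T)
open import Data.Fin using (Fin; zero; suc; toℕ; _↑ˡ_; _↑ʳ_)
open import Data.List using (List; []; _∷_; map)
open import Data.List.Membership.Propositional using (_∈_)
open import Data.List.Relation.Unary.All using (All)
open import Data.Nat using (ℕ; zero; suc; _+_; _*_; _<_)
open import Data.Product using (Σ-syntax; ∃-syntax; _×_; _,_)
open import Data.Unit using (tt)
open import Data.Vec using (Vec; []; _∷_; lookup)
import Data.Vec.Functional as F
open import Function using (_∘_; _⇔_)
open import Relation.Binary.PropositionalEquality using (_≡_)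
open import Relation.Nullary using (¬_)
open import Relation.Unary using (Pred; ∅)

triangle : ℕ → ℕ
triangle zero    = 0
triangle (suc n) = suc n + triangle n

pair : ℕ → ℕ → ℕ
pair x y = triangle (x + y) + y

-- Indices of partial recursive functions with one oracle.
data Code : ℕ → Set where
  zeroᶜ  : Code 0
  sucᶜ   : Code 1
  oracle : Code 1
  proj   : ∀ {n} → Fin n → Code n
  comp   : ∀ {n k} → Code k → Vec (Code n) k → Code n
  prec   : ∀ {n} → Code n → Code (2 + n) → Code (1 + n)
  μ      : ∀ {n} → Code (1 + n) → Code n

-- A ∣ c · xs ⇓ y : the function with index c, relative to the oracle A,
-- is defined at xs with value y.
mutual
  data _∣_·_⇓_ (A : Pred ℕ 0ℓ) : ∀ {n} → Code n → Vec ℕ n → ℕ → Set where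
    zero⇓  : A ∣ zeroᶜ · [] ⇓ 0
    suc⇓   : ∀ {x} → A ∣ sucᶜ · (x ∷ []) ⇓ suc x
    yes⇓   : ∀ {x} → A x → A ∣ oracle · (x ∷ []) ⇓ 1
    no⇓    : ∀ {x} → ¬ A x → A ∣ oracle · (x ∷ []) ⇓ 0
    proj⇓  : ∀ {n} {i : Fin n} {xs} → A ∣ proj i · xs ⇓ lookup xs i
    comp⇓  : ∀ {n k} {c : Code k} {ds : Vec (Code n) k} {xs ys z} →
             A ∣ ds ·· xs ⇓ ys → A ∣ c · ys ⇓ z → A ∣ comp c ds · xs ⇓ z
    precZ⇓ : ∀ {n} {c : Code n} {d xs y} →
             A ∣ c · xs ⇓ y → A ∣ prec c d · (0 ∷ xs) ⇓ y
    precS⇓ : ∀ {n} {c : Code n} {d m xs y z} →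
             A ∣ prec c d · (m ∷ xs) ⇓ y → A ∣ d · (m ∷ y ∷ xs) ⇓ z →
             A ∣ prec c d · (suc m ∷ xs) ⇓ z
    μ⇓     : ∀ {n} {c : Code (1 + n)} {xs y} →
             A ∣ c · (y ∷ xs) ⇓ 0 →
             (∀ m → m < y → ∃[ v ] A ∣ c · (m ∷ xs) ⇓ suc v) →
             A ∣ μ c · xs ⇓ y

  data _∣_··_⇓_ (A : Pred ℕ 0ℓ) {n} : ∀ {k} → Vec (Code n) k → Vec ℕ n → Vec ℕ k → Set where
    []⇓  : ∀ {xs} → A ∣ [] ·· xs ⇓ []
    _∷⇓_ : ∀ {k c xs y} {cs : Vec (Code n) k} {ys} →
           A ∣ c · xs ⇓ y → A ∣ cs ·· xs ⇓ ys → A ∣ (c ∷ cs) ·· xs ⇓ (y ∷ ys)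

mutual
  ⌜_⌝ᶜ : ∀ {n} → Code n → ℕ
  ⌜ zeroᶜ ⌝ᶜ             = pair 0 0
  ⌜ sucᶜ ⌝ᶜ              = pair 1 0
  ⌜ oracle ⌝ᶜ            = pair 2 0
  ⌜ proj i ⌝ᶜ            = pair 3 (toℕ i)
  ⌜ comp {k = k} c ds ⌝ᶜ = pair 4 (pair k (pair ⌜ c ⌝ᶜ ⌜ ds ⌝ᶜˢ))
  ⌜ prec c d ⌝ᶜ          = pair 5 (pair ⌜ c ⌝ᶜ ⌜ d ⌝ᶜ)
  ⌜ μ c ⌝ᶜ               = pair 6 ⌜ c ⌝ᶜ

  ⌜_⌝ᶜˢ : ∀ {n k} → Vec (Code n) k → ℕ
  ⌜ [] ⌝ᶜˢ     = 0
  ⌜ c ∷ cs ⌝ᶜˢ = pair ⌜ c ⌝ᶜ ⌜ cs ⌝ᶜˢ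

infix 4 _≤ᵀ_ _<ᵀ_ _≡ᵀ_

-- Some index computes the characteristic function of A from the oracle B.
_≤ᵀ_ : Pred ℕ 0ℓ → Pred ℕ 0ℓ → Set
A ≤ᵀ B = Σ[ c ∈ Code 1 ]
           (∀ x → A x → B ∣ c · (x ∷ []) ⇓ 1) × (∀ x → ¬ A x → B ∣ c · (x ∷ []) ⇓ 0)

-- A Turing degree is represented by any of its members, equality of degrees
-- being _≡ᵀ_ and the strict order of degrees being _<ᵀ_.
_<ᵀ_ : Pred ℕ 0ℓ → Pred ℕ 0ℓ → Set
A <ᵀ B = A ≤ᵀ B × ¬ (B ≤ᵀ A)

_≡ᵀ_ : Pred ℕ 0ℓ → Pred ℕ 0ℓ → Set
A ≡ᵀ B = A ≤ᵀ B × B ≤ᵀ A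

Recursive : Pred ℕ 0ℓ → Set
Recursive A = A ≤ᵀ ∅

-- The Turing jump; ∅ ′ represents the degree 0′.
_′ : Pred ℕ 0ℓ → Pred ℕ 0ℓ
(A ′) e = Σ[ c ∈ Code 1 ] (⌜ c ⌝ᶜ ≡ e × ∃[ y ] A ∣ c · (e ∷ []) ⇓ y)

-- The recursively enumerable set with index c.
W : Code 1 → Pred ℕ 0ℓ
W c x = ∃[ y ] ∅ ∣ c · (x ∷ []) ⇓ y

HasREDegree : Pred ℕ 0ℓ → Set
HasREDegree A = Σ[ c ∈ Code 1 ] A ≡ᵀ W c

-- hasFun k i ≡ true when the i-th k-ary function symbol is in the language;
-- constants are the 0-ary function symbols.
record Language : Set where
  field
    hasFun hasRel : ℕ → ℕ → Bool

  FunSym RelSym : ℕ → Set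
  FunSym k = Σ[ i ∈ ℕ ] T (hasFun k i)
  RelSym k = Σ[ i ∈ ℕ ] T (hasRel k i)

open Language

RecursiveLanguage : Language → Set
RecursiveLanguage L = Recursive (codes (hasFun L)) × Recursive (codes (hasRel L))
  where
  codes : (ℕ → ℕ → Bool) → Pred ℕ 0ℓ
  codes p m = ∃[ k ] ∃[ i ] (T (p k i) × pair k i ≡ m)

data Term (L : Language) (n : ℕ) : Set where
  var : Fin n → Term L n
  fun : ∀ {k} → FunSym L k → Vec (Term L n) k → Term L n

infix  7 _≐_
infixr 4 _⇒_

-- Formulas with free variables in Fin n, in de Bruijn style.
data Formula (L : Language) : ℕ → Set where
  _≐_ : ∀ {n} → Term L n → Term L n → Formula L n
  rel : ∀ {n k} → RelSym L k → Vec (Term L n) k → Formula L n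
  ⊥̇   : ∀ {n} → Formula L n
  _⇒_ : ∀ {n} → Formula L n → Formula L n → Formula L n
  ∀̇   : ∀ {n} → Formula L (suc n) → Formula L n

Sentence : Language → Set
Sentence L = Formula L 0

module _ {L : Language} where

  infixr 6 _∧̇_
  infixr 5 _∨̇_

  ¬̇ : ∀ {n} → Formula L n → Formula L n
  ¬̇ φ = φ ⇒ ⊥̇

  ⊤̇ : ∀ {n} → Formula L n
  ⊤̇ = ¬̇ ⊥̇

  _∧̇_ _∨̇_ : ∀ {n} → Formula L n → Formula L n → Formula L n
  φ ∧̇ ψ = ¬̇ (φ ⇒ ¬̇ ψ)
  φ ∨̇ ψ = ¬̇ φ ⇒ ψ

  ∃̇ : ∀ {n} → Formula L (suc n) → Formula L n
  ∃̇ φ = ¬̇ (∀̇ (¬̇ φ))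

  mutual
    renameᵗ : ∀ {m n} → (Fin m → Fin n) → Term L m → Term L n
    renameᵗ ρ (var x)    = var (ρ x)
    renameᵗ ρ (fun f ts) = fun f (renameᵗˢ ρ ts)

    renameᵗˢ : ∀ {m n k} → (Fin m → Fin n) → Vec (Term L m) k → Vec (Term L n) k
    renameᵗˢ ρ []       = []
    renameᵗˢ ρ (t ∷ ts) = renameᵗ ρ t ∷ renameᵗˢ ρ ts

  rename : ∀ {m n} → (Fin m → Fin n) → Formula L m → Formula L n
  rename ρ (s ≐ t)    = renameᵗ ρ s ≐ renameᵗ ρ t
  rename ρ (rel r ts) = rel r (renameᵗˢ ρ ts)
  rename ρ ⊥̇          = ⊥̇
  rename ρ (φ ⇒ ψ)    = rename ρ φ ⇒ rename ρ ψ
  rename ρ (∀̇ φ)      = ∀̇ (rename (zero F.∷ suc ∘ ρ) φ)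

  mutual
    substᵗ : ∀ {m n} → (Fin m → Term L n) → Term L m → Term L n
    substᵗ σ (var x)    = σ x
    substᵗ σ (fun f ts) = fun f (substᵗˢ σ ts)

    substᵗˢ : ∀ {m n k} → (Fin m → Term L n) → Vec (Term L m) k → Vec (Term L n) k
    substᵗˢ σ []       = []
    substᵗˢ σ (t ∷ ts) = substᵗ σ t ∷ substᵗˢ σ ts

  subst : ∀ {m n} → (Fin m → Term L n) → Formula L m → Formula L n
  subst σ (s ≐ t)    = substᵗ σ s ≐ substᵗ σ t
  subst σ (rel r ts) = rel r (substᵗˢ σ ts)
  subst σ ⊥̇          = ⊥̇
  subst σ (φ ⇒ ψ)    = subst σ φ ⇒ subst σ ψ
  subst σ (∀̇ φ)      = ∀̇ (subst (var zero F.∷ renameᵗ suc ∘ σ) φ)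

  _[_] : ∀ {n} → Formula L (suc n) → Term L n → Formula L n
  φ [ t ] = subst (t F.∷ var) φ

  infix 3 _⊢_

  data _⊢_ : ∀ {n} → List (Formula L n) → Formula L n → Set where
    hyp      : ∀ {n Γ} {φ : Formula L n} → φ ∈ Γ → Γ ⊢ φ
    ⇒-intro  : ∀ {n Γ} {φ ψ : Formula L n} → φ ∷ Γ ⊢ ψ → Γ ⊢ φ ⇒ ψ
    ⇒-elim   : ∀ {n Γ} {φ ψ : Formula L n} → Γ ⊢ φ ⇒ ψ → Γ ⊢ φ → Γ ⊢ ψ
    raa      : ∀ {n Γ} {φ : Formula L n} → ¬̇ φ ∷ Γ ⊢ ⊥̇ → Γ ⊢ φ
    ∀-intro  : ∀ {n Γ} {φ : Formula L (suc n)} → map (rename suc) Γ ⊢ φ → Γ ⊢ ∀̇ φ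
    ∀-elim   : ∀ {n Γ} {φ : Formula L (suc n)} → Γ ⊢ ∀̇ φ → (t : Term L n) → Γ ⊢ φ [ t ]
    ≐-refl   : ∀ {n Γ} (t : Term L n) → Γ ⊢ t ≐ t
    ≐-subst  : ∀ {n Γ} {s t : Term L n} (φ : Formula L (suc n)) →
               Γ ⊢ s ≐ t → Γ ⊢ φ [ s ] → Γ ⊢ φ [ t ]
    -- A fresh variable may be discarded: domains are nonempty, which scoped
    -- syntax would not force in a language without constants.
    nonempty : ∀ {n Γ} {φ : Formula L n} → map (rename suc) Γ ⊢ rename suc φ → Γ ⊢ φ

  mutual
    ⌜_⌝ᵗ : ∀ {n} → Term L n → ℕ
    ⌜ var x ⌝ᵗ                = pair 0 (toℕ x)
    ⌜ fun {k = k} (i , _) ts ⌝ᵗ = pair 1 (pair k (pair i ⌜ ts ⌝ᵗˢ))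

    ⌜_⌝ᵗˢ : ∀ {n k} → Vec (Term L n) k → ℕ
    ⌜ [] ⌝ᵗˢ     = 0
    ⌜ t ∷ ts ⌝ᵗˢ = pair ⌜ t ⌝ᵗ ⌜ ts ⌝ᵗˢ

  ⌜_⌝ : ∀ {n} → Formula L n → ℕ
  ⌜ s ≐ t ⌝                  = pair 0 (pair ⌜ s ⌝ᵗ ⌜ t ⌝ᵗ)
  ⌜ rel {k = k} (i , _) ts ⌝ = pair 1 (pair k (pair i ⌜ ts ⌝ᵗˢ))
  ⌜ ⊥̇ ⌝                      = pair 2 0
  ⌜ φ ⇒ ψ ⌝                  = pair 3 (pair ⌜ φ ⌝ ⌜ ψ ⌝)
  ⌜ ∀̇ φ ⌝                    = pair 4 ⌜ φ ⌝

  gödelNumbers : Pred (Sentence L) 0ℓ → Pred ℕ 0ℓ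
  gödelNumbers X m = Σ[ φ ∈ Sentence L ] (X φ × ⌜ φ ⌝ ≡ m)

  Theorems : Pred (Sentence L) 0ℓ → Pred (Sentence L) 0ℓ
  Theorems X φ = ∃[ Γ ] (All X Γ × Γ ⊢ φ)

-- A theory is a set of sentences of its language, not necessarily closed
-- under deduction.  The Gödel numbers of a recursively axiomatizable theory
-- that is closed form a recursively enumerable set, so such a theory has an
-- r.e. degree; without closure every degree can occur.
record Theory : Set₁ where
  field
    lang      : Language
    sentences : Pred (Sentence lang) 0ℓ

  Proves : Sentence lang → Set
  Proves = Theorems sentences

open Theory

-- A representative of the Turing degree of U.
degree : Theory → Pred ℕ 0ℓ
degree U = gödelNumbers (sentences U)

DeductivelyClosed Consistent Incomplete : Theory → Set
DeductivelyClosed U = ∀ φ → Proves U φ → sentences U φ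
Consistent        U = ¬ Proves U ⊥̇
Incomplete        U = Σ[ φ ∈ Sentence (lang U) ] (¬ Proves U φ × ¬ Proves U (¬̇ φ))

RecursivelyAxiomatizable : Theory → Set₁
RecursivelyAxiomatizable U =
  RecursiveLanguage (lang U) ×
  Σ[ X ∈ Pred (Sentence (lang U)) 0ℓ ]
    (Recursive (gödelNumbers X) × (∀ φ → Theorems X φ ⇔ Proves U φ))

-- One-dimensional, parameter-free translations, with a domain formula and
-- with equality translated by a formula.
record Translation (L M : Language) : Set where
  field
    dom  : Formula M 1
    eq   : Formula M 2
    relᴵ : ∀ {k} → RelSym L k → Formula M k
    -- In funᴵ f the variable zero is the value, suc i the i-th argument.
    funᴵ : ∀ {k} → FunSym L k → Formula M (suc k)

  infix 7 _≈_

  δ : ∀ {n} → Fin n → Formula M n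
  δ x = rename (λ _ → x) dom

  _≈_ : ∀ {n} → Fin n → Fin n → Formula M n
  x ≈ y = rename (x F.∷ y F.∷ F.[]) eq

  ∀δ ∃δ : ∀ {n} → Formula M (suc n) → Formula M n
  ∀δ φ = ∀̇ (δ zero ⇒ φ)
  ∃δ φ = ∃̇ (δ zero ∧̇ φ)

  ∃δs : ∀ k {n} → Formula M (k + n) → Formula M n
  ∃δs zero    φ = φ
  ∃δs (suc k) φ = ∃δs k (∃δ φ)

  ∀δ-closure : ∀ {n} → Formula M n → Sentence M
  ∀δ-closure {zero}  φ = φ
  ∀δ-closure {suc n} φ = ∀δ-closure (∀δ φ)

  -- value t ρ y says that y is the value of t when its variables are read
  -- as ρ; nested terms are thereby unravelled into conditions f(z̄) = y.
  mutual
    value : ∀ {m n} → Term L m → (Fin m → Fin n) → Fin n → Formula M n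
    value (var x)            ρ y = ρ x ≈ y
    value {n = n} (fun {k = k} f ts) ρ y =
      ∃δs k (values ts ((k ↑ʳ_) ∘ ρ) (_↑ˡ n) ∧̇ rename ((k ↑ʳ y) F.∷ (_↑ˡ n)) (funᴵ f))

    values : ∀ {m n k} → Vec (Term L m) k → (Fin m → Fin n) → (Fin k → Fin n) → Formula M n
    values []       ρ z = ⊤̇
    values (t ∷ ts) ρ z = value t ρ (z zero) ∧̇ values ts ρ (z ∘ suc)

  translateAtom : ∀ {n k} → Formula M k → Vec (Term L n) k → Formula M n
  translateAtom {n} {k} α ts = ∃δs k (values ts (k ↑ʳ_) (_↑ˡ n) ∧̇ rename (_↑ˡ n) α)

  translate : ∀ {n} → Formula L n → Formula M n
  translate (s ≐ t)    = translateAtom eq (s ∷ t ∷ [])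
  translate (rel r ts) = translateAtom (relᴵ r) ts
  translate ⊥̇          = ⊥̇
  translate (φ ⇒ ψ)    = translate φ ⇒ translate ψ
  translate (∀̇ φ)      = ∀δ (translate φ)

  pointwise≈ : ∀ {k n} → (Fin k → Fin n) → (Fin k → Fin n) → Formula M n
  pointwise≈ {zero}  x y = ⊤̇
  pointwise≈ {suc k} x y = x zero ≈ y zero ∧̇ pointwise≈ (x ∘ suc) (y ∘ suc)

  congruence : ∀ {k} → Formula M k → Sentence M
  congruence {k} α = ∀δ-closure {k + k}
    (pointwise≈ (_↑ˡ k) (k ↑ʳ_) ⇒ rename (_↑ˡ k) α ⇒ rename (k ↑ʳ_) α)

open Translation

record IsInterpretation (U S : Theory) (I : Translation (lang U) (lang S)) : Set where
  field
    dom-nonempty : Proves S (∃̇ (dom I))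
    eq-refl      : Proves S (∀δ-closure I {1} (_≈_ I zero zero))
    eq-sym       : Proves S (∀δ-closure I {2} (_≈_ I zero (suc zero) ⇒ _≈_ I (suc zero) zero))
    eq-trans     : Proves S (∀δ-closure I {3}
                     (_≈_ I zero (suc zero) ⇒ _≈_ I (suc zero) (suc (suc zero)) ⇒ _≈_ I zero (suc (suc zero))))
    rel-cong     : ∀ {k} (r : RelSym (lang U) k) → Proves S (congruence I (relᴵ I r))
    fun-cong     : ∀ {k} (f : FunSym (lang U) k) → Proves S (congruence I (funᴵ I f))
    fun-total    : ∀ {k} (f : FunSym (lang U) k) → Proves S (∀δ-closure I (∃δ I (funᴵ I f)))
    fun-unique   : ∀ {k} (f : FunSym (lang U) k) → Proves S (∀δ-closure I {2 + k}
                     (rename (zero F.∷ λ i → suc (suc i)) (funᴵ I f) ⇒ rename suc (funᴵ I f) ⇒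
                      _≈_ I zero (suc zero)))
    sound        : ∀ φ → sentences U φ → Proves S (translate I φ)

_InterpretableIn_ : Theory → Theory → Set
U InterpretableIn S = Σ[ I ∈ Translation (lang U) (lang S) ] IsInterpretation U S I

G1HoldsFor : Theory → Set₁
G1HoldsFor U =
  RecursivelyAxiomatizable U × Consistent U ×
  (∀ S → RecursivelyAxiomatizable S → Consistent S → U InterpretableIn S → Incomplete S)

L-R : Language
L-R = record { hasFun = hasFunR ; hasRel = hasRelR }
  where
  hasFunR hasRelR : ℕ → ℕ → Bool
  hasFunR 0 0 = true
  hasFunR 1 0 = true
  hasFunR 2 0 = true
  hasFunR 2 1 = true
  hasFunR _ _ = false
  hasRelR 2 0 = true
  hasRelR _ _ = false

module _ {n : ℕ} where

  infixl 8 _+̇_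
  infixl 9 _·̇_
  infix  7 _≤̇_

  0̇ : Term L-R n
  0̇ = fun (0 , tt) []

  Ṡ : Term L-R n → Term L-R n
  Ṡ t = fun (0 , tt) (t ∷ [])

  _+̇_ _·̇_ : Term L-R n → Term L-R n → Term L-R n
  s +̇ t = fun (0 , tt) (s ∷ t ∷ [])
  s ·̇ t = fun (1 , tt) (s ∷ t ∷ [])

  _≤̇_ : Term L-R n → Term L-R n → Formula L-R n
  s ≤̇ t = rel (0 , tt) (s ∷ t ∷ [])

  num : ℕ → Term L-R n
  num zero    = 0̇
  num (suc m) = Ṡ (num m)

  -- t = 0 ∨ … ∨ t = m
  oneOfUpTo : Term L-R n → ℕ → Formula L-R n
  oneOfUpTo t zero    = t ≐ num 0
  oneOfUpTo t (suc m) = oneOfUpTo t m ∨̇ t ≐ num (suc m)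

data AxiomR : Pred (Sentence L-R) 0ℓ where
  R1 : ∀ m n → AxiomR (num m +̇ num n ≐ num (m + n))
  R2 : ∀ m n → AxiomR (num m ·̇ num n ≐ num (m * n))
  R3 : ∀ m n → ¬ (m ≡ n) → AxiomR (¬̇ (num m ≐ num n))
  R4 : ∀ n → AxiomR (∀̇ (var zero ≤̇ num n ⇒ oneOfUpTo (var zero) n))
  R5 : ∀ n → AxiomR (∀̇ (var zero ≤̇ num n ∨̇ num n ≤̇ var zero))

R : Theory
R = record { lang = L-R ; sentences = AxiomR }

{-# OPTIONS --safe #-}
-- Let W be a nonrecursive r.e. set, of degree d if d is an r.e. degree.  Put e ∙ x into
-- B, when x enters W, if the computation of the index e at e ∙ x has by then been seen to
-- give 1, and into A otherwise.  A recursive separation of A and B would tell by which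
-- stage x must have entered W, so A and B are recursively inseparable; both are recursive
-- in W, and W is reducible to A through an index that is nowhere defined.
--
-- The theory speaks about an equivalence relation with at most one class of each finite
-- size; it says that there is a class of size n + 1 for n in A, and none for n in B.  If a
-- complete r.e. theory interprets it, the translations of these sentences separate A and
-- B.  In R, the numbers cell n i with i ≤ n are put into one class exactly when a Rosser
-- formula for n ∈ A against n ∈ B holds, and everything else into one infinite class; the
-- definition is guarded so that a nonstandard n only produces infinite classes.
--
-- An Ehrenfeucht–Fraïssé game shows that a sentence φ of quantifier depth q is decided by
-- the existence of classes of sizes up to q.  So φ is not a theorem if and only if, for some
-- choice of these truth values that is compatible with A and B, the theory proves that the
-- choice implies ¬ φ; hence the set of theorems is recursive in W.  When d is not an r.e.
-- degree, take any W and add provable sentences that code d to a recursive set of axioms.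
--
-- All r.e. facts needed here (evaluation of indices, derivability, being no formula) are
-- given by Horn programs.  A derivation is a finite set, coded by divisibility, with a
-- property expressed by a bounded formula, which is decidable and absolute for models of R.
module Submission where

open import Defs
open import Level using (0ℓ)
open import Axiom.ExcludedMiddle using (ExcludedMiddle)
open import Data.Bool using (Bool; true; false; T)
open import Data.Bool.Properties using (T-irrelevant)
open import Data.Empty using (⊥)
open import Data.Fin using (Fin; zero; suc; toℕ; fromℕ; fromℕ<; inject₁; inject≤; #_; _↑ˡ_; _↑ʳ_)
open import Data.Fin.Properties using (toℕ-injective; toℕ<n; toℕ-fromℕ; toℕ-fromℕ<; toℕ-inject₁; toℕ-↑ˡ; inject≤-injective; pigeonhole; injective⇒≤) renaming (_≟_ to _≟ᶠ_; <⇒≢ to <ᶠ⇒≢)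
open import Data.List using (List; []; _∷_; _++_; map; length)
import Data.List as L
open import Data.List.Properties using (map-++; map-∘; map-cong; map-id)
open import Data.List.Membership.Propositional using (_∈_)
open import Data.List.Membership.Propositional.Properties using (∈-++⁺ˡ; ∈-++⁺ʳ; ∈-++⁻; ∈-map⁺; ∈-map⁻; ∈-lookup; ∈-tabulate⁺)
open import Data.List.Relation.Unary.All using (All; []; _∷_)
import Data.List.Relation.Unary.All as All
open import Data.List.Relation.Unary.All.Properties using () renaming (++⁺ to All-++⁺; tabulate⁺ to All-tabulate⁺)
open import Data.List.Relation.Unary.Any using (here; there)
open import Data.Nat
open import Data.Nat.Coprimality using (Coprime; coprime-divisor) renaming (sym to coprime-sym)
open import Data.Nat.Divisibility using (_∣_; divides; ∣-trans; ∣m+n∣m⇒∣n; ∣n⇒∣m*n; ∣1⇒≡1; m≤n⇒m!∣n!; m∣m*n)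
open import Data.Nat.Properties
open import Data.List.Membership.DecPropositional _≟_ using (_∈?_)
open import Data.Product using (Σ-syntax; ∃-syntax; _×_; _,_; proj₁; proj₂; map₂; swap)
open import Data.Sum using (_⊎_; inj₁; inj₂; [_,_]′)
import Data.Sum as Sum
open import Data.Unit using (tt)
open import Data.Vec using (Vec; []; _∷_; lookup)
import Data.Vec as V
open import Data.Vec.Properties using (lookup-++ˡ; lookup-++ʳ; lookup∘tabulate; tabulate∘lookup; tabulate-∘)
import Data.Vec.Functional as F
open import Function using (_∘_; id; case_of_; mk⇔; Equivalence)
open import Relation.Binary.Definitions using (tri<; tri≈; tri>)
open import Relation.Binary.PropositionalEquality using (_≡_; _≢_; refl; sym; trans; cong; cong₂; subst₂; module ≡-Reasoning)
import Relation.Binary.PropositionalEquality as Eq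
open import Relation.Nullary using (¬_; yes; no; contradiction)
open import Relation.Unary using (Pred; ∅)

-- Two demands pull against each other. Every consistent recursively axiomatized theory that
-- interprets the theory must be incomplete, while its own theorems must stay below degree 0′; a
-- consistent r.e. theory as strong as R has theorems of degree 0′ already. A recursively
-- inseparable pair can have any nonzero r.e. degree and still forces incompleteness. What remains
-- is to find a theory whose theorems carry no information beyond such a pair. Class sizes serve for
-- this: with at most one class of each size, the only facts visible to a sentence are which small
-- classes exist, and the infinitely many classes given by A provide enough large ones in every
-- game. In R nothing is known about nonstandard elements; the order need not even be transitive
-- there. So no derivation in R is ever written down: statements are checked in all models of R, and
-- the completeness theorem turns them into proofs. In such a model the Rosser formula can hold of a
-- nonstandard n, and the translation must then not create a new finite class.

-- The pairing function and codes of finite sets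

module Pairing where

  triangle-mono : ∀ {m n} → m ≤ n → triangle m ≤ triangle n
  triangle-mono z≤n                       = z≤n
  triangle-mono {suc m} {suc n} (s≤s m≤n) = +-mono-≤ (s≤s m≤n) (triangle-mono m≤n)

  n≤triangle : ∀ n → n ≤ triangle n
  n≤triangle zero    = z≤n
  n≤triangle (suc n) = m≤m+n (suc n) (triangle n)

  2*triangle : ∀ n → 2 * triangle n ≡ n * (n + 1)
  2*triangle zero    = refl
  2*triangle (suc n) = begin
    2 * (suc n + triangle n)       ≡⟨ *-distribˡ-+ 2 (suc n) (triangle n) ⟩
    2 * suc n + 2 * triangle n     ≡⟨ cong (2 * suc n +_) (2*triangle n) ⟩
    2 * suc n + n * (n + 1)        ≡⟨ cong (λ z → 2 * suc n + n * z) (+-comm n 1) ⟩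
    2 * suc n + n * suc n          ≡⟨ *-distribʳ-+ (suc n) 2 n ⟨
    (2 + n) * suc n                ≡⟨ *-comm (2 + n) (suc n) ⟩
    suc n * (2 + n)                ≡⟨ cong (λ z → suc n * suc z) (+-comm 1 n) ⟩
    suc n * (suc n + 1)            ∎
    where open ≡-Reasoning

  -- The pairing function is opaque so that codes are compared argumentwise
  -- instead of being unfolded to numerals.
  infixr 6 _∙_
  opaque
    _∙_ : ℕ → ℕ → ℕ
    x ∙ y = pair x y

    ∙≡pair : ∀ x y → x ∙ y ≡ pair x y
    ∙≡pair x y = refl

    private
      -- Pairs with sum s have their codes between `triangle s` and `triangle s + s`, and the next
      -- block starts at `triangle (suc s)`. So a larger sum would give a larger code.
      sum-≤ : ∀ x y x′ y′ → pair x y ≡ pair x′ y′ → x + y ≤ x′ + y′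
      sum-≤ x y x′ y′ eq with x + y ≤? x′ + y′
      ... | yes p = p
      ... | no ¬p = contradiction eq (>⇒≢ (begin-strict
        triangle (x′ + y′) + y′                 <⟨ +-monoʳ-< (triangle (x′ + y′)) (s≤s (m≤n+m y′ x′)) ⟩
        triangle (x′ + y′) + suc (x′ + y′)      ≡⟨ +-comm (triangle (x′ + y′)) _ ⟩
        triangle (suc (x′ + y′))                ≤⟨ triangle-mono (≰⇒> ¬p) ⟩
        triangle (x + y)                        ≤⟨ m≤m+n _ y ⟩
        triangle (x + y) + y                    ∎))
        where open ≤-Reasoning

      same-sum : ∀ x y x′ y′ → pair x y ≡ pair x′ y′ → x + y ≡ x′ + y′
      same-sum x y x′ y′ eq = ≤-antisym (sum-≤ x y x′ y′ eq) (sum-≤ x′ y′ x y (sym eq))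

    ∙-injʳ : ∀ {x y x′ y′} → x ∙ y ≡ x′ ∙ y′ → y ≡ y′
    ∙-injʳ {x} {y} {x′} {y′} eq = +-cancelˡ-≡ (triangle (x + y)) y y′
      (trans eq (cong (λ z → triangle z + y′) (sym (same-sum x y x′ y′ eq))))

    ∙-injˡ : ∀ {x y x′ y′} → x ∙ y ≡ x′ ∙ y′ → x ≡ x′
    ∙-injˡ {x} {y} {x′} {y′} eq = +-cancelʳ-≡ y x x′
      (trans (same-sum x y x′ y′ eq) (cong (x′ +_) (sym (∙-injʳ {x} {y} {x′} {y′} eq))))

    m≤m∙n : ∀ x y → x ≤ x ∙ y
    m≤m∙n x y = ≤-trans (m≤m+n x y) (≤-trans (n≤triangle (x + y)) (m≤m+n _ y))

    n≤m∙n : ∀ x y → y ≤ x ∙ y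
    n≤m∙n x y = m≤n+m y (triangle (x + y))

    -- With first component 0 strictness can fail, since `0 ∙ 0` is 0. Positive tags make it
    -- available, and recursion on the codes of implications and quantifications relies on it.
    n<1+m∙n : ∀ x y → y < suc x ∙ y
    n<1+m∙n x y = m<n+m y {triangle (suc x + y)} (s≤s z≤n)

    -- Doubling removes the division hidden in the triangular numbers. The graph of pairing becomes
    -- an equation of polynomials, which an atom of a bounded formula can state.
    2∙ : ∀ x y → 2 * (x ∙ y) ≡ (x + y) * (x + y + 1) + 2 * y
    2∙ x y = trans (*-distribˡ-+ 2 (triangle (x + y)) y) (cong (_+ 2 * y) (2*triangle (x + y)))

    unpair : ∀ z → Σ[ x ∈ ℕ ] Σ[ y ∈ ℕ ] x ∙ y ≡ z
    unpair zero    = 0 , 0 , refl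
    unpair (suc z) with unpair z
    ... | suc x , y , eq = x , suc y , trans (cong (λ s → triangle s + suc y) (+-suc x y))
                                       (trans (+-suc _ y) (cong suc eq))
    ... | zero  , y , eq = suc y , 0 , trans (+-identityʳ _)
        (trans (cong (λ s → suc s + triangle s) (+-identityʳ y))
               (cong suc (trans (+-comm y (triangle y)) eq)))

  ∙-cancel : ∀ {x y x′ y′} → x ∙ y ≡ x′ ∙ y′ → x ≡ x′ × y ≡ y′
  ∙-cancel eq = ∙-injˡ eq , ∙-injʳ eq

  2∙⁻¹ : ∀ x y z → 2 * z ≡ (x + y) * (x + y + 1) + 2 * y → z ≡ x ∙ y
  2∙⁻¹ x y z eq = *-cancelˡ-≡ z (x ∙ y) 2 (trans eq (sym (2∙ x y)))

  -- p belongs to the set coded by a and c when 1 + (p + 1) c divides a; if c is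
  -- divisible by all positive numbers up to N, these moduli are pairwise coprime
  -- for p ≤ N, so a product of moduli codes exactly the set of its factors.
  modulus : ℕ → ℕ → ℕ
  modulus c p = 1 + (p + 1) * c

  MemberOf : ℕ → ℕ → ℕ → Set
  MemberOf a c p = Σ[ q ∈ ℕ ] (q ≤ a × q * modulus c p ≡ a)

  module _ (N : ℕ) where

    private
      c = N !

      positive∣c : ∀ k → suc k ≤ N → suc k ∣ c
      positive∣c k k<N = ∣-trans (m∣m*n (k !)) (m≤n⇒m!∣n! k<N)

      -- A common divisor d divides the difference (k + 1) c. It is coprime to c, because it divides
      -- a number of the form 1 + (p + 1) c; hence d divides k + 1. As k + 1 ≤ N, this divides c = N
      -- !, so d divides c and must be 1.
      modulus-coprime-< : ∀ p k → p + suc k ≤ N → Coprime (modulus c p) (modulus c (p + suc k))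
      modulus-coprime-< p k p+k≤N {d} (d∣₁ , d∣₂) = ∣1⇒≡1 (d∣1 d∣c)
        where
        d∣1 : d ∣ c → d ∣ 1
        d∣1 d∣c′ = ∣m+n∣m⇒∣n {m = (p + 1) * c} (Eq.subst (d ∣_) (+-comm 1 ((p + 1) * c)) d∣₁) (∣n⇒∣m*n (p + 1) d∣c′)
        difference : modulus c (p + suc k) ≡ modulus c p + suc k * c
        difference = cong suc (trans (cong (_* c) (trans (+-assoc p (suc k) 1)
          (trans (cong (p +_) (+-comm (suc k) 1)) (sym (+-assoc p 1 (suc k)))))) (*-distribʳ-+ c (p + 1) (suc k)))
        d∣kc : d ∣ c * suc k
        d∣kc = Eq.subst (d ∣_) (*-comm (suc k) c) (∣m+n∣m⇒∣n (Eq.subst (d ∣_) difference d∣₂) d∣₁)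
        coprime-dc : Coprime d c
        coprime-dc {e} (e∣d , e∣c) = ∣1⇒≡1 (∣m+n∣m⇒∣n {m = (p + 1) * c}
          (Eq.subst (e ∣_) (+-comm 1 ((p + 1) * c)) (∣-trans e∣d d∣₁)) (∣n⇒∣m*n (p + 1) e∣c))
        d∣c : d ∣ c
        d∣c = ∣-trans (coprime-divisor coprime-dc d∣kc) (positive∣c k (≤-trans (m≤n+m (suc k) p) p+k≤N))

      modulus-coprime : ∀ p p′ → p ≤ N → p′ ≤ N → p ≢ p′ → Coprime (modulus c p) (modulus c p′)
      modulus-coprime p p′ p≤N p′≤N p≢p′ with <-cmp p p′
      ... | tri< p<p′ _ _ with k , refl ← m≤n⇒∃[o]m+o≡n p<p′ =
            Eq.subst (λ z → Coprime (modulus c p) (modulus c z)) (+-suc p k)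
              (modulus-coprime-< p k (≤-trans (≤-reflexive (+-suc p k)) p′≤N))
      ... | tri≈ _ p≡p′ _ = contradiction p≡p′ p≢p′
      ... | tri> _ _ p′<p with k , refl ← m≤n⇒∃[o]m+o≡n p′<p =
            coprime-sym (Eq.subst (λ z → Coprime (modulus c p′) (modulus c z)) (+-suc p′ k)
              (modulus-coprime-< p′ k (≤-trans (≤-reflexive (+-suc p′ k)) p≤N)))

      moduli : List ℕ → ℕ
      moduli []       = 1
      moduli (p ∷ ps) = modulus c p * moduli ps

      moduli-∣ : ∀ {p ps} → p ∈ ps → modulus c p ∣ moduli ps
      moduli-∣ {p} (here refl)          = m∣m*n _
      moduli-∣ {ps = q ∷ ps} (there p∈) = ∣n⇒∣m*n (modulus c q) (moduli-∣ p∈)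

      ∣-moduli : ∀ {p} ps → (∀ {q} → q ∈ ps → q ≤ N) → p ≤ N → modulus c p ∣ moduli ps → p ∈ ps
      ∣-moduli {p} [] _ _ m∣ = contradiction (∣1⇒≡1 m∣) (λ eq → n≢0 (suc-injective eq))
        where
        n≢0 : (p + 1) * c ≢ 0
        n≢0 eq with m*n≡0⇒m≡0∨n≡0 (p + 1) eq
        ... | inj₁ z = contradiction (trans (+-comm 1 p) z) λ ()
        ... | inj₂ z = >⇒≢ (1≤n! N) z
      ∣-moduli {p} (q ∷ ps) ps≤N p≤N m∣ with p ≟ q
      ... | yes refl = here refl
      ... | no p≢q   = there (∣-moduli ps (ps≤N ∘ there) p≤N
                         (coprime-divisor (modulus-coprime p q p≤N (ps≤N (here refl)) p≢q) m∣))

    finite-set-code : ∀ ps → (∀ {q} → q ∈ ps → q ≤ N) → Σ[ a ∈ ℕ ] Σ[ c′ ∈ ℕ ]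
      ((∀ {p} → p ∈ ps → MemberOf a c′ p) × (∀ {p} → p ≤ N → MemberOf a c′ p → p ∈ ps))
    finite-set-code ps ps≤N = moduli ps , c , to , from
      where
      to : ∀ {p} → p ∈ ps → MemberOf (moduli ps) c p
      to {p} p∈ with divides q eq ← moduli-∣ p∈ =
        q , ≤-trans (m≤m*n q (modulus c p)) (≤-reflexive (sym eq)) , sym eq
      from : ∀ {p} → p ≤ N → MemberOf (moduli ps) c p → p ∈ ps
      from p≤N (q , _ , eq) = ∣-moduli ps ps≤N p≤N (divides q (sym eq))

open Pairing

-- Relative computability and decidable predicates

module Computability where

  private variable
    A B : Pred ℕ 0ℓ
    n k : ℕ

  mutual
    ⇓-functional : (c : Code n) → ∀ {xs y z} → A ∣ c · xs ⇓ y → A ∣ c · xs ⇓ z → y ≡ z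
    ⇓-functional zeroᶜ zero⇓ zero⇓ = refl
    ⇓-functional sucᶜ suc⇓ suc⇓ = refl
    ⇓-functional oracle (yes⇓ _) (yes⇓ _) = refl
    ⇓-functional oracle (yes⇓ a) (no⇓ ¬a) = contradiction a ¬a
    ⇓-functional oracle (no⇓ ¬a) (yes⇓ a) = contradiction a ¬a
    ⇓-functional oracle (no⇓ _) (no⇓ _) = refl
    ⇓-functional (proj i) proj⇓ proj⇓ = refl
    ⇓-functional (comp c ds) (comp⇓ p q) (comp⇓ p′ q′) with refl ← ⇓-functionals ds p p′ = ⇓-functional c q q′
    ⇓-functional (prec c d) {m ∷ xs} p q = prec-functional c d m p q
    ⇓-functional (μ c) {z = _} (μ⇓ {y = y} p f) (μ⇓ {y = z} q g) with <-cmp y z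
    ... | tri< y<z _ _ = contradiction (⇓-functional c p (proj₂ (g y y<z))) λ ()
    ... | tri≈ _ y≡z _ = y≡z
    ... | tri> _ _ z<y = contradiction (⇓-functional c q (proj₂ (f z z<y))) λ ()

    -- In the recursion case the index stays the same and only the first argument decreases, so
    -- uniqueness needs its own induction on that argument.
    prec-functional : (c : Code n) (d : Code (2 + n)) → ∀ m {xs y z} →
      A ∣ prec c d · (m ∷ xs) ⇓ y → A ∣ prec c d · (m ∷ xs) ⇓ z → y ≡ z
    prec-functional c d zero (precZ⇓ p) (precZ⇓ q) = ⇓-functional c p q
    prec-functional c d (suc m) (precS⇓ p p′) (precS⇓ q q′) with refl ← prec-functional c d m p q = ⇓-functional d p′ q′

    ⇓-functionals : (cs : Vec (Code n) k) → ∀ {xs ys zs} → A ∣ cs ·· xs ⇓ ys → A ∣ cs ·· xs ⇓ zs → ys ≡ zs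
    ⇓-functionals [] []⇓ []⇓ = refl
    ⇓-functionals (c ∷ cs) (p ∷⇓ ps) (q ∷⇓ qs) = cong₂ _∷_ (⇓-functional c p q) (⇓-functionals cs ps qs)

  module _ (o : Code 1) where
    mutual
      replaceOracle : Code n → Code n
      replaceOracle zeroᶜ       = zeroᶜ
      replaceOracle sucᶜ        = sucᶜ
      replaceOracle oracle      = o
      replaceOracle (proj i)    = proj i
      replaceOracle (comp c ds) = comp (replaceOracle c) (replaceOracles ds)
      replaceOracle (prec c d)  = prec (replaceOracle c) (replaceOracle d)
      replaceOracle (μ c)       = μ (replaceOracle c)

      replaceOracles : Vec (Code n) k → Vec (Code n) k
      replaceOracles []       = []
      replaceOracles (c ∷ cs) = replaceOracle c ∷ replaceOracles cs

  ≤ᵀ-trans : A ≤ᵀ B → ∀ {C} → C ≤ᵀ A → C ≤ᵀ B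
  ≤ᵀ-trans {A} {B} (o , o-yes , o-no) (c , c-yes , c-no) =
    replaceOracle o c , (λ x p → run c (c-yes x p)) , (λ x ¬p → run c (c-no x ¬p))
    where
    mutual
      run : (c : Code n) → ∀ {xs y} → A ∣ c · xs ⇓ y → B ∣ replaceOracle o c · xs ⇓ y
      run zeroᶜ zero⇓ = zero⇓
      run sucᶜ suc⇓ = suc⇓
      run oracle (yes⇓ a) = o-yes _ a
      run oracle (no⇓ ¬a) = o-no _ ¬a
      run (proj i) proj⇓ = proj⇓
      run (comp c ds) (comp⇓ p q) = comp⇓ (runs ds p) (run c q)
      run (prec c d) {m ∷ xs} p = run-prec c d m p
      run (μ c) (μ⇓ p f) = μ⇓ (run c p) (λ m m<y → proj₁ (f m m<y) , run c (proj₂ (f m m<y)))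

      run-prec : (c : Code n) (d : Code (2 + n)) → ∀ m {xs y} →
        A ∣ prec c d · (m ∷ xs) ⇓ y → B ∣ replaceOracle o (prec c d) · (m ∷ xs) ⇓ y
      run-prec c d zero (precZ⇓ p) = precZ⇓ (run c p)
      run-prec c d (suc m) (precS⇓ p q) = precS⇓ (run-prec c d m p) (run d q)

      runs : (cs : Vec (Code n) k) → ∀ {xs ys} → A ∣ cs ·· xs ⇓ ys → B ∣ replaceOracles o cs ·· xs ⇓ ys
      runs [] []⇓ = []⇓
      runs (c ∷ cs) (p ∷⇓ ps) = run c p ∷⇓ runs cs ps

  -- A total function is kept together with an index for it. Functions can then be composed and
  -- compared by their values, without returning to the runs of the indices.
  record Fn (A : Pred ℕ 0ℓ) (n : ℕ) : Set where
    constructor fn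
    field
      ⟪_⟫  : Vec ℕ n → ℕ
      code : Code n
      runs : ∀ xs → A ∣ code · xs ⇓ ⟪_⟫ xs

  open Fn public

  arg : Fin n → Fn A n
  arg i = fn (λ xs → lookup xs i) (proj i) (λ _ → proj⇓)

  infix 8 _⊚_
  _⊚_ : Fn A k → Vec (Fn A n) k → Fn A n
  _⊚_ {A} {k} {n} f gs = fn (λ xs → ⟪ f ⟫ (V.map (λ g → ⟪ g ⟫ xs) gs)) (comp (code f) (V.map code gs))
    (λ xs → comp⇓ (vec gs xs) (runs f _))
    where
    vec : ∀ {k} (gs : Vec (Fn A n) k) xs → A ∣ V.map code gs ·· xs ⇓ V.map (λ g → ⟪ g ⟫ xs) gs
    vec []       xs = []⇓
    vec (g ∷ gs) xs = runs g xs ∷⇓ vec gs xs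

  recursion : (Vec ℕ n → ℕ) → (Vec ℕ (2 + n) → ℕ) → Vec ℕ (1 + n) → ℕ
  recursion f g (zero  ∷ xs) = f xs
  recursion f g (suc m ∷ xs) = g (m ∷ recursion f g (m ∷ xs) ∷ xs)

  rec : Fn A n → Fn A (2 + n) → Fn A (1 + n)
  rec {A} {n} f g = fn (recursion ⟪ f ⟫ ⟪ g ⟫) (prec (code f) (code g)) go
    where
    go : ∀ xs → A ∣ prec (code f) (code g) · xs ⇓ recursion ⟪ f ⟫ ⟪ g ⟫ xs
    go (zero  ∷ xs) = precZ⇓ (runs f xs)
    go (suc m ∷ xs) = precS⇓ (go (m ∷ xs)) (runs g _)

  computing : (f : Vec ℕ n → ℕ) (g : Fn A n) → (∀ xs → ⟪ g ⟫ xs ≡ f xs) → Fn A n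
  computing {A = A} f g eq = fn f (code g) (λ xs → Eq.subst (A ∣ code g · xs ⇓_) (eq xs) (runs g xs))

  constant : ℕ → Fn A n
  constant {A} {n} m = fn (λ _ → m) (proj₁ (go m)) (proj₂ (go m))
    where
    go : ∀ m → Σ[ c ∈ Code n ] (∀ xs → A ∣ c · xs ⇓ m)
    go zero    = comp zeroᶜ [] , λ _ → comp⇓ []⇓ zero⇓
    go (suc m) = comp sucᶜ (proj₁ (go m) ∷ []) , λ xs → comp⇓ (proj₂ (go m) xs ∷⇓ []⇓) suc⇓

  binary : (ℕ → ℕ → ℕ) → Vec ℕ 2 → ℕ
  binary f (x ∷ y ∷ []) = f x y

  infixl 6 _⊕_ _⊖_
  infixl 7 _⊗_
  infixr 6 _⊙_

  successor : Fn A n → Fn A n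
  successor f = fn (suc ∘ V.head) sucᶜ (λ { (x ∷ []) → suc⇓ }) ⊚ (f ∷ [])

  _⊕_ _⊗_ _⊖_ _⊙_ : Fn A n → Fn A n → Fn A n
  f ⊕ g = computing (binary _+_) (rec (arg (# 0)) (successor (arg (# 1)))) plus ⊚ (f ∷ g ∷ [])
    where
    plus : ∀ xs → recursion (λ xs → lookup xs (# 0)) (λ xs → suc (lookup xs (# 1))) xs ≡ binary _+_ xs
    plus (zero  ∷ y ∷ []) = refl
    plus (suc x ∷ y ∷ []) = cong suc (plus (x ∷ y ∷ []))
  f ⊗ g = computing (binary _*_) (rec (constant 0) (arg (# 2) ⊕ arg (# 1))) times ⊚ (f ∷ g ∷ [])
    where
    times : ∀ xs → recursion (λ _ → 0) (λ xs → lookup xs (# 2) + lookup xs (# 1)) xs ≡ binary _*_ xs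
    times (zero  ∷ y ∷ []) = refl
    times (suc x ∷ y ∷ []) = cong (y +_) (times (x ∷ y ∷ []))
  -- Primitive recursion runs on the first argument, so the number to be subtracted comes first and
  -- the arguments are swapped.
  f ⊖ g = computing (binary (λ y x → x ∸ y))
            (rec (arg (# 0)) (computing (pred ∘ V.head) (rec (constant 0) (arg (# 0))) predecessor ⊚ (arg (# 1) ∷ [])))
            minus ⊚ (g ∷ f ∷ [])
    where
    predecessor : ∀ xs → recursion (λ _ → 0) (λ xs → lookup xs (# 0)) xs ≡ pred (V.head xs)
    predecessor (zero  ∷ []) = refl
    predecessor (suc x ∷ []) = refl
    minus : ∀ xs → recursion (λ xs → lookup xs (# 0)) (λ xs → pred (lookup xs (# 1))) xs ≡ binary (λ y x → x ∸ y) xs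
    minus (zero  ∷ x ∷ []) = refl
    minus (suc y ∷ x ∷ []) = trans (cong pred (minus (y ∷ x ∷ []))) (pred[m∸n]≡m∸[1+n] x y)
  f ⊙ g = computing (binary _∙_) (computing (triangle ∘ V.head) (rec (constant 0) (successor (arg (# 0)) ⊕ arg (# 1))) tri
              ⊚ (arg (# 0) ⊕ arg (# 1) ∷ []) ⊕ arg (# 1)) pairing ⊚ (f ∷ g ∷ [])
    where
    tri : ∀ xs → recursion (λ _ → 0) (λ xs → suc (lookup xs (# 0)) + lookup xs (# 1)) xs ≡ triangle (V.head xs)
    tri (zero  ∷ []) = refl
    tri (suc x ∷ []) = cong (suc x +_) (tri (x ∷ []))
    pairing : ∀ xs → triangle (lookup xs (# 0) + lookup xs (# 1)) + lookup xs (# 1) ≡ binary _∙_ xs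
    pairing (x ∷ y ∷ []) = sym (∙≡pair x y)

  Decides : Pred ℕ 0ℓ → (Vec ℕ n → Set) → Set
  Decides {n} A P = Σ[ c ∈ Code n ] ((∀ xs → P xs → A ∣ c · xs ⇓ 1) × (∀ xs → ¬ P xs → A ∣ c · xs ⇓ 0))

  ≤ᵀ⇒decides : ∀ {X} → X ≤ᵀ A → Decides A (X ∘ V.head)
  ≤ᵀ⇒decides (c , c-yes , c-no) = c , (λ { (x ∷ []) → c-yes x }) , (λ { (x ∷ []) → c-no x })

  decides⇒≤ᵀ : ∀ {X} → Decides A (X ∘ V.head) → X ≤ᵀ A
  decides⇒≤ᵀ (c , c-yes , c-no) = c , (λ x → c-yes (x ∷ [])) , (λ x → c-no (x ∷ []))

  oracle-decides : ∀ A → Decides {1} A (A ∘ V.head)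
  oracle-decides A = oracle , (λ { (x ∷ []) → yes⇓ }) , (λ { (x ∷ []) → no⇓ })

  module Deciding (em : ExcludedMiddle 0ℓ) where

    -- Excluded middle only provides the value. That an index computes it has to come from a proof
    -- of `Decides`, by way of `characteristic`.
    χ : Set → ℕ
    χ P with em {P}
    ... | yes _ = 1
    ... | no _  = 0

    χ-yes : ∀ {P} → P → χ P ≡ 1
    χ-yes {P} p with em {P}
    ... | yes _ = refl
    ... | no ¬p = contradiction p ¬p

    χ-no : ∀ {P} → ¬ P → χ P ≡ 0
    χ-no {P} ¬p with em {P}
    ... | yes p = contradiction p ¬p
    ... | no _  = refl

    characteristic : {P : Vec ℕ n → Set} → Decides A P → Fn A n
    characteristic {A = A} {P = P} (c , c-yes , c-no) = fn (χ ∘ P) c go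
      where
      go : ∀ xs → A ∣ c · xs ⇓ χ (P xs)
      go xs with em {P xs}
      ... | yes p = c-yes xs p
      ... | no ¬p = c-no xs ¬p

    fromFn : {P : Vec ℕ n → Set} (f : Fn A n) → (∀ xs → P xs → ⟪ f ⟫ xs ≡ 1) → (∀ xs → ¬ P xs → ⟪ f ⟫ xs ≡ 0) → Decides A P
    fromFn {A = A} f f-yes f-no = code f , (λ xs p → Eq.subst (A ∣ code f · xs ⇓_) (f-yes xs p) (runs f xs))
                                   , (λ xs ¬p → Eq.subst (A ∣ code f · xs ⇓_) (f-no xs ¬p) (runs f xs))

    dec-map : {P Q : Vec ℕ n → Set} → (∀ xs → P xs → Q xs) → (∀ xs → Q xs → P xs) → Decides A P → Decides A Q
    dec-map to from (c , c-yes , c-no) = c , (λ xs → c-yes xs ∘ from xs) , (λ xs ¬q → c-no xs (¬q ∘ to xs))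

    dec-∘ : {P : Vec ℕ k → Set} → Decides A P → (gs : Vec (Fn A n) k) →
            Decides A (λ xs → P (V.map (λ g → ⟪ g ⟫ xs) gs))
    dec-∘ dP gs = fromFn (characteristic dP ⊚ gs) (λ _ → χ-yes) (λ _ → χ-no)

    dec-¬ : {P : Vec ℕ n → Set} → Decides A P → Decides A (¬_ ∘ P)
    dec-¬ dP = fromFn (constant 1 ⊖ characteristic dP) (λ _ ¬p → cong (1 ∸_) (χ-no ¬p))
      (λ xs ¬¬p → case em of λ { (yes p) → cong (1 ∸_) (χ-yes p) ; (no ¬p) → contradiction ¬p ¬¬p })

    dec-× : {P Q : Vec ℕ n → Set} → Decides A P → Decides A Q → Decides A (λ xs → P xs × Q xs)
    dec-× {P = P} {Q = Q} dP dQ = fromFn (characteristic dP ⊗ characteristic dQ)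
      (λ _ (p , q) → cong₂ _*_ (χ-yes p) (χ-yes q)) no-case
      where
      no-case : ∀ xs → ¬ (P xs × Q xs) → χ (P xs) * χ (Q xs) ≡ 0
      no-case xs ¬pq with em {P xs}
      ... | yes p = trans (*-identityˡ _) (χ-no (λ q → ¬pq (p , q)))
      ... | no ¬p = refl

    dec-→ : {P Q : Vec ℕ n → Set} → Decides A P → Decides A Q → Decides A (λ xs → P xs → Q xs)
    dec-→ {P = P} {Q = Q} dP dQ = dec-map
      (λ xs ¬pq p → case em {Q xs} of λ { (yes q) → q ; (no ¬q) → contradiction (p , ¬q) ¬pq })
      (λ xs pq (p , ¬q) → ¬q (pq p)) (dec-¬ (dec-× dP (dec-¬ dQ)))

    dec-⊎ : {P Q : Vec ℕ n → Set} → Decides A P → Decides A Q → Decides A (λ xs → P xs ⊎ Q xs)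
    dec-⊎ {P = P} dP dQ = dec-map
      (λ xs pq → case em {P xs} of λ { (yes p) → inj₁ p ; (no ¬p) → inj₂ (pq ¬p) })
      (λ { xs (inj₁ p) ¬p → contradiction p ¬p ; xs (inj₂ q) _ → q }) (dec-→ (dec-¬ dP) dQ)

    dec-≡ : (f g : Fn A n) → Decides A (λ xs → ⟪ f ⟫ xs ≡ ⟪ g ⟫ xs)
    dec-≡ f g = fromFn (constant 1 ⊖ ((f ⊖ g) ⊕ (g ⊖ f)))
      (λ xs eq → cong (1 ∸_) (cong₂ _+_ (m≤n⇒m∸n≡0 (≤-reflexive eq)) (m≤n⇒m∸n≡0 (≤-reflexive (sym eq)))))
      (λ xs neq → m≤n⇒m∸n≡0 (n≢0⇒n>0 (λ s≡0 → neq (≤-antisym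
        (m∸n≡0⇒m≤n (m+n≡0⇒m≡0 _ s≡0)) (m∸n≡0⇒m≤n (m+n≡0⇒n≡0 (⟪ f ⟫ xs ∸ ⟪ g ⟫ xs) s≡0))))))

    dec-∀≤ : {P : Vec ℕ (suc n) → Set} → Decides A P → (b : Fn A n) →
             Decides A (λ xs → ∀ i → i ≤ ⟪ b ⟫ xs → P (i ∷ xs))
    dec-∀≤ {n = n} {A = A} {P = P} dP b = fromFn (rec base step ⊚ (b ∷ args)) yes-case no-case
      where
      args : ∀ {n} → Vec (Fn A n) n
      args = V.tabulate arg
      args-id : ∀ {n} (xs : Vec ℕ n) → V.map (λ g → ⟪ g ⟫ xs) (args {n}) ≡ xs
      args-id xs = trans (sym (tabulate-∘ _ arg)) (tabulate∘lookup xs)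
      base : Fn A n
      base = characteristic dP ⊚ (constant 0 ∷ args)
      step : Fn A (2 + n)
      step = arg (# 1) ⊗ characteristic dP ⊚ (successor (arg (# 0)) ∷ V.tabulate (λ i → arg (suc (suc i))))
      tail-id : ∀ m v (xs : Vec ℕ n) → V.map (λ g → ⟪ g ⟫ (m ∷ v ∷ xs)) (V.tabulate (λ i → arg {A = A} (suc (suc i)))) ≡ xs
      tail-id m v xs = trans (sym (tabulate-∘ _ _)) (tabulate∘lookup xs)
      all : ℕ → Vec ℕ n → ℕ
      all m xs = recursion ⟪ base ⟫ ⟪ step ⟫ (m ∷ xs)
      all-yes : ∀ m xs → (∀ i → i ≤ m → P (i ∷ xs)) → all m xs ≡ 1
      all-yes zero xs p = trans (cong (λ ys → χ (P (0 ∷ ys))) (args-id xs)) (χ-yes (p 0 z≤n))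
      all-yes (suc m) xs p = cong₂ _*_ (all-yes m xs (λ i i≤m → p i (m≤n⇒m≤1+n i≤m)))
        (trans (cong (λ ys → χ (P (suc m ∷ ys))) (tail-id m _ xs)) (χ-yes (p (suc m) ≤-refl)))
      all-no : ∀ m xs → ¬ (∀ i → i ≤ m → P (i ∷ xs)) → all m xs ≡ 0
      all-no zero xs ¬p = trans (cong (λ ys → χ (P (0 ∷ ys))) (args-id xs)) (χ-no (λ p → ¬p λ { zero z≤n → p }))
      all-no (suc m) xs ¬p with em {∀ i → i ≤ m → P (i ∷ xs)}
      ... | no ¬q = cong₂ _*_ (all-no m xs ¬q) refl
      ... | yes q = trans (cong (all m xs *_) (trans (cong (λ ys → χ (P (suc m ∷ ys))) (tail-id m _ xs)) (χ-no ¬last)))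
                          (*-zeroʳ (all m xs))
        where
        ¬last : ¬ P (suc m ∷ xs)
        ¬last p = ¬p λ i i≤ → [ (λ i<1+m → q i (s≤s⁻¹ i<1+m)) , (λ { refl → p }) ]′ (m≤n⇒m<n∨m≡n i≤)
      at : ∀ xs → recursion ⟪ base ⟫ ⟪ step ⟫ (⟪ b ⟫ xs ∷ V.map (λ g → ⟪ g ⟫ xs) (args {n})) ≡ all (⟪ b ⟫ xs) xs
      at xs = cong (all (⟪ b ⟫ xs)) (args-id xs)
      yes-case : ∀ xs → (∀ i → i ≤ ⟪ b ⟫ xs → P (i ∷ xs)) → _
      yes-case xs p = trans (at xs) (all-yes (⟪ b ⟫ xs) xs p)
      no-case : ∀ xs → ¬ (∀ i → i ≤ ⟪ b ⟫ xs → P (i ∷ xs)) → _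
      no-case xs ¬p = trans (at xs) (all-no (⟪ b ⟫ xs) xs ¬p)

    dec-∃≤ : {P : Vec ℕ (suc n) → Set} → Decides A P → (b : Fn A n) →
             Decides A (λ xs → Σ[ i ∈ ℕ ] (i ≤ ⟪ b ⟫ xs × P (i ∷ xs)))
    dec-∃≤ {P = P} dP b = dec-map
      (λ xs ¬∀ → case em of λ { (yes p) → p ; (no ¬∃) → contradiction (λ i i≤ p → ¬∃ (i , i≤ , p)) ¬∀ })
      (λ xs (i , i≤ , p) ∀¬ → ∀¬ i i≤ p) (dec-¬ (dec-∀≤ (dec-¬ dP) b))

    least : (P : ℕ → Set) → ∀ m → P m → Σ[ i ∈ ℕ ] (P i × (∀ j → j < i → ¬ P j))
    least P m p = go m m ≤-refl p
      where
      go : ∀ b m → m ≤ b → P m → Σ[ i ∈ ℕ ] (P i × (∀ j → j < i → ¬ P j))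
      go b m m≤b p with em {Σ[ j ∈ ℕ ] (j < m × P j)}
      ... | no none = m , p , λ j j<m pj → none (j , j<m , pj)
      go (suc b) m m≤b p | yes (j , j<m , pj) = go b j (s≤s⁻¹ (≤-trans j<m m≤b)) pj
      go zero zero _ p | yes (_ , () , _)

    search : {P : Vec ℕ (suc n) → Set} → Decides A P → Code n
    search dP = μ (code (constant 1 ⊖ characteristic dP))

    module _ {n} {A} {P : Vec ℕ (suc n) → Set} (dP : Decides A P) where

      private
        test = constant 1 ⊖ characteristic dP

      search-sound : ∀ {xs y} → A ∣ search dP · xs ⇓ y → P (y ∷ xs)
      search-sound {xs} {y} (μ⇓ p _) = case em of λ
        { (yes q) → q
        ; (no ¬q) → contradiction (trans (⇓-functional (code test) p (runs test (y ∷ xs))) (cong (1 ∸_) (χ-no ¬q))) λ () }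

      search-complete : ∀ {xs y} → P (y ∷ xs) → Σ[ m ∈ ℕ ] (A ∣ search dP · xs ⇓ m × P (m ∷ xs))
      search-complete {xs} {y} p with m , q , below ← least (λ y → P (y ∷ xs)) y p = m , μ⇓ found skipped , q
        where
        found : A ∣ code test · (m ∷ xs) ⇓ 0
        found = Eq.subst (A ∣ code test · (m ∷ xs) ⇓_) (cong (1 ∸_) (χ-yes q)) (runs test (m ∷ xs))
        skipped : ∀ i → i < m → ∃[ v ] A ∣ code test · (i ∷ xs) ⇓ suc v
        skipped i i<m = 0 , Eq.subst (A ∣ code test · (i ∷ xs) ⇓_) (cong (1 ∸_) (χ-no (below i i<m))) (runs test (i ∷ xs))

    -- Post's theorem relative to an oracle. Certificates for X and against X are searched for
    -- together. The first number that is a certificate of either kind exists in all cases, and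
    -- whether it satisfies P is the answer.
    decides-by-search : {X : Vec ℕ n → Set} {P Q : Vec ℕ (suc n) → Set} → Decides A P → Decides A Q →
      (∀ {w xs} → P (w ∷ xs) → X xs) → (∀ {w xs} → Q (w ∷ xs) → ¬ X xs) →
      (∀ xs → X xs → Σ[ w ∈ ℕ ] P (w ∷ xs)) → (∀ xs → ¬ X xs → Σ[ w ∈ ℕ ] Q (w ∷ xs)) → Decides A X
    decides-by-search {n = n} {A = A} {X = X} {P = P} {Q = Q} dP dQ P⇒X Q⇒¬X X⇒P ¬X⇒Q =
      comp (code (characteristic dP)) (search P⊎Q ∷ V.map code (V.tabulate arg)) , yes-case , no-case
      where
      P⊎Q : Decides A (λ xs → P xs ⊎ Q xs)
      P⊎Q = dec-⊎ dP dQ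
      args⇓ : ∀ {k} (ρ : Fin k → Fin n) xs → A ∣ V.map code (V.tabulate {n = k} (arg {A = A} ∘ ρ)) ·· xs ⇓ V.tabulate (lookup xs ∘ ρ)
      args⇓ {zero}  ρ xs = []⇓
      args⇓ {suc k} ρ xs = proj⇓ ∷⇓ args⇓ (ρ ∘ suc) xs
      args⇓′ : ∀ xs → A ∣ V.map code (V.tabulate (arg {n} {A})) ·· xs ⇓ xs
      args⇓′ xs = Eq.subst (A ∣ V.map code (V.tabulate arg) ·· xs ⇓_) (tabulate∘lookup xs) (args⇓ id xs)
      yes-case : ∀ xs → X xs → _
      yes-case xs x with m , run , pq ← search-complete P⊎Q {xs} (inj₁ (proj₂ (X⇒P xs x))) =
        comp⇓ (run ∷⇓ args⇓′ xs) (proj₁ (proj₂ dP) (m ∷ xs) ([ id , (λ q → contradiction x (Q⇒¬X q)) ]′ pq))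
      no-case : ∀ xs → ¬ X xs → _
      no-case xs ¬x with m , run , pq ← search-complete P⊎Q {xs} (inj₂ (proj₂ (¬X⇒Q xs ¬x))) =
        comp⇓ (run ∷⇓ args⇓′ xs) (proj₂ (proj₂ dP) (m ∷ xs) (λ p → ¬x (P⇒X p)))

open Computability

-- Bounded formulas and Horn programs

module HornPrograms where

  infixl 6 _⊞_
  infixl 7 _⊠_
  infix  5 _≗_
  infixr 4 _∧ᵇ_
  infixr 3 _∨ᵇ_

  data Poly (n : ℕ) : Set where
    var       : Fin n → Poly n
    lit       : ℕ → Poly n
    _⊞_ _⊠_   : Poly n → Poly n → Poly n

  -- The parameters stand for predicates supplied from outside, such as the axioms of a theory.
  -- Formulas with b = 0 are the ones that are translated into the language of R.
  data Bounded (b n : ℕ) : Set where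
    _≗_       : Poly n → Poly n → Bounded b n
    param     : Fin b → Fin n → Bounded b n
    ⊥ᵇ        : Bounded b n
    _∧ᵇ_ _∨ᵇ_ : Bounded b n → Bounded b n → Bounded b n
    ¬ᵇ        : Bounded b n → Bounded b n
    ∀≤ ∃≤     : Fin n → Bounded b (suc n) → Bounded b n

  polyValue : ∀ {n} → Poly n → Vec ℕ n → ℕ
  polyValue (var i) xs = lookup xs i
  polyValue (lit m) xs = m
  polyValue (s ⊞ t) xs = polyValue s xs + polyValue t xs
  polyValue (s ⊠ t) xs = polyValue s xs * polyValue t xs

  private variable
    b n : ℕ

  module _ (B : Fin b → ℕ → Set) where
    Holds : Bounded b n → Vec ℕ n → Set
    Holds (s ≗ t)     xs = polyValue s xs ≡ polyValue t xs
    Holds (param j i) xs = B j (lookup xs i)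
    Holds ⊥ᵇ          xs = ⊥
    Holds (φ ∧ᵇ ψ)    xs = Holds φ xs × Holds ψ xs
    Holds (φ ∨ᵇ ψ)    xs = Holds φ xs ⊎ Holds ψ xs
    Holds (¬ᵇ φ)      xs = ¬ Holds φ xs
    Holds (∀≤ i φ)    xs = ∀ x → x ≤ lookup xs i → Holds φ (x ∷ xs)
    Holds (∃≤ i φ)    xs = Σ[ x ∈ ℕ ] (x ≤ lookup xs i × Holds φ (x ∷ xs))

  polyFn : ∀ {A} → Poly n → Fn A n
  polyFn {n} {A} t = computing (polyValue t) (go t) (eq t)
    where
    go : Poly n → Fn A n
    go (var i) = arg i
    go (lit m) = constant m
    go (s ⊞ t) = go s ⊕ go t
    go (s ⊠ t) = go s ⊗ go t
    eq : ∀ t xs → ⟪ go t ⟫ xs ≡ polyValue t xs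
    eq (var i) xs = refl
    eq (lit m) xs = refl
    eq (s ⊞ t) xs = cong₂ _+_ (eq s xs) (eq t xs)
    eq (s ⊠ t) xs = cong₂ _*_ (eq s xs) (eq t xs)

  module _ (em : ExcludedMiddle 0ℓ) where
    open Deciding em

    decideBounded : ∀ {A} {B : Fin b → ℕ → Set} → (∀ j → Decides A (B j ∘ V.head)) →
                    (φ : Bounded b n) → Decides A (Holds B φ)
    decideBounded dB (s ≗ t)     = dec-≡ (polyFn s) (polyFn t)
    decideBounded dB (param j i) = dec-∘ (dB j) (arg i ∷ [])
    decideBounded dB ⊥ᵇ          = fromFn (constant 0) (λ _ ()) (λ _ _ → refl)
    decideBounded dB (φ ∧ᵇ ψ)    = dec-× (decideBounded dB φ) (decideBounded dB ψ)
    decideBounded dB (φ ∨ᵇ ψ)    = dec-⊎ (decideBounded dB φ) (decideBounded dB ψ)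
    decideBounded dB (¬ᵇ φ)      = dec-¬ (decideBounded dB φ)
    decideBounded dB (∀≤ i φ)    = dec-∀≤ (decideBounded dB φ) (arg i)
    decideBounded dB (∃≤ i φ)    = dec-∃≤ (decideBounded dB φ) (arg i)

  -- The number of variables is dictated by the longest rule of all programs, the one for `≐-subst`,
  -- which uses eight.
  data Pattern : Set where
    var   : Fin 8 → Pattern
    lit   : ℕ → Pattern
    1+    : Pattern → Pattern
    _⊡_   : Pattern → Pattern → Pattern

  infixr 6 _⊡_

  patternValue : (Fin 8 → ℕ) → Pattern → ℕ
  patternValue ρ (var i) = ρ i
  patternValue ρ (lit m) = m
  patternValue ρ (1+ t)  = suc (patternValue ρ t)
  patternValue ρ (s ⊡ t) = patternValue ρ s ∙ patternValue ρ t

  FactPattern : Set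
  FactPattern = ℕ × Vec Pattern 4

  factCode : ℕ → Vec ℕ 4 → ℕ
  factCode t (x ∷ y ∷ z ∷ u ∷ []) = t ∙ x ∙ y ∙ z ∙ u

  factCode-injective : ∀ {t t′} v v′ → factCode t v ≡ factCode t′ v′ → (t , v) ≡ (t′ , v′)
  factCode-injective (_ ∷ _ ∷ _ ∷ _ ∷ []) (_ ∷ _ ∷ _ ∷ _ ∷ []) eq
    with refl , eq ← ∙-cancel eq with refl , eq ← ∙-cancel eq with refl , eq ← ∙-cancel eq with refl , refl ← ∙-cancel eq = refl

  record Rule : Set where
    constructor _⟸_
    field
      conclusion : FactPattern
      premises   : List FactPattern

  infix 1 _⟸_
  open Rule public

  instanceCode : (Fin 8 → ℕ) → FactPattern → ℕ
  instanceCode ρ (t , ps) = factCode t (V.map (patternValue ρ) ps)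

  valuation : List ℕ → Fin 8 → ℕ
  valuation xs i = go xs (toℕ i)
    where
    go : List ℕ → ℕ → ℕ
    go []       _       = 0
    go (x ∷ xs) zero    = x
    go (x ∷ xs) (suc i) = go xs i

  module Horn (rules : List Rule) where

    data Derivable (B : Fin b → ℕ → Set) : ℕ → Vec ℕ 4 → Set where
      base : ∀ j {z} → B j z → Derivable B (toℕ j) (z ∷ 0 ∷ 0 ∷ 0 ∷ [])
      rule : ∀ (i : Fin (length rules)) ρ →
             All (λ p → Derivable B (proj₁ p) (V.map (patternValue ρ) (proj₂ p))) (premises (L.lookup rules i)) →
             Derivable B (proj₁ (conclusion (L.lookup rules i))) (V.map (patternValue ρ) (proj₂ (conclusion (L.lookup rules i))))

    Sound : (ℕ → Vec ℕ 4 → Set) → Rule → Set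
    Sound M r = ∀ ρ → All (λ p → M (proj₁ p) (V.map (patternValue ρ) (proj₂ p))) (premises r) →
                M (proj₁ (conclusion r)) (V.map (patternValue ρ) (proj₂ (conclusion r)))

    module _ {B : Fin b → ℕ → Set} (M : ℕ → Vec ℕ 4 → Set) (base-sound : ∀ j {z} → B j z → M (toℕ j) (z ∷ 0 ∷ 0 ∷ 0 ∷ []))
             (rules-sound : All (Sound M) rules) where
      mutual
        derivable-sound : ∀ {t v} → Derivable B t v → M t v
        derivable-sound (base j z)    = base-sound j z
        derivable-sound (rule i ρ ps) = All.lookup rules-sound (∈-lookup i) ρ (derivables-sound ps)

        derivables-sound : ∀ {ρ ps} → All (λ p → Derivable B (proj₁ p) (V.map (patternValue ρ) (proj₂ p))) ps →
                           All (λ p → M (proj₁ p) (V.map (patternValue ρ) (proj₂ p))) ps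
        derivables-sound []       = []
        derivables-sound (d ∷ ds) = derivable-sound d ∷ derivables-sound ds

    -- A derivation is a finite set of numbers r ∙ y, where the fact y has rank r
    -- and follows by a rule from facts of smaller rank in the set.

    pairs : Fin n → Fin n → Fin n → Bounded b n
    pairs z x y = lit 2 ⊠ var z ≗ (var x ⊞ var y) ⊠ (var x ⊞ var y ⊞ lit 1) ⊞ lit 2 ⊠ var y

    member : Fin n → Fin n → Fin n → Bounded b n
    member a c p = ∃≤ a (var zero ⊠ (lit 1 ⊞ (var (suc p) ⊞ lit 1) ⊠ var (suc c)) ≗ var (suc a))

    matches : Pattern → (Fin 8 → Fin n) → Fin n → Bounded b n
    matches (var i) ρ x = var x ≗ var (ρ i)
    matches (lit m) ρ x = var x ≗ lit m
    matches (1+ t)  ρ x = ∃≤ x (matches t (suc ∘ ρ) zero ∧ᵇ var (suc x) ≗ lit 1 ⊞ var zero)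
    matches (s ⊡ t) ρ x = ∃≤ x (∃≤ (suc x) (matches s (λ i → suc (suc (ρ i))) (suc zero) ∧ᵇ matches t (λ i → suc (suc (ρ i))) zero
                            ∧ᵇ pairs (suc (suc x)) (suc zero) zero))

    factMatches : FactPattern → (Fin 8 → Fin n) → Fin n → Bounded b n
    factMatches (t , x ∷ y ∷ z ∷ u ∷ []) = matches (lit t ⊡ x ⊡ y ⊡ z ⊡ u)

    ⋁ : ∀ m → (Fin m → Bounded b n) → Bounded b n
    ⋁ zero    φ = ⊥ᵇ
    ⋁ (suc m) φ = φ zero ∨ᵇ ⋁ m (φ ∘ suc)

    ∃≤ⁿ : ∀ k → Fin n → Bounded b (k + n) → Bounded b n
    ∃≤ⁿ zero    i φ = φ
    ∃≤ⁿ (suc k) i φ = ∃≤ⁿ k i (∃≤ (k ↑ʳ i) φ)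

    -- In the contexts below, r and y come first, then p, N, c and a.
    premisesHold : List FactPattern → Bounded b (8 + (6 + n))
    premisesHold []       = lit 0 ≗ lit 0
    premisesHold (p ∷ ps) = ∃≤ (# 11) (∃≤ (# 12) (∃≤ (# 10)
        (factMatches p (λ i → suc (suc (suc (i ↑ˡ _)))) (# 2) ∧ᵇ pairs (# 1) (# 0) (# 2) ∧ᵇ ¬ᵇ (var (# 0) ≗ var (# 11))
         ∧ᵇ member (# 16) (# 15) (# 1))))
      ∧ᵇ premisesHold ps

    ruleBody : Rule → Bounded b (8 + (6 + n))
    ruleBody r = factMatches (conclusion r) (_↑ˡ _) (# 9) ∧ᵇ premisesHold (premises r)

    byRule : Rule → Bounded b (6 + n)
    byRule r = ∃≤ⁿ 8 (# 3) (ruleBody r)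

    byParam : Fin b → Bounded b (6 + n)
    byParam j = ∃≤ (# 1) (factMatches (toℕ j , var (# 0) ∷ lit 0 ∷ lit 0 ∷ lit 0 ∷ []) (λ _ → zero) (# 2) ∧ᵇ param j zero)

    justified : ∀ b {n} → Bounded b (4 + n)
    justified b = ∃≤ (# 0) (∃≤ (# 1) (pairs (# 2) (# 0) (# 1) ∧ᵇ
      (⋁ b byParam ∨ᵇ ⋁ (length rules) (byRule ∘ L.lookup rules))))

    -- The free variables are the code of the fact and a bound for the derivation.
    opaque
      derivation : ∀ b → Bounded b 2
      derivation b = ∃≤ (# 1) (∃≤ (# 2) (∃≤ (# 3)
        (∃≤ (# 0) (∃≤ (# 1) (pairs (# 0) (# 1) (# 5) ∧ᵇ member (# 4) (# 3) (# 0)))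
         ∧ᵇ ∀≤ (# 0) (¬ᵇ (member (# 3) (# 2) (# 0)) ∨ᵇ justified b))))

    module _ {B : Fin b → ℕ → Set} where

      matches⁻ : ∀ t (ρ : Fin 8 → Fin n) x xs → Holds B (matches t ρ x) xs → lookup xs x ≡ patternValue (lookup xs ∘ ρ) t
      matches⁻ (var i) ρ x xs h = h
      matches⁻ (lit m) ρ x xs h = h
      matches⁻ (1+ t) ρ x xs (y , _ , h , eq) = trans eq (cong suc (matches⁻ t _ zero (y ∷ xs) h))
      matches⁻ (s ⊡ t) ρ x xs (y , _ , z , _ , hs , ht , eq) =
        trans (2∙⁻¹ y z (lookup xs x) eq) (cong₂ _∙_ (matches⁻ s _ _ (z ∷ y ∷ xs) hs) (matches⁻ t _ zero (z ∷ y ∷ xs) ht))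

      matches⁺ : ∀ t (ρ : Fin 8 → Fin n) x xs → lookup xs x ≡ patternValue (lookup xs ∘ ρ) t → Holds B (matches t ρ x) xs
      matches⁺ (var i) ρ x xs eq = eq
      matches⁺ (lit m) ρ x xs eq = eq
      matches⁺ (1+ t) ρ x xs eq = _ , ≤-trans (n≤1+n _) (≤-reflexive (sym eq)) , matches⁺ t _ zero (_ ∷ xs) refl , eq
      matches⁺ (s ⊡ t) ρ x xs eq = _ , ≤-trans (m≤m∙n _ _) (≤-reflexive (sym eq)) , _ , ≤-trans (n≤m∙n _ _) (≤-reflexive (sym eq)) ,
        matches⁺ s _ _ (patternValue (lookup xs ∘ ρ) t ∷ patternValue (lookup xs ∘ ρ) s ∷ xs) refl , matches⁺ t _ zero _ refl ,
        trans (cong (2 *_) eq) (2∙ _ _)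

      factMatches⁻ : ∀ p (ρ : Fin 8 → Fin n) x xs → Holds B (factMatches p ρ x) xs → lookup xs x ≡ instanceCode (lookup xs ∘ ρ) p
      factMatches⁻ (t , x ∷ y ∷ z ∷ u ∷ []) = matches⁻ (lit t ⊡ x ⊡ y ⊡ z ⊡ u)

      factMatches⁺ : ∀ p (ρ : Fin 8 → Fin n) x xs → lookup xs x ≡ instanceCode (lookup xs ∘ ρ) p → Holds B (factMatches p ρ x) xs
      factMatches⁺ (t , x ∷ y ∷ z ∷ u ∷ []) = matches⁺ (lit t ⊡ x ⊡ y ⊡ z ⊡ u)

      ⋁⁻ : ∀ m (φ : Fin m → Bounded b n) xs → Holds B (⋁ m φ) xs → Σ[ i ∈ Fin m ] Holds B (φ i) xs
      ⋁⁻ (suc m) φ xs (inj₁ h) = zero , h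
      ⋁⁻ (suc m) φ xs (inj₂ h) with i , h′ ← ⋁⁻ m (φ ∘ suc) xs h = suc i , h′

      ⋁⁺ : ∀ m (φ : Fin m → Bounded b n) xs i → Holds B (φ i) xs → Holds B (⋁ m φ) xs
      ⋁⁺ (suc m) φ xs zero    h = inj₁ h
      ⋁⁺ (suc m) φ xs (suc i) h = inj₂ (⋁⁺ m (φ ∘ suc) xs i h)

      ∃≤ⁿ⁻ : ∀ k i (φ : Bounded b (k + n)) xs → Holds B (∃≤ⁿ k i φ) xs → Σ[ es ∈ Vec ℕ k ] Holds B φ (es V.++ xs)
      ∃≤ⁿ⁻ zero    i φ xs h = [] , h
      ∃≤ⁿ⁻ (suc k) i φ xs h with es , e , _ , h′ ← ∃≤ⁿ⁻ k i (∃≤ (k ↑ʳ i) φ) xs h = e ∷ es , h′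

      ∃≤ⁿ⁺ : ∀ k i (φ : Bounded b (k + n)) xs (es : Vec ℕ k) → (∀ j → lookup es j ≤ lookup xs i) →
             Holds B φ (es V.++ xs) → Holds B (∃≤ⁿ k i φ) xs
      ∃≤ⁿ⁺ zero    i φ xs []       es≤ h = h
      ∃≤ⁿ⁺ (suc k) i φ xs (e ∷ es) es≤ h =
        ∃≤ⁿ⁺ k i (∃≤ (k ↑ʳ i) φ) xs es (es≤ ∘ suc) (e , ≤-trans (es≤ zero) (≤-reflexive (sym (lookup-++ʳ es xs i))) , h)

      value-cong : ∀ {ρ ρ′} → (∀ i → ρ i ≡ ρ′ i) → ∀ t → patternValue ρ t ≡ patternValue ρ′ t
      value-cong eq (var i) = eq i
      value-cong eq (lit m) = refl
      value-cong eq (1+ t)  = cong suc (value-cong eq t)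
      value-cong eq (s ⊡ t) = cong₂ _∙_ (value-cong eq s) (value-cong eq t)

      instanceCode-cong : ∀ {ρ ρ′} → (∀ i → ρ i ≡ ρ′ i) → ∀ p → instanceCode ρ p ≡ instanceCode ρ′ p
      instanceCode-cong eq (t , x ∷ y ∷ z ∷ u ∷ []) = value-cong eq (lit t ⊡ x ⊡ y ⊡ z ⊡ u)

      module _ (a c N : ℕ) (xs : Vec ℕ n)
               (closed : ∀ p → p ≤ N → MemberOf a c p → Holds B (justified b) (p ∷ N ∷ c ∷ a ∷ xs)) where

        IsDerivable : ℕ → Set
        IsDerivable y = Σ[ t ∈ ℕ ] Σ[ v ∈ Vec ℕ 4 ] (y ≡ factCode t v × Derivable B t v)

        -- A set in which every member is justified by others might support its facts in a circle.
        -- The ranks exclude this: premises have smaller rank, and the induction is on the bound `R`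
        -- of the rank.
        rank-sound : ∀ R r y → r < R → r ∙ y ≤ N → MemberOf a c (r ∙ y) → IsDerivable y
        rank-sound (suc R) r y r<R ≤N m with closed (r ∙ y) ≤N m
        ... | y′ , _ , r′ , _ , eq , just with refl , refl ← ∙-cancel (2∙⁻¹ r′ y′ (r ∙ y) eq) = from just
          where
          ctx : Vec ℕ (6 + n)
          ctx = r ∷ y ∷ (r ∙ y) ∷ N ∷ c ∷ a ∷ xs
          from : Holds B (⋁ b byParam ∨ᵇ ⋁ (length rules) (byRule ∘ L.lookup rules)) ctx → IsDerivable y
          from (inj₁ h) with j , z , _ , hy , bz ← ⋁⁻ b byParam ctx h =
            toℕ j , z ∷ 0 ∷ 0 ∷ 0 ∷ [] ,
            factMatches⁻ (toℕ j , var (# 0) ∷ lit 0 ∷ lit 0 ∷ lit 0 ∷ []) (λ _ → zero) (# 2) (z ∷ ctx) hy , base j bz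
          from (inj₂ h) with i , h′ ← ⋁⁻ (length rules) (byRule ∘ L.lookup rules) ctx h
            with es@(_ ∷ _ ∷ _ ∷ _ ∷ _ ∷ _ ∷ _ ∷ _ ∷ []) , hy , hps ← ∃≤ⁿ⁻ 8 (# 3) (ruleBody (L.lookup rules i)) ctx h′ =
            _ , _ , trans (factMatches⁻ (conclusion (L.lookup rules i)) (_↑ˡ _) (# 9) (es V.++ ctx) hy)
                          (instanceCode-cong ρ-eq (conclusion (L.lookup rules i))) ,
            rule i ρ (premises-sound (premises (L.lookup rules i)) hps)
            where
            ρ : Fin 8 → ℕ
            ρ = lookup es
            ρ-eq : ∀ j → lookup (es V.++ ctx) (j ↑ˡ _) ≡ ρ j
            ρ-eq = lookup-++ˡ es ctx
            premises-sound : ∀ ps → Holds B (premisesHold ps) (es V.++ ctx) →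
                             All (λ p → Derivable B (proj₁ p) (V.map (patternValue ρ) (proj₂ p))) ps
            premises-sound [] _ = []
            premises-sound (p ∷ ps) ((y″ , _ , p″ , p≤N , r″ , r″≤r , hy , eq , r≢ , m) , hs)
              with refl ← 2∙⁻¹ r″ y″ p″ eq
              -- The bounded quantifier only gives r″ ≤ r; the inequation r″ ≠ r in `premisesHold`
              -- makes the rank drop strictly.
              with t , v , eq″ , d ← rank-sound R r″ y″ (≤-trans (≤∧≢⇒< r″≤r r≢) (s≤s⁻¹ r<R)) p≤N m =
              Eq.subst (λ (t , v) → Derivable B t v)
                (factCode-injective v (V.map (patternValue _) (proj₂ p)) (trans (sym eq″)
                  (trans (factMatches⁻ p _ (# 2) (r″ ∷ (r″ ∙ y″) ∷ y″ ∷ es V.++ ctx) hy)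
                         (instanceCode-cong (lookup-++ˡ es ctx) p)))) d
              ∷ premises-sound ps hs

      opaque
        unfolding derivation
        derivation-sound : ∀ {t v w} → Holds B (derivation b) (factCode t v ∷ w ∷ []) → Derivable B t v
        derivation-sound {t} {v} {w} (a , _ , c , _ , N , _ , (r , _ , p , p≤N , eq , m) , closed)
          with refl ← 2∙⁻¹ r (factCode t v) p eq
          with t′ , v′ , eq′ , d ← rank-sound a c N (factCode t v ∷ w ∷ [])
                 (λ p p≤N m → [ (λ ¬m → contradiction m ¬m) , id ]′ (closed p p≤N)) (suc r) r (factCode t v) ≤-refl p≤N m
          with refl ← factCode-injective v v′ eq′ = d

      -- Items are the facts occurring in a derivation tree, ranked by height.

      Items : Set
      Items = List (ℕ × ℕ)

      PremiseIn : Items → (Fin 8 → ℕ) → ℕ → FactPattern → Set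
      PremiseIn I ρ r p = Σ[ r′ ∈ ℕ ] (r′ < r × (r′ , instanceCode ρ p) ∈ I)

      Justified : ℕ → Items → ℕ × ℕ → Set
      Justified N I (r , y) =
        (Σ[ j ∈ Fin b ] Σ[ z ∈ ℕ ] (B j z × y ≡ factCode (toℕ j) (z ∷ 0 ∷ 0 ∷ 0 ∷ []))) ⊎
        (Σ[ i ∈ Fin (length rules) ] Σ[ ρ ∈ (Fin 8 → ℕ) ] ((∀ k → ρ k ≤ N) ×
          y ≡ instanceCode ρ (conclusion (L.lookup rules i)) × All (PremiseIn I ρ r) (premises (L.lookup rules i))))

      Derivation : ℕ → Items → Set
      Derivation N I = All (Justified N I) I

      justified-mono : ∀ {N N′ I I′} → N ≤ N′ → (∀ {x} → x ∈ I → x ∈ I′) → ∀ {x} → Justified N I x → Justified N′ I′ x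
      justified-mono N≤ I⊆ (inj₁ h) = inj₁ h
      justified-mono N≤ I⊆ (inj₂ (i , ρ , ρ≤ , eq , ps)) =
        inj₂ (i , ρ , (λ k → ≤-trans (ρ≤ k) N≤) , eq , All.map (λ (r′ , r′< , ∈I) → r′ , r′< , I⊆ ∈I) ps)

      valuation-bound : ∀ {k} (ρ : Fin k → ℕ) → Σ[ N ∈ ℕ ] (∀ i → ρ i ≤ N)
      valuation-bound {zero}  ρ = 0 , λ ()
      valuation-bound {suc k} ρ with N , N≥ ← valuation-bound (ρ ∘ suc) =
        ρ zero + N , λ { zero → m≤m+n _ N ; (suc i) → ≤-trans (N≥ i) (m≤n+m N _) }

      mutual
        collect : ∀ {t v} → Derivable B t v →
          Σ[ I ∈ Items ] Σ[ N ∈ ℕ ] (Derivation N I × Σ[ r ∈ ℕ ] ((r , factCode t v) ∈ I))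
        collect (base j {z} bz) = (0 , _) ∷ [] , 0 , (inj₁ (j , z , bz , refl) ∷ []) , 0 , here refl
        collect (rule i ρ ds) with I , N , ok , R , ps ← collects ds with M , M≥ ← valuation-bound ρ =
          (R , _) ∷ I , N + M ,
          (inj₂ (i , ρ , (λ k → ≤-trans (M≥ k) (m≤n+m M N)) , refl , All.map (λ (r′ , r′< , ∈I) → r′ , r′< , there ∈I) ps)
            ∷ All.map (justified-mono (m≤m+n N M) there) ok) ,
          R , here refl

        collects : ∀ {ρ ps} → All (λ p → Derivable B (proj₁ p) (V.map (patternValue ρ) (proj₂ p))) ps →
          Σ[ I ∈ Items ] Σ[ N ∈ ℕ ] (Derivation N I × Σ[ R ∈ ℕ ] All (PremiseIn I ρ R) ps)
        collects [] = [] , 0 , [] , 0 , []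
        collects (d ∷ ds) with I , N , ok , r , ∈I ← collect d with I′ , N′ , ok′ , R , ps ← collects ds =
          I ++ I′ , N + N′ ,
          All-++⁺ (All.map (justified-mono (m≤m+n N N′) ∈-++⁺ˡ) ok) (All.map (justified-mono (m≤n+m N′ N) (∈-++⁺ʳ I)) ok′) ,
          -- This number must exceed the ranks of all premises. Sums serve as upper bounds here, in
          -- place of maxima, as they do for the bounds on valuations.
          suc r + R , (r , m≤m+n (suc r) R , ∈-++⁺ˡ ∈I)
            ∷ All.map (λ (r′ , r′< , ∈I′) → r′ , ≤-trans r′< (m≤n+m R (suc r)) , ∈-++⁺ʳ I ∈I′) ps

      items-bound : ∀ I → Σ[ N ∈ ℕ ] (∀ {r y} → (r , y) ∈ I → r ∙ y ≤ N)
      items-bound [] = 0 , λ ()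
      items-bound ((r , y) ∷ I) with N , N≥ ← items-bound I =
        (r ∙ y) + N , λ { (here refl) → m≤m+n _ N ; (there ∈I) → ≤-trans (N≥ ∈I) (m≤n+m N _) }

      module _ {N I} (ok : Derivation N I) (I≤N : ∀ {r y} → (r , y) ∈ I → r ∙ y ≤ N) (xs : Vec ℕ n) {a c}
               (code-of : ∀ {r y} → (r , y) ∈ I → MemberOf a c (r ∙ y)) where

        premises-hold : ∀ r y p es ps → All (PremiseIn I (lookup es) r) ps →
          Holds B (premisesHold ps) (es V.++ (r ∷ y ∷ p ∷ N ∷ c ∷ a ∷ xs))
        premises-hold r y p es [] [] = refl
        premises-hold r y p es@(_ ∷ _ ∷ _ ∷ _ ∷ _ ∷ _ ∷ _ ∷ _ ∷ []) (q ∷ ps) ((r′ , r′<r , ∈I) ∷ hs) =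
          (instanceCode (lookup es) q , ≤-trans (n≤m∙n r′ _) (I≤N ∈I) , r′ ∙ instanceCode (lookup es) q , I≤N ∈I , r′ , <⇒≤ r′<r ,
            factMatches⁺ q _ (# 2) (r′ ∷ (r′ ∙ instanceCode (lookup es) q) ∷ instanceCode (lookup es) q ∷ es V.++ (r ∷ y ∷ p ∷ N ∷ c ∷ a ∷ xs))
              (sym (instanceCode-cong (lookup-++ˡ es _) q)) ,
            2∙ _ _ , <⇒≢ r′<r , code-of ∈I) ,
          premises-hold r y p es ps hs

        justified-holds : ∀ {r y} → (r , y) ∈ I → Holds B (justified b) ((r ∙ y) ∷ N ∷ c ∷ a ∷ xs)
        justified-holds {r} {y} ∈I = y , n≤m∙n r y , r , m≤m∙n r y , 2∙ r y , to (All.lookup ok ∈I)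
          where
          ctx : Vec ℕ (6 + n)
          ctx = r ∷ y ∷ (r ∙ y) ∷ N ∷ c ∷ a ∷ xs
          to : Justified N I (r , y) → Holds B (⋁ b byParam ∨ᵇ ⋁ (length rules) (byRule ∘ L.lookup rules)) ctx
          to (inj₁ (j , z , bz , eq)) = inj₁ (⋁⁺ b byParam ctx j (z ,
            ≤-trans (≤-trans (m≤m∙n z _) (n≤m∙n (toℕ j) _)) (≤-reflexive (sym eq)) ,
            factMatches⁺ (toℕ j , var (# 0) ∷ lit 0 ∷ lit 0 ∷ lit 0 ∷ []) (λ _ → zero) (# 2) (z ∷ ctx) eq , bz))
          to (inj₂ (i , ρ , ρ≤ , eq , ps)) = inj₂ (⋁⁺ (length rules) (byRule ∘ L.lookup rules) ctx i
            (∃≤ⁿ⁺ 8 (# 3) (ruleBody (L.lookup rules i)) ctx es es≤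
              (factMatches⁺ (conclusion (L.lookup rules i)) (_↑ˡ _) (# 9) (es V.++ ctx)
                (trans eq (instanceCode-cong (λ j → sym (trans (lookup-++ˡ es ctx j) (es≡ j))) (conclusion (L.lookup rules i)))) ,
               premises-hold r y (r ∙ y) es (premises (L.lookup rules i)) (All.map (λ {p} → adjust {p}) ps))))
            where
            es : Vec ℕ 8
            es = V.tabulate ρ
            es≡ : ∀ j → lookup es j ≡ ρ j
            es≡ = lookup∘tabulate ρ
            es≤ : ∀ j → lookup es j ≤ N
            es≤ j = ≤-trans (≤-reflexive (es≡ j)) (ρ≤ j)
            adjust : ∀ {p} → PremiseIn I ρ r p → PremiseIn I (lookup es) r p
            adjust {p} (r′ , r′<r , ∈I′) =
              r′ , r′<r , Eq.subst (λ z → (r′ , z) ∈ I) (sym (instanceCode-cong es≡ p)) ∈I′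

      opaque
        unfolding derivation
        derivation-complete : ∀ {t v} → Derivable B t v → Σ[ w ∈ ℕ ] Holds B (derivation b) (factCode t v ∷ w ∷ [])
        derivation-complete {t} {v} d
          with I , N₀ , ok₀ , r , ∈I ← collect d
          with N₁ , I≤N₁ ← items-bound I
          with a , c , to , from ← finite-set-code (N₀ + N₁) (map (λ (r , y) → r ∙ y) I)
                 (λ q∈ → case ∈-map⁻ _ q∈ of λ { (_ , x∈ , refl) → ≤-trans (I≤N₁ x∈) (m≤n+m N₁ N₀) }) =
          -- Only a, c and N are bounded by the second free variable of `derivation`, so their sum
          -- is a large enough value for it. All other quantifiers are bounded by these three or by
          -- smaller numbers.
          a + c + N , a , ≤-trans (m≤m+n a c) (m≤m+n _ N) , c , ≤-trans (m≤n+m c a) (m≤m+n _ N) , N , m≤n+m N (a + c) ,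
          (r , ≤-trans (m≤m∙n r _) (I≤N ∈I) , r ∙ factCode t v , I≤N ∈I , 2∙ _ _ , to (∈-map⁺ _ ∈I)) ,
          closed
          where
          N : ℕ
          N = N₀ + N₁
          I≤N : ∀ {r y} → (r , y) ∈ I → r ∙ y ≤ N
          I≤N x∈ = ≤-trans (I≤N₁ x∈) (m≤n+m N₁ N₀)
          ok : Derivation N I
          ok = All.map (justified-mono (m≤m+n N₀ N₁) id) ok₀
          closed : ∀ p → p ≤ N → ¬ MemberOf a c p ⊎ Holds B (justified b) (p ∷ N ∷ c ∷ a ∷ factCode t v ∷ (a + c + N) ∷ [])
          closed p p≤N with p ∈? map (λ (r , y) → r ∙ y) I
          ... | no p∉ = inj₁ (p∉ ∘ from p≤N)
          ... | yes p∈ with (r , y) , x∈ , refl ← ∈-map⁻ _ p∈ =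
            inj₂ (justified-holds ok I≤N (factCode t v ∷ (a + c + N) ∷ []) (λ x∈ → to (∈-map⁺ _ x∈)) x∈)

open HornPrograms

-- Evaluation of indices as a Horn program

module UniversalProgram where

  v₀ v₁ v₂ v₃ v₄ v₅ v₆ v₇ : Pattern
  v₀ = var (# 0)
  v₁ = var (# 1)
  v₂ = var (# 2)
  v₃ = var (# 3)
  v₄ = var (# 4)
  v₅ = var (# 5)
  v₆ = var (# 6)
  v₇ = var (# 7)

  fact : ℕ → Pattern → Pattern → Pattern → Pattern → FactPattern
  fact t x y z u = t , x ∷ y ∷ z ∷ u ∷ []

  listCode : ∀ {n} → Vec ℕ n → ℕ
  listCode []       = 0
  listCode (x ∷ xs) = x ∙ listCode xs

  listCode-injective : ∀ {n} (xs ys : Vec ℕ n) → listCode xs ≡ listCode ys → xs ≡ ys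
  listCode-injective []       []       eq = refl
  listCode-injective (x ∷ xs) (y ∷ ys) eq = cong₂ _∷_ (∙-injˡ eq) (listCode-injective xs ys (∙-injʳ eq))

  nthRules : List Rule
  nthRules = (fact 0 (v₀ ⊡ v₁) (lit 0) v₀ (lit 0) ⟸ [])
           ∷ (fact 0 (v₀ ⊡ v₁) (1+ v₂) v₃ (lit 0) ⟸ fact 0 v₁ v₂ v₃ (lit 0) ∷ [])
           ∷ []

  mutual
    -- Tag and rest are computed separately, so that an equation between tags alone determines the
    -- constructor when the meaning of a rule is checked.
    index : ∀ {n} → Code n → ℕ
    index c = indexTag c ∙ indexRest c

    indexTag : ∀ {n} → Code n → ℕ
    indexTag zeroᶜ       = 0
    indexTag sucᶜ        = 1
    indexTag oracle      = 2
    indexTag (proj i)    = 3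
    indexTag (comp c ds) = 4
    indexTag (prec c d)  = 5
    indexTag (μ c)       = 6

    indexRest : ∀ {n} → Code n → ℕ
    indexRest zeroᶜ               = 0
    indexRest sucᶜ                = 0
    indexRest oracle              = 0
    indexRest (proj i)            = toℕ i
    indexRest (comp {k = k} c ds) = k ∙ index c ∙ indices ds
    indexRest (prec c d)          = index c ∙ index d
    indexRest (μ c)               = index c

    indices : ∀ {n k} → Vec (Code n) k → ℕ
    indices []       = 0
    indices (c ∷ cs) = index c ∙ indices cs

  -- fact 0: an entry of a list; facts 1 and 2: evaluation of an index, of k indices;
  -- fact 3: an index has positive values below a bound
  evalRules : List Rule
  evalRules = nthRules ++
      (fact 1 (lit 0 ⊡ lit 0) (lit 0) (lit 0) (lit 0) ⟸ [])
    ∷ (fact 1 (lit 1 ⊡ lit 0) (v₀ ⊡ lit 0) (1+ v₀) (lit 0) ⟸ [])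
    ∷ (fact 1 (lit 2 ⊡ lit 0) (v₀ ⊡ lit 0) (lit 0) (lit 0) ⟸ [])
    ∷ (fact 1 (lit 3 ⊡ v₀) v₁ v₂ (lit 0) ⟸ fact 0 v₁ v₀ v₂ (lit 0) ∷ [])
    ∷ (fact 1 (lit 4 ⊡ v₀ ⊡ v₁ ⊡ v₂) v₃ v₅ (lit 0) ⟸ fact 2 v₀ v₂ v₃ v₄ ∷ fact 1 v₁ v₄ v₅ (lit 0) ∷ [])
    ∷ (fact 1 (lit 5 ⊡ v₀ ⊡ v₁) (lit 0 ⊡ v₂) v₃ (lit 0) ⟸ fact 1 v₀ v₂ v₃ (lit 0) ∷ [])
    ∷ (fact 1 (lit 5 ⊡ v₀ ⊡ v₁) (1+ v₂ ⊡ v₃) v₅ (lit 0) ⟸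
         fact 1 (lit 5 ⊡ v₀ ⊡ v₁) (v₂ ⊡ v₃) v₄ (lit 0) ∷ fact 1 v₁ (v₂ ⊡ v₄ ⊡ v₃) v₅ (lit 0) ∷ [])
    ∷ (fact 1 (lit 6 ⊡ v₀) v₁ v₂ (lit 0) ⟸ fact 1 v₀ (v₂ ⊡ v₁) (lit 0) (lit 0) ∷ fact 3 v₀ v₁ v₂ (lit 0) ∷ [])
    ∷ (fact 2 (lit 0) (lit 0) v₀ (lit 0) ⟸ [])
    ∷ (fact 2 (1+ v₀) (v₁ ⊡ v₂) v₃ (v₄ ⊡ v₅) ⟸ fact 1 v₁ v₃ v₄ (lit 0) ∷ fact 2 v₀ v₂ v₃ v₅ ∷ [])
    ∷ (fact 3 v₀ v₁ (lit 0) (lit 0) ⟸ [])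
    ∷ (fact 3 v₀ v₁ (1+ v₂) (lit 0) ⟸ fact 3 v₀ v₁ v₂ (lit 0) ∷ fact 1 v₀ (v₂ ⊡ v₁) (1+ v₃) (lit 0) ∷ [])
    ∷ []

  module Eval = Horn evalRules

  no-param : Fin 0 → ℕ → Set
  no-param ()

  Evaluates : ℕ → ℕ → ℕ → Set
  Evaluates e xs y = Eval.Derivable no-param 1 (e ∷ xs ∷ y ∷ 0 ∷ [])

  NthMeans : ℕ → ℕ → ℕ → Set
  NthMeans l i y = ∀ {n} (xs : Vec ℕ n) (j : Fin n) → listCode xs ≡ l → toℕ j ≡ i → lookup xs j ≡ y

  nth-zero : ∀ {x l} → NthMeans (x ∙ l) 0 x
  nth-zero (x ∷ xs) zero eq refl = ∙-injˡ eq

  nth-suc : ∀ {x l i y} → NthMeans l i y → NthMeans (x ∙ l) (suc i) y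
  nth-suc h (x ∷ xs) (suc j) eq refl = h xs j (∙-injʳ eq) refl

  private
    -- A number does not determine an arity: `proj i` has the same number in every arity, and since
    -- `0 ∙ 0` is 0 a list code does not determine the length of the list. So the meaning of a fact
    -- quantifies over all arities, all indices and all lists with the given codes.
    EvalMeans : ℕ → ℕ → ℕ → Set
    EvalMeans e l y = ∀ {n} (c : Code n) xs → index c ≡ e → listCode xs ≡ l → ∅ ∣ c · xs ⇓ y

    EvalsMean : ℕ → ℕ → ℕ → ℕ → Set
    EvalsMean k es l ls = ∀ {n} (cs : Vec (Code n) k) xs → indices cs ≡ es → listCode xs ≡ l →
                          Σ[ ys ∈ Vec ℕ k ] (listCode ys ≡ ls × ∅ ∣ cs ·· xs ⇓ ys)

    PositiveMeans : ℕ → ℕ → ℕ → Set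
    PositiveMeans e l y = ∀ {n} (c : Code (suc n)) xs → index c ≡ e → listCode xs ≡ l →
                          ∀ m → m < y → ∃[ v ] ∅ ∣ c · (m ∷ xs) ⇓ suc v

    Means : ℕ → Vec ℕ 4 → Set
    Means 0 (l ∷ i ∷ y ∷ _ ∷ [])   = NthMeans l i y
    Means 1 (e ∷ l ∷ y ∷ _ ∷ [])   = EvalMeans e l y
    Means 2 (k ∷ es ∷ l ∷ ls ∷ []) = EvalsMean k es l ls
    Means _ (e ∷ l ∷ y ∷ _ ∷ [])   = PositiveMeans e l y

    eval-zero : EvalMeans (0 ∙ 0) 0 0
    eval-zero c xs eqc eqx = go c (∙-injˡ eqc) xs
      where
      go : ∀ {n} (c : Code n) → indexTag c ≡ 0 → ∀ xs → ∅ ∣ c · xs ⇓ 0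
      go zeroᶜ refl [] = zero⇓

    eval-suc : ∀ {x} → EvalMeans (1 ∙ 0) (x ∙ 0) (suc x)
    eval-suc {x} c xs eqc eqx = go c (∙-injˡ eqc) xs eqx
      where
      go : ∀ {n} (c : Code n) → indexTag c ≡ 1 → ∀ xs → listCode xs ≡ x ∙ 0 → ∅ ∣ c · xs ⇓ suc x
      go sucᶜ refl (_ ∷ []) eq with refl ← ∙-injˡ eq = suc⇓

    eval-oracle : ∀ {x} → EvalMeans (2 ∙ 0) (x ∙ 0) 0
    eval-oracle c xs eqc eqx = go c (∙-injˡ eqc) xs
      where
      go : ∀ {n} (c : Code n) → indexTag c ≡ 2 → ∀ xs → ∅ ∣ c · xs ⇓ 0
      go oracle refl (x ∷ []) = no⇓ λ ()

    eval-proj : ∀ {i l y} → NthMeans l i y → EvalMeans (3 ∙ i) l y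
    eval-proj {i} {l} {y} h c xs eqc eqx = go c (∙-injˡ eqc) (∙-injʳ eqc) xs eqx
      where
      go : ∀ {n} (c : Code n) → indexTag c ≡ 3 → indexRest c ≡ i → ∀ xs → listCode xs ≡ l → ∅ ∣ c · xs ⇓ y
      go (proj j) refl eq xs eqx with refl ← h xs j eqx eq = proj⇓

    eval-comp : ∀ {k e es l ls y} → EvalsMean k es l ls → EvalMeans e ls y → EvalMeans (4 ∙ k ∙ e ∙ es) l y
    eval-comp {k} {e} {es} {l} {ls} {y} hs h c xs eqc eqx = go c (∙-injˡ eqc) (∙-injʳ eqc) xs eqx
      where
      go : ∀ {n} (c : Code n) → indexTag c ≡ 4 → indexRest c ≡ k ∙ e ∙ es → ∀ xs → listCode xs ≡ l → ∅ ∣ c · xs ⇓ y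
      go (comp c ds) refl eq xs eqx with refl , eq′ ← ∙-cancel eq with ys , eqy , ds⇓ ← hs ds xs (∙-injʳ eq′) eqx =
        comp⇓ ds⇓ (h c ys (∙-injˡ eq′) eqy)

    eval-precZ : ∀ {e e′ l y} → EvalMeans e l y → EvalMeans (5 ∙ e ∙ e′) (0 ∙ l) y
    eval-precZ {e} {e′} {l} {y} h c xs eqc eqx = go c (∙-injˡ eqc) (∙-injʳ eqc) xs eqx
      where
      go : ∀ {n} (c : Code n) → indexTag c ≡ 5 → indexRest c ≡ e ∙ e′ → ∀ xs → listCode xs ≡ 0 ∙ l → ∅ ∣ c · xs ⇓ y
      go (prec c d) refl eq (x ∷ xs) eqx with refl , eqx′ ← ∙-cancel eqx = precZ⇓ (h c xs (∙-injˡ eq) eqx′)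

    eval-precS : ∀ {e e′ m l y z} → EvalMeans (5 ∙ e ∙ e′) (m ∙ l) y → EvalMeans e′ (m ∙ y ∙ l) z →
                 EvalMeans (5 ∙ e ∙ e′) (suc m ∙ l) z
    eval-precS {e} {e′} {m} {l} {y} {z} h h′ c xs eqc eqx = go c (∙-injˡ eqc) (∙-injʳ eqc) xs eqx
      where
      go : ∀ {n} (c : Code n) → indexTag c ≡ 5 → indexRest c ≡ e ∙ e′ → ∀ xs → listCode xs ≡ suc m ∙ l → ∅ ∣ c · xs ⇓ z
      go (prec c d) refl eq (x ∷ xs) eqx with refl , refl ← ∙-cancel eqx =
        precS⇓ (h (prec c d) (m ∷ xs) (cong (5 ∙_) eq) refl) (h′ d (m ∷ y ∷ xs) (∙-injʳ eq) refl)

    eval-μ : ∀ {e l y} → EvalMeans e (y ∙ l) 0 → PositiveMeans e l y → EvalMeans (6 ∙ e) l y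
    eval-μ {e} {l} {y} h h′ c xs eqc eqx = go c (∙-injˡ eqc) (∙-injʳ eqc) xs eqx
      where
      go : ∀ {n} (c : Code n) → indexTag c ≡ 6 → indexRest c ≡ e → ∀ xs → listCode xs ≡ l → ∅ ∣ c · xs ⇓ y
      go (μ c) refl eq xs eqx = μ⇓ (h c (y ∷ xs) eq (cong (y ∙_) eqx)) (h′ c xs eq eqx)

    evals-cons : ∀ {k e es l y ys} → EvalMeans e l y → EvalsMean k es l ys → EvalsMean (suc k) (e ∙ es) l (y ∙ ys)
    evals-cons h hs (c ∷ cs) xs eqc eqx with ys , eqy , cs⇓ ← hs cs xs (∙-injʳ eqc) eqx =
      _ ∷ ys , cong (_ ∙_) eqy , h c xs (∙-injˡ eqc) eqx ∷⇓ cs⇓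

    positive-suc : ∀ {e l m v} → PositiveMeans e l m → EvalMeans e (m ∙ l) (suc v) → PositiveMeans e l (suc m)
    positive-suc {m = m} h h′ c xs eqc eqx i i<1+m with m≤n⇒m<n∨m≡n (s≤s⁻¹ i<1+m)
    ... | inj₁ i<m  = h c xs eqc eqx i i<m
    ... | inj₂ refl = _ , h′ c (i ∷ xs) eqc (cong (i ∙_) eqx)

  evaluates-sound : ∀ {n} (c : Code n) xs {y} → Evaluates (index c) (listCode xs) y → ∅ ∣ c · xs ⇓ y
  evaluates-sound c xs d = Eval.derivable-sound Means (λ ())
    ( (λ ρ → λ { [] → nth-zero })
    ∷ (λ ρ → λ { (h ∷ []) → nth-suc h })
    ∷ (λ ρ → λ { [] → eval-zero })
    ∷ (λ ρ → λ { [] → eval-suc })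
    ∷ (λ ρ → λ { [] → eval-oracle })
    ∷ (λ ρ → λ { (h ∷ []) → eval-proj h })
    ∷ (λ ρ → λ { (hs ∷ h ∷ []) → eval-comp hs h })
    ∷ (λ ρ → λ { (h ∷ []) → eval-precZ h })
    ∷ (λ ρ → λ { (h ∷ h′ ∷ []) → eval-precS h h′ })
    ∷ (λ ρ → λ { (h ∷ h′ ∷ []) → eval-μ h h′ })
    ∷ (λ ρ → λ { [] [] xs eqc eqx → [] , refl , []⇓ })
    ∷ (λ ρ → λ { (h ∷ hs ∷ []) → evals-cons h hs })
    ∷ (λ ρ → λ { [] c xs eqc eqx m () })
    ∷ (λ ρ → λ { (h ∷ h′ ∷ []) → positive-suc h h′ })
    ∷ []) d c xs refl refl

  nth-derivable : ∀ {n} (xs : Vec ℕ n) i → Eval.Derivable no-param 0 (listCode xs ∷ toℕ i ∷ lookup xs i ∷ 0 ∷ [])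
  nth-derivable (x ∷ xs) zero    = Eval.rule (# 0) (valuation (x ∷ listCode xs ∷ [])) []
  nth-derivable (x ∷ xs) (suc i) = Eval.rule (# 1) (valuation (x ∷ listCode xs ∷ toℕ i ∷ lookup xs i ∷ [])) (nth-derivable xs i ∷ [])

  mutual
    evaluates-complete : ∀ {n} (c : Code n) xs {y} → ∅ ∣ c · xs ⇓ y → Evaluates (index c) (listCode xs) y
    evaluates-complete zeroᶜ [] zero⇓ = Eval.rule (# 2) (valuation []) []
    evaluates-complete sucᶜ (x ∷ []) suc⇓ = Eval.rule (# 3) (valuation (x ∷ [])) []
    evaluates-complete oracle (x ∷ []) (no⇓ _) = Eval.rule (# 4) (valuation (x ∷ [])) []
    evaluates-complete (proj i) xs proj⇓ =
      Eval.rule (# 5) (valuation (toℕ i ∷ listCode xs ∷ lookup xs i ∷ [])) (nth-derivable xs i ∷ [])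
    evaluates-complete (comp {k = k} c ds) xs {y} (comp⇓ {ys = ys} p q) =
      Eval.rule (# 6) (valuation (k ∷ index c ∷ indices ds ∷ listCode xs ∷ listCode ys ∷ y ∷ []))
        (evaluate-all ds xs p ∷ evaluates-complete c ys q ∷ [])
    evaluates-complete (prec c d) (m ∷ xs) p = prec-complete c d m xs p
    evaluates-complete (μ c) xs {y} (μ⇓ p f) =
      Eval.rule (# 9) (valuation (index c ∷ listCode xs ∷ y ∷ [])) (evaluates-complete c (y ∷ xs) p ∷ positive-complete c xs y f ∷ [])

    prec-complete : ∀ {n} (c : Code n) d m xs {y} → ∅ ∣ prec c d · (m ∷ xs) ⇓ y → Evaluates (index (prec c d)) (m ∙ listCode xs) y
    prec-complete c d zero xs {y} (precZ⇓ p) =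
      Eval.rule (# 7) (valuation (index c ∷ index d ∷ listCode xs ∷ y ∷ [])) (evaluates-complete c xs p ∷ [])
    prec-complete c d (suc m) xs {z} (precS⇓ {y = y} p q) =
      Eval.rule (# 8) (valuation (index c ∷ index d ∷ m ∷ listCode xs ∷ y ∷ z ∷ []))
        (prec-complete c d m xs p ∷ evaluates-complete d (m ∷ y ∷ xs) q ∷ [])

    evaluate-all : ∀ {n k} (cs : Vec (Code n) k) xs {ys} → ∅ ∣ cs ·· xs ⇓ ys →
      Eval.Derivable no-param 2 (k ∷ indices cs ∷ listCode xs ∷ listCode ys ∷ [])
    evaluate-all [] xs []⇓ = Eval.rule (# 10) (valuation (listCode xs ∷ [])) []
    evaluate-all {k = suc k} (c ∷ cs) xs {y ∷ ys} (p ∷⇓ ps) =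
      Eval.rule (# 11) (valuation (k ∷ index c ∷ indices cs ∷ listCode xs ∷ y ∷ listCode ys ∷ []))
        (evaluates-complete c xs p ∷ evaluate-all cs xs ps ∷ [])

    positive-complete : ∀ {n} (c : Code (suc n)) xs y → (∀ m → m < y → ∃[ v ] ∅ ∣ c · (m ∷ xs) ⇓ suc v) →
      Eval.Derivable no-param 3 (index c ∷ listCode xs ∷ y ∷ 0 ∷ [])
    positive-complete c xs zero f = Eval.rule (# 12) (valuation (index c ∷ listCode xs ∷ [])) []
    positive-complete c xs (suc m) f =
      Eval.rule (# 13) (valuation (index c ∷ listCode xs ∷ m ∷ proj₁ (f m ≤-refl) ∷ []))
        (positive-complete c xs m (λ i i<m → f i (m<n⇒m<1+n i<m)) ∷ evaluates-complete c (m ∷ xs) (proj₂ (f m ≤-refl)) ∷ [])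

open UniversalProgram

-- Stages of computations and recursively inseparable sets

module InseparableSets where

  rename-poly : ∀ {m n} → (Fin m → Fin n) → Poly m → Poly n
  rename-poly ρ (var i) = var (ρ i)
  rename-poly ρ (lit m) = lit m
  rename-poly ρ (s ⊞ t) = rename-poly ρ s ⊞ rename-poly ρ t
  rename-poly ρ (s ⊠ t) = rename-poly ρ s ⊠ rename-poly ρ t

  rename-bounded : ∀ {b m n} → (Fin m → Fin n) → Bounded b m → Bounded b n
  rename-bounded ρ (s ≗ t)     = rename-poly ρ s ≗ rename-poly ρ t
  rename-bounded ρ (param j i) = param j (ρ i)
  rename-bounded ρ ⊥ᵇ          = ⊥ᵇ
  rename-bounded ρ (φ ∧ᵇ ψ)    = rename-bounded ρ φ ∧ᵇ rename-bounded ρ ψ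
  rename-bounded ρ (φ ∨ᵇ ψ)    = rename-bounded ρ φ ∨ᵇ rename-bounded ρ ψ
  rename-bounded ρ (¬ᵇ φ)      = ¬ᵇ (rename-bounded ρ φ)
  rename-bounded ρ (∀≤ i φ)    = ∀≤ (ρ i) (rename-bounded (zero F.∷ suc ∘ ρ) φ)
  rename-bounded ρ (∃≤ i φ)    = ∃≤ (ρ i) (rename-bounded (zero F.∷ suc ∘ ρ) φ)

  module _ {b} {B : Fin b → ℕ → Set} where

    private
      poly-rename : ∀ {m n} {ρ : Fin m → Fin n} {xs ys} → (∀ i → lookup ys (ρ i) ≡ lookup xs i) →
                    ∀ t → polyValue (rename-poly ρ t) ys ≡ polyValue t xs
      poly-rename eq (var i) = eq i
      poly-rename eq (lit m) = refl
      poly-rename eq (s ⊞ t) = cong₂ _+_ (poly-rename eq s) (poly-rename eq t)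
      poly-rename eq (s ⊠ t) = cong₂ _*_ (poly-rename eq s) (poly-rename eq t)

      lift-eq : ∀ {m n x} {ρ : Fin m → Fin n} {xs : Vec ℕ m} {ys : Vec ℕ n} → (∀ i → lookup ys (ρ i) ≡ lookup xs i) →
                ∀ i → lookup (x ∷ ys) ((zero F.∷ suc ∘ ρ) i) ≡ lookup (x ∷ xs) i
      lift-eq eq zero    = refl
      lift-eq eq (suc i) = eq i

    holds-rename : ∀ {m n} {ρ : Fin m → Fin n} {xs ys} → (∀ i → lookup ys (ρ i) ≡ lookup xs i) →
      ∀ φ → (Holds B (rename-bounded ρ φ) ys → Holds B φ xs) × (Holds B φ xs → Holds B (rename-bounded ρ φ) ys)
    holds-rename eq (s ≗ t) = (λ h → trans (sym (poly-rename eq s)) (trans h (poly-rename eq t)))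
                            , (λ h → trans (poly-rename eq s) (trans h (sym (poly-rename eq t))))
    holds-rename eq (param j i) = Eq.subst (B j) (eq i) , Eq.subst (B j) (sym (eq i))
    holds-rename eq ⊥ᵇ = id , id
    holds-rename eq (φ ∧ᵇ ψ) = (λ (p , q) → proj₁ (holds-rename eq φ) p , proj₁ (holds-rename eq ψ) q)
                             , (λ (p , q) → proj₂ (holds-rename eq φ) p , proj₂ (holds-rename eq ψ) q)
    holds-rename eq (φ ∨ᵇ ψ) = [ inj₁ ∘ proj₁ (holds-rename eq φ) , inj₂ ∘ proj₁ (holds-rename eq ψ) ]′
                             , [ inj₁ ∘ proj₂ (holds-rename eq φ) , inj₂ ∘ proj₂ (holds-rename eq ψ) ]′
    holds-rename eq (¬ᵇ φ) = (_∘ proj₂ (holds-rename eq φ)) , (_∘ proj₁ (holds-rename eq φ))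
    holds-rename eq (∀≤ i φ) =
        (λ h x x≤ → proj₁ (holds-rename (lift-eq eq) φ) (h x (Eq.subst (x ≤_) (sym (eq i)) x≤)))
      , (λ h x x≤ → proj₂ (holds-rename (lift-eq eq) φ) (h x (Eq.subst (x ≤_) (eq i) x≤)))
    holds-rename eq (∃≤ i φ) =
        (λ (x , x≤ , h) → x , Eq.subst (x ≤_) (eq i) x≤ , proj₁ (holds-rename (lift-eq eq) φ) h)
      , (λ (x , x≤ , h) → x , Eq.subst (x ≤_) (sym (eq i)) x≤ , proj₂ (holds-rename (lift-eq eq) φ) h)

  -- Seen e x y s: the computation of the index e at x with value y is found below s.

  evalFact : FactPattern
  evalFact = fact 1 v₀ (v₁ ⊡ lit 0) v₂ (lit 0)

  evalArgs : Fin 8 → Fin 6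
  evalArgs zero          = # 2
  evalArgs (suc zero)    = # 3
  evalArgs (suc (suc _)) = # 4

  opaque
    seenᵇ : Bounded 0 4
    seenᵇ = ∃≤ (# 3) (∃≤ (# 4)
      (Eval.factMatches evalFact evalArgs (# 1) ∧ᵇ rename-bounded (# 1 F.∷ # 0 F.∷ F.[]) (Eval.derivation 0)))

    haltsᵇ : Bounded 0 3
    haltsᵇ = ∃≤ (# 2) (rename-bounded (# 1 F.∷ # 2 F.∷ # 0 F.∷ # 3 F.∷ F.[]) seenᵇ)

  Seen : ℕ → ℕ → ℕ → ℕ → Set
  Seen e x y s = Holds no-param seenᵇ (e ∷ x ∷ y ∷ s ∷ [])

  Halts : ℕ → ℕ → ℕ → Set
  Halts e x s = Holds no-param haltsᵇ (e ∷ x ∷ s ∷ [])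

  private
    -- The stage s occurs only as an upper bound, for the code of the fact and for the size of its
    -- derivation. This makes visibility monotone in s.
    SeenBelow : ℕ → ℕ → ℕ → ℕ → Set
    SeenBelow e x y s = Σ[ w ∈ ℕ ] (w ≤ s × factCode 1 (e ∷ x ∙ 0 ∷ y ∷ 0 ∷ []) ≤ s ×
      Holds no-param (Eval.derivation 0) (factCode 1 (e ∷ x ∙ 0 ∷ y ∷ 0 ∷ []) ∷ w ∷ []))

    in-order : ∀ {e x y s z w : ℕ} i → lookup (w ∷ z ∷ e ∷ x ∷ y ∷ s ∷ []) ((# 1 F.∷ # 0 F.∷ F.[]) i) ≡ lookup (z ∷ w ∷ []) i
    in-order zero       = refl
    in-order (suc zero) = refl

    opaque
      unfolding seenᵇ

      seen⁻ : ∀ {e x y s} → Seen e x y s → SeenBelow e x y s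
      seen⁻ {e} {x} {y} {s} (z , z≤ , w , w≤ , m , d) with refl ← Eval.factMatches⁻ {B = no-param} evalFact evalArgs (# 1) (w ∷ z ∷ e ∷ x ∷ y ∷ s ∷ []) m =
        w , w≤ , z≤ , proj₁ (holds-rename in-order (Eval.derivation 0)) d

      seen⁺ : ∀ {e x y s} → SeenBelow e x y s → Seen e x y s
      seen⁺ {e} {x} {y} {s} (w , w≤ , z≤ , d) = factCode 1 (e ∷ x ∙ 0 ∷ y ∷ 0 ∷ []) , z≤ , w , w≤ ,
        Eval.factMatches⁺ {B = no-param} evalFact evalArgs (# 1) (w ∷ factCode 1 (e ∷ x ∙ 0 ∷ y ∷ 0 ∷ []) ∷ e ∷ x ∷ y ∷ s ∷ []) refl ,
        proj₂ (holds-rename in-order (Eval.derivation 0)) d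

    seen-in : ∀ {e x y s : ℕ} i → lookup (y ∷ e ∷ x ∷ s ∷ []) ((# 1 F.∷ # 2 F.∷ # 0 F.∷ # 3 F.∷ F.[]) i) ≡ lookup (e ∷ x ∷ y ∷ s ∷ []) i
    seen-in zero                   = refl
    seen-in (suc zero)             = refl
    seen-in (suc (suc zero))       = refl
    seen-in (suc (suc (suc zero))) = refl

  seen-sound : ∀ {e x y s} → Seen e x y s → Evaluates e (x ∙ 0) y
  seen-sound h with _ , _ , _ , d ← seen⁻ h = Eval.derivation-sound d

  seen-complete : ∀ {e x y} → Evaluates e (x ∙ 0) y → Σ[ s ∈ ℕ ] Seen e x y s
  seen-complete {e} {x} {y} d with w , h ← Eval.derivation-complete d = w + _ , seen⁺ (w , m≤m+n w _ , m≤n+m _ w , h)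

  seen-mono : ∀ {e x y s t} → s ≤ t → Seen e x y s → Seen e x y t
  seen-mono s≤t h with w , w≤ , z≤ , d ← seen⁻ h = seen⁺ (w , ≤-trans w≤ s≤t , ≤-trans z≤ s≤t , d)

  opaque
    unfolding haltsᵇ

    halts⁻ : ∀ {e x s} → Halts e x s → Σ[ y ∈ ℕ ] (y ≤ s × Seen e x y s)
    halts⁻ (y , y≤s , h) = y , y≤s , proj₁ (holds-rename seen-in seenᵇ) h

    halts⁺ : ∀ {e x s y} → y ≤ s → Seen e x y s → Halts e x s
    halts⁺ y≤s h = _ , y≤s , proj₂ (holds-rename seen-in seenᵇ) h

  halts-mono : ∀ {e x s t} → s ≤ t → Halts e x s → Halts e x t
  halts-mono s≤t h with y , y≤ , h′ ← halts⁻ h = halts⁺ (≤-trans y≤ s≤t) (seen-mono s≤t h′)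

  halts-complete : ∀ {e x y} → Evaluates e (x ∙ 0) y → Σ[ s ∈ ℕ ] Halts e x s
  halts-complete {y = y} d with s , h ← seen-complete d = y + s , halts⁺ (m≤m+n y s) (seen-mono (m≤n+m s y) h)

  halts⇒W : ∀ c {x s} → Halts (index c) x s → W c x
  halts⇒W c {x} h with y , _ , h′ ← halts⁻ h = y , evaluates-sound c (x ∷ []) (seen-sound h′)

  opaque
    W⇒halts : ∀ c {x} → W c x → Σ[ s ∈ ℕ ] Halts (index c) x s
    W⇒halts c {x} (y , c⇓) = halts-complete (evaluates-complete c (x ∷ []) c⇓)

  module Inseparability (em : ExcludedMiddle 0ℓ) where
    open Deciding em

    decideSeen : ∀ {A} → Decides A (Holds no-param seenᵇ)
    decideSeen = decideBounded em (λ ()) seenᵇ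

    decideHalts : ∀ {A} → Decides A (Holds no-param haltsᵇ)
    decideHalts = decideBounded em (λ ()) haltsᵇ

    selfHalts : Decides ∅ (λ (xs : Vec ℕ 2) → Halts (lookup xs (# 1)) (lookup xs (# 1)) (lookup xs (# 0)))
    selfHalts = dec-∘ decideHalts (arg (# 1) ∷ arg (# 1) ∷ arg (# 0) ∷ [])

    diagonal : Code 1
    diagonal = search selfHalts

    -- `W diagonal` is the halting problem on the diagonal. A decision procedure for it would yield
    -- an index `g` that halts exactly outside this set, which is absurd at the number `e` of `g`
    -- itself.
    diagonal-nonrecursive : ¬ Recursive (W diagonal)
    diagonal-nonrecursive rec = self-contradictory (not-W , W-not)
      where
      avoiding : Decides ∅ (λ (xs : Vec ℕ 2) → ¬ W diagonal (lookup xs (# 1)))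
      avoiding = dec-∘ (dec-¬ (≤ᵀ⇒decides rec)) (arg {2} (# 1) ∷ [])
      g : Code 1
      g = search avoiding
      e : ℕ
      e = index g
      self-contradictory : ∀ {P : Set} → ¬ ((P → ¬ P) × (¬ P → P))
      self-contradictory {P} (f , g) = ¬p (g ¬p)
        where
        ¬p : ¬ P
        ¬p p = f p p
      not-W : W diagonal e → ¬ W diagonal e
      not-W (s , run) = search-sound avoiding (proj₂ (halts⇒W g (search-sound selfHalts run)))
      W-not : ¬ W diagonal e → W diagonal e
      W-not ¬w with m , run , _ ← search-complete avoiding {e ∷ []} {0} ¬w
        with s , h ← W⇒halts g (m , run)
        with s′ , run′ , _ ← search-complete selfHalts {e ∷ []} {s} h = s′ , run′

    module _ (c : Code 1) where

      Enters : ℕ → ℕ → Set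
      Enters x s = Halts (index c) x s × (∀ t → t ≤ s → Halts (index c) x t → t ≡ s)

      opaque
        enters : ∀ {x} → W c x → Σ[ s ∈ ℕ ] Enters x s
        enters {x} w with s , h , below ← least (Halts (index c) x) _ (proj₂ (W⇒halts c w)) =
          s , h , λ t t≤s h′ → [ (λ t<s → contradiction h′ (below t t<s)) , id ]′ (m≤n⇒m<n∨m≡n t≤s)

      enters-unique : ∀ {x s t} → Enters x s → Enters x t → s ≡ t
      enters-unique {x} {s} {t} (h , first) (h′ , first′) with ≤-total s t
      ... | inj₁ s≤t = first′ s s≤t h
      ... | inj₂ t≤s = sym (first t t≤s h′)

      -- When x enters W c, the number e ∙ x is put into the set that refutes
      -- the computation of e at e ∙ x, if that computation is already visible.
      A-stage B-stage : ℕ → ℕ → Set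
      A-stage z s = Σ[ e ∈ ℕ ] (e ≤ z × Σ[ x ∈ ℕ ] (x ≤ z × z ≡ e ∙ x × Enters x s × ¬ Seen e z 1 s))
      B-stage z s = Σ[ e ∈ ℕ ] (e ≤ z × Σ[ x ∈ ℕ ] (x ≤ z × z ≡ e ∙ x × Enters x s × Seen e z 1 s))

      SetA SetB : ℕ → Set
      SetA z = Σ[ s ∈ ℕ ] A-stage z s
      SetB z = Σ[ s ∈ ℕ ] B-stage z s

      private
        decideStage : ∀ {O} {P : Vec ℕ 4 → Set} → Decides O P →
          Decides O (λ (xs : Vec ℕ 2) → Σ[ e ∈ ℕ ] (e ≤ lookup xs (# 1) × Σ[ x ∈ ℕ ] (x ≤ lookup xs (# 1) ×
            lookup xs (# 1) ≡ e ∙ x × Enters x (lookup xs (# 0)) × P (x ∷ e ∷ xs))))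
        decideStage dP = dec-∃≤ (dec-∃≤ (dec-× (dec-≡ (arg (# 3)) (arg (# 1) ⊙ arg (# 0))) (dec-× dEnters dP)) (arg (# 2))) (arg (# 1))
          where
          dEnters = dec-× (dec-∘ decideHalts (constant (index c) ∷ arg (# 0) ∷ arg (# 2) ∷ []))
                          (dec-∀≤ (dec-→ (dec-∘ decideHalts (constant (index c) ∷ arg (# 1) ∷ arg (# 0) ∷ [])) (dec-≡ (arg (# 0)) (arg (# 3)))) (arg (# 2)))
        dSeen : ∀ {O} → Decides O (λ (xs : Vec ℕ 4) → Seen (lookup xs (# 1)) (lookup xs (# 3)) 1 (lookup xs (# 2)))
        dSeen = dec-∘ decideSeen (arg (# 1) ∷ arg (# 3) ∷ constant 1 ∷ arg (# 2) ∷ [])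

      decideA : ∀ {O} → Decides O (λ xs → A-stage (lookup xs (# 1)) (lookup xs (# 0)))
      decideA = dec-map (λ { (s ∷ z ∷ []) → id }) (λ { (s ∷ z ∷ []) → id }) (decideStage (dec-¬ dSeen))

      decideB : ∀ {O} → Decides O (λ xs → B-stage (lookup xs (# 1)) (lookup xs (# 0)))
      decideB = dec-map (λ { (s ∷ z ∷ []) → id }) (λ { (s ∷ z ∷ []) → id }) (decideStage dSeen)

      stage-cases : ∀ e x {s} → Enters x s → A-stage (e ∙ x) s ⊎ B-stage (e ∙ x) s
      stage-cases e x {s} en with em {Seen e (e ∙ x) 1 s}
      ... | yes seen = inj₂ (e , m≤m∙n e x , x , n≤m∙n e x , refl , en , seen)
      ... | no ¬seen = inj₁ (e , m≤m∙n e x , x , n≤m∙n e x , refl , en , ¬seen)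

      disjoint : ∀ {z} → SetA z → ¬ SetB z
      disjoint (s , e , _ , x , _ , refl , en , ¬seen) (t , e′ , _ , x′ , _ , eq , en′ , seen)
        with refl , refl ← ∙-cancel eq with refl ← enters-unique en en′ = ¬seen seen

      private
        component : ∀ {z} → SetA z ⊎ SetB z → Σ[ e ∈ ℕ ] Σ[ x ∈ ℕ ] (z ≡ e ∙ x × W c x)
        component (inj₁ (_ , e , _ , x , _ , eq , (h , _) , _)) = e , x , eq , halts⇒W c h
        component (inj₂ (_ , e , _ , x , _ , eq , (h , _) , _)) = e , x , eq , halts⇒W c h

        Outside : Vec ℕ 2 → Set
        Outside xs = Σ[ e ∈ ℕ ] (e ≤ lookup xs (# 1) × Σ[ x ∈ ℕ ] (x ≤ lookup xs (# 1) × lookup xs (# 1) ≡ e ∙ x × ¬ W c x))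

        decideOutside : ∀ {O} → W c ≤ᵀ O → Decides O Outside
        decideOutside red = dec-∃≤ (dec-∃≤ (dec-× (dec-≡ (arg (# 3)) (arg (# 1) ⊙ arg (# 0)))
          (dec-∘ (dec-¬ (≤ᵀ⇒decides red)) (arg (# 0) ∷ []))) (arg (# 2))) (arg (# 1))

        outside-sound : ∀ {z s} → Outside (s ∷ z ∷ []) → ¬ (SetA z ⊎ SetB z)
        outside-sound (e , _ , x , _ , eq , ¬w) ab with e′ , x′ , eq′ , w ← component ab
          with refl , refl ← ∙-cancel (trans (sym eq) eq′) = ¬w w

        cases : ∀ z → Outside (0 ∷ z ∷ []) ⊎ SetA z ⊎ SetB z
        cases z with e , x , refl ← unpair z with em {W c x}
        ... | no ¬w = inj₁ (e , m≤m∙n e x , x , n≤m∙n e x , refl , ¬w)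
        ... | yes w with s , en ← enters w = inj₂ ([ inj₁ ∘ (s ,_) , inj₂ ∘ (s ,_) ]′ (stage-cases e x en))

      -- Every number is of the form e ∙ x. If x is not in `W c`, which the oracle tells, the number
      -- is in neither set; otherwise the stage at which x enters puts it into one of them. So each
      -- number has a certificate that settles its membership.
      SetA≤ᵀ : ∀ {O} → W c ≤ᵀ O → SetA ≤ᵀ O
      SetA≤ᵀ red = decides⇒≤ᵀ (decides-by-search decideA (dec-⊎ (decideOutside red) decideB)
        (λ { {s} {z ∷ []} a → s , a })
        (λ { {s} {z ∷ []} (inj₁ out) a → outside-sound {s = s} out (inj₁ a) ; {s} {z ∷ []} (inj₂ b) a → disjoint a (s , b) })
        (λ { (z ∷ []) a → a })
        (λ { (z ∷ []) ¬a → [ (λ out → 0 , inj₁ out) , [ (λ a → contradiction a ¬a) , map₂ inj₂ ]′ ]′ (cases z) }))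

      SetB≤ᵀ : ∀ {O} → W c ≤ᵀ O → SetB ≤ᵀ O
      SetB≤ᵀ red = decides⇒≤ᵀ (decides-by-search decideB (dec-⊎ (decideOutside red) decideA)
        (λ { {s} {z ∷ []} b → s , b })
        (λ { {s} {z ∷ []} (inj₁ out) b → outside-sound {s = s} out (inj₂ b) ; {s} {z ∷ []} (inj₂ a) b → disjoint (s , a) b })
        (λ { (z ∷ []) b → b })
        (λ { (z ∷ []) ¬b → [ (λ out → 0 , inj₁ out) , [ map₂ inj₂ , (λ b → contradiction b ¬b) ]′ ]′ (cases z) }))

      -- An index that is nowhere defined makes W c reducible to SetA.
      private
        falsity : Decides {2} ∅ (λ _ → ⊥)
        falsity = fromFn (constant 0) (λ _ ()) (λ _ _ → refl)

        nowhere : Code 1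
        nowhere = search falsity

        never-seen : ∀ {z s} → ¬ Seen (index nowhere) z 1 s
        never-seen {z} seen = search-sound falsity (evaluates-sound nowhere (z ∷ []) (seen-sound seen))

      W⇔SetA : ∀ x → (W c x → SetA (index nowhere ∙ x)) × (SetA (index nowhere ∙ x) → W c x)
      W⇔SetA x = (λ w → let s , en = enters w in s , [ id , (λ (e , _ , x′ , _ , eq , _ , seen) →
                    contradiction (Eq.subst (λ e → Seen e _ 1 s) (sym (∙-injˡ eq)) seen) never-seen) ]′ (stage-cases (index nowhere) x en))
               , (λ a → let e , x′ , eq , w = component (inj₁ a) in Eq.subst (W c) (sym (∙-injʳ eq)) w)

      W≤ᵀSetA : ∀ {O} → SetA ≤ᵀ O → W c ≤ᵀ O
      W≤ᵀSetA red = decides⇒≤ᵀ (dec-map (λ { (x ∷ []) → proj₂ (W⇔SetA x) }) (λ { (x ∷ []) → proj₁ (W⇔SetA x) })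
        (dec-∘ (≤ᵀ⇒decides red) (constant (index nowhere) ⊙ arg (# 0) ∷ [])))

      -- Let `k` decide X, with number `e`, and suppose that x enters `W c` only after the value of
      -- `k` at e ∙ x has become visible. Value 1 puts e ∙ x into the second set, where `k` must
      -- give 0. Value 0 is impossible in the first set, where `k` must give 1, and also in the
      -- second, which requires a visible value 1. Hence x is outside `W c` as soon as the value is
      -- visible and x has not entered. Since `k` is total, this gives certificates for the
      -- complement.
      inseparable : ∀ {X : Pred ℕ 0ℓ} → (∀ z → SetA z → X z) → (∀ z → SetB z → ¬ X z) → Recursive X → Recursive (W c)
      inseparable {X} A⊆X B∩X (k , k-yes , k-no) = decides⇒≤ᵀ (decides-by-search
        (dec-∘ decideHalts (constant (index c) ∷ arg (# 1) ∷ arg (# 0) ∷ []))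
        (dec-× (dec-⊎ (seenAs 1) (seenAs 0)) (dec-¬ (dec-∘ decideHalts (constant (index c) ∷ arg (# 1) ∷ arg (# 0) ∷ []))))
        (λ { {s} {x ∷ []} h → halts⇒W c h }) (λ { {s} {x ∷ []} → refuted }) (λ { (x ∷ []) → W⇒halts c }) outside)
        where
        e : ℕ
        e = index k
        seenAs : ∀ v → Decides ∅ (λ (xs : Vec ℕ 2) → Seen e (e ∙ lookup xs (# 1)) v (lookup xs (# 0)))
        seenAs v = dec-∘ decideSeen (constant e ∷ (constant e ⊙ arg (# 1)) ∷ constant v ∷ arg (# 0) ∷ [])
        runs-to : ∀ {z v s} → Seen e z v s → ∅ ∣ k · (z ∷ []) ⇓ v
        runs-to seen = evaluates-sound k _ (seen-sound seen)
        refuted : ∀ {s x} → (Seen e (e ∙ x) 1 s ⊎ Seen e (e ∙ x) 0 s) × ¬ Halts (index c) x s → ¬ W c x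
        refuted {s} {x} (seen , ¬h) w with t , en@(h , _) ← enters w with seen | stage-cases e x en
        ... | inj₁ yes-seen | inj₁ (e′ , _ , x′ , _ , eq , _ , ¬seen) =
              ¬seen (Eq.subst (λ i → Seen i (e ∙ x) 1 t) (∙-injˡ eq) (seen-mono (<⇒≤ (≰⇒> (λ t≤s → ¬h (halts-mono t≤s h)))) yes-seen))
        ... | inj₁ yes-seen | inj₂ b = contradiction (⇓-functional k (runs-to yes-seen) (k-no _ (B∩X _ (t , b)))) λ ()
        ... | inj₂ no-seen  | inj₁ a = contradiction (⇓-functional k (runs-to no-seen) (k-yes _ (A⊆X _ (t , a)))) λ ()
        ... | inj₂ no-seen  | inj₂ (e′ , _ , x′ , _ , eq , _ , yes-seen) =
              contradiction (⇓-functional k (runs-to no-seen) (runs-to (Eq.subst (λ i → Seen i (e ∙ x) 1 t) (sym (∙-injˡ eq)) yes-seen))) λ ()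
        outside : ∀ xs → ¬ W c (V.head xs) → Σ[ s ∈ ℕ ] _
        outside (x ∷ []) ¬w with em {X (e ∙ x)}
        ... | yes p with s , h ← seen-complete (evaluates-complete k (e ∙ x ∷ []) (k-yes _ p)) = s , inj₁ h , ¬w ∘ halts⇒W c
        ... | no ¬p with s , h ← seen-complete (evaluates-complete k (e ∙ x ∷ []) (k-no _ ¬p)) = s , inj₂ h , ¬w ∘ halts⇒W c

open InseparableSets

-- Substitution and derived rules of the calculus

module Syntax where

  liftʳ : ∀ {m n} → (Fin m → Fin n) → Fin (suc m) → Fin (suc n)
  liftʳ ρ = zero F.∷ suc ∘ ρ

  module _ {L : Language} where

    private variable
      l m n k : ℕ

    lift : (Fin m → Term L n) → Fin (suc m) → Term L (suc n)
    lift σ = var zero F.∷ renameᵗ suc ∘ σ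

    lift-cong : {σ τ : Fin m → Term L n} → (∀ i → σ i ≡ τ i) → ∀ i → lift σ i ≡ lift τ i
    lift-cong eq zero    = refl
    lift-cong eq (suc i) = cong (renameᵗ suc) (eq i)

    mutual
      substᵗ-cong : {σ τ : Fin m → Term L n} → (∀ i → σ i ≡ τ i) → ∀ t → substᵗ σ t ≡ substᵗ τ t
      substᵗ-cong eq (var x)    = eq x
      substᵗ-cong eq (fun f ts) = cong (fun f) (substᵗˢ-cong eq ts)

      substᵗˢ-cong : {σ τ : Fin m → Term L n} → (∀ i → σ i ≡ τ i) → (ts : Vec (Term L m) k) → substᵗˢ σ ts ≡ substᵗˢ τ ts
      substᵗˢ-cong eq []       = refl
      substᵗˢ-cong eq (t ∷ ts) = cong₂ _∷_ (substᵗ-cong eq t) (substᵗˢ-cong eq ts)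

    subst-cong : {σ τ : Fin m → Term L n} → (∀ i → σ i ≡ τ i) → ∀ φ → subst σ φ ≡ subst τ φ
    subst-cong eq (s ≐ t)    = cong₂ _≐_ (substᵗ-cong eq s) (substᵗ-cong eq t)
    subst-cong eq (rel r ts) = cong (rel r) (substᵗˢ-cong eq ts)
    subst-cong eq ⊥̇          = refl
    subst-cong eq (φ ⇒ ψ)    = cong₂ _⇒_ (subst-cong eq φ) (subst-cong eq ψ)
    subst-cong eq (∀̇ φ)      = cong ∀̇ (subst-cong (lift-cong eq) φ)

    mutual
      -- Renaming is reduced to substitution, so that laws about composed renamings follow from
      -- those about substitution.
      renameᵗ-subst : (ρ : Fin m → Fin n) → ∀ t → renameᵗ {L} ρ t ≡ substᵗ (var ∘ ρ) t
      renameᵗ-subst ρ (var x)    = refl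
      renameᵗ-subst ρ (fun f ts) = cong (fun f) (renameᵗˢ-subst ρ ts)

      renameᵗˢ-subst : (ρ : Fin m → Fin n) → (ts : Vec (Term L m) k) → renameᵗˢ ρ ts ≡ substᵗˢ (var ∘ ρ) ts
      renameᵗˢ-subst ρ []       = refl
      renameᵗˢ-subst ρ (t ∷ ts) = cong₂ _∷_ (renameᵗ-subst ρ t) (renameᵗˢ-subst ρ ts)

    rename-subst : (ρ : Fin m → Fin n) → ∀ φ → rename {L} ρ φ ≡ subst (var ∘ ρ) φ
    rename-subst ρ (s ≐ t)    = cong₂ _≐_ (renameᵗ-subst ρ s) (renameᵗ-subst ρ t)
    rename-subst ρ (rel r ts) = cong (rel r) (renameᵗˢ-subst ρ ts)
    rename-subst ρ ⊥̇          = refl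
    rename-subst ρ (φ ⇒ ψ)    = cong₂ _⇒_ (rename-subst ρ φ) (rename-subst ρ ψ)
    rename-subst ρ (∀̇ φ)      = cong ∀̇ (trans (rename-subst (liftʳ ρ) φ)
      (subst-cong (λ { zero → refl ; (suc i) → refl }) φ))

    mutual
      substᵗ-renameᵗ : (σ : Fin m → Term L n) (ρ : Fin l → Fin m) → ∀ t → substᵗ σ (renameᵗ ρ t) ≡ substᵗ (σ ∘ ρ) t
      substᵗ-renameᵗ σ ρ (var x)    = refl
      substᵗ-renameᵗ σ ρ (fun f ts) = cong (fun f) (substᵗˢ-renameᵗˢ σ ρ ts)

      substᵗˢ-renameᵗˢ : (σ : Fin m → Term L n) (ρ : Fin l → Fin m) (ts : Vec (Term L l) k) →
                         substᵗˢ σ (renameᵗˢ ρ ts) ≡ substᵗˢ (σ ∘ ρ) ts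
      substᵗˢ-renameᵗˢ σ ρ []       = refl
      substᵗˢ-renameᵗˢ σ ρ (t ∷ ts) = cong₂ _∷_ (substᵗ-renameᵗ σ ρ t) (substᵗˢ-renameᵗˢ σ ρ ts)

    subst-rename : (σ : Fin m → Term L n) (ρ : Fin l → Fin m) → ∀ φ → subst σ (rename ρ φ) ≡ subst (σ ∘ ρ) φ
    subst-rename σ ρ (s ≐ t)    = cong₂ _≐_ (substᵗ-renameᵗ σ ρ s) (substᵗ-renameᵗ σ ρ t)
    subst-rename σ ρ (rel r ts) = cong (rel r) (substᵗˢ-renameᵗˢ σ ρ ts)
    subst-rename σ ρ ⊥̇          = refl
    subst-rename σ ρ (φ ⇒ ψ)    = cong₂ _⇒_ (subst-rename σ ρ φ) (subst-rename σ ρ ψ)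
    subst-rename σ ρ (∀̇ φ)      = cong ∀̇ (trans (subst-rename (lift σ) (liftʳ ρ) φ)
      (subst-cong (λ { zero → refl ; (suc i) → refl }) φ))

    mutual
      substᵗ-substᵗ : (τ : Fin m → Term L n) (σ : Fin l → Term L m) → ∀ t → substᵗ τ (substᵗ σ t) ≡ substᵗ (substᵗ τ ∘ σ) t
      substᵗ-substᵗ τ σ (var x)    = refl
      substᵗ-substᵗ τ σ (fun f ts) = cong (fun f) (substᵗˢ-substᵗˢ τ σ ts)

      substᵗˢ-substᵗˢ : (τ : Fin m → Term L n) (σ : Fin l → Term L m) (ts : Vec (Term L l) k) →
                        substᵗˢ τ (substᵗˢ σ ts) ≡ substᵗˢ (substᵗ τ ∘ σ) ts
      substᵗˢ-substᵗˢ τ σ []       = refl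
      substᵗˢ-substᵗˢ τ σ (t ∷ ts) = cong₂ _∷_ (substᵗ-substᵗ τ σ t) (substᵗˢ-substᵗˢ τ σ ts)

    renameᵗ-substᵗ : (ρ : Fin m → Fin n) (σ : Fin l → Term L m) → ∀ t → renameᵗ ρ (substᵗ σ t) ≡ substᵗ (renameᵗ ρ ∘ σ) t
    renameᵗ-substᵗ ρ σ t = trans (renameᵗ-subst ρ (substᵗ σ t)) (trans (substᵗ-substᵗ (var ∘ ρ) σ t)
      (substᵗ-cong (λ i → sym (renameᵗ-subst ρ (σ i))) t))

    lift-∘ : (τ : Fin m → Term L n) (σ : Fin l → Term L m) → ∀ i → substᵗ (lift τ) (lift σ i) ≡ lift (substᵗ τ ∘ σ) i
    lift-∘ τ σ zero    = refl
    lift-∘ τ σ (suc i) = trans (substᵗ-renameᵗ (lift τ) suc (σ i)) (sym (renameᵗ-substᵗ suc τ (σ i)))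

    subst-subst : (τ : Fin m → Term L n) (σ : Fin l → Term L m) → ∀ φ → subst τ (subst σ φ) ≡ subst (substᵗ τ ∘ σ) φ
    subst-subst τ σ (s ≐ t)    = cong₂ _≐_ (substᵗ-substᵗ τ σ s) (substᵗ-substᵗ τ σ t)
    subst-subst τ σ (rel r ts) = cong (rel r) (substᵗˢ-substᵗˢ τ σ ts)
    subst-subst τ σ ⊥̇          = refl
    subst-subst τ σ (φ ⇒ ψ)    = cong₂ _⇒_ (subst-subst τ σ φ) (subst-subst τ σ ψ)
    subst-subst τ σ (∀̇ φ)      = cong ∀̇ (trans (subst-subst (lift τ) (lift σ) φ) (subst-cong (lift-∘ τ σ) φ))

    mutual
      substᵗ-id : (t : Term L n) → substᵗ var t ≡ t
      substᵗ-id (var x)    = refl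
      substᵗ-id (fun f ts) = cong (fun f) (substᵗˢ-id ts)

      substᵗˢ-id : (ts : Vec (Term L n) k) → substᵗˢ var ts ≡ ts
      substᵗˢ-id []       = refl
      substᵗˢ-id (t ∷ ts) = cong₂ _∷_ (substᵗ-id t) (substᵗˢ-id ts)

    subst-id : (φ : Formula L n) → subst var φ ≡ φ
    subst-id (s ≐ t)    = cong₂ _≐_ (substᵗ-id s) (substᵗ-id t)
    subst-id (rel r ts) = cong (rel r) (substᵗˢ-id ts)
    subst-id ⊥̇          = refl
    subst-id (φ ⇒ ψ)    = cong₂ _⇒_ (subst-id φ) (subst-id ψ)
    subst-id (∀̇ φ)      = cong ∀̇ (trans (subst-cong (λ { zero → refl ; (suc i) → refl }) φ) (subst-id φ))

    rename-∘ : (ρ : Fin m → Fin n) (π : Fin l → Fin m) → ∀ φ → rename {L} ρ (rename π φ) ≡ rename (ρ ∘ π) φ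
    rename-∘ ρ π φ = trans (rename-subst ρ (rename π φ)) (trans (subst-rename (var ∘ ρ) π φ) (sym (rename-subst (ρ ∘ π) φ)))

    renameᵗ-∘ : (ρ : Fin m → Fin n) (π : Fin l → Fin m) → ∀ t → renameᵗ {L} ρ (renameᵗ π t) ≡ renameᵗ (ρ ∘ π) t
    renameᵗ-∘ ρ π t = trans (renameᵗ-subst ρ (renameᵗ π t)) (trans (substᵗ-renameᵗ (var ∘ ρ) π t) (sym (renameᵗ-subst (ρ ∘ π) t)))

    rename-id : {ρ : Fin n → Fin n} → (∀ i → ρ i ≡ i) → ∀ φ → rename {L} ρ φ ≡ φ
    rename-id {ρ = ρ} eq φ = trans (rename-subst ρ φ) (trans (subst-cong (cong var ∘ eq) φ) (subst-id φ))

    rename-cong : {ρ π : Fin m → Fin n} → (∀ i → ρ i ≡ π i) → ∀ φ → rename {L} ρ φ ≡ rename π φ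
    rename-cong {ρ = ρ} {π} eq φ =
      trans (rename-subst ρ φ) (trans (subst-cong (cong var ∘ eq) φ) (sym (rename-subst π φ)))

    rename-[] : (ρ : Fin m → Fin n) (φ : Formula L (suc m)) (t : Term L m) →
                rename ρ (φ [ t ]) ≡ rename (liftʳ ρ) φ [ renameᵗ ρ t ]
    rename-[] ρ φ t = begin
      rename ρ (subst (t F.∷ var) φ)                       ≡⟨ rename-subst ρ _ ⟩
      subst (var ∘ ρ) (subst (t F.∷ var) φ)                ≡⟨ subst-subst (var ∘ ρ) (t F.∷ var) φ ⟩
      subst (substᵗ (var ∘ ρ) ∘ (t F.∷ var)) φ             ≡⟨ subst-cong (λ { zero → sym (renameᵗ-subst ρ t) ; (suc i) → refl }) φ ⟩
      subst ((renameᵗ ρ t F.∷ var) ∘ liftʳ ρ) φ            ≡⟨ subst-rename _ (liftʳ ρ) φ ⟨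
      subst (renameᵗ ρ t F.∷ var) (rename (liftʳ ρ) φ)     ∎
      where open ≡-Reasoning

    lift-[] : (φ : Formula L (suc n)) → rename (liftʳ suc) φ [ var zero ] ≡ φ
    lift-[] φ = trans (subst-rename _ (liftʳ suc) φ) (trans (subst-cong (λ { zero → refl ; (suc i) → refl }) φ) (subst-id φ))

    infixr 5 _⊆-∷_

    private
      _⊆-∷_ : ∀ {A : Set} {xs ys : List A} (x : A) → (∀ {y} → y ∈ xs → y ∈ ys) → ∀ {y} → y ∈ x ∷ xs → y ∈ x ∷ ys
      (x ⊆-∷ s) (here eq) = here eq
      (x ⊆-∷ s) (there p) = there (s p)

      ⊆-map : ∀ {A B : Set} (f : A → B) {xs ys : List A} → (∀ {y} → y ∈ xs → y ∈ ys) → ∀ {z} → z ∈ map f xs → z ∈ map f ys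
      ⊆-map f s p with y , y∈ , refl ← ∈-map⁻ f p = ∈-map⁺ f (s y∈)

    weaken : ∀ {Γ Δ} {φ : Formula L n} → (∀ {ψ} → ψ ∈ Γ → ψ ∈ Δ) → Γ ⊢ φ → Δ ⊢ φ
    weaken s (hyp p)           = hyp (s p)
    weaken s (⇒-intro {φ = φ} d) = ⇒-intro (weaken (φ ⊆-∷ s) d)
    weaken s (⇒-elim d e)      = ⇒-elim (weaken s d) (weaken s e)
    weaken s (raa {φ = φ} d)   = raa (weaken (¬̇ φ ⊆-∷ s) d)
    weaken s (∀-intro d)       = ∀-intro (weaken (⊆-map (rename suc) s) d)
    weaken s (∀-elim d t)      = ∀-elim (weaken s d) t
    weaken s (≐-refl t)        = ≐-refl t
    weaken s (≐-subst φ d e)   = ≐-subst φ (weaken s d) (weaken s e)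
    weaken s (nonempty d)      = nonempty (weaken (⊆-map (rename suc) s) d)

    private
      rename-suc-comm : (ρ : Fin m → Fin n) (φ : Formula L m) → rename (liftʳ ρ) (rename suc φ) ≡ rename suc (rename ρ φ)
      rename-suc-comm ρ φ = trans (rename-∘ (liftʳ ρ) suc φ) (sym (rename-∘ suc ρ φ))

      map-rename-suc : (ρ : Fin m → Fin n) (Γ : List (Formula L m)) →
        map (rename (liftʳ ρ)) (map (rename suc) Γ) ≡ map (rename suc) (map (rename ρ) Γ)
      map-rename-suc ρ []      = refl
      map-rename-suc ρ (φ ∷ Γ) = cong₂ _∷_ (rename-suc-comm ρ φ) (map-rename-suc ρ Γ)

    ⊢-rename : ∀ {Γ} {φ : Formula L m} (ρ : Fin m → Fin n) → Γ ⊢ φ → map (rename ρ) Γ ⊢ rename ρ φ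
    ⊢-rename ρ (hyp p)         = hyp (∈-map⁺ (rename ρ) p)
    ⊢-rename ρ (⇒-intro d)     = ⇒-intro (⊢-rename ρ d)
    ⊢-rename ρ (⇒-elim d e)    = ⇒-elim (⊢-rename ρ d) (⊢-rename ρ e)
    ⊢-rename ρ (raa d)         = raa (⊢-rename ρ d)
    ⊢-rename ρ (∀-intro {Γ = Γ} d) = ∀-intro (Eq.subst (_⊢ _) (map-rename-suc ρ Γ) (⊢-rename (liftʳ ρ) d))
    ⊢-rename ρ (∀-elim {φ = φ} d t) = Eq.subst (_ ⊢_) (sym (rename-[] ρ φ t)) (∀-elim (⊢-rename ρ d) (renameᵗ ρ t))
    ⊢-rename ρ (≐-refl t)      = ≐-refl (renameᵗ ρ t)
    ⊢-rename ρ (≐-subst {s = s} {t} φ d e) = Eq.subst (_ ⊢_) (sym (rename-[] ρ φ t))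
      (≐-subst (rename (liftʳ ρ) φ) (⊢-rename ρ d) (Eq.subst (_ ⊢_) (rename-[] ρ φ s) (⊢-rename ρ e)))
    ⊢-rename ρ (nonempty {Γ = Γ} {φ} d) = nonempty (subst₂ _⊢_ (map-rename-suc ρ Γ) (rename-suc-comm ρ φ) (⊢-rename (liftʳ ρ) d))

    cut : ∀ {Γ Δ} {φ : Formula L n} → (∀ {ψ} → ψ ∈ Δ → Γ ⊢ ψ) → Δ ⊢ φ → Γ ⊢ φ
    cut {Γ = Γ} {Δ} s d = discharge Δ s (weaken (∈-++⁺ˡ) d)
      where
      discharge : ∀ Δ {φ} → (∀ {ψ} → ψ ∈ Δ → Γ ⊢ ψ) → Δ ++ Γ ⊢ φ → Γ ⊢ φ
      discharge []      s d = d
      discharge (ψ ∷ Δ) s d = ⇒-elim (discharge Δ (s ∘ there) (⇒-intro d)) (s (here refl))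

    theorems-closed : ∀ {X : Pred (Sentence L) 0ℓ} {Γ φ} → All (Theorems X) Γ → Γ ⊢ φ → Theorems X φ
    theorems-closed {X} all d = let Δ , Δ⊆X , proofs = gather all in Δ , Δ⊆X , cut proofs d
      where
      gather : ∀ {Γ} → All (Theorems X) Γ → Σ[ Δ ∈ List (Sentence L) ] (All X Δ × (∀ {ψ} → ψ ∈ Γ → Δ ⊢ ψ))
      gather [] = [] , [] , λ ()
      gather ((Δ , Δ⊆X , e) ∷ all) with Δ′ , Δ′⊆X , es ← gather all =
        Δ ++ Δ′ , All-++⁺ Δ⊆X Δ′⊆X , λ { (here refl) → weaken ∈-++⁺ˡ e ; (there p) → weaken (∈-++⁺ʳ Δ) (es p) }

    theorems-⇒ : ∀ {X : Pred (Sentence L) 0ℓ} {φ ψ} → Theorems X (φ ⇒ ψ) → Theorems X φ → Theorems X ψ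
    theorems-⇒ d e = theorems-closed (d ∷ e ∷ []) (⇒-elim (hyp (here refl)) (hyp (there (here refl))))

    axiom : ∀ {X : Pred (Sentence L) 0ℓ} {φ} → X φ → Theorems X φ
    axiom x = _ , x ∷ [] , hyp (here refl)

open Syntax

-- Codes of syntax and derivability as a Horn program

module ProofPrograms where

  module _ {L : Language} where
    open Language L

    mutual
      termCode : ∀ {n} → Term L n → ℕ
      termCode (var x)                  = 0 ∙ toℕ x
      termCode (fun {k = k} (i , _) ts) = 1 ∙ k ∙ i ∙ termsCode ts

      termsCode : ∀ {n k} → Vec (Term L n) k → ℕ
      termsCode []       = 0
      termsCode (t ∷ ts) = termCode t ∙ termsCode ts

    mutual
      -- This agrees with the Gödel number by `formulaCode≡`, but it is built on the opaque pairing
      -- function and separates the tag, so that an equation of codes is taken apart by cases on the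
      -- constructor.
      formulaCode : ∀ {n} → Formula L n → ℕ
      formulaCode φ = formulaTag φ ∙ formulaRest φ

      formulaTag : ∀ {n} → Formula L n → ℕ
      formulaTag (s ≐ t)    = 0
      formulaTag (rel r ts) = 1
      formulaTag ⊥̇          = 2
      formulaTag (φ ⇒ ψ)    = 3
      formulaTag (∀̇ φ)      = 4

      formulaRest : ∀ {n} → Formula L n → ℕ
      formulaRest (s ≐ t)                  = termCode s ∙ termCode t
      formulaRest (rel {k = k} (i , _) ts) = k ∙ i ∙ termsCode ts
      formulaRest ⊥̇                        = 0
      formulaRest (φ ⇒ ψ)                  = formulaCode φ ∙ formulaCode ψ
      formulaRest (∀̇ φ)                    = formulaCode φ

    -- As `0 ∙ 0` is 0, the successor is what separates nonempty contexts from the empty one. Lists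
    -- of terms carry no such mark, because their length is known from the arity.
    contextCode : ∀ {n} → List (Formula L n) → ℕ
    contextCode []      = 0
    contextCode (φ ∷ Γ) = suc (formulaCode φ ∙ contextCode Γ)

    opaque
      unfolding _∙_

      mutual
        termCode≡ : ∀ {n} (t : Term L n) → termCode t ≡ ⌜ t ⌝ᵗ
        termCode≡ (var x)                  = refl
        termCode≡ (fun {k = k} (i , _) ts) = cong (λ z → pair 1 (pair k (pair i z))) (termsCode≡ ts)

        termsCode≡ : ∀ {n k} (ts : Vec (Term L n) k) → termsCode ts ≡ ⌜ ts ⌝ᵗˢ
        termsCode≡ []       = refl
        termsCode≡ (t ∷ ts) = cong₂ pair (termCode≡ t) (termsCode≡ ts)

      formulaCode≡ : ∀ {n} (φ : Formula L n) → formulaCode φ ≡ ⌜ φ ⌝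
      formulaCode≡ (s ≐ t)                  = cong (pair 0) (cong₂ pair (termCode≡ s) (termCode≡ t))
      formulaCode≡ (rel {k = k} (i , _) ts) = cong (λ z → pair 1 (pair k (pair i z))) (termsCode≡ ts)
      formulaCode≡ ⊥̇                        = refl
      formulaCode≡ (φ ⇒ ψ)                  = cong (pair 3) (cong₂ pair (formulaCode≡ φ) (formulaCode≡ ψ))
      formulaCode≡ (∀̇ φ)                    = cong (pair 4) (formulaCode≡ φ)

    mutual
      termCode-injective : ∀ {n} (s t : Term L n) → termCode s ≡ termCode t → s ≡ t
      termCode-injective (var x) (var y) eq = cong var (toℕ-injective (∙-injʳ eq))
      termCode-injective (var x) (fun _ _) eq = contradiction (∙-injˡ eq) λ ()
      termCode-injective (fun _ _) (var x) eq = contradiction (∙-injˡ eq) λ ()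
      termCode-injective (fun (i , p) ss) (fun (j , q) ts) eq
        with refl , eq ← ∙-cancel (∙-injʳ eq) with refl , eq ← ∙-cancel eq =
        cong₂ (λ p ts → fun (i , p) ts) (T-irrelevant p q) (termsCode-injective ss ts eq)

      termsCode-injective : ∀ {n k} (ss ts : Vec (Term L n) k) → termsCode ss ≡ termsCode ts → ss ≡ ts
      termsCode-injective []       []       eq = refl
      termsCode-injective (s ∷ ss) (t ∷ ts) eq =
        cong₂ _∷_ (termCode-injective s t (∙-injˡ eq)) (termsCode-injective ss ts (∙-injʳ eq))

    formulaCode-injective : ∀ {n} (φ ψ : Formula L n) → formulaCode φ ≡ formulaCode ψ → φ ≡ ψ
    formulaCode-injective φ ψ eq = go φ ψ (∙-injˡ eq) (∙-injʳ eq)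
      where
      go : ∀ {n} (φ ψ : Formula L n) → formulaTag φ ≡ formulaTag ψ → formulaRest φ ≡ formulaRest ψ → φ ≡ ψ
      go (s ≐ t) (s′ ≐ t′) refl eq = cong₂ _≐_ (termCode-injective s s′ (∙-injˡ eq)) (termCode-injective t t′ (∙-injʳ eq))
      go (rel (i , p) ss) (rel (j , q) ts) refl eq with refl , eq ← ∙-cancel eq with refl , eq ← ∙-cancel eq =
        cong₂ (λ p ts → rel (i , p) ts) (T-irrelevant p q) (termsCode-injective ss ts eq)
      go ⊥̇ ⊥̇ refl eq = refl
      go (φ ⇒ ψ) (φ′ ⇒ ψ′) refl eq with eq₁ , eq₂ ← ∙-cancel eq =
        cong₂ _⇒_ (go φ φ′ (∙-injˡ eq₁) (∙-injʳ eq₁)) (go ψ ψ′ (∙-injˡ eq₂) (∙-injʳ eq₂))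
      go (∀̇ φ) (∀̇ ψ) refl eq = cong ∀̇ (go φ ψ (∙-injˡ eq) (∙-injʳ eq))

    contextCode-injective : ∀ {n} (Γ Δ : List (Formula L n)) → contextCode Γ ≡ contextCode Δ → Γ ≡ Δ
    contextCode-injective []      []      eq = refl
    contextCode-injective (φ ∷ Γ) (ψ ∷ Δ) eq with eq₁ , eq₂ ← ∙-cancel (suc-injective eq) =
      cong₂ _∷_ (formulaCode-injective φ ψ eq₁) (contextCode-injective Γ Δ eq₂)

  -- The parameters 0, 1 and 2 are the codes of function symbols, relation symbols and axioms.
  proofRules : List Rule
  proofRules =
      (fact 3 (lit 0) (1+ v₀) (lit 0) (lit 0) ⟸ [])
    ∷ (fact 3 (1+ v₀) (1+ v₁) (lit 0) (lit 0) ⟸ fact 3 v₀ v₁ (lit 0) (lit 0) ∷ [])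
    -- fact 4: a term with n variables; fact 5: k such terms
    ∷ (fact 4 v₀ (lit 0 ⊡ v₁) (lit 0) (lit 0) ⟸ fact 3 v₁ v₀ (lit 0) (lit 0) ∷ [])
    ∷ (fact 4 v₀ (lit 1 ⊡ v₁ ⊡ v₂ ⊡ v₃) (lit 0) (lit 0) ⟸ fact 0 (v₁ ⊡ v₂) (lit 0) (lit 0) (lit 0) ∷ fact 5 v₀ v₁ v₃ (lit 0) ∷ [])
    ∷ (fact 5 v₀ (lit 0) (lit 0) (lit 0) ⟸ [])
    ∷ (fact 5 v₀ (1+ v₁) (v₂ ⊡ v₃) (lit 0) ⟸ fact 4 v₀ v₂ (lit 0) (lit 0) ∷ fact 5 v₀ v₁ v₃ (lit 0) ∷ [])
    -- fact 6: a formula with n free variables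
    ∷ (fact 6 v₀ (lit 0 ⊡ v₁ ⊡ v₂) (lit 0) (lit 0) ⟸ fact 4 v₀ v₁ (lit 0) (lit 0) ∷ fact 4 v₀ v₂ (lit 0) (lit 0) ∷ [])
    ∷ (fact 6 v₀ (lit 1 ⊡ v₁ ⊡ v₂ ⊡ v₃) (lit 0) (lit 0) ⟸ fact 1 (v₁ ⊡ v₂) (lit 0) (lit 0) (lit 0) ∷ fact 5 v₀ v₁ v₃ (lit 0) ∷ [])
    ∷ (fact 6 v₀ (lit 2 ⊡ lit 0) (lit 0) (lit 0) ⟸ [])
    ∷ (fact 6 v₀ (lit 3 ⊡ v₁ ⊡ v₂) (lit 0) (lit 0) ⟸ fact 6 v₀ v₁ (lit 0) (lit 0) ∷ fact 6 v₀ v₂ (lit 0) (lit 0) ∷ [])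
    ∷ (fact 6 v₀ (lit 4 ⊡ v₁) (lit 0) (lit 0) ⟸ fact 6 (1+ v₀) v₁ (lit 0) (lit 0) ∷ [])
    -- fact 7: an entry of a list; fact 8: the list of the variables i, …, i + n - 1
    ∷ (fact 7 (v₀ ⊡ v₁) (lit 0) v₀ (lit 0) ⟸ [])
    ∷ (fact 7 (v₀ ⊡ v₁) (1+ v₂) v₃ (lit 0) ⟸ fact 7 v₁ v₂ v₃ (lit 0) ∷ [])
    ∷ (fact 8 v₀ (lit 0) (lit 0) (lit 0) ⟸ [])
    ∷ (fact 8 v₀ (1+ v₁) ((lit 0 ⊡ v₀) ⊡ v₂) (lit 0) ⟸ fact 8 (1+ v₀) v₁ v₂ (lit 0) ∷ [])
    -- facts 9, 10, 11: substitution of a list in a term, in k terms, in a formula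
    ∷ (fact 9 v₀ (lit 0 ⊡ v₁) v₂ (lit 0) ⟸ fact 7 v₀ v₁ v₂ (lit 0) ∷ [])
    ∷ (fact 9 v₀ (lit 1 ⊡ v₁ ⊡ v₂ ⊡ v₃) (lit 1 ⊡ v₁ ⊡ v₂ ⊡ v₄) (lit 0) ⟸ fact 10 v₀ v₁ v₃ v₄ ∷ [])
    ∷ (fact 10 v₀ (lit 0) (lit 0) (lit 0) ⟸ [])
    ∷ (fact 10 v₀ (1+ v₁) (v₂ ⊡ v₃) (v₄ ⊡ v₅) ⟸ fact 9 v₀ v₂ v₄ (lit 0) ∷ fact 10 v₀ v₁ v₃ v₅ ∷ [])
    ∷ (fact 11 v₀ v₁ (lit 0 ⊡ v₂ ⊡ v₃) (lit 0 ⊡ v₄ ⊡ v₅) ⟸ fact 9 v₁ v₂ v₄ (lit 0) ∷ fact 9 v₁ v₃ v₅ (lit 0) ∷ [])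
    ∷ (fact 11 v₀ v₁ (lit 1 ⊡ v₂ ⊡ v₃ ⊡ v₄) (lit 1 ⊡ v₂ ⊡ v₃ ⊡ v₅) ⟸ fact 10 v₁ v₂ v₄ v₅ ∷ [])
    ∷ (fact 11 v₀ v₁ (lit 2 ⊡ lit 0) (lit 2 ⊡ lit 0) ⟸ [])
    ∷ (fact 11 v₀ v₁ (lit 3 ⊡ v₂ ⊡ v₃) (lit 3 ⊡ v₄ ⊡ v₅) ⟸ fact 11 v₀ v₁ v₂ v₄ ∷ fact 11 v₀ v₁ v₃ v₅ ∷ [])
    ∷ (fact 11 (v₀ ⊡ v₁) v₂ (lit 4 ⊡ v₃) (lit 4 ⊡ v₄) ⟸
         fact 8 (lit 1) v₁ v₅ (lit 0) ∷ fact 10 v₅ v₀ v₂ v₆ ∷ fact 11 (1+ v₀ ⊡ 1+ v₁) ((lit 0 ⊡ lit 0) ⊡ v₆) v₃ v₄ ∷ [])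
    -- fact 12: a context; fact 13: membership in a context; fact 14: renaming of a context by suc
    ∷ (fact 12 v₀ (lit 0) (lit 0) (lit 0) ⟸ [])
    ∷ (fact 12 v₀ (1+ (v₁ ⊡ v₂)) (lit 0) (lit 0) ⟸ fact 6 v₀ v₁ (lit 0) (lit 0) ∷ fact 12 v₀ v₂ (lit 0) (lit 0) ∷ [])
    ∷ (fact 13 v₀ (1+ (v₀ ⊡ v₁)) (lit 0) (lit 0) ⟸ [])
    ∷ (fact 13 v₀ (1+ (v₁ ⊡ v₂)) (lit 0) (lit 0) ⟸ fact 13 v₀ v₂ (lit 0) (lit 0) ∷ [])
    ∷ (fact 14 v₀ (lit 0) (lit 0) (lit 0) ⟸ [])
    ∷ (fact 14 v₀ (1+ (v₁ ⊡ v₂)) (1+ (v₃ ⊡ v₄)) (lit 0) ⟸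
         fact 8 (lit 1) v₀ v₅ (lit 0) ∷ fact 11 (v₀ ⊡ 1+ v₀) v₅ v₁ v₃ ∷ fact 14 v₀ v₂ v₄ (lit 0) ∷ [])
    -- fact 15: derivability of a formula from a context, one rule for each constructor
    ∷ (fact 15 v₀ v₁ v₂ (lit 0) ⟸ fact 12 v₀ v₁ (lit 0) (lit 0) ∷ fact 13 v₂ v₁ (lit 0) (lit 0) ∷ [])
    ∷ (fact 15 v₀ v₁ (lit 3 ⊡ v₂ ⊡ v₃) (lit 0) ⟸ fact 15 v₀ (1+ (v₂ ⊡ v₁)) v₃ (lit 0) ∷ [])
    ∷ (fact 15 v₀ v₁ v₃ (lit 0) ⟸ fact 15 v₀ v₁ (lit 3 ⊡ v₂ ⊡ v₃) (lit 0) ∷ fact 15 v₀ v₁ v₂ (lit 0) ∷ [])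
    ∷ (fact 15 v₀ v₁ v₂ (lit 0) ⟸ fact 15 v₀ (1+ ((lit 3 ⊡ v₂ ⊡ lit 2 ⊡ lit 0) ⊡ v₁)) (lit 2 ⊡ lit 0) (lit 0) ∷ [])
    ∷ (fact 15 v₀ v₁ (lit 4 ⊡ v₂) (lit 0) ⟸
         fact 12 v₀ v₁ (lit 0) (lit 0) ∷ fact 14 v₀ v₁ v₃ (lit 0) ∷ fact 15 (1+ v₀) v₃ v₂ (lit 0) ∷ [])
    ∷ (fact 15 v₀ v₁ v₅ (lit 0) ⟸ fact 15 v₀ v₁ (lit 4 ⊡ v₂) (lit 0) ∷ fact 4 v₀ v₃ (lit 0) (lit 0) ∷
         fact 8 (lit 0) v₀ v₄ (lit 0) ∷ fact 11 (1+ v₀ ⊡ v₀) (v₃ ⊡ v₄) v₂ v₅ ∷ [])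
    ∷ (fact 15 v₀ v₁ (lit 0 ⊡ v₂ ⊡ v₂) (lit 0) ⟸ fact 12 v₀ v₁ (lit 0) (lit 0) ∷ fact 4 v₀ v₂ (lit 0) (lit 0) ∷ [])
    ∷ (fact 15 v₀ v₁ v₇ (lit 0) ⟸ fact 6 (1+ v₀) v₂ (lit 0) (lit 0) ∷ fact 15 v₀ v₁ (lit 0 ⊡ v₃ ⊡ v₄) (lit 0) ∷
         fact 8 (lit 0) v₀ v₅ (lit 0) ∷ fact 11 (1+ v₀ ⊡ v₀) (v₃ ⊡ v₅) v₂ v₆ ∷ fact 15 v₀ v₁ v₆ (lit 0) ∷
         fact 11 (1+ v₀ ⊡ v₀) (v₄ ⊡ v₅) v₂ v₇ ∷ [])
    ∷ (fact 15 v₀ v₁ v₂ (lit 0) ⟸ fact 12 v₀ v₁ (lit 0) (lit 0) ∷ fact 6 v₀ v₂ (lit 0) (lit 0) ∷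
         fact 8 (lit 1) v₀ v₃ (lit 0) ∷ fact 11 (v₀ ⊡ 1+ v₀) v₃ v₂ v₄ ∷ fact 14 v₀ v₁ v₅ (lit 0) ∷
         fact 15 (1+ v₀) v₅ v₄ (lit 0) ∷ [])
    -- fact 16: a list of axioms; fact 17: a theorem
    ∷ (fact 16 (lit 0) (lit 0) (lit 0) (lit 0) ⟸ [])
    ∷ (fact 16 (1+ (v₀ ⊡ v₁)) (lit 0) (lit 0) (lit 0) ⟸ fact 2 v₀ (lit 0) (lit 0) (lit 0) ∷ fact 16 v₁ (lit 0) (lit 0) (lit 0) ∷ [])
    ∷ (fact 17 v₁ (lit 0) (lit 0) (lit 0) ⟸ fact 16 v₀ (lit 0) (lit 0) (lit 0) ∷ fact 15 (lit 0) v₀ v₁ (lit 0) ∷ [])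
    ∷ []

  module Prove = Horn proofRules

  module Provability (L : Language) (X : Pred (Sentence L) 0ℓ) where
    open Language L

    proofParams : Fin 3 → ℕ → Set
    proofParams zero             z = Σ[ k ∈ ℕ ] Σ[ i ∈ ℕ ] (T (hasFun k i) × k ∙ i ≡ z)
    proofParams (suc zero)       z = Σ[ k ∈ ℕ ] Σ[ i ∈ ℕ ] (T (hasRel k i) × k ∙ i ≡ z)
    proofParams (suc (suc zero)) z = Σ[ φ ∈ Sentence L ] (X φ × formulaCode φ ≡ z)

    private
      Der : ℕ → Vec ℕ 4 → Set
      Der = Prove.Derivable proofParams

      <-der : ∀ {i n} → i < n → Der 3 (i ∷ n ∷ 0 ∷ 0 ∷ [])
      <-der {zero}  {suc n} _       = Prove.rule (# 0) (valuation (n ∷ [])) []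
      <-der {suc i} {suc n} (s≤s p) = Prove.rule (# 1) (valuation (i ∷ n ∷ [])) (<-der p ∷ [])

      mutual
        term-der : ∀ {n} (t : Term L n) → Der 4 (n ∷ termCode t ∷ 0 ∷ 0 ∷ [])
        term-der {n} (var x) = Prove.rule (# 2) (valuation (n ∷ toℕ x ∷ [])) (<-der (toℕ<n x) ∷ [])
        term-der {n} (fun {k = k} (i , p) ts) = Prove.rule (# 3) (valuation (n ∷ k ∷ i ∷ termsCode ts ∷ []))
          (Prove.base zero (k , i , p , refl) ∷ terms-der ts ∷ [])

        terms-der : ∀ {n k} (ts : Vec (Term L n) k) → Der 5 (n ∷ k ∷ termsCode ts ∷ 0 ∷ [])
        terms-der {n} [] = Prove.rule (# 4) (valuation (n ∷ [])) []
        terms-der {n} {suc k} (t ∷ ts) = Prove.rule (# 5) (valuation (n ∷ k ∷ termCode t ∷ termsCode ts ∷ [])) (term-der t ∷ terms-der ts ∷ [])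

      formula-der : ∀ {n} (φ : Formula L n) → Der 6 (n ∷ formulaCode φ ∷ 0 ∷ 0 ∷ [])
      formula-der {n} (s ≐ t) = Prove.rule (# 6) (valuation (n ∷ termCode s ∷ termCode t ∷ [])) (term-der s ∷ term-der t ∷ [])
      formula-der {n} (rel {k = k} (i , p) ts) = Prove.rule (# 7) (valuation (n ∷ k ∷ i ∷ termsCode ts ∷ []))
        (Prove.base (suc zero) (k , i , p , refl) ∷ terms-der ts ∷ [])
      formula-der {n} ⊥̇ = Prove.rule (# 8) (valuation (n ∷ [])) []
      formula-der {n} (φ ⇒ ψ) = Prove.rule (# 9) (valuation (n ∷ formulaCode φ ∷ formulaCode ψ ∷ [])) (formula-der φ ∷ formula-der ψ ∷ [])
      formula-der {n} (∀̇ φ) = Prove.rule (# 10) (valuation (n ∷ formulaCode φ ∷ [])) (formula-der φ ∷ [])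

      nth-der : ∀ {m n} (σ : Fin m → Term L n) i → Der 7 (termsCode (V.tabulate σ) ∷ toℕ i ∷ termCode (σ i) ∷ 0 ∷ [])
      nth-der σ zero    = Prove.rule (# 11) (valuation (termCode (σ zero) ∷ termsCode (V.tabulate (σ ∘ suc)) ∷ [])) []
      nth-der σ (suc i) = Prove.rule (# 12) (valuation (termCode (σ zero) ∷ termsCode (V.tabulate (σ ∘ suc)) ∷ toℕ i ∷ termCode (σ (suc i)) ∷ []))
        (nth-der (σ ∘ suc) i ∷ [])

      variables : ℕ → ℕ → ℕ
      variables i zero    = 0
      variables i (suc n) = (0 ∙ i) ∙ variables (suc i) n

      variables-der : ∀ i n → Der 8 (i ∷ n ∷ variables i n ∷ 0 ∷ [])
      variables-der i zero    = Prove.rule (# 13) (valuation (i ∷ [])) []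
      variables-der i (suc n) = Prove.rule (# 14) (valuation (i ∷ n ∷ variables (suc i) n ∷ [])) (variables-der (suc i) n ∷ [])

      variables≡ : ∀ {n N} i (σ : Fin n → Term L N) → (∀ j → termCode (σ j) ≡ 0 ∙ (i + toℕ j)) → termsCode (V.tabulate σ) ≡ variables i n
      variables≡ {zero}  i σ eq = refl
      variables≡ {suc n} i σ eq = cong₂ _∙_ (trans (eq zero) (cong (0 ∙_) (+-identityʳ i)))
        (variables≡ (suc i) (σ ∘ suc) (λ j → trans (eq (suc j)) (cong (0 ∙_) (+-suc i (toℕ j)))))

      shifts : ∀ n → termsCode (V.tabulate {n = n} (λ i → var {L} (suc i))) ≡ variables 1 n
      shifts n = variables≡ 1 (λ (i : Fin n) → var (suc i)) (λ _ → refl)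

      identity : ∀ n → termsCode (V.tabulate {n = n} (var {L})) ≡ variables 0 n
      identity n = variables≡ 0 (var {n = n}) (λ _ → refl)

      mutual
        substᵗ-der : ∀ {m n} (σ : Fin m → Term L n) t → Der 9 (termsCode (V.tabulate σ) ∷ termCode t ∷ termCode (substᵗ σ t) ∷ 0 ∷ [])
        substᵗ-der σ (var x) = Prove.rule (# 15) (valuation (termsCode (V.tabulate σ) ∷ toℕ x ∷ termCode (σ x) ∷ [])) (nth-der σ x ∷ [])
        substᵗ-der σ (fun {k = k} (i , _) ts) =
          Prove.rule (# 16) (valuation (termsCode (V.tabulate σ) ∷ k ∷ i ∷ termsCode ts ∷ termsCode (substᵗˢ σ ts) ∷ [])) (substᵗˢ-der σ ts ∷ [])

        substᵗˢ-der : ∀ {m n k} (σ : Fin m → Term L n) (ts : Vec (Term L m) k) →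
                      Der 10 (termsCode (V.tabulate σ) ∷ k ∷ termsCode ts ∷ termsCode (substᵗˢ σ ts) ∷ [])
        substᵗˢ-der σ [] = Prove.rule (# 17) (valuation (termsCode (V.tabulate σ) ∷ [])) []
        substᵗˢ-der {k = suc k} σ (t ∷ ts) = Prove.rule (# 18)
          (valuation (termsCode (V.tabulate σ) ∷ k ∷ termCode t ∷ termsCode ts ∷ termCode (substᵗ σ t) ∷ termsCode (substᵗˢ σ ts) ∷ []))
          (substᵗ-der σ t ∷ substᵗˢ-der σ ts ∷ [])

      weakening : ∀ {m n} (σ : Fin m → Term L n) → substᵗˢ (λ i → var (suc i)) (V.tabulate σ) ≡ V.tabulate (renameᵗ suc ∘ σ)
      weakening {zero}  σ = refl
      weakening {suc m} σ = cong₂ _∷_ (sym (renameᵗ-subst suc (σ zero))) (weakening (σ ∘ suc))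

      -- Passing under a quantifier requires the list of all old entries shifted by one. To produce
      -- it the program has to know the length m of the substitution and the number n of target
      -- variables, which the codes do not record; hence the argument m ∙ n.
      subst-der : ∀ {m n} (σ : Fin m → Term L n) φ →
                  Der 11 ((m ∙ n) ∷ termsCode (V.tabulate σ) ∷ formulaCode φ ∷ formulaCode (subst σ φ) ∷ [])
      subst-der {m} {n} σ (s ≐ t) = Prove.rule (# 19)
        (valuation ((m ∙ n) ∷ termsCode (V.tabulate σ) ∷ termCode s ∷ termCode t ∷ termCode (substᵗ σ s) ∷ termCode (substᵗ σ t) ∷ []))
        (substᵗ-der σ s ∷ substᵗ-der σ t ∷ [])
      subst-der {m} {n} σ (rel {k = k} (i , _) ts) = Prove.rule (# 20)
        (valuation ((m ∙ n) ∷ termsCode (V.tabulate σ) ∷ k ∷ i ∷ termsCode ts ∷ termsCode (substᵗˢ σ ts) ∷ [])) (substᵗˢ-der σ ts ∷ [])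
      subst-der {m} {n} σ ⊥̇ = Prove.rule (# 21) (valuation ((m ∙ n) ∷ termsCode (V.tabulate σ) ∷ [])) []
      subst-der {m} {n} σ (φ ⇒ ψ) = Prove.rule (# 22)
        (valuation ((m ∙ n) ∷ termsCode (V.tabulate σ) ∷ formulaCode φ ∷ formulaCode ψ ∷ formulaCode (subst σ φ) ∷ formulaCode (subst σ ψ) ∷ []))
        (subst-der σ φ ∷ subst-der σ ψ ∷ [])
      subst-der {m} {n} σ (∀̇ φ) = Prove.rule (# 23)
        (valuation (m ∷ n ∷ termsCode (V.tabulate σ) ∷ formulaCode φ ∷ formulaCode (subst (lift σ) φ) ∷ variables 1 n ∷
          termsCode (V.tabulate (renameᵗ suc ∘ σ)) ∷ []))
        (variables-der 1 n ∷
         subst₂ (λ w s → Der 10 (w ∷ m ∷ termsCode (V.tabulate σ) ∷ s ∷ [])) (shifts n) (cong termsCode (weakening σ))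
           (substᵗˢ-der (λ i → var (suc i)) (V.tabulate σ)) ∷
         subst-der (lift σ) φ ∷ [])

      context-der : ∀ {n} (Γ : List (Formula L n)) → Der 12 (n ∷ contextCode Γ ∷ 0 ∷ 0 ∷ [])
      context-der {n} [] = Prove.rule (# 24) (valuation (n ∷ [])) []
      context-der {n} (φ ∷ Γ) = Prove.rule (# 25) (valuation (n ∷ formulaCode φ ∷ contextCode Γ ∷ [])) (formula-der φ ∷ context-der Γ ∷ [])

      member-der : ∀ {n} {φ : Formula L n} {Γ} → φ ∈ Γ → Der 13 (formulaCode φ ∷ contextCode Γ ∷ 0 ∷ 0 ∷ [])
      member-der {φ = φ} {_ ∷ Γ} (here refl) = Prove.rule (# 26) (valuation (formulaCode φ ∷ contextCode Γ ∷ [])) []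
      member-der {φ = φ} {ψ ∷ Γ} (there p) = Prove.rule (# 27) (valuation (formulaCode φ ∷ formulaCode ψ ∷ contextCode Γ ∷ [])) (member-der p ∷ [])

      shift-der : ∀ {n} (φ : Formula L n) → Der 11 ((n ∙ suc n) ∷ variables 1 n ∷ formulaCode φ ∷ formulaCode (rename suc φ) ∷ [])
      shift-der {n} φ = subst₂ (λ w s → Der 11 ((n ∙ suc n) ∷ w ∷ formulaCode φ ∷ s ∷ [])) (shifts n)
        (cong formulaCode (sym (rename-subst suc φ))) (subst-der (λ i → var (suc i)) φ)

      shift-context-der : ∀ {n} (Γ : List (Formula L n)) → Der 14 (n ∷ contextCode Γ ∷ contextCode (map (rename suc) Γ) ∷ 0 ∷ [])
      shift-context-der {n} [] = Prove.rule (# 28) (valuation (n ∷ [])) []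
      shift-context-der {n} (φ ∷ Γ) = Prove.rule (# 29)
        (valuation (n ∷ formulaCode φ ∷ contextCode Γ ∷ formulaCode (rename suc φ) ∷ contextCode (map (rename suc) Γ) ∷ variables 1 n ∷ []))
        (variables-der 1 n ∷ shift-der φ ∷ shift-context-der Γ ∷ [])

      instantiate-der : ∀ {n} (φ : Formula L (suc n)) t →
        Der 11 ((suc n ∙ n) ∷ (termCode t ∙ variables 0 n) ∷ formulaCode φ ∷ formulaCode (φ [ t ]) ∷ [])
      instantiate-der {n} φ t = Eq.subst (λ w → Der 11 ((suc n ∙ n) ∷ (termCode t ∙ w) ∷ formulaCode φ ∷ formulaCode (φ [ t ]) ∷ []))
        (identity n) (subst-der (t F.∷ var) φ)

      ⊢-der : ∀ {n Γ} {φ : Formula L n} → Γ ⊢ φ → Der 15 (n ∷ contextCode Γ ∷ formulaCode φ ∷ 0 ∷ [])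
      ⊢-der {n} {Γ} {φ} (hyp p) = Prove.rule (# 30) (valuation (n ∷ contextCode Γ ∷ formulaCode φ ∷ [])) (context-der Γ ∷ member-der p ∷ [])
      ⊢-der {n} {Γ} (⇒-intro {φ = φ} {ψ} d) = Prove.rule (# 31) (valuation (n ∷ contextCode Γ ∷ formulaCode φ ∷ formulaCode ψ ∷ [])) (⊢-der d ∷ [])
      ⊢-der {n} {Γ} (⇒-elim {φ = φ} {ψ} d e) = Prove.rule (# 32) (valuation (n ∷ contextCode Γ ∷ formulaCode φ ∷ formulaCode ψ ∷ [])) (⊢-der d ∷ ⊢-der e ∷ [])
      ⊢-der {n} {Γ} {φ} (raa d) = Prove.rule (# 33) (valuation (n ∷ contextCode Γ ∷ formulaCode φ ∷ [])) (⊢-der d ∷ [])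
      ⊢-der {n} {Γ} (∀-intro {φ = φ} d) = Prove.rule (# 34)
        (valuation (n ∷ contextCode Γ ∷ formulaCode φ ∷ contextCode (map (rename suc) Γ) ∷ [])) (context-der Γ ∷ shift-context-der Γ ∷ ⊢-der d ∷ [])
      ⊢-der {n} {Γ} (∀-elim {φ = φ} d t) = Prove.rule (# 35)
        (valuation (n ∷ contextCode Γ ∷ formulaCode φ ∷ termCode t ∷ variables 0 n ∷ formulaCode (φ [ t ]) ∷ []))
        (⊢-der d ∷ term-der t ∷ variables-der 0 n ∷ instantiate-der φ t ∷ [])
      ⊢-der {n} {Γ} (≐-refl t) = Prove.rule (# 36) (valuation (n ∷ contextCode Γ ∷ termCode t ∷ [])) (context-der Γ ∷ term-der t ∷ [])
      ⊢-der {n} {Γ} (≐-subst {s = s} {t} φ d e) = Prove.rule (# 37)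
        (valuation (n ∷ contextCode Γ ∷ formulaCode φ ∷ termCode s ∷ termCode t ∷ variables 0 n ∷ formulaCode (φ [ s ]) ∷ formulaCode (φ [ t ]) ∷ []))
        (formula-der φ ∷ ⊢-der d ∷ variables-der 0 n ∷ instantiate-der φ s ∷ ⊢-der e ∷ instantiate-der φ t ∷ [])
      ⊢-der {n} {Γ} {φ} (nonempty d) = Prove.rule (# 38)
        (valuation (n ∷ contextCode Γ ∷ formulaCode φ ∷ variables 1 n ∷ formulaCode (rename suc φ) ∷ contextCode (map (rename suc) Γ) ∷ []))
        (context-der Γ ∷ formula-der φ ∷ variables-der 1 n ∷ shift-der φ ∷ shift-context-der Γ ∷ ⊢-der d ∷ [])

      axioms-der : ∀ {Γ} → All X Γ → Der 16 (contextCode Γ ∷ 0 ∷ 0 ∷ 0 ∷ [])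
      axioms-der [] = Prove.rule (# 39) (valuation []) []
      axioms-der {φ ∷ Γ} (x ∷ xs) = Prove.rule (# 40) (valuation (formulaCode φ ∷ contextCode Γ ∷ []))
        (Prove.base (suc (suc zero)) (φ , x , refl) ∷ axioms-der xs ∷ [])

    theorem-derivable : ∀ {φ} → Theorems X φ → Prove.Derivable proofParams 17 (formulaCode φ ∷ 0 ∷ 0 ∷ 0 ∷ [])
    theorem-derivable {φ} (Γ , xs , d) = Prove.rule (# 41) (valuation (contextCode Γ ∷ formulaCode φ ∷ [])) (axioms-der xs ∷ ⊢-der d ∷ [])

    private
      -- Facts that produce syntax are read as existence statements in a given scope. Facts that
      -- compute on syntax, such as substitution, are read as statements about all terms or formulas
      -- with these codes, because a code does not determine its scope.
      TermMeans : ℕ → ℕ → Set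
      TermMeans n z = Σ[ t ∈ Term L n ] termCode t ≡ z

      TermsMean : ℕ → ℕ → ℕ → Set
      TermsMean n k z = Σ[ ts ∈ Vec (Term L n) k ] termsCode ts ≡ z

      FormulaMeans : ℕ → ℕ → Set
      FormulaMeans n z = Σ[ φ ∈ Formula L n ] formulaCode φ ≡ z

      EntryMeans : ℕ → ℕ → ℕ → Set
      EntryMeans l i z = ∀ {m n} (σ : Fin m → Term L n) j → termsCode (V.tabulate σ) ≡ l → toℕ j ≡ i → termCode (σ j) ≡ z

      SubstTermMeans : ℕ → ℕ → ℕ → Set
      SubstTermMeans s z z′ = ∀ {m n} (σ : Fin m → Term L n) t → termsCode (V.tabulate σ) ≡ s → termCode t ≡ z → termCode (substᵗ σ t) ≡ z′

      SubstTermsMean : ℕ → ℕ → ℕ → ℕ → Set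
      SubstTermsMean s k z z′ = ∀ {m n} (σ : Fin m → Term L n) (ts : Vec (Term L m) k) →
        termsCode (V.tabulate σ) ≡ s → termsCode ts ≡ z → termsCode (substᵗˢ σ ts) ≡ z′

      SubstMeans : ℕ → ℕ → ℕ → ℕ → Set
      SubstMeans p s z z′ = ∀ {m n} (σ : Fin m → Term L n) φ → m ∙ n ≡ p → termsCode (V.tabulate σ) ≡ s →
        formulaCode φ ≡ z → formulaCode (subst σ φ) ≡ z′

      ContextMeans : ℕ → ℕ → Set
      ContextMeans n g = Σ[ Γ ∈ List (Formula L n) ] contextCode Γ ≡ g

      MemberMeans : ℕ → ℕ → Set
      MemberMeans z g = ∀ {n} (Γ : List (Formula L n)) → contextCode Γ ≡ g → Σ[ φ ∈ Formula L n ] (φ ∈ Γ × formulaCode φ ≡ z)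

      ShiftMeans : ℕ → ℕ → ℕ → Set
      ShiftMeans n g g′ = (Γ : List (Formula L n)) → contextCode Γ ≡ g → contextCode (map (rename suc) Γ) ≡ g′

      DerivableMeans : ℕ → ℕ → ℕ → Set
      DerivableMeans n g z = Σ[ Γ ∈ List (Formula L n) ] Σ[ φ ∈ Formula L n ] (contextCode Γ ≡ g × formulaCode φ ≡ z × Γ ⊢ φ)

      Means : ℕ → Vec ℕ 4 → Set
      Means 0  (z ∷ _)                = proofParams zero z
      Means 1  (z ∷ _)                = proofParams (suc zero) z
      Means 2  (z ∷ _)                = proofParams (suc (suc zero)) z
      Means 3  (i ∷ n ∷ _)            = i < n
      Means 4  (n ∷ z ∷ _)            = TermMeans n z
      Means 5  (n ∷ k ∷ z ∷ _)        = TermsMean n k z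
      Means 6  (n ∷ z ∷ _)            = FormulaMeans n z
      Means 7  (l ∷ i ∷ z ∷ _)        = EntryMeans l i z
      Means 8  (i ∷ n ∷ l ∷ _)        = l ≡ variables i n
      Means 9  (s ∷ z ∷ z′ ∷ _)       = SubstTermMeans s z z′
      Means 10 (s ∷ k ∷ z ∷ z′ ∷ _)   = SubstTermsMean s k z z′
      Means 11 (p ∷ s ∷ z ∷ z′ ∷ _)   = SubstMeans p s z z′
      Means 12 (n ∷ g ∷ _)            = ContextMeans n g
      Means 13 (z ∷ g ∷ _)            = MemberMeans z g
      Means 14 (n ∷ g ∷ g′ ∷ _)       = ShiftMeans n g g′
      Means 15 (n ∷ g ∷ z ∷ _)        = DerivableMeans n g z
      Means 16 (g ∷ _)                = Σ[ Γ ∈ List (Sentence L) ] (contextCode Γ ≡ g × All X Γ)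
      Means _  (z ∷ _)                = Σ[ φ ∈ Sentence L ] (formulaCode φ ≡ z × Theorems X φ)

      substᵗ-var : ∀ {s i z} → EntryMeans s i z → SubstTermMeans s (0 ∙ i) z
      substᵗ-var h σ (var x)    eqs eqt = h σ x eqs (∙-injʳ eqt)
      substᵗ-var h σ (fun _ _)  eqs eqt = contradiction (∙-injˡ eqt) λ ()

      substᵗ-fun : ∀ {s k i z z′} → SubstTermsMean s k z z′ → SubstTermMeans s (1 ∙ k ∙ i ∙ z) (1 ∙ k ∙ i ∙ z′)
      substᵗ-fun h σ (var x)            eqs eqt = contradiction (∙-injˡ eqt) λ ()
      substᵗ-fun h σ (fun (i , _) ts)   eqs eqt with refl , eq ← ∙-cancel (∙-injʳ eqt) with refl , eq ← ∙-cancel eq =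
        cong (λ w → 1 ∙ _ ∙ i ∙ w) (h σ ts eqs eq)

      subst-≐ : ∀ {p s a b a′ b′} → SubstTermMeans s a a′ → SubstTermMeans s b b′ → SubstMeans p s (0 ∙ a ∙ b) (0 ∙ a′ ∙ b′)
      subst-≐ {s = s} {a} {b} {a′} {b′} h h′ σ φ _ eqs eqφ = go φ σ eqs (∙-injˡ eqφ) (∙-injʳ eqφ)
        where
        go : ∀ {m n} (φ : Formula L m) (σ : Fin m → Term L n) → termsCode (V.tabulate σ) ≡ s →
             formulaTag φ ≡ 0 → formulaRest φ ≡ a ∙ b → formulaCode (subst σ φ) ≡ 0 ∙ a′ ∙ b′
        go (t ≐ u) σ eqs refl eq = cong (0 ∙_) (cong₂ _∙_ (h σ t eqs (∙-injˡ eq)) (h′ σ u eqs (∙-injʳ eq)))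

      subst-rel : ∀ {p s k i a a′} → SubstTermsMean s k a a′ → SubstMeans p s (1 ∙ k ∙ i ∙ a) (1 ∙ k ∙ i ∙ a′)
      subst-rel {s = s} {k} {i} {a} {a′} h σ φ _ eqs eqφ = go φ σ eqs (∙-injˡ eqφ) (∙-injʳ eqφ)
        where
        go : ∀ {m n} (φ : Formula L m) (σ : Fin m → Term L n) → termsCode (V.tabulate σ) ≡ s →
             formulaTag φ ≡ 1 → formulaRest φ ≡ k ∙ i ∙ a → formulaCode (subst σ φ) ≡ 1 ∙ k ∙ i ∙ a′
        go (rel _ ts) σ eqs refl eq with refl , eq ← ∙-cancel eq with refl , eq ← ∙-cancel eq =
          cong (λ w → 1 ∙ k ∙ i ∙ w) (h σ ts eqs eq)

      subst-⊥ : ∀ {p s} → SubstMeans p s (2 ∙ 0) (2 ∙ 0)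
      subst-⊥ σ φ _ _ eqφ = go φ σ (∙-injˡ eqφ)
        where
        go : ∀ {m n} (φ : Formula L m) (σ : Fin m → Term L n) → formulaTag φ ≡ 2 → formulaCode (subst σ φ) ≡ 2 ∙ 0
        go ⊥̇ σ refl = refl

      subst-⇒ : ∀ {p s a b a′ b′} → SubstMeans p s a a′ → SubstMeans p s b b′ → SubstMeans p s (3 ∙ a ∙ b) (3 ∙ a′ ∙ b′)
      subst-⇒ {p} {s} {a} {b} {a′} {b′} h h′ σ φ eqp eqs eqφ = go φ σ eqp eqs (∙-injˡ eqφ) (∙-injʳ eqφ)
        where
        go : ∀ {m n} (φ : Formula L m) (σ : Fin m → Term L n) → m ∙ n ≡ p → termsCode (V.tabulate σ) ≡ s →
             formulaTag φ ≡ 3 → formulaRest φ ≡ a ∙ b → formulaCode (subst σ φ) ≡ 3 ∙ a′ ∙ b′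
        go (φ ⇒ ψ) σ eqp eqs refl eq = cong (3 ∙_) (cong₂ _∙_ (h σ φ eqp eqs (∙-injˡ eq)) (h′ σ ψ eqp eqs (∙-injʳ eq)))

      subst-∀ : ∀ {k l s a a′ w s′} → w ≡ variables 1 l → SubstTermsMean w k s s′ →
        SubstMeans (suc k ∙ suc l) ((0 ∙ 0) ∙ s′) a a′ → SubstMeans (k ∙ l) s (4 ∙ a) (4 ∙ a′)
      subst-∀ {k} {l} {s} {a} {a′} {w} {s′} refl hs h σ φ eqp eqs eqφ = go φ σ eqp eqs (∙-injˡ eqφ) (∙-injʳ eqφ)
        where
        go : ∀ {m n} (φ : Formula L m) (σ : Fin m → Term L n) → m ∙ n ≡ k ∙ l → termsCode (V.tabulate σ) ≡ s →
             formulaTag φ ≡ 4 → formulaRest φ ≡ a → formulaCode (subst σ φ) ≡ 4 ∙ a′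
        go {m} {n} (∀̇ φ) σ eqp eqs refl eq with refl , refl ← ∙-cancel eqp = cong (4 ∙_) (h (lift σ) φ refl
          (cong ((0 ∙ 0) ∙_) (trans (cong termsCode (sym (weakening σ)))
            (hs (λ i → var (suc i)) (V.tabulate σ) (shifts n) eqs))) eq)

      member-here : ∀ {z g} → MemberMeans z (suc (z ∙ g))
      member-here (φ ∷ Γ) eq = φ , here refl , ∙-injˡ (suc-injective eq)

      member-there : ∀ {z y g} → MemberMeans z g → MemberMeans z (suc (y ∙ g))
      member-there h (ψ ∷ Γ) eq with φ , p , eq′ ← h Γ (∙-injʳ (suc-injective eq)) = φ , there p , eq′

      shift-formula : ∀ {n w a a′} → w ≡ variables 1 n → SubstMeans (n ∙ suc n) w a a′ →
        (φ : Formula L n) → formulaCode φ ≡ a → formulaCode (rename suc φ) ≡ a′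
      shift-formula {n} refl h φ eq = trans (cong formulaCode (rename-subst suc φ)) (h (λ i → var (suc i)) φ refl (shifts n) eq)

      shift-cons : ∀ {n a g a′ g′ w} → w ≡ variables 1 n → SubstMeans (n ∙ suc n) w a a′ → ShiftMeans n g g′ →
        ShiftMeans n (suc (a ∙ g)) (suc (a′ ∙ g′))
      shift-cons eqw h h′ (φ ∷ Γ) eq = cong suc (cong₂ _∙_ (shift-formula eqw h φ (∙-injˡ (suc-injective eq))) (h′ Γ (∙-injʳ (suc-injective eq))))

      instantiate : ∀ {n t w a a′} (u : Term L n) → termCode u ≡ t → w ≡ variables 0 n → SubstMeans (suc n ∙ n) (t ∙ w) a a′ →
        (φ : Formula L (suc n)) → formulaCode φ ≡ a → formulaCode (φ [ u ]) ≡ a′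
      instantiate {n} u eqt refl h φ eq = h (u F.∷ var) φ refl (cong₂ _∙_ eqt (identity n)) eq

      by-hyp : ∀ {n g z} → ContextMeans n g → MemberMeans z g → DerivableMeans n g z
      by-hyp (Γ , eq) h with φ , p , eq′ ← h Γ eq = Γ , φ , eq , eq′ , hyp p

      by-⇒-intro : ∀ {n g a b} → DerivableMeans n (suc (a ∙ g)) b → DerivableMeans n g (3 ∙ a ∙ b)
      by-⇒-intro (φ ∷ Γ , ψ , eqΓ , eqψ , d) with eq₁ , eq₂ ← ∙-cancel (suc-injective eqΓ) =
        Γ , (φ ⇒ ψ) , eq₂ , cong (3 ∙_) (cong₂ _∙_ eq₁ eqψ) , ⇒-intro d

      by-⇒-elim : ∀ {n g a b} → DerivableMeans n g (3 ∙ a ∙ b) → DerivableMeans n g a → DerivableMeans n g b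
      by-⇒-elim {n} {g} {a} {b} (Γ , χ , eqΓ , eqχ , d) (Δ , φ , eqΔ , eqφ , e) = go χ (∙-injˡ eqχ) (∙-injʳ eqχ) d
        where
        go : (χ : Formula L n) → formulaTag χ ≡ 3 → formulaRest χ ≡ a ∙ b → Γ ⊢ χ → DerivableMeans n g b
        go (φ′ ⇒ ψ) refl eq d with refl ← formulaCode-injective φ′ φ (trans (∙-injˡ eq) (sym eqφ))
          with refl ← contextCode-injective Δ Γ (trans eqΔ (sym eqΓ)) = Γ , ψ , eqΓ , ∙-injʳ eq , ⇒-elim d e

      by-raa : ∀ {n g a} → DerivableMeans n (suc ((3 ∙ a ∙ 2 ∙ 0) ∙ g)) (2 ∙ 0) → DerivableMeans n g a
      by-raa {n} {g} {a} (χ ∷ Γ , φ , eqΓ , eqφ , d) with eq₁ , eq₂ ← ∙-cancel (suc-injective eqΓ)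
        with refl ← formulaCode-injective φ ⊥̇ eqφ = go χ (∙-injˡ eq₁) (∙-injʳ eq₁) d
        where
        go : (χ : Formula L n) → formulaTag χ ≡ 3 → formulaRest χ ≡ a ∙ 2 ∙ 0 → χ ∷ Γ ⊢ ⊥̇ → DerivableMeans n g a
        go (ψ ⇒ θ) refl eq d with refl ← formulaCode-injective θ ⊥̇ (∙-injʳ eq) = Γ , ψ , ∙-injʳ (suc-injective eqΓ) , ∙-injˡ eq , raa d

      by-∀-intro : ∀ {n g g′ a} → ContextMeans n g → ShiftMeans n g g′ → DerivableMeans (suc n) g′ a → DerivableMeans n g (4 ∙ a)
      by-∀-intro (Γ , eqΓ) h (Δ , φ , eqΔ , eqφ , d)
        with refl ← contextCode-injective Δ (map (rename suc) Γ) (trans eqΔ (sym (h Γ eqΓ))) =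
        Γ , ∀̇ φ , eqΓ , cong (4 ∙_) eqφ , ∀-intro d

      by-∀-elim : ∀ {n g a t w a′} → DerivableMeans n g (4 ∙ a) → TermMeans n t → w ≡ variables 0 n →
        SubstMeans (suc n ∙ n) (t ∙ w) a a′ → DerivableMeans n g a′
      by-∀-elim {n} {g} {a} {a′ = a′} (Γ , χ , eqΓ , eqχ , d) (t , eqt) eqw h = go χ (∙-injˡ eqχ) (∙-injʳ eqχ) d
        where
        go : (χ : Formula L n) → formulaTag χ ≡ 4 → formulaRest χ ≡ a → Γ ⊢ χ → DerivableMeans n g a′
        go (∀̇ φ) refl eq d = Γ , φ [ t ] , eqΓ , instantiate t eqt eqw h φ eq , ∀-elim d t

      by-subst : ∀ {n g a s t w a₁ a₂} → FormulaMeans (suc n) a → DerivableMeans n g (0 ∙ s ∙ t) → w ≡ variables 0 n →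
        SubstMeans (suc n ∙ n) (s ∙ w) a a₁ → DerivableMeans n g a₁ → SubstMeans (suc n ∙ n) (t ∙ w) a a₂ → DerivableMeans n g a₂
      by-subst {n} {g} {a} {s} {t} {w} {a₁} {a₂} (φ , eqφ) (Γ , χ , eqΓ , eqχ , d) eqw h₁ (Δ , ψ , eqΔ , eqψ , e) h₂ =
        go χ (∙-injˡ eqχ) (∙-injʳ eqχ) d
        where
        go : (χ : Formula L n) → formulaTag χ ≡ 0 → formulaRest χ ≡ s ∙ t → Γ ⊢ χ → DerivableMeans n g a₂
        go (u ≐ v) refl eq d
          with refl ← formulaCode-injective ψ (φ [ u ]) (trans eqψ (sym (instantiate u (∙-injˡ eq) eqw h₁ φ eqφ)))
          with refl ← contextCode-injective Δ Γ (trans eqΔ (sym eqΓ)) =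
          Γ , φ [ v ] , eqΓ , instantiate v (∙-injʳ eq) eqw h₂ φ eqφ , ≐-subst φ d e

      by-nonempty : ∀ {n g a w a′ g′} → ContextMeans n g → FormulaMeans n a → w ≡ variables 1 n → SubstMeans (n ∙ suc n) w a a′ →
        ShiftMeans n g g′ → DerivableMeans (suc n) g′ a′ → DerivableMeans n g a
      by-nonempty (Γ , eqΓ) (φ , eqφ) eqw h h′ (Δ , ψ , eqΔ , eqψ , d)
        with refl ← contextCode-injective Δ (map (rename suc) Γ) (trans eqΔ (sym (h′ Γ eqΓ)))
        with refl ← formulaCode-injective ψ (rename suc φ) (trans eqψ (sym (shift-formula eqw h φ eqφ))) =
        Γ , φ , eqΓ , eqφ , nonempty d

      is-theorem : ∀ {g z} → Σ[ Γ ∈ List (Sentence L) ] (contextCode Γ ≡ g × All X Γ) → DerivableMeans 0 g z →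
        Σ[ φ ∈ Sentence L ] (formulaCode φ ≡ z × Theorems X φ)
      is-theorem (Γ , eqΓ , xs) (Δ , φ , eqΔ , eqφ , d) with refl ← contextCode-injective Δ Γ (trans eqΔ (sym eqΓ)) =
        φ , eqφ , Γ , xs , d

      term-var : ∀ {n i} → i < n → TermMeans n (0 ∙ i)
      term-var i<n = var (fromℕ< i<n) , cong (0 ∙_) (toℕ-fromℕ< i<n)

      term-fun : ∀ {n k i z} → proofParams zero (k ∙ i) → TermsMean n k z → TermMeans n (1 ∙ k ∙ i ∙ z)
      term-fun (k , i , p , eq) (ts , eqts) with refl , refl ← ∙-cancel eq = fun (i , p) ts , cong (λ z → 1 ∙ k ∙ i ∙ z) eqts

      formula-rel : ∀ {n k i z} → proofParams (suc zero) (k ∙ i) → TermsMean n k z → FormulaMeans n (1 ∙ k ∙ i ∙ z)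
      formula-rel (k , i , p , eq) (ts , eqts) with refl , refl ← ∙-cancel eq = rel (i , p) ts , cong (λ z → 1 ∙ k ∙ i ∙ z) eqts

      entry-zero : ∀ {z l} → EntryMeans (z ∙ l) 0 z
      entry-zero {m = suc m} σ zero eq refl = ∙-injˡ eq

      entry-suc : ∀ {y l i z} → EntryMeans l i z → EntryMeans (y ∙ l) (suc i) z
      entry-suc h {suc m} σ (suc j) eq refl = h (σ ∘ suc) j (∙-injʳ eq) refl

      substᵗˢ-cons : ∀ {s k a as b bs} → SubstTermMeans s a b → SubstTermsMean s k as bs → SubstTermsMean s (suc k) (a ∙ as) (b ∙ bs)
      substᵗˢ-cons h hs σ (t ∷ ts) eqs eq = cong₂ _∙_ (h σ t eqs (∙-injˡ eq)) (hs σ ts eqs (∙-injʳ eq))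

      base-means : ∀ j {z} → proofParams j z → Means (toℕ j) (z ∷ 0 ∷ 0 ∷ 0 ∷ [])
      base-means zero             p = p
      base-means (suc zero)       p = p
      base-means (suc (suc zero)) p = p

      rules-mean : All (Prove.Sound Means) proofRules
      rules-mean =
          (λ ρ → λ { [] → s≤s z≤n })
        ∷ (λ ρ → λ { (p ∷ []) → s≤s p })
        ∷ (λ ρ → λ { (p ∷ []) → term-var p })
        ∷ (λ ρ → λ { (p ∷ ts ∷ []) → term-fun p ts })
        ∷ (λ ρ → λ { [] → [] , refl })
        ∷ (λ ρ → λ { ((t , eq) ∷ (ts , eqs) ∷ []) → t ∷ ts , cong₂ _∙_ eq eqs })
        ∷ (λ ρ → λ { ((s , eqs) ∷ (t , eqt) ∷ []) → (s ≐ t) , cong (0 ∙_) (cong₂ _∙_ eqs eqt) })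
        ∷ (λ ρ → λ { (p ∷ ts ∷ []) → formula-rel p ts })
        ∷ (λ ρ → λ { [] → ⊥̇ , refl })
        ∷ (λ ρ → λ { ((φ , eqφ) ∷ (ψ , eqψ) ∷ []) → (φ ⇒ ψ) , cong (3 ∙_) (cong₂ _∙_ eqφ eqψ) })
        ∷ (λ ρ → λ { ((φ , eqφ) ∷ []) → ∀̇ φ , cong (4 ∙_) eqφ })
        ∷ (λ ρ → λ { [] → entry-zero })
        ∷ (λ ρ → λ { (h ∷ []) → entry-suc h })
        ∷ (λ ρ → λ { [] → refl })
        ∷ (λ ρ → λ { (eq ∷ []) → cong ((0 ∙ _) ∙_) eq })
        ∷ (λ ρ → λ { (h ∷ []) → substᵗ-var h })
        ∷ (λ ρ → λ { (h ∷ []) → substᵗ-fun h })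
        ∷ (λ ρ → λ { [] σ [] _ _ → refl })
        ∷ (λ ρ → λ { (h ∷ hs ∷ []) → substᵗˢ-cons h hs })
        ∷ (λ ρ → λ { (h ∷ h′ ∷ []) → subst-≐ h h′ })
        ∷ (λ ρ → λ { (h ∷ []) → subst-rel h })
        ∷ (λ ρ → λ { [] → subst-⊥ })
        ∷ (λ ρ → λ { (h ∷ h′ ∷ []) → subst-⇒ h h′ })
        ∷ (λ ρ → λ { (eq ∷ hs ∷ h ∷ []) → subst-∀ eq hs h })
        ∷ (λ ρ → λ { [] → [] , refl })
        ∷ (λ ρ → λ { ((φ , eqφ) ∷ (Γ , eqΓ) ∷ []) → φ ∷ Γ , cong suc (cong₂ _∙_ eqφ eqΓ) })
        ∷ (λ ρ → λ { [] → member-here })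
        ∷ (λ ρ → λ { (h ∷ []) → member-there h })
        ∷ (λ ρ → λ { [] [] _ → refl })
        ∷ (λ ρ → λ { (eq ∷ h ∷ h′ ∷ []) → shift-cons eq h h′ })
        ∷ (λ ρ → λ { (h ∷ h′ ∷ []) → by-hyp h h′ })
        ∷ (λ ρ → λ { (h ∷ []) → by-⇒-intro h })
        ∷ (λ ρ → λ { (h ∷ h′ ∷ []) → by-⇒-elim h h′ })
        ∷ (λ ρ → λ { (h ∷ []) → by-raa h })
        ∷ (λ ρ → λ { (h ∷ h′ ∷ h″ ∷ []) → by-∀-intro h h′ h″ })
        ∷ (λ ρ → λ { (h ∷ t ∷ eq ∷ h′ ∷ []) → by-∀-elim h t eq h′ })
        ∷ (λ ρ → λ { ((Γ , eqΓ) ∷ (t , eqt) ∷ []) → Γ , (t ≐ t) , eqΓ , cong (0 ∙_) (cong₂ _∙_ eqt eqt) , ≐-refl t })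
        ∷ (λ ρ → λ { (φ ∷ d ∷ eq ∷ h ∷ e ∷ h′ ∷ []) → by-subst φ d eq h e h′ })
        ∷ (λ ρ → λ { (Γ ∷ φ ∷ eq ∷ h ∷ h′ ∷ d ∷ []) → by-nonempty Γ φ eq h h′ d })
        ∷ (λ ρ → λ { [] → [] , refl , [] })
        ∷ (λ ρ → λ { ((φ , x , eqφ) ∷ (Γ , eqΓ , xs) ∷ []) → φ ∷ Γ , cong suc (cong₂ _∙_ eqφ eqΓ) , x ∷ xs })
        ∷ (λ ρ → λ { (h ∷ d ∷ []) → is-theorem h d })
        ∷ []

    derivable-theorem : ∀ {z} → Prove.Derivable proofParams 17 (z ∷ 0 ∷ 0 ∷ 0 ∷ []) → Σ[ φ ∈ Sentence L ] (formulaCode φ ≡ z × Theorems X φ)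
    derivable-theorem d = Prove.derivable-sound Means base-means rules-mean d

    ProvedBy : ℕ → ℕ → Set
    ProvedBy w z = Holds proofParams (Prove.derivation 3) (factCode 17 (z ∷ 0 ∷ 0 ∷ 0 ∷ []) ∷ w ∷ [])

    theorem⇒proved : ∀ {φ} → Theorems X φ → Σ[ w ∈ ℕ ] ProvedBy w (formulaCode φ)
    theorem⇒proved t = Prove.derivation-complete (theorem-derivable t)

    proved⇒theorem : ∀ {w} φ → ProvedBy w (formulaCode φ) → Theorems X φ
    proved⇒theorem {w} φ p with ψ , eq , t ← derivable-theorem (Prove.derivation-sound {v = formulaCode φ ∷ 0 ∷ 0 ∷ 0 ∷ []} p)
      with refl ← formulaCode-injective ψ φ eq = t

    module _ (em : ExcludedMiddle 0ℓ) where
      open Deciding em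

      decideProved : ∀ {A} → (∀ j → Decides A (proofParams j ∘ V.head)) →
        Decides A (λ (xs : Vec ℕ 2) → ProvedBy (lookup xs (# 0)) (lookup xs (# 1)))
      decideProved dP = dec-∘ (decideBounded em dP (Prove.derivation 3))
        ((constant 17 ⊙ arg (# 1) ⊙ constant 0 ⊙ constant 0 ⊙ constant 0) ∷ arg (# 0) ∷ [])

      decideParams : RecursiveLanguage L → Recursive (gödelNumbers X) → ∀ j → Decides {1} ∅ (proofParams j ∘ V.head)
      decideParams (dF , dR) dX zero = dec-map
        (λ _ (k , i , p , eq) → k , i , p , trans (∙≡pair k i) eq) (λ _ (k , i , p , eq) → k , i , p , trans (sym (∙≡pair k i)) eq) (≤ᵀ⇒decides dF)
      decideParams (dF , dR) dX (suc zero) = dec-map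
        (λ _ (k , i , p , eq) → k , i , p , trans (∙≡pair k i) eq) (λ _ (k , i , p , eq) → k , i , p , trans (sym (∙≡pair k i)) eq) (≤ᵀ⇒decides dR)
      decideParams (dF , dR) dX (suc (suc zero)) = dec-map
        (λ _ (φ , x , eq) → φ , x , trans (formulaCode≡ φ) eq) (λ _ (φ , x , eq) → φ , x , trans (sym (formulaCode≡ φ)) eq) (≤ᵀ⇒decides dX)

open ProofPrograms

-- Structures, satisfaction and soundness

module Structures where

  -- Equality is interpreted by a congruence, so that no quotients are needed.

  record Structure (L : Language) : Set₁ where
    infix 4 _≈_
    open Language L
    field
      Carrier   : Set
      _≈_       : Carrier → Carrier → Set
      point     : Carrier
      function  : ∀ {k} → FunSym k → Vec Carrier k → Carrier
      relation  : ∀ {k} → RelSym k → Vec Carrier k → Set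
      ≈-refl    : ∀ {x} → x ≈ x
      ≈-sym     : ∀ {x y} → x ≈ y → y ≈ x
      ≈-trans   : ∀ {x y z} → x ≈ y → y ≈ z → x ≈ z
      function-cong : ∀ {k} (f : FunSym k) {xs ys} → (∀ i → lookup xs i ≈ lookup ys i) → function f xs ≈ function f ys
      relation-cong : ∀ {k} (r : RelSym k) {xs ys} → (∀ i → lookup xs i ≈ lookup ys i) → relation r xs → relation r ys

    private variable
      m n k : ℕ

    mutual
      ⟦_⟧ᵗ : Term L n → (Fin n → Carrier) → Carrier
      ⟦ var x ⟧ᵗ    ρ = ρ x
      ⟦ fun f ts ⟧ᵗ ρ = function f (⟦ ts ⟧ᵗˢ ρ)

      ⟦_⟧ᵗˢ : Vec (Term L n) k → (Fin n → Carrier) → Vec Carrier k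
      ⟦ [] ⟧ᵗˢ     ρ = []
      ⟦ t ∷ ts ⟧ᵗˢ ρ = ⟦ t ⟧ᵗ ρ ∷ ⟦ ts ⟧ᵗˢ ρ

    Sat : Formula L n → (Fin n → Carrier) → Set
    Sat (s ≐ t)    ρ = ⟦ s ⟧ᵗ ρ ≈ ⟦ t ⟧ᵗ ρ
    Sat (rel r ts) ρ = relation r (⟦ ts ⟧ᵗˢ ρ)
    Sat ⊥̇          ρ = ⊥
    Sat (φ ⇒ ψ)    ρ = Sat φ ρ → Sat ψ ρ
    Sat (∀̇ φ)      ρ = ∀ x → Sat φ (x F.∷ ρ)

    Models : Pred (Sentence L) 0ℓ → Set
    Models X = ∀ φ → X φ → ∀ ρ → Sat φ ρ

    ≈-reflexive : ∀ {x y} → x ≡ y → x ≈ y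
    ≈-reflexive refl = ≈-refl

    mutual
      ⟦⟧ᵗ-cong : ∀ {ρ π : Fin n → Carrier} → (∀ i → ρ i ≈ π i) → ∀ t → ⟦ t ⟧ᵗ ρ ≈ ⟦ t ⟧ᵗ π
      ⟦⟧ᵗ-cong eq (var x)    = eq x
      ⟦⟧ᵗ-cong eq (fun f ts) = function-cong f (⟦⟧ᵗˢ-cong eq ts)

      ⟦⟧ᵗˢ-cong : ∀ {ρ π : Fin n → Carrier} → (∀ i → ρ i ≈ π i) → (ts : Vec (Term L n) k) →
                  ∀ i → lookup (⟦ ts ⟧ᵗˢ ρ) i ≈ lookup (⟦ ts ⟧ᵗˢ π) i
      ⟦⟧ᵗˢ-cong eq (t ∷ ts) zero    = ⟦⟧ᵗ-cong eq t
      ⟦⟧ᵗˢ-cong eq (t ∷ ts) (suc i) = ⟦⟧ᵗˢ-cong eq ts i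

    ∷-cong : ∀ {ρ π : Fin n → Carrier} {x y} → x ≈ y → (∀ i → ρ i ≈ π i) → ∀ i → (x F.∷ ρ) i ≈ (y F.∷ π) i
    ∷-cong eq eqs zero    = eq
    ∷-cong eq eqs (suc i) = eqs i

    Sat-cong : ∀ {ρ π : Fin n → Carrier} → (∀ i → ρ i ≈ π i) → ∀ φ → Sat φ ρ → Sat φ π
    Sat-cong eq (s ≐ t) h = ≈-trans (⟦⟧ᵗ-cong (≈-sym ∘ eq) s) (≈-trans h (⟦⟧ᵗ-cong eq t))
    Sat-cong eq (rel r ts) h = relation-cong r (⟦⟧ᵗˢ-cong eq ts) h
    Sat-cong eq (φ ⇒ ψ) h p = Sat-cong eq ψ (h (Sat-cong (≈-sym ∘ eq) φ p))
    Sat-cong eq (∀̇ φ) h x = Sat-cong (∷-cong ≈-refl eq) φ (h x)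

    Sat-≡ : ∀ {ρ π : Fin n → Carrier} → (∀ i → ρ i ≡ π i) → ∀ φ → Sat φ ρ → Sat φ π
    Sat-≡ eq = Sat-cong (≈-reflexive ∘ eq)

    mutual
      ⟦⟧ᵗ-subst : (σ : Fin m → Term L n) (ρ : Fin n → Carrier) → ∀ t → ⟦ substᵗ σ t ⟧ᵗ ρ ≡ ⟦ t ⟧ᵗ (λ i → ⟦ σ i ⟧ᵗ ρ)
      ⟦⟧ᵗ-subst σ ρ (var x)    = refl
      ⟦⟧ᵗ-subst σ ρ (fun f ts) = cong (function f) (⟦⟧ᵗˢ-subst σ ρ ts)

      ⟦⟧ᵗˢ-subst : (σ : Fin m → Term L n) (ρ : Fin n → Carrier) (ts : Vec (Term L m) k) → ⟦ substᵗˢ σ ts ⟧ᵗˢ ρ ≡ ⟦ ts ⟧ᵗˢ (λ i → ⟦ σ i ⟧ᵗ ρ)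
      ⟦⟧ᵗˢ-subst σ ρ []       = refl
      ⟦⟧ᵗˢ-subst σ ρ (t ∷ ts) = cong₂ _∷_ (⟦⟧ᵗ-subst σ ρ t) (⟦⟧ᵗˢ-subst σ ρ ts)

    ⟦⟧ᵗ-rename : (π : Fin m → Fin n) (ρ : Fin n → Carrier) → ∀ t → ⟦ renameᵗ π t ⟧ᵗ ρ ≡ ⟦ t ⟧ᵗ (ρ ∘ π)
    ⟦⟧ᵗ-rename π ρ t = trans (cong (λ u → ⟦ u ⟧ᵗ ρ) (renameᵗ-subst π t)) (⟦⟧ᵗ-subst (var ∘ π) ρ t)

    Sat-subst : (σ : Fin m → Term L n) (ρ : Fin n → Carrier) → ∀ φ →
      (Sat (subst σ φ) ρ → Sat φ (λ i → ⟦ σ i ⟧ᵗ ρ)) × (Sat φ (λ i → ⟦ σ i ⟧ᵗ ρ) → Sat (subst σ φ) ρ)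
    Sat-subst σ ρ (s ≐ t)
      rewrite ⟦⟧ᵗ-subst σ ρ s | ⟦⟧ᵗ-subst σ ρ t = id , id
    Sat-subst σ ρ (rel r ts) rewrite ⟦⟧ᵗˢ-subst σ ρ ts = id , id
    Sat-subst σ ρ ⊥̇ = id , id
    Sat-subst σ ρ (φ ⇒ ψ) = (λ h p → proj₁ (Sat-subst σ ρ ψ) (h (proj₂ (Sat-subst σ ρ φ) p)))
                          , (λ h p → proj₂ (Sat-subst σ ρ ψ) (h (proj₁ (Sat-subst σ ρ φ) p)))
    Sat-subst σ ρ (∀̇ φ) = (λ h x → Sat-≡ (lifted x) φ (proj₁ (Sat-subst (lift σ) (x F.∷ ρ) φ) (h x)))
                        , (λ h x → proj₂ (Sat-subst (lift σ) (x F.∷ ρ) φ) (Sat-≡ (sym ∘ lifted x) φ (h x)))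
      where
      lifted : ∀ x i → ⟦ lift σ i ⟧ᵗ (x F.∷ ρ) ≡ (x F.∷ (λ i → ⟦ σ i ⟧ᵗ ρ)) i
      lifted x zero    = refl
      lifted x (suc i) = ⟦⟧ᵗ-rename suc (x F.∷ ρ) (σ i)

    Sat-rename : (π : Fin m → Fin n) (ρ : Fin n → Carrier) → ∀ φ →
      (Sat (rename π φ) ρ → Sat φ (ρ ∘ π)) × (Sat φ (ρ ∘ π) → Sat (rename π φ) ρ)
    Sat-rename π ρ φ rewrite rename-subst {L} π φ = Sat-subst (var ∘ π) ρ φ

    Sat-[] : (φ : Formula L (suc n)) (t : Term L n) (ρ : Fin n → Carrier) →
      (Sat (φ [ t ]) ρ → Sat φ (⟦ t ⟧ᵗ ρ F.∷ ρ)) × (Sat φ (⟦ t ⟧ᵗ ρ F.∷ ρ) → Sat (φ [ t ]) ρ)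
    Sat-[] φ t ρ = Sat-≡ env φ ∘ proj₁ (Sat-subst (t F.∷ var) ρ φ) , proj₂ (Sat-subst (t F.∷ var) ρ φ) ∘ Sat-≡ (sym ∘ env) φ
      where
      env : ∀ i → ⟦ (t F.∷ var) i ⟧ᵗ ρ ≡ (⟦ t ⟧ᵗ ρ F.∷ ρ) i
      env zero    = refl
      env (suc i) = refl

    module _ (em : ExcludedMiddle 0ℓ) where

      stable : ∀ {P : Set} → ¬ ¬ P → P
      stable {P} ¬¬p = case em {P} of λ { (yes p) → p ; (no ¬p) → contradiction ¬p ¬¬p }

      sound : ∀ {Γ} {φ : Formula L n} → Γ ⊢ φ → ∀ ρ → (∀ {ψ} → ψ ∈ Γ → Sat ψ ρ) → Sat φ ρ
      sound (hyp p) ρ hs = hs p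
      sound (⇒-intro d) ρ hs p = sound d ρ λ { (here refl) → p ; (there q) → hs q }
      sound (⇒-elim d e) ρ hs = sound d ρ hs (sound e ρ hs)
      sound (raa d) ρ hs = stable λ ¬p → sound d ρ λ { (here refl) → ¬p ; (there q) → hs q }
      sound (∀-intro {Γ = Γ} d) ρ hs x = sound d (x F.∷ ρ) λ q → shifted q
        where
        shifted : ∀ {ψ} → ψ ∈ map (rename suc) Γ → Sat ψ (x F.∷ ρ)
        shifted q with χ , χ∈ , refl ← ∈-map⁻ (rename suc) q = proj₂ (Sat-rename suc (x F.∷ ρ) χ) (hs χ∈)
      sound (∀-elim {φ = φ} d t) ρ hs = proj₂ (Sat-[] φ t ρ) (sound d ρ hs (⟦ t ⟧ᵗ ρ))
      sound (≐-refl t) ρ hs = ≈-refl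
      sound (≐-subst {s = s} {t} φ d e) ρ hs = proj₂ (Sat-[] φ t ρ)
        (Sat-cong (∷-cong (sound d ρ hs) (λ _ → ≈-refl)) φ (proj₁ (Sat-[] φ s ρ) (sound e ρ hs)))
      sound (nonempty {Γ = Γ} {φ} d) ρ hs = proj₁ (Sat-rename suc (point F.∷ ρ) φ) (sound d (point F.∷ ρ) λ q → shifted q)
        where
        shifted : ∀ {ψ} → ψ ∈ map (rename suc) Γ → Sat ψ (point F.∷ ρ)
        shifted q with χ , χ∈ , refl ← ∈-map⁻ (rename suc) q = proj₂ (Sat-rename suc (point F.∷ ρ) χ) (hs χ∈)

      theorem-sound : ∀ {X : Pred (Sentence L) 0ℓ} {φ} → Models X → Theorems X φ → ∀ ρ → Sat φ ρ
      theorem-sound M (Γ , xs , d) ρ = sound d ρ λ q → M _ (All.lookup xs q) ρ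

      Sat-∧⁻ : ∀ (φ ψ : Formula L n) {ρ} → Sat (φ ∧̇ ψ) ρ → Sat φ ρ × Sat ψ ρ
      Sat-∧⁻ φ ψ h = stable (λ ¬p → h λ p _ → ¬p (p , stable (λ ¬q → h λ p q → ¬q q))) .proj₁ , stable (λ ¬q → h λ p q → ¬q q)

      Sat-∧⁺ : ∀ (φ ψ : Formula L n) {ρ} → Sat φ ρ → Sat ψ ρ → Sat (φ ∧̇ ψ) ρ
      Sat-∧⁺ φ ψ p q h = h p q

      Sat-∨⁻ : ∀ (φ ψ : Formula L n) {ρ} → Sat (φ ∨̇ ψ) ρ → Sat φ ρ ⊎ Sat ψ ρ
      Sat-∨⁻ φ ψ {ρ} h = case em {Sat φ ρ} of λ { (yes p) → inj₁ p ; (no ¬p) → inj₂ (h ¬p) }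

      Sat-∨⁺ : ∀ (φ ψ : Formula L n) {ρ} → Sat φ ρ ⊎ Sat ψ ρ → Sat (φ ∨̇ ψ) ρ
      Sat-∨⁺ φ ψ (inj₁ p) ¬p = contradiction p ¬p
      Sat-∨⁺ φ ψ (inj₂ q) _  = q

      Sat-∃⁻ : ∀ (φ : Formula L (suc n)) {ρ} → Sat (∃̇ φ) ρ → Σ[ x ∈ Carrier ] Sat φ (x F.∷ ρ)
      Sat-∃⁻ φ h = stable λ ¬∃ → h λ x p → ¬∃ (x , p)

      Sat-∃⁺ : ∀ (φ : Formula L (suc n)) {ρ} x → Sat φ (x F.∷ ρ) → Sat (∃̇ φ) ρ
      Sat-∃⁺ φ x p h = h x p

open Structures

-- The completeness theorem by Henkin's construction

module Completeness where

  module _ {L : Language} where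

    private
      hole : ∀ {k n} → Fin k → (Fin k → Term L n) → Fin k → Term L (suc n)
      hole j σ i with i ≟ᶠ j
      ... | yes _ = var zero
      ... | no _  = renameᵗ suc (σ i)

      hole-[] : ∀ {k n} (j : Fin k) (σ τ : Fin k → Term L n) → (∀ i → i ≢ j → σ i ≡ τ i) →
                (θ : Formula L k) → subst (hole j σ) θ [ τ j ] ≡ subst τ θ
      hole-[] j σ τ eq θ = trans (subst-subst (τ j F.∷ var) (hole j σ) θ) (subst-cong pointwise θ)
        where
        pointwise : ∀ i → substᵗ (τ j F.∷ var) (hole j σ i) ≡ τ i
        pointwise i with i ≟ᶠ j
        ... | yes refl = refl
        ... | no i≢j   = trans (substᵗ-renameᵗ (τ j F.∷ var) suc (σ i)) (trans (substᵗ-id (σ i)) (eq i i≢j))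

      replace-one : ∀ {k n Γ} (j : Fin k) (σ τ : Fin k → Term L n) → (∀ i → i ≢ j → σ i ≡ τ i) → Γ ⊢ σ j ≐ τ j →
                    (θ : Formula L k) → Γ ⊢ subst σ θ → Γ ⊢ subst τ θ
      replace-one j σ τ eq e θ d = Eq.subst (_ ⊢_) (hole-[] j σ τ eq θ)
        (≐-subst (subst (hole j σ) θ) e (Eq.subst (_ ⊢_) (sym (hole-[] j σ σ (λ _ _ → refl) θ)) d))

      hybrid : ∀ {k n} → ℕ → (σ τ : Fin k → Term L n) → Fin k → Term L n
      hybrid j σ τ i with toℕ i <? j
      ... | yes _ = τ i
      ... | no _  = σ i

    renameᵗ-suc-[] : ∀ {n} (s t : Term L n) → substᵗ (t F.∷ var) (renameᵗ suc s) ≡ s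
    renameᵗ-suc-[] s t = trans (substᵗ-renameᵗ (t F.∷ var) suc s) (substᵗ-id s)

    symmetric : ∀ {n} (s t : Term L n) → (s ≐ t) ∷ [] ⊢ t ≐ s
    symmetric s t = Eq.subst (λ u → (s ≐ t) ∷ [] ⊢ t ≐ u) (renameᵗ-suc-[] s t)
      (≐-subst {s = s} {t} (var zero ≐ renameᵗ suc s) (hyp (here refl)) (Eq.subst (λ u → (s ≐ t) ∷ [] ⊢ s ≐ u) (sym (renameᵗ-suc-[] s s)) (≐-refl s)))

    transitive : ∀ {n} (s t u : Term L n) → (s ≐ t) ∷ (t ≐ u) ∷ [] ⊢ s ≐ u
    transitive s t u = Eq.subst (λ v → (s ≐ t) ∷ (t ≐ u) ∷ [] ⊢ v ≐ u) (renameᵗ-suc-[] s u)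
      (≐-subst {s = t} {u} (renameᵗ suc s ≐ var zero) (hyp (there (here refl))) (Eq.subst (λ v → (s ≐ t) ∷ (t ≐ u) ∷ [] ⊢ v ≐ t) (sym (renameᵗ-suc-[] s t)) (hyp (here refl))))

    -- The rule `≐-subst` replaces a single term. The hybrids take `τ` at the first j arguments and
    -- `σ` at the others, so that consecutive ones differ in at most one argument.
    replace-equals : ∀ {k n Γ} (σ τ : Fin k → Term L n) → (∀ i → Γ ⊢ σ i ≐ τ i) →
                     (θ : Formula L k) → Γ ⊢ subst σ θ → Γ ⊢ subst τ θ
    replace-equals {k} {Γ = Γ} σ τ eqs θ d = Eq.subst (Γ ⊢_) (subst-cong end θ) (go k ≤-refl)
      where
      end : ∀ i → hybrid k σ τ i ≡ τ i
      end i with toℕ i <? k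
      ... | yes _ = refl
      ... | no ¬p = contradiction (toℕ<n i) ¬p
      start : ∀ i → hybrid 0 σ τ i ≡ σ i
      start i = refl
      step : ∀ j (j<k : j < k) i → i ≢ fromℕ< j<k → hybrid j σ τ i ≡ hybrid (suc j) σ τ i
      step j j<k i i≢ with toℕ i <? j | toℕ i <? suc j
      ... | yes _ | yes _ = refl
      ... | yes p | no ¬q = contradiction (m<n⇒m<1+n p) ¬q
      ... | no ¬p | yes q = contradiction (toℕ-injective (trans (≤-antisym (s≤s⁻¹ q) (≮⇒≥ ¬p)) (sym (toℕ-fromℕ< j<k)))) i≢
      ... | no _  | no _  = refl
      at : ∀ j (j<k : j < k) → Γ ⊢ hybrid j σ τ (fromℕ< j<k) ≐ hybrid (suc j) σ τ (fromℕ< j<k)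
      at j j<k with toℕ (fromℕ< j<k) <? j | toℕ (fromℕ< j<k) <? suc j
      ... | yes p | _     = contradiction (toℕ-fromℕ< j<k) (<⇒≢ p)
      ... | no _  | yes _ = eqs (fromℕ< j<k)
      ... | no _  | no ¬q = contradiction (s≤s (≤-reflexive (toℕ-fromℕ< j<k))) ¬q
      go : ∀ j → j ≤ k → Γ ⊢ subst (hybrid j σ τ) θ
      go zero    _   = Eq.subst (Γ ⊢_) (subst-cong (sym ∘ start) θ) d
      go (suc j) j<k = replace-one (fromℕ< j<k) _ _ (step j j<k) (at j j<k) θ (go j (<⇒≤ j<k))

  module Henkin (em : ExcludedMiddle 0ℓ) {L : Language} (X : Pred (Sentence L) 0ℓ) where
    open Language L

    private variable
      m n k N : ℕ

    none : Fin 0 → Fin n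
    none ()

    infix 3 _⊩_

    _⊩_ : List (Formula L n) → Formula L n → Set
    Γ ⊩ φ = Σ[ Δ ∈ List (Sentence L) ] (All X Δ × Γ ++ map (rename none) Δ ⊢ φ)

    ⊩-closed : ∀ {Γ Φ} {φ : Formula L n} → All (Γ ⊩_) Φ → Φ ⊢ φ → Γ ⊩ φ
    ⊩-closed {Γ = Γ} all d = let Δ , Δ⊆X , proofs = gather all in Δ , Δ⊆X , cut proofs d
      where
      left : ∀ Δ Δ′ {ψ} → ψ ∈ Γ ++ map (rename none) Δ → ψ ∈ Γ ++ map (rename none) (Δ ++ Δ′)
      left Δ Δ′ q with ∈-++⁻ Γ q
      ... | inj₁ p = ∈-++⁺ˡ p
      ... | inj₂ p = ∈-++⁺ʳ Γ (Eq.subst (_ ∈_) (sym (map-++ (rename none) Δ Δ′)) (∈-++⁺ˡ p))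
      right : ∀ Δ Δ′ {ψ} → ψ ∈ Γ ++ map (rename none) Δ′ → ψ ∈ Γ ++ map (rename none) (Δ ++ Δ′)
      right Δ Δ′ q with ∈-++⁻ Γ q
      ... | inj₁ p = ∈-++⁺ˡ p
      ... | inj₂ p = ∈-++⁺ʳ Γ (Eq.subst (_ ∈_) (sym (map-++ (rename none) Δ Δ′)) (∈-++⁺ʳ (map (rename none) Δ) p))
      gather : ∀ {Φ} → All (Γ ⊩_) Φ → Σ[ Δ ∈ List (Sentence L) ] (All X Δ × (∀ {ψ} → ψ ∈ Φ → Γ ++ map (rename none) Δ ⊢ ψ))
      gather [] = [] , [] , λ ()
      gather ((Δ , Δ⊆X , e) ∷ all) = let Δ′ , Δ′⊆X , es = gather all in
        Δ ++ Δ′ , All-++⁺ Δ⊆X Δ′⊆X , λ { (here refl) → weaken (left Δ Δ′) e ; (there p) → weaken (right Δ Δ′) (es p) }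

    ⊩-hyp : ∀ {Γ} {φ : Formula L n} → φ ∈ Γ → Γ ⊩ φ
    ⊩-hyp p = [] , [] , hyp (∈-++⁺ˡ p)

    shift : List (Formula L n) → List (Formula L (suc n))
    shift = map (rename suc)

    private
      shift-none : ∀ (Γ : List (Formula L n)) Δ → shift (Γ ++ map (rename none) Δ) ≡ shift Γ ++ map (rename none) Δ
      shift-none Γ Δ = trans (map-++ (rename suc) Γ _) (cong (shift Γ ++_) (trans (sym (map-∘ Δ))
        (map-cong (λ φ → trans (rename-∘ suc none φ) (rename-cong (λ ()) φ)) Δ)))

    ⊩-shift : ∀ {Γ} {φ : Formula L n} → Γ ⊩ φ → shift Γ ⊩ rename suc φ
    ⊩-shift {Γ = Γ} (Δ , Δ⊆X , d) = Δ , Δ⊆X , Eq.subst (_⊢ _) (shift-none Γ Δ) (⊢-rename suc d)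

    ⊩-∀-intro : ∀ {Γ} {φ : Formula L (suc n)} → shift Γ ⊩ φ → Γ ⊩ ∀̇ φ
    ⊩-∀-intro {Γ = Γ} (Δ , Δ⊆X , d) = Δ , Δ⊆X , ∀-intro (Eq.subst (_⊢ _) (sym (shift-none Γ Δ)) d)

    ⊩-nonempty : ∀ {Γ} {φ : Formula L n} → shift Γ ⊩ rename suc φ → Γ ⊩ φ
    ⊩-nonempty {Γ = Γ} (Δ , Δ⊆X , d) = Δ , Δ⊆X , nonempty (Eq.subst (_⊢ _) (sym (shift-none Γ Δ)) d)

    ⊩-weaken : ∀ {Γ Γ′} {φ : Formula L n} → (∀ {ψ} → ψ ∈ Γ → ψ ∈ Γ′) → Γ ⊩ φ → Γ′ ⊩ φ
    ⊩-weaken {Γ = Γ} {Γ′} s (Δ , Δ⊆X , d) = Δ , Δ⊆X , weaken (λ q → [ ∈-++⁺ˡ ∘ s , ∈-++⁺ʳ Γ′ ]′ (∈-++⁻ Γ q)) d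

    Consistentᴴ : List (Formula L n) → Set
    Consistentᴴ Γ = ¬ (Γ ⊩ ⊥̇)

    -- Stage N uses the variables as names of the elements 0, …, N; the newest
    -- element N is the variable zero.
    idx : ∀ N → ℕ → Fin (suc N)
    idx zero    e = zero
    idx (suc N) e with e ≟ suc N
    ... | yes _ = zero
    ... | no _  = suc (idx N e)

    idx-suc : ∀ {N e} → e ≤ N → idx (suc N) e ≡ suc (idx N e)
    idx-suc {N} {e} e≤N with e ≟ suc N
    ... | yes refl = contradiction e≤N 1+n≰n
    ... | no _     = refl

    idx-new : ∀ N → idx (suc N) (suc N) ≡ zero
    idx-new N with suc N ≟ suc N
    ... | yes _ = refl
    ... | no ¬p = contradiction refl ¬p

    -- A task asks for a decision on `∀̇ ψ` at some named elements and is treated at the stage given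
    -- by its own code. This code is at least as large as every element named in it, so the names
    -- exist by then.
    Task : Set
    Task = Σ[ n ∈ ℕ ] (Formula L (suc n) × Vec ℕ n)

    taskCode : Task → ℕ
    taskCode (n , ψ , ρ) = n ∙ formulaCode ψ ∙ listCode ρ

    taskCode-injective : ∀ t u → taskCode t ≡ taskCode u → t ≡ u
    taskCode-injective (n , ψ , ρ) (n′ , ψ′ , ρ′) eq with refl , eq ← ∙-cancel eq
      with refl ← formulaCode-injective ψ ψ′ (∙-injˡ eq) with refl ← listCode-injective ρ ρ′ (∙-injʳ eq) = refl

    named : ∀ N → Task → Formula L (suc (suc N))
    named N (n , ψ , ρ) = rename (liftʳ (idx N ∘ lookup ρ)) ψ

    -- One step both decides a universal formula and provides the Henkin witness: if `∀̇ χ` cannot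
    -- be added consistently, the new variable becomes a counterexample to `χ`.
    extend : Formula L (suc n) → List (Formula L n) → List (Formula L (suc n))
    extend χ Γ with em {Consistentᴴ (∀̇ χ ∷ Γ)}
    ... | yes _ = shift (∀̇ χ ∷ Γ)
    ... | no _  = ¬̇ χ ∷ shift Γ

    extend-⊇ : ∀ (χ : Formula L (suc n)) Γ {ψ} → ψ ∈ shift Γ → ψ ∈ extend χ Γ
    extend-⊇ χ Γ p with em {Consistentᴴ (∀̇ χ ∷ Γ)}
    ... | yes _ = there p
    ... | no _  = there p

    extend-decides : ∀ (χ : Formula L (suc n)) Γ → rename suc (∀̇ χ) ∈ extend χ Γ ⊎ ¬̇ χ ∈ extend χ Γ
    extend-decides χ Γ with em {Consistentᴴ (∀̇ χ ∷ Γ)}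
    ... | yes _ = inj₁ (here refl)
    ... | no _  = inj₂ (here refl)

    extend-consistent : ∀ (χ : Formula L (suc n)) Γ → Consistentᴴ Γ → Consistentᴴ (extend χ Γ)
    extend-consistent χ Γ con with em {Consistentᴴ (∀̇ χ ∷ Γ)}
    ... | yes con′ = λ inc → con′ (⊩-nonempty inc)
    ... | no ¬con′ = λ (Δ , Δ⊆X , d) → ¬con′ λ (Δ′ , Δ′⊆X , d′) →
          con (⊩-closed ((Δ′ , Δ′⊆X , ⇒-intro d′) ∷ ⊩-∀-intro {φ = χ} (Δ , Δ⊆X , raa d) ∷ [])
                (⇒-elim (hyp (here refl)) (hyp (there (here refl)))))

    module _ (Γ₀ : List (Sentence L)) where

      stage : ∀ N → List (Formula L (suc N))
      stage zero    = shift Γ₀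
      stage (suc N) with em {Σ[ t ∈ Task ] taskCode t ≡ N}
      ... | yes (t , _) = extend (named N t) (stage N)
      ... | no _        = shift (stage N)

      stage-mono : ∀ N {φ} → stage N ⊩ φ → stage (suc N) ⊩ rename suc φ
      stage-mono N p with em {Σ[ t ∈ Task ] taskCode t ≡ N}
      ... | yes (t , _) = ⊩-weaken (extend-⊇ (named N t) (stage N)) (⊩-shift p)
      ... | no _        = ⊩-shift p

      stage-decides : ∀ t → let N = taskCode t in
        rename suc (∀̇ (named N t)) ∈ stage (suc N) ⊎ ¬̇ (named N t) ∈ stage (suc N)
      stage-decides t with em {Σ[ u ∈ Task ] taskCode u ≡ taskCode t}
      ... | no none = contradiction (t , refl) none
      ... | yes (u , eq) with refl ← taskCode-injective u t eq = extend-decides (named (taskCode t) t) (stage (taskCode t))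

      module _ (consistent : Consistentᴴ Γ₀) where

        stage-consistent : ∀ N → Consistentᴴ (stage N)
        stage-consistent zero = λ inc → consistent (⊩-nonempty inc)
        stage-consistent (suc N) with em {Σ[ t ∈ Task ] taskCode t ≡ N}
        ... | yes (t , _) = extend-consistent (named N t) (stage N) (stage-consistent N)
        ... | no _        = λ inc → stage-consistent N (⊩-nonempty inc)

        HoldsAt : ∀ N → Formula L n → (Fin n → ℕ) → Set
        HoldsAt N φ ρ = stage N ⊩ rename (idx N ∘ ρ) φ

        -- The stages live in different scopes and have no union. Truth is therefore derivability at
        -- some stage at which the elements exist, and `together` brings finitely many truths to a
        -- common stage.
        True : Formula L n → (Fin n → ℕ) → Set
        True φ ρ = Σ[ N ∈ ℕ ] ((∀ i → ρ i ≤ N) × HoldsAt N φ ρ)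

        holds-suc : ∀ {φ : Formula L n} {ρ} → (∀ i → ρ i ≤ N) → HoldsAt N φ ρ → HoldsAt (suc N) φ ρ
        holds-suc {N = N} {φ} {ρ} ρ≤ h = Eq.subst (stage (suc N) ⊩_)
          (trans (rename-∘ suc (idx N ∘ ρ) φ) (rename-cong (λ i → sym (idx-suc (ρ≤ i))) φ)) (stage-mono N h)

        holds-mono : ∀ {φ : Formula L n} {ρ} d → (∀ i → ρ i ≤ N) → HoldsAt N φ ρ → HoldsAt (d + N) φ ρ
        holds-mono zero    ρ≤ h = h
        holds-mono {φ = φ} (suc d) ρ≤ h = holds-suc {φ = φ} (λ i → ≤-trans (ρ≤ i) (m≤n+m _ d)) (holds-mono {φ = φ} d ρ≤ h)

        holds-≤ : ∀ {φ : Formula L n} {ρ M} → (∀ i → ρ i ≤ N) → N ≤ M → HoldsAt N φ ρ → HoldsAt M φ ρ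
        holds-≤ {φ = φ} {ρ} ρ≤ N≤M h = Eq.subst (λ M → HoldsAt M φ ρ) (m∸n+n≡m N≤M) (holds-mono {φ = φ} _ ρ≤ h)

        bound : ∀ {k} (ρ : Fin k → ℕ) → Σ[ N ∈ ℕ ] (∀ i → ρ i ≤ N)
        bound {zero}  ρ = 0 , λ ()
        bound {suc k} ρ with N , N≥ ← bound (ρ ∘ suc) =
          ρ zero + N , λ { zero → m≤m+n _ N ; (suc i) → ≤-trans (N≥ i) (m≤n+m N _) }

        true-intro : ∀ (φ : Formula L n) ρ → (∀ N → (∀ i → ρ i ≤ N) → HoldsAt N φ ρ) → True φ ρ
        true-intro φ ρ h with N , ρ≤ ← bound ρ = N , ρ≤ , h N ρ≤

        together : ∀ {k} (B : ℕ) {a : Fin k → ℕ} (φ : ∀ j → Formula L (a j)) (ρ : ∀ j → Fin (a j) → ℕ) →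
          (∀ j → True (φ j) (ρ j)) → Σ[ N ∈ ℕ ] (B ≤ N × (∀ j → HoldsAt N (φ j) (ρ j)))
        together {zero}  B φ ρ h = B , ≤-refl , λ ()
        together {suc k} B {a} φ ρ h with N , ρ≤ , h₀ ← h zero with M , B≤M , hs ← together (B + N) (φ ∘ suc) (ρ ∘ suc) (h ∘ suc) =
          M , ≤-trans (m≤m+n B N) B≤M ,
          λ { zero → holds-≤ {φ = φ zero} ρ≤ (≤-trans (m≤n+m N B) B≤M) h₀ ; (suc j) → hs j }

        true-closed : ∀ {Φ} {φ : Formula L n} {ρ} → All (λ ψ → True ψ ρ) Φ → Φ ⊢ φ → True φ ρ
        true-closed {Φ = Φ} {φ} {ρ} hs d with B , ρ≤ ← bound ρ
          with N , B≤N , hsN ← together B (L.lookup Φ) (λ _ → ρ) (λ j → All.lookup hs (∈-lookup j)) =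
          N , (λ i → ≤-trans (ρ≤ i) B≤N) , ⊩-closed (all Φ hsN) (⊢-rename (idx N ∘ ρ) d)
          where
          all : ∀ Φ → (∀ j → HoldsAt N (L.lookup Φ j) ρ) → All (stage N ⊩_) (map (rename (idx N ∘ ρ)) Φ)
          all []      hs = []
          all (ψ ∷ Φ) hs = hs zero ∷ all Φ (hs ∘ suc)

        true-consistent : ∀ {ρ : Fin n → ℕ} → ¬ True ⊥̇ ρ
        true-consistent (N , _ , h) = stage-consistent N h

        true-rename⁻ : ∀ (φ : Formula L m) (π : Fin m → Fin n) {ρ} → True (rename π φ) ρ → True φ (ρ ∘ π)
        true-rename⁻ φ π {ρ} (N , ρ≤ , h) = N , ρ≤ ∘ π , Eq.subst (stage N ⊩_) (rename-∘ (idx N ∘ ρ) π φ) h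

        true-rename⁺ : ∀ (φ : Formula L m) (π : Fin m → Fin n) {ρ} → True φ (ρ ∘ π) → True (rename π φ) ρ
        true-rename⁺ φ π {ρ} (N , ρπ≤ , h) with B , ρ≤ ← bound ρ =
          B + N , (λ i → ≤-trans (ρ≤ i) (m≤m+n B N)) ,
          Eq.subst (stage (B + N) ⊩_) (sym (rename-∘ (idx (B + N) ∘ ρ) π φ)) (holds-≤ {φ = φ} ρπ≤ (m≤n+m N B) h)

        true-≗ : ∀ (φ : Formula L n) {ρ π : Fin n → ℕ} → (∀ i → ρ i ≡ π i) → True φ ρ → True φ π
        true-≗ φ eq (N , ρ≤ , h) = N , (λ i → ≤-trans (≤-reflexive (sym (eq i))) (ρ≤ i)) ,
          Eq.subst (stage N ⊩_) (rename-cong (λ i → cong (idx N) (eq i)) φ) h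

        true-instance : ∀ (ψ : Formula L (suc n)) {ρ} e → True (∀̇ ψ) ρ → True ψ (e F.∷ ρ)
        true-instance ψ e h = true-closed (true-rename⁺ (∀̇ ψ) suc h ∷ [])
          (Eq.subst (rename suc (∀̇ ψ) ∷ [] ⊢_) (lift-[] ψ) (∀-elim (hyp (here refl)) (var zero)))

        lookup≤listCode : ∀ {n} (ρ : Vec ℕ n) i → lookup ρ i ≤ listCode ρ
        lookup≤listCode (x ∷ ρ) zero    = m≤m∙n x (listCode ρ)
        lookup≤listCode (x ∷ ρ) (suc i) = ≤-trans (lookup≤listCode ρ i) (n≤m∙n x (listCode ρ))

        true-or-witness : ∀ (ψ : Formula L (suc n)) ρ → True (∀̇ ψ) ρ ⊎ Σ[ e ∈ ℕ ] True (¬̇ ψ) (e F.∷ ρ)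
        true-or-witness {n} ψ ρ = Sum.map (true-≗ (∀̇ ψ) (lookup∘tabulate ρ))
            (λ (e , h) → e , true-≗ (¬̇ ψ) (λ { zero → refl ; (suc i) → lookup∘tabulate ρ i }) h) (decided (stage-decides t))
          where
          t : Task
          t = n , ψ , V.tabulate ρ
          v : Vec ℕ n
          v = V.tabulate ρ
          M : ℕ
          M = taskCode t
          v≤ : ∀ i → lookup v i ≤ M
          v≤ i = ≤-trans (lookup≤listCode v i) (≤-trans (n≤m∙n (formulaCode ψ) _) (n≤m∙n n _))
          decided : rename suc (∀̇ (named M t)) ∈ stage (suc M) ⊎ ¬̇ (named M t) ∈ stage (suc M) →
                    True (∀̇ ψ) (lookup v) ⊎ Σ[ e ∈ ℕ ] True (¬̇ ψ) (e F.∷ lookup v)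
          decided (inj₁ p) = inj₁ (suc M , (λ i → m≤n⇒m≤1+n (v≤ i)) , Eq.subst (stage (suc M) ⊩_)
            (trans (rename-∘ suc (idx M ∘ lookup v) (∀̇ ψ)) (rename-cong (λ i → sym (idx-suc (v≤ i))) (∀̇ ψ))) (⊩-hyp p))
          decided (inj₂ p) = inj₂ (suc M , suc M , (λ { zero → ≤-refl ; (suc i) → m≤n⇒m≤1+n (v≤ i) }) ,
            Eq.subst (stage (suc M) ⊩_) (rename-cong (λ { zero → sym (idx-new M) ; (suc i) → sym (idx-suc (v≤ i)) }) (¬̇ ψ)) (⊩-hyp p))

        true-∀ : ∀ (ψ : Formula L (suc n)) {ρ} → (∀ e → True ψ (e F.∷ ρ)) → True (∀̇ ψ) ρ
        true-∀ ψ {ρ} h with true-or-witness ψ ρ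
        ... | inj₁ t       = t
        ... | inj₂ (e , t) = contradiction (true-closed (t ∷ h e ∷ []) (⇒-elim (hyp (here refl)) (hyp (there (here refl))))) true-consistent

        -- Tasks decide universal formulas only, so φ is decided as the body of a vacuous
        -- quantifier.
        true-decided : ∀ (φ : Formula L n) ρ → True φ ρ ⊎ True (¬̇ φ) ρ
        true-decided φ ρ with true-or-witness (rename suc φ) ρ
        ... | inj₁ t       = inj₁ (true-rename⁻ φ suc {0 F.∷ ρ} (true-instance (rename suc φ) 0 t))
        ... | inj₂ (e , t) = inj₂ (true-rename⁻ (¬̇ φ) suc t)

        -- The elements of the term model are names, and a term has a value only up to provable
        -- equality. This moves a formula between terms and the names of their values, as the truth
        -- lemma requires for atoms.
        true-replace : ∀ {k} (θ : Formula L k) (es : Fin k → ℕ) (ts : Fin k → Term L n) {ρ} →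
          (∀ j → True (var zero ≐ renameᵗ suc (ts j)) (es j F.∷ ρ)) →
          (True θ es → True (subst ts θ) ρ) × (True (subst ts θ) ρ → True θ es)
        true-replace {n} {k} θ es ts {ρ} eqs = to , from
          where
          names : ∀ N → Fin k → Term L (suc N)
          names N j = var (idx N (es j))
          values : ∀ N → Fin k → Term L (suc N)
          values N j = renameᵗ (idx N ∘ ρ) (ts j)
          name-eq : ∀ N → stage N ⊩ rename (idx N ∘ es) θ → stage N ⊩ subst (names N) θ
          name-eq N = Eq.subst (stage N ⊩_) (rename-subst (idx N ∘ es) θ)
          value-eq : ∀ N → rename (idx N ∘ ρ) (subst ts θ) ≡ subst (values N) θ
          value-eq N = trans (rename-subst (idx N ∘ ρ) (subst ts θ)) (trans (subst-subst _ ts θ)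
            (subst-cong (λ j → sym (renameᵗ-subst (idx N ∘ ρ) (ts j))) θ))
          equation : ∀ N j → rename (idx N ∘ (es j F.∷ ρ)) (var zero ≐ renameᵗ suc (ts j)) ≡ (names N j ≐ values N j)
          equation N j = cong (names N j ≐_) (trans (renameᵗ-subst _ (renameᵗ suc (ts j))) (trans (substᵗ-renameᵗ _ suc (ts j))
            (sym (renameᵗ-subst (idx N ∘ ρ) (ts j)))))
          replace : ∀ {N} (σ τ : Fin k → Term L (suc N)) → (∀ j → stage N ⊩ σ j ≐ τ j) → stage N ⊩ subst σ θ → stage N ⊩ subst τ θ
          replace σ τ hs d = ⊩-closed (d ∷ All-tabulate⁺ hs)
            (replace-equals σ τ (λ j → hyp (there (∈-tabulate⁺ j))) θ (hyp (here refl)))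
          flip : ∀ {N} {s t : Term L (suc N)} → stage N ⊩ s ≐ t → stage N ⊩ t ≐ s
          flip {s = s} {t} d = ⊩-closed (d ∷ []) (symmetric s t)
          common : ∀ B → Σ[ N ∈ ℕ ] (B ≤ N × (∀ j → stage N ⊩ names N j ≐ values N j))
          common B with N , B≤N , hs ← together B (λ j → var zero ≐ renameᵗ suc (ts j)) (λ j → es j F.∷ ρ) eqs =
            N , B≤N , λ j → Eq.subst (stage N ⊩_) (equation N j) (hs j)
          to : True θ es → True (subst ts θ) ρ
          to (M , es≤ , h) with B , ρ≤ ← bound ρ with N , ≤N , hs ← common (M + B) =
            N , (λ i → ≤-trans (ρ≤ i) (≤-trans (m≤n+m B M) ≤N)) ,
            Eq.subst (stage N ⊩_) (sym (value-eq N)) (replace (names N) (values N) hs (name-eq N (holds-≤ {φ = θ} es≤ (≤-trans (m≤m+n M B) ≤N) h)))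
          from : True (subst ts θ) ρ → True θ es
          from (M , ρ≤ , h) with B , es≤ ← bound es with N , ≤N , hs ← common (M + B) =
            N , (λ i → ≤-trans (es≤ i) (≤-trans (m≤n+m B M) ≤N)) ,
            Eq.subst (stage N ⊩_) (sym (rename-subst (idx N ∘ es) θ)) (replace (values N) (names N) (flip ∘ hs)
              (Eq.subst (stage N ⊩_) (value-eq N) (holds-≤ {φ = subst ts θ} ρ≤ (≤-trans (m≤m+n M B) ≤N) h)))

        true-≐-refl : ∀ (ρ : Fin n → ℕ) i → True (var zero ≐ var (suc i)) (ρ i F.∷ ρ)
        true-≐-refl ρ i = true-intro (var zero ≐ var (suc i)) (ρ i F.∷ ρ) λ N _ → [] , [] , ≐-refl _

        -- If no element were equal to t, all instances of the inequation would be true, hence also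
        -- its universal closure by the Henkin property. Its instance at t itself contradicts
        -- reflexivity.
        value-exists : ∀ (t : Term L n) ρ → Σ[ e ∈ ℕ ] True (var zero ≐ renameᵗ suc t) (e F.∷ ρ)
        value-exists t ρ with em {Σ[ e ∈ ℕ ] True (var zero ≐ renameᵗ suc t) (e F.∷ ρ)}
        ... | yes p = p
        ... | no ¬p = contradiction (true-closed (true-∀ (¬̇ (var zero ≐ renameᵗ suc t)) unequal ∷ []) refuted) true-consistent
          where
          unequal : ∀ e → True (¬̇ (var zero ≐ renameᵗ suc t)) (e F.∷ ρ)
          unequal e = [ (λ h → contradiction (e , h) ¬p) , id ]′ (true-decided (var zero ≐ renameᵗ suc t) (e F.∷ ρ))
          refuted : ∀̇ (¬̇ (var zero ≐ renameᵗ suc t)) ∷ [] ⊢ ⊥̇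
          refuted = ⇒-elim (∀-elim (hyp (here refl)) t)
            (Eq.subst (λ u → ∀̇ (¬̇ (var zero ≐ renameᵗ suc t)) ∷ [] ⊢ t ≐ u) (sym (trans (substᵗ-renameᵗ (t F.∷ var) suc t) (substᵗ-id t))) (≐-refl t))

        Equal : ℕ → ℕ → Set
        Equal d e = True (var zero ≐ var (suc zero)) (d F.∷ e F.∷ F.[])

        private
          two : ∀ (x y : Fin n) (ρ : Fin n → ℕ) (i : Fin 2) → ρ ((x F.∷ y F.∷ F.[]) i) ≡ (ρ x F.∷ ρ y F.∷ F.[]) i
          two x y ρ zero       = refl
          two x y ρ (suc zero) = refl

        equal⁻ : ∀ (x y : Fin n) {ρ} → True (var x ≐ var y) ρ → Equal (ρ x) (ρ y)
        equal⁻ x y {ρ} h = true-≗ (var zero ≐ var (suc zero)) (two x y ρ)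
          (true-rename⁻ (var zero ≐ var (suc zero)) (x F.∷ y F.∷ F.[]) h)

        equal⁺ : ∀ (x y : Fin n) {ρ} → Equal (ρ x) (ρ y) → True (var x ≐ var y) ρ
        equal⁺ x y {ρ} h = true-rename⁺ (var zero ≐ var (suc zero)) (x F.∷ y F.∷ F.[])
          (true-≗ (var zero ≐ var (suc zero)) (sym ∘ two x y ρ) h)

        applied : ∀ {k} → FunSym k → Term L k
        applied f = fun f (V.tabulate var)

        pointwise-replace : ∀ {k} (θ : Formula L k) {es es′ : Fin k → ℕ} → (∀ i → Equal (es i) (es′ i)) → True θ es → True θ es′
        pointwise-replace θ {es} {es′} eqs h = Eq.subst (λ θ → True θ es′) (subst-id θ)
          (proj₁ (true-replace θ es var (λ j → equal⁺ zero (suc j) (eqs j))) h)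

        termModel : Structure L
        termModel = record
          { Carrier       = ℕ
          ; _≈_           = Equal
          ; point         = 0
          ; function      = λ f es → proj₁ (value-exists (applied f) (lookup es))
          ; relation      = λ r es → True (rel r (V.tabulate var)) (lookup es)
          ; ≈-refl        = equal-refl
          ; ≈-sym         = equal-sym
          ; ≈-trans       = equal-trans
          ; function-cong = λ f {xs} {ys} eqs → equal-trans
              (unique f ys (pointwise-replace (var zero ≐ renameᵗ suc (applied f)) (λ { zero → equal-refl ; (suc i) → eqs i })
                (proj₂ (value-exists (applied f) (lookup xs))))) equal-refl
          ; relation-cong = λ r eqs → pointwise-replace (rel r (V.tabulate var)) eqs
          }
          where
          equal-refl : ∀ {x} → Equal x x
          equal-refl {x} = true-intro (var zero ≐ var (suc zero)) (x F.∷ x F.∷ F.[]) λ N _ → [] , [] , ≐-refl _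
          equal-sym : ∀ {x y} → Equal x y → Equal y x
          equal-sym {x} {y} h = equal⁻ (suc zero) zero {x F.∷ y F.∷ F.[]} (true-closed (h ∷ []) (symmetric (var zero) (var (suc zero))))
          equal-trans : ∀ {x y z} → Equal x y → Equal y z → Equal x z
          equal-trans {x} {y} {z} h h′ = equal⁻ zero (suc (suc zero)) {x F.∷ y F.∷ z F.∷ F.[]}
            (true-closed (equal⁺ zero (suc zero) h ∷ equal⁺ (suc zero) (suc (suc zero)) h′ ∷ [])
              (transitive (var zero) (var (suc zero)) (var (suc (suc zero)))))
          unique : ∀ {k} (f : FunSym k) es {e} → True (var zero ≐ renameᵗ suc (applied f)) (e F.∷ lookup es) →
            Equal e (proj₁ (value-exists (applied f) (lookup es)))
          unique f es {e} h = equal⁻ zero (suc zero) {e F.∷ e′ F.∷ lookup es} (true-closed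
            (Eq.subst (λ u → True (var zero ≐ u) (e F.∷ e′ F.∷ lookup es)) (renameᵗ-∘ _ suc (applied f))
               (true-rename⁺ equation (zero F.∷ λ i → suc (suc i)) (true-≗ equation (λ { zero → refl ; (suc i) → refl }) h))
             ∷ Eq.subst (λ u → True (var (suc zero) ≐ u) (e F.∷ e′ F.∷ lookup es)) (renameᵗ-∘ suc suc (applied f))
               (true-rename⁺ equation suc (true-≗ equation (λ { zero → refl ; (suc i) → refl }) (proj₂ (value-exists (applied f) (lookup es))))) ∷ [])
            (cut (λ { (here refl) → hyp (here refl) ; (there (here refl)) → weaken there (symmetric (var (suc zero)) _) })
              (transitive (var zero) (renameᵗ (λ i → suc (suc i)) (applied f)) (var (suc zero)))))
            where
            e′ : ℕ
            e′ = proj₁ (value-exists (applied f) (lookup es))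
            equation : Formula L _
            equation = var zero ≐ renameᵗ suc (applied f)

        open Structure termModel using (⟦_⟧ᵗ; ⟦_⟧ᵗˢ; Sat)

        tabulate-subst : ∀ {k m} (σ : Fin k → Term L m) (π : Fin n → Fin k) → substᵗˢ σ (V.tabulate (var ∘ π)) ≡ V.tabulate (σ ∘ π)
        tabulate-subst {zero}  σ π = refl
        tabulate-subst {suc n} σ π = cong (σ (π zero) ∷_) (tabulate-subst σ (π ∘ suc))

        args-subst : ∀ {k} (ts : Vec (Term L n) k) → substᵗˢ (lookup ts) (V.tabulate var) ≡ ts
        args-subst ts = trans (tabulate-subst (lookup ts) id) (tabulate∘lookup ts)

        mutual
          value-true : ∀ (t : Term L n) ρ → True (var zero ≐ renameᵗ suc t) (⟦ t ⟧ᵗ ρ F.∷ ρ)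
          value-true (var x)    ρ = true-≐-refl ρ x
          value-true {n} (fun f ts) ρ = Eq.subst (λ u → True (var zero ≐ u) (e F.∷ ρ)) shifted
            (proj₁ (true-replace (var zero ≐ renameᵗ suc (applied f)) (e F.∷ lookup (⟦ ts ⟧ᵗˢ ρ)) (lift (lookup ts)) {e F.∷ ρ} equal-at)
              (proj₂ (value-exists (applied f) (lookup (⟦ ts ⟧ᵗˢ ρ)))))
            where
            e : ℕ
            e = ⟦ fun f ts ⟧ᵗ ρ
            equal-at : ∀ j → True (var zero ≐ renameᵗ suc (lift (lookup ts) j)) ((e F.∷ lookup (⟦ ts ⟧ᵗˢ ρ)) j F.∷ e F.∷ ρ)
            equal-at zero    = true-≐-refl (e F.∷ ρ) zero
            equal-at (suc j) = Eq.subst (λ u → True (var zero ≐ u) (lookup (⟦ ts ⟧ᵗˢ ρ) j F.∷ e F.∷ ρ))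
              (trans (renameᵗ-∘ (liftʳ suc) suc (lookup ts j)) (sym (renameᵗ-∘ suc suc (lookup ts j))))
              (true-rename⁺ (var zero ≐ renameᵗ suc (lookup ts j)) (liftʳ suc)
                (true-≗ (var zero ≐ renameᵗ suc (lookup ts j)) (λ { zero → refl ; (suc i) → refl }) (values-true ts ρ j)))
            shifted : substᵗ (lift (lookup ts)) (renameᵗ suc (applied f)) ≡ renameᵗ suc (fun f ts)
            shifted = trans (substᵗ-renameᵗ (lift (lookup ts)) suc (applied f))
              (trans (sym (renameᵗ-substᵗ suc (lookup ts) (applied f))) (cong (λ us → renameᵗ suc (fun f us)) (args-subst ts)))

          values-true : ∀ {k} (ts : Vec (Term L n) k) ρ j → True (var zero ≐ renameᵗ suc (lookup ts j)) (lookup (⟦ ts ⟧ᵗˢ ρ) j F.∷ ρ)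
          values-true (t ∷ ts) ρ zero    = value-true t ρ
          values-true (t ∷ ts) ρ (suc j) = values-true ts ρ j

        truth : ∀ (φ : Formula L n) ρ → (Sat φ ρ → True φ ρ) × (True φ ρ → Sat φ ρ)
        truth (s ≐ t) ρ = true-replace (var zero ≐ var (suc zero)) (⟦ s ⟧ᵗ ρ F.∷ ⟦ t ⟧ᵗ ρ F.∷ F.[]) (s F.∷ t F.∷ F.[])
          λ { zero → value-true s ρ ; (suc zero) → value-true t ρ }
        truth (rel r ts) ρ = Eq.subst (λ us → (atom → True (rel r us) ρ) × (True (rel r us) ρ → atom)) (args-subst ts)
          (true-replace (rel r (V.tabulate var)) (lookup (⟦ ts ⟧ᵗˢ ρ)) (lookup ts) (values-true ts ρ))
          where
          atom : Set
          atom = True (rel r (V.tabulate var)) (lookup (⟦ ts ⟧ᵗˢ ρ))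
        truth ⊥̇ ρ = (λ ()) , λ h → contradiction h true-consistent
        truth (φ ⇒ ψ) ρ = to , from
          where
          to : (Sat φ ρ → Sat ψ ρ) → True (φ ⇒ ψ) ρ
          to h with true-decided φ ρ
          ... | inj₁ t = true-closed (proj₁ (truth ψ ρ) (h (proj₂ (truth φ ρ) t)) ∷ []) (⇒-intro (hyp (there (here refl))))
          ... | inj₂ f = true-closed (f ∷ []) (⇒-intro (raa (⇒-elim (hyp (there (there (here refl)))) (hyp (there (here refl))))))
          from : True (φ ⇒ ψ) ρ → Sat φ ρ → Sat ψ ρ
          from t p = proj₂ (truth ψ ρ) (true-closed (t ∷ proj₁ (truth φ ρ) p ∷ []) (⇒-elim (hyp (here refl)) (hyp (there (here refl)))))
        truth (∀̇ φ) ρ = (λ h → true-∀ φ (λ e → proj₁ (truth φ (e F.∷ ρ)) (h e)))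
                      , (λ t e → proj₂ (truth φ (e F.∷ ρ)) (true-instance φ e t))

    countermodel : ∀ φ → ¬ Theorems X φ → Σ[ M ∈ Structure L ] (Structure.Models M X × ∀ ρ → ¬ Structure.Sat M φ ρ)
    countermodel φ ¬t = termModel Γ₀ consistent , models , λ ρ → proj₂ (truth Γ₀ consistent (¬̇ φ) ρ) (¬φ-true ρ)
      where
      Γ₀ : List (Sentence L)
      Γ₀ = ¬̇ φ ∷ []
      closed : ∀ Δ → map (rename none) Δ ≡ Δ
      closed Δ = trans (map-cong (rename-id (λ ())) Δ) (map-id Δ)
      consistent : Consistentᴴ Γ₀
      consistent (Δ , Δ⊆X , d) = ¬t (Δ , Δ⊆X , raa (Eq.subst (λ Δ → ¬̇ φ ∷ Δ ⊢ ⊥̇) (closed Δ) d))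
      ¬φ-true : ∀ ρ → True Γ₀ consistent (¬̇ φ) ρ
      ¬φ-true ρ = 0 , (λ ()) , Eq.subst (stage Γ₀ 0 ⊩_) (rename-cong (λ ()) (¬̇ φ)) (⊩-hyp (here refl))
      models : Structure.Models (termModel Γ₀ consistent) X
      models ψ ψ∈X ρ = proj₂ (truth Γ₀ consistent ψ ρ) (true-intro Γ₀ consistent ψ ρ λ N _ →
        ψ ∷ [] , ψ∈X ∷ [] , hyp (∈-++⁺ʳ (stage Γ₀ N) (here (rename-cong (λ ()) ψ))))

    completeness : ∀ φ → ((M : Structure L) → Structure.Models M X → ∀ ρ → Structure.Sat M φ ρ) → Theorems X φ
    completeness φ valid with em {Theorems X φ}
    ... | yes t = t
    ... | no ¬t = let M , models , ¬φ = countermodel φ ¬t in contradiction (valid M models (λ ())) (¬φ (λ ()))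

open Completeness

-- Models of R, absoluteness and Rosser formulas

module ModelsOfR where

  polyTerm : ∀ {n} → Poly n → Term L-R n
  polyTerm (var i) = var i
  polyTerm (lit m) = num m
  polyTerm (s ⊞ t) = polyTerm s +̇ polyTerm t
  polyTerm (s ⊠ t) = polyTerm s ·̇ polyTerm t

  boundedFormula : ∀ {n} → Bounded 0 n → Formula L-R n
  boundedFormula (s ≗ t)  = polyTerm s ≐ polyTerm t
  boundedFormula ⊥ᵇ       = ⊥̇
  boundedFormula (φ ∧ᵇ ψ) = boundedFormula φ ∧̇ boundedFormula ψ
  boundedFormula (φ ∨ᵇ ψ) = boundedFormula φ ∨̇ boundedFormula ψ
  boundedFormula (¬ᵇ φ)   = ¬̇ (boundedFormula φ)
  boundedFormula (∀≤ i φ) = ∀̇ (var zero ≤̇ var (suc i) ⇒ boundedFormula φ)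
  boundedFormula (∃≤ i φ) = ∃̇ (var zero ≤̇ var (suc i) ∧̇ boundedFormula φ)

  module ModelOfR (em : ExcludedMiddle 0ℓ) (M : Structure L-R) (models : Structure.Models M AxiomR) where
    open Structure M public

    infix 4 _≤ᴹ_
    _≤ᴹ_ : Carrier → Carrier → Set
    x ≤ᴹ y = relation (0 , tt) (x ∷ y ∷ [])

    plus times : Carrier → Carrier → Carrier
    plus x y  = function (0 , tt) (x ∷ y ∷ [])
    times x y = function (1 , tt) (x ∷ y ∷ [])

    ν : ℕ → Carrier
    ν zero    = function (0 , tt) []
    ν (suc m) = function (0 , tt) (ν m ∷ [])

    num-value : ∀ {n} m {ρ : Fin n → Carrier} → ⟦ num m ⟧ᵗ ρ ≡ ν m
    num-value zero    = refl
    num-value (suc m) = cong (λ x → function (0 , tt) (x ∷ [])) (num-value m)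

    two-cong : ∀ {x y x′ y′} → x ≈ x′ → y ≈ y′ → ∀ i → lookup (x ∷ y ∷ []) i ≈ lookup (x′ ∷ y′ ∷ []) i
    two-cong p q zero       = p
    two-cong p q (suc zero) = q

    plus-cong : ∀ {x y x′ y′} → x ≈ x′ → y ≈ y′ → plus x y ≈ plus x′ y′
    plus-cong p q = function-cong (0 , tt) (two-cong p q)

    times-cong : ∀ {x y x′ y′} → x ≈ x′ → y ≈ y′ → times x y ≈ times x′ y′
    times-cong p q = function-cong (1 , tt) (two-cong p q)

    ≤ᴹ-resp : ∀ {x y x′ y′} → x ≈ x′ → y ≈ y′ → x ≤ᴹ y → x′ ≤ᴹ y′
    ≤ᴹ-resp p q = relation-cong (0 , tt) (two-cong p q)

    private
      empty : Fin 0 → Carrier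
      empty ()

    ν-plus : ∀ m n → plus (ν m) (ν n) ≈ ν (m + n)
    ν-plus m n = subst₂ _≈_ (cong₂ plus (num-value m) (num-value n)) (num-value (m + n)) (models _ (R1 m n) empty)

    ν-times : ∀ m n → times (ν m) (ν n) ≈ ν (m * n)
    ν-times m n = subst₂ _≈_ (cong₂ times (num-value m) (num-value n)) (num-value (m * n)) (models _ (R2 m n) empty)

    ν-injective : ∀ m n → ν m ≈ ν n → m ≡ n
    ν-injective m n eq with m ≟ n
    ... | yes p = p
    ... | no ¬p = contradiction (subst₂ _≈_ (sym (num-value m)) (sym (num-value n)) eq) (models _ (R3 m n ¬p) empty)

    ≤-standard : ∀ n x → x ≤ᴹ ν n → Σ[ i ∈ ℕ ] (i ≤ n × x ≈ ν i)
    ≤-standard n x x≤ = go n (models _ (R4 n) empty x (Eq.subst (x ≤ᴹ_) (sym (num-value n)) x≤))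
      where
      go : ∀ n {ρ : Fin 0 → Carrier} → Sat (oneOfUpTo (var zero) n) (x F.∷ ρ) → Σ[ i ∈ ℕ ] (i ≤ n × x ≈ ν i)
      go zero    h = 0 , z≤n , h
      go (suc n) {ρ} h with Sat-∨⁻ em (oneOfUpTo (var zero) n) (var zero ≐ num (suc n)) {x F.∷ ρ} h
      ... | inj₁ h′ with i , i≤n , eq ← go n {ρ} h′ = i , m≤n⇒m≤1+n i≤n , eq
      ... | inj₂ h′ = suc n , ≤-refl , Eq.subst (x ≈_) (num-value (suc n)) h′

    ≤-total-standard : ∀ n x → x ≤ᴹ ν n ⊎ ν n ≤ᴹ x
    ≤-total-standard n x with Sat-∨⁻ em (var zero ≤̇ num n) (num n ≤̇ var zero) {x F.∷ empty} (models _ (R5 n) empty x)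
    ... | inj₁ h = inj₁ (Eq.subst (x ≤ᴹ_) (num-value n) h)
    ... | inj₂ h = inj₂ (Eq.subst (_≤ᴹ x) (num-value n) h)

    -- No axiom of R states an inequality between numerals outright. R5 offers one of two
    -- comparisons; if it is the unwanted one, R4 gives n ≤ i, so that i and n coincide.
    ν-≤ : ∀ {i n} → i ≤ n → ν i ≤ᴹ ν n
    ν-≤ {i} {n} i≤n with ≤-total-standard n (ν i)
    ... | inj₁ h = h
    ... | inj₂ h with j , j≤i , eq ← ≤-standard i (ν n) h with refl ← ν-injective n j eq with refl ← ≤-antisym i≤n j≤i = h

    ν-≤⁻ : ∀ {i n} → ν i ≤ᴹ ν n → i ≤ n
    ν-≤⁻ {i} {n} h with j , j≤n , eq ← ≤-standard n (ν i) h with refl ← ν-injective i j eq = j≤n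

    standard : ∀ {n} → Vec ℕ n → Fin n → Carrier
    standard xs i = ν (lookup xs i)

    poly-standard : ∀ {n} (t : Poly n) xs → ⟦ polyTerm t ⟧ᵗ (standard xs) ≈ ν (polyValue t xs)
    poly-standard (var i) xs = ≈-refl
    poly-standard (lit m) xs = ≈-reflexive (num-value m)
    poly-standard (s ⊞ t) xs = ≈-trans (plus-cong (poly-standard s xs) (poly-standard t xs)) (ν-plus (polyValue s xs) (polyValue t xs))
    poly-standard (s ⊠ t) xs = ≈-trans (times-cong (poly-standard s xs) (poly-standard t xs)) (ν-times (polyValue s xs) (polyValue t xs))

    standard-cons : ∀ {n x k} (xs : Vec ℕ n) → x ≈ ν k → ∀ i → (x F.∷ standard xs) i ≈ standard (k ∷ xs) i
    standard-cons xs eq zero    = eq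
    standard-cons xs eq (suc i) = ≈-refl

    -- By R4 everything below a numeral is itself a numeral, so a quantifier with a standard bound
    -- has the same range in the model as in the natural numbers.
    absolute : ∀ {n} (φ : Bounded 0 n) xs → (Sat (boundedFormula φ) (standard xs) → Holds no-param φ xs)
                                          × (Holds no-param φ xs → Sat (boundedFormula φ) (standard xs))
    absolute (s ≗ t) xs =
        (λ h → ν-injective _ _ (≈-trans (≈-sym (poly-standard s xs)) (≈-trans h (poly-standard t xs))))
      , (λ h → ≈-trans (poly-standard s xs) (≈-trans (≈-reflexive (cong ν h)) (≈-sym (poly-standard t xs))))
    absolute ⊥ᵇ xs = id , id
    absolute (φ ∧ᵇ ψ) xs =
        (λ h → let p , q = Sat-∧⁻ em (boundedFormula φ) (boundedFormula ψ) h in proj₁ (absolute φ xs) p , proj₁ (absolute ψ xs) q)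
      , (λ (p , q) → Sat-∧⁺ em (boundedFormula φ) (boundedFormula ψ) (proj₂ (absolute φ xs) p) (proj₂ (absolute ψ xs) q))
    absolute (φ ∨ᵇ ψ) xs =
        (λ h → [ inj₁ ∘ proj₁ (absolute φ xs) , inj₂ ∘ proj₁ (absolute ψ xs) ]′ (Sat-∨⁻ em (boundedFormula φ) (boundedFormula ψ) h))
      , (λ h → Sat-∨⁺ em (boundedFormula φ) (boundedFormula ψ) ([ inj₁ ∘ proj₂ (absolute φ xs) , inj₂ ∘ proj₂ (absolute ψ xs) ]′ h))
    absolute (¬ᵇ φ) xs = (_∘ proj₂ (absolute φ xs)) , (_∘ proj₁ (absolute φ xs))
    absolute (∀≤ i φ) xs =
        (λ h k k≤ → proj₁ (absolute φ (k ∷ xs)) (Sat-cong (standard-cons xs ≈-refl) (boundedFormula φ) (h (ν k) (ν-≤ k≤))))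
      , (λ h x x≤ → let k , k≤ , eq = ≤-standard (lookup xs i) x x≤ in
          Sat-cong (≈-sym ∘ standard-cons xs eq) (boundedFormula φ) (proj₂ (absolute φ (k ∷ xs)) (h k k≤)))
    absolute (∃≤ i φ) xs =
        (λ h → let x , h′ = Sat-∃⁻ em (var zero ≤̇ var (suc i) ∧̇ boundedFormula φ) {standard xs} h
                   x≤ , hx = Sat-∧⁻ em (var zero ≤̇ var (suc i)) (boundedFormula φ) {x F.∷ standard xs} h′
                   k , k≤ , eq = ≤-standard (lookup xs i) x x≤
               in k , k≤ , proj₁ (absolute φ (k ∷ xs)) (Sat-cong (standard-cons xs eq) (boundedFormula φ) hx))
      , (λ (k , k≤ , h) → Sat-∃⁺ em (var zero ≤̇ var (suc i) ∧̇ boundedFormula φ) {standard xs} (ν k)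
          (Sat-∧⁺ em (var zero ≤̇ var (suc i)) (boundedFormula φ) {ν k F.∷ standard xs} (ν-≤ k≤)
            (Sat-cong (≈-sym ∘ standard-cons xs ≈-refl) (boundedFormula φ) (proj₂ (absolute φ (k ∷ xs)) h))))

  -- haltsAt c: the computation of c at x (variable 0) is found below s (variable 1).
  haltsAt : Code 1 → Formula L-R 2
  haltsAt c = subst (num (index c) F.∷ var) (boundedFormula haltsᵇ)

  -- A Rosser formula: c is seen to halt at x before d is.
  precedes : Code 1 → Code 1 → Formula L-R 1
  precedes c d = ∃̇ (rename (suc zero F.∷ zero F.∷ F.[]) (haltsAt c) ∧̇
                    ∀̇ (var zero ≤̇ var (suc zero) ⇒ ¬̇ (rename (suc (suc zero) F.∷ zero F.∷ F.[]) (haltsAt d))))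

  module Rosser (em : ExcludedMiddle 0ℓ) (M : Structure L-R) (models : Structure.Models M AxiomR) where
    open ModelOfR em M models

    HaltsAt : Code 1 → Carrier → Carrier → Set
    HaltsAt c x s = Sat (haltsAt c) (x F.∷ s F.∷ F.[])

    halts-standard : ∀ c x s → (HaltsAt c (ν x) (ν s) → Halts (index c) x s) × (Halts (index c) x s → HaltsAt c (ν x) (ν s))
    halts-standard c x s =
        (λ h → proj₁ (absolute haltsᵇ (index c ∷ x ∷ s ∷ [])) (Sat-cong env (boundedFormula haltsᵇ)
          (proj₁ (Sat-subst (num (index c) F.∷ var) (ν x F.∷ ν s F.∷ F.[]) (boundedFormula haltsᵇ)) h)))
      , (λ h → proj₂ (Sat-subst (num (index c) F.∷ var) (ν x F.∷ ν s F.∷ F.[]) (boundedFormula haltsᵇ))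
          (Sat-cong (≈-sym ∘ env) (boundedFormula haltsᵇ) (proj₂ (absolute haltsᵇ (index c ∷ x ∷ s ∷ [])) h)))
      where
      env : ∀ i → ⟦ (num (index c) F.∷ var) i ⟧ᵗ (ν x F.∷ ν s F.∷ F.[]) ≈ standard (index c ∷ x ∷ s ∷ []) i
      env zero             = ≈-reflexive (num-value (index c))
      env (suc zero)       = ≈-refl
      env (suc (suc zero)) = ≈-refl

    halts-resp : ∀ c {x s s′} → s ≈ s′ → HaltsAt c x s → HaltsAt c x s′
    halts-resp c {x} {s} {s′} eq = Sat-cong env (haltsAt c)
      where
      env : ∀ i → (x F.∷ s F.∷ F.[]) i ≈ (x F.∷ s′ F.∷ F.[]) i
      env zero       = ≈-refl
      env (suc zero) = eq

    Precedes : Code 1 → Code 1 → Carrier → Set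
    Precedes c d x = Σ[ s ∈ Carrier ] (HaltsAt c x s × (∀ t → t ≤ᴹ s → ¬ HaltsAt d x t))

    private
      pick : ∀ {n} (ρ : Fin n → Carrier) (i j : Fin n) (k : Fin 2) → ρ ((i F.∷ j F.∷ F.[]) k) ≡ (ρ i F.∷ ρ j F.∷ F.[]) k
      pick ρ i j zero       = refl
      pick ρ i j (suc zero) = refl

      at : ∀ {n} c (ρ : Fin n → Carrier) i j →
        (Sat (rename (i F.∷ j F.∷ F.[]) (haltsAt c)) ρ → HaltsAt c (ρ i) (ρ j)) ×
        (HaltsAt c (ρ i) (ρ j) → Sat (rename (i F.∷ j F.∷ F.[]) (haltsAt c)) ρ)
      at c ρ i j = Sat-≡ (pick ρ i j) (haltsAt c) ∘ proj₁ (Sat-rename _ ρ (haltsAt c))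
                 , proj₂ (Sat-rename _ ρ (haltsAt c)) ∘ Sat-≡ (sym ∘ pick ρ i j) (haltsAt c)

      left : Code 1 → Formula L-R 2
      left c = rename (suc zero F.∷ zero F.∷ F.[]) (haltsAt c)
      right : Code 1 → Formula L-R 2
      right d = ∀̇ (var zero ≤̇ var (suc zero) ⇒ ¬̇ (rename (suc (suc zero) F.∷ zero F.∷ F.[]) (haltsAt d)))

    precedes-sat : ∀ c d ρ → (Sat (precedes c d) ρ → Precedes c d (ρ zero)) × (Precedes c d (ρ zero) → Sat (precedes c d) ρ)
    precedes-sat c d ρ =
        (λ h → let s , h′ = Sat-∃⁻ em (left c ∧̇ right d) {ρ} h
                   hc , hd = Sat-∧⁻ em (left c) (right d) {s F.∷ ρ} h′
               in s , proj₁ (at c (s F.∷ ρ) (suc zero) zero) hc ,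
                  λ t t≤s ht → hd t t≤s (proj₂ (at d (t F.∷ s F.∷ ρ) (suc (suc zero)) zero) ht))
      , (λ (s , hc , hd) → Sat-∃⁺ em (left c ∧̇ right d) {ρ} s (Sat-∧⁺ em (left c) (right d) {s F.∷ ρ}
          (proj₂ (at c (s F.∷ ρ) (suc zero) zero) hc)
          λ t t≤s ht → hd t t≤s (proj₁ (at d (t F.∷ s F.∷ ρ) (suc (suc zero)) zero) ht)))

    precedes-yes : ∀ c d {x} → W c x → ¬ W d x → Precedes c d (ν x)
    precedes-yes c d {x} w ¬w with s , h ← W⇒halts c w = ν s , proj₂ (halts-standard c x s) h , none
      where
      none : ∀ t → t ≤ᴹ ν s → ¬ HaltsAt d (ν x) t
      none t t≤s h′ with i , _ , eq ← ≤-standard s t t≤s = ¬w (halts⇒W d (proj₁ (halts-standard d x i) (halts-resp d eq h′)))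

    -- The supposed witness s may be nonstandard, but R5 compares it with the standard stage s₀ at
    -- which `d` halts. Above s₀ it is refuted by `d`; below s₀ it is a numeral by R4, and `c` would
    -- really halt.
    precedes-no : ∀ c d {x} → W d x → ¬ W c x → ¬ Precedes c d (ν x)
    precedes-no c d {x} w ¬w (s , hc , hd) with s₀ , h ← W⇒halts d w with ≤-total-standard s₀ s
    ... | inj₂ s₀≤s = hd (ν s₀) s₀≤s (proj₂ (halts-standard d x s₀) h)
    ... | inj₁ s≤s₀ with i , _ , eq ← ≤-standard s₀ s s≤s₀ = ¬w (halts⇒W c (proj₁ (halts-standard c x i) (halts-resp c eq hc)))

open ModelsOfR

-- Sentences about sizes of equivalence classes

module ClassSizes where

  L-E : Language
  L-E = record { hasFun = λ _ _ → false ; hasRel = hasRelE }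
    where
    hasRelE : ℕ → ℕ → Bool
    hasRelE 2 0 = true
    hasRelE _ _ = false

  infix 7 _~̇_

  _~̇_ : ∀ {n} → Term L-E n → Term L-E n → Formula L-E n
  s ~̇ t = rel (0 , tt) (s ∷ t ∷ [])

  -- The variables are treated from the last to the first, so that the variable in each step is
  -- fixed by the number j alone. The Gödel number then obeys the same recursion on j, see
  -- `distinctCode`.
  distinctFrom : ∀ {n} j → (Fin j → Fin n) → Formula L-E (suc n) → Formula L-E (suc n)
  distinctFrom zero    ι ψ = ψ
  distinctFrom (suc j) ι ψ = ¬̇ (var zero ≐ var (suc (ι (fromℕ j)))) ⇒ distinctFrom j (ι ∘ inject₁) ψ

  -- With x₀, …, xₖ the first k + 1 variables in reverse order: ψ holds of every
  -- element of the class of x₀ other than x₀, …, xₖ.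
  forFresh : ∀ k o → Formula L-E (suc (suc k + o)) → Formula L-E (suc k + o)
  forFresh k o ψ = ∀̇ (var zero ~̇ var (suc (fromℕ k ↑ˡ o)) ⇒ distinctFrom (suc k) (_↑ˡ o) ψ)

  -- The class of x₀ has exactly r elements besides x₀, …, xₖ.
  remaining : (r k o : ℕ) → Formula L-E (suc k + o)
  remaining zero    k o = forFresh k o ⊥̇
  remaining (suc r) k o = ¬̇ (forFresh k o (¬̇ (remaining r (suc k) o)))

  -- class n and uniqueClass n speak of classes with n + 1 elements.
  class uniqueClass : ℕ → Sentence L-E
  class n       = ∃̇ (remaining n 0 0)
  uniqueClass n = ∀̇ (remaining n 0 0 ⇒ ∀̇ (remaining n 0 1 ⇒ var zero ~̇ var (suc zero)))

  module Classes (em : ExcludedMiddle 0ℓ) (M : Structure L-E) where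
    open Structure M public

    infix 4 _~_
    _~_ : Carrier → Carrier → Set
    x ~ y = relation (0 , tt) (x ∷ y ∷ [])

    ~-resp : ∀ {x y x′ y′} → x ≈ x′ → y ≈ y′ → x ~ y → x′ ~ y′
    ~-resp p q = relation-cong (0 , tt) λ { zero → p ; (suc zero) → q }

    record Equivalence~ : Set where
      field
        ~-refl  : ∀ {x} → x ~ x
        ~-sym   : ∀ {x y} → x ~ y → y ~ x
        ~-trans : ∀ {x y z} → x ~ y → y ~ z → x ~ z

    Distinct : ∀ {m} → (Fin m → Carrier) → Set
    Distinct f = ∀ {i j} → f i ≈ f j → i ≡ j

    AtLeast Exactly : Carrier → ℕ → Set
    AtLeast x m = Σ[ f ∈ (Fin m → Carrier) ] (Distinct f × (∀ i → x ~ f i))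
    Exactly x m = AtLeast x m × ¬ AtLeast x (suc m)

    fresh : ∀ {m k} (f : Fin m → Carrier) (g : Fin k → Carrier) → Distinct f → k < m → Σ[ i ∈ Fin m ] (∀ j → ¬ f i ≈ g j)
    fresh {m} {k} f g distinct k<m with em {Σ[ i ∈ Fin m ] (∀ j → ¬ f i ≈ g j)}
    ... | yes p = p
    ... | no ¬p = let i , j , i<j , eq = pigeonhole k<m (λ i → proj₁ (hit i)) in
      contradiction (distinct (≈-trans (proj₂ (hit i)) (Eq.subst (λ s → g s ≈ f j) (sym eq) (≈-sym (proj₂ (hit j)))))) (<ᶠ⇒≢ i<j)
      where
      hit : ∀ i → Σ[ j ∈ Fin k ] f i ≈ g j
      hit i with em {Σ[ j ∈ Fin k ] f i ≈ g j}
      ... | yes q = q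
      ... | no ¬q = contradiction (i , λ j e → ¬q (j , e)) ¬p

    atLeast-≤ : ∀ {x m k} → m ≤ k → AtLeast x k → AtLeast x m
    atLeast-≤ m≤k (f , distinct , ~f) =
      (λ i → f (inject≤ i m≤k)) , (λ eq → inject≤-injective m≤k m≤k _ _ (distinct eq)) , (λ i → ~f (inject≤ i m≤k))

    exactly-≤ : ∀ {x n m} → Exactly x n → AtLeast x m → m ≤ n
    exactly-≤ {x} {n} {m} (_ , ¬more) h with m ≤? n
    ... | yes p = p
    ... | no ¬p = contradiction (atLeast-≤ (≰⇒> ¬p) h) ¬more

    exactly-unique : ∀ {x n m} → Exactly x n → Exactly x m → n ≡ m
    exactly-unique e e′ = ≤-antisym (exactly-≤ e′ (proj₁ e)) (exactly-≤ e (proj₁ e′))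

    size-below : ∀ x m → ¬ AtLeast x m → Σ[ n ∈ ℕ ] (n < m × Exactly x n)
    size-below x zero    ¬h = contradiction ((λ ()) , (λ { {()} }) , λ ()) ¬h
    size-below x (suc m) ¬h with em {AtLeast x m}
    ... | yes h = m , ≤-refl , h , ¬h
    ... | no ¬h′ with n , n<m , e ← size-below x m ¬h′ = n , m<n⇒m<1+n n<m , e

    cons-distinct : ∀ {m x} {f : Fin m → Carrier} → (∀ i → ¬ x ≈ f i) → Distinct f → Distinct (x F.∷ f)
    cons-distinct new distinct {zero}  {zero}  eq = refl
    cons-distinct new distinct {zero}  {suc j} eq = contradiction eq (new j)
    cons-distinct new distinct {suc i} {zero}  eq = contradiction (≈-sym eq) (new i)
    cons-distinct new distinct {suc i} {suc j} eq = cong suc (distinct eq)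

    module _ (eq : Equivalence~) where
      open Equivalence~ eq

      atLeast-~ : ∀ {x y m} → x ~ y → AtLeast x m → AtLeast y m
      atLeast-~ x~y (f , distinct , ~f) = f , distinct , λ i → ~-trans (~-sym x~y) (~f i)

      exactly-~ : ∀ {x y m} → x ~ y → Exactly x m → Exactly y m
      exactly-~ x~y (h , ¬more) = atLeast-~ x~y h , ¬more ∘ atLeast-~ (~-sym x~y)

    module Semantics (equiv : Equivalence~) where
      open Equivalence~ equiv

      private
        last-case : ∀ {j} {P : Fin (suc j) → Set} → P (fromℕ j) → (∀ i → P (inject₁ i)) → ∀ i → P i
        last-case {zero}  p q zero    = p
        last-case {suc j} p q zero    = q zero
        last-case {suc j} {P} p q (suc i) = last-case {P = P ∘ suc} p (q ∘ suc) i

      distinctFrom⁻ : ∀ {n} j (ι : Fin j → Fin n) ψ {ρ} → Sat (distinctFrom j ι ψ) ρ → (∀ i → ¬ ρ zero ≈ ρ (suc (ι i))) → Sat ψ ρ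
      distinctFrom⁻ zero    ι ψ h _   = h
      distinctFrom⁻ (suc j) ι ψ h new = distinctFrom⁻ j (ι ∘ inject₁) ψ (h (new (fromℕ j))) (new ∘ inject₁)

      distinctFrom⁺ : ∀ {n} j (ι : Fin j → Fin n) ψ {ρ} → ((∀ i → ¬ ρ zero ≈ ρ (suc (ι i))) → Sat ψ ρ) → Sat (distinctFrom j ι ψ) ρ
      distinctFrom⁺ zero    ι ψ h = h λ ()
      distinctFrom⁺ (suc j) ι ψ {ρ} h new = distinctFrom⁺ j (ι ∘ inject₁) ψ λ news → h (last-case {P = λ i → ¬ ρ zero ≈ ρ (suc (ι i))} new news)

      private
        front : ∀ k o → (Fin (suc k + o) → Carrier) → Fin (suc k) → Carrier
        front k o ρ i = ρ (i ↑ˡ o)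

      Listed : ∀ k o → (Fin (suc k + o) → Carrier) → Set
      Listed k o ρ = Distinct (front k o ρ) × (∀ i → front k o ρ (fromℕ k) ~ front k o ρ i)

      forFresh⁻ : ∀ k o ψ ρ → Sat (forFresh k o ψ) ρ → ∀ y → front k o ρ (fromℕ k) ~ y → (∀ i → ¬ y ≈ front k o ρ i) → Sat ψ (y F.∷ ρ)
      forFresh⁻ k o ψ ρ h y x~y new = distinctFrom⁻ (suc k) (_↑ˡ o) ψ (h y (~-sym x~y)) new

      forFresh⁺ : ∀ k o ψ ρ → (∀ y → front k o ρ (fromℕ k) ~ y → (∀ i → ¬ y ≈ front k o ρ i) → Sat ψ (y F.∷ ρ)) → Sat (forFresh k o ψ) ρ
      forFresh⁺ k o ψ ρ h y y~x = distinctFrom⁺ (suc k) (_↑ˡ o) ψ (h y (~-sym y~x))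

      private
        listed-cons : ∀ {k o} {ρ : Fin (suc k + o) → Carrier} {y} → Listed k o ρ → front k o ρ (fromℕ k) ~ y →
                      (∀ i → ¬ y ≈ front k o ρ i) → Listed (suc k) o (y F.∷ ρ)
        listed-cons {k} {o} {ρ} {y} (distinct , related) x~y new = (λ {i} {j} → distinct′ i j) , related′
          where
          shape : ∀ i → front (suc k) o (y F.∷ ρ) i ≡ (y F.∷ front k o ρ) i
          shape zero    = refl
          shape (suc i) = refl
          distinct′ : ∀ i j → front (suc k) o (y F.∷ ρ) i ≈ front (suc k) o (y F.∷ ρ) j → i ≡ j
          distinct′ i j eq = cons-distinct new distinct {i} {j} (subst₂ _≈_ (shape i) (shape j) eq)
          related′ : ∀ i → front k o ρ (fromℕ k) ~ front (suc k) o (y F.∷ ρ) i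
          related′ zero    = x~y
          related′ (suc i) = related i

        no-fresh : ∀ {k} {g : Fin (suc k) → Carrier} {x} → (∀ y → x ~ y → ¬ (∀ i → ¬ y ≈ g i)) → ¬ AtLeast x (suc (suc k))
        no-fresh {g = g} none (f , distinct , ~f) with i , new ← fresh f g distinct ≤-refl = none (f i) (~f i) new

      remaining⁻ : ∀ (r k o : ℕ) (ρ : Fin (suc k + o) → Carrier) → Listed k o ρ → Sat (remaining r k o) ρ → Exactly (front k o ρ (fromℕ k)) (suc k + r)
      remaining⁻ zero k o ρ (distinct , related) h = Eq.subst (Exactly _) (sym (+-identityʳ (suc k)))
        ((front k o ρ , distinct , related) , no-fresh λ y x~y new → forFresh⁻ k o ⊥̇ ρ h y x~y new)
      remaining⁻ (suc r) k o ρ listed h = Eq.subst (Exactly _) (sym (+-suc (suc k) r)) (stable em λ ¬e →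
        h (forFresh⁺ k o (¬̇ (remaining r (suc k) o)) ρ λ y x~y new h′ → ¬e (remaining⁻ r (suc k) o (y F.∷ ρ) (listed-cons {k} {o} {ρ} listed x~y new) h′)))

      remaining⁺ : ∀ (r k o : ℕ) (ρ : Fin (suc k + o) → Carrier) → Listed k o ρ → Exactly (front k o ρ (fromℕ k)) (suc k + r) → Sat (remaining r k o) ρ
      remaining⁺ zero k o ρ (distinct , related) (_ , ¬more) = forFresh⁺ k o ⊥̇ ρ λ y x~y new →
        ¬more (Eq.subst (AtLeast (front k o ρ (fromℕ k)) ∘ suc) (sym (+-identityʳ (suc k)))
          (y F.∷ front k o ρ , cons-distinct new distinct , λ { zero → x~y ; (suc i) → related i }))
      remaining⁺ (suc r) k o ρ listed e@((f , distinct , ~f) , _) h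
        with i , new ← fresh f (front k o ρ) distinct (≤-trans (s≤s (m≤m+n (suc k) r)) (≤-reflexive (sym (+-suc (suc k) r)))) =
        forFresh⁻ k o (¬̇ (remaining r (suc k) o)) ρ h (f i) (~f i) new
          (remaining⁺ r (suc k) o (f i F.∷ ρ) (listed-cons {k} {o} {ρ} listed (~f i) new) (Eq.subst (Exactly _) (+-suc (suc k) r) e))

      private
        listed-one : ∀ o (ρ : Fin (1 + o) → Carrier) → Listed 0 o ρ
        listed-one o ρ = (λ {i} {j} _ → only i j) , λ { zero → ~-refl }
          where
          only : (i j : Fin 1) → i ≡ j
          only zero zero = refl

      HasClass : ℕ → Set
      HasClass n = Σ[ x ∈ Carrier ] Exactly x (suc n)

      class⁻ : ∀ n {ρ} → Sat (class n) ρ → HasClass n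
      class⁻ n {ρ} h with x , h′ ← Sat-∃⁻ em (remaining n 0 0) {ρ} h = x , remaining⁻ n 0 0 (x F.∷ ρ) (listed-one 0 (x F.∷ ρ)) h′

      class⁺ : ∀ n {ρ} → HasClass n → Sat (class n) ρ
      class⁺ n {ρ} (x , e) = Sat-∃⁺ em (remaining n 0 0) {ρ} x (remaining⁺ n 0 0 (x F.∷ ρ) (listed-one 0 (x F.∷ ρ)) e)

      uniqueClass⁻ : ∀ n {ρ} → Sat (uniqueClass n) ρ → ∀ {x y} → Exactly x (suc n) → Exactly y (suc n) → x ~ y
      uniqueClass⁻ n {ρ} h {x} {y} e e′ = ~-sym (h x (remaining⁺ n 0 0 (x F.∷ ρ) (listed-one 0 (x F.∷ ρ)) e)
        y (remaining⁺ n 0 1 (y F.∷ x F.∷ ρ) (listed-one 1 (y F.∷ x F.∷ ρ)) e′))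

      uniqueClass⁺ : ∀ n {ρ} → (∀ {x y} → Exactly x (suc n) → Exactly y (suc n) → x ~ y) → Sat (uniqueClass n) ρ
      uniqueClass⁺ n {ρ} h x e y e′ = ~-sym (h (remaining⁻ n 0 0 (x F.∷ ρ) (listed-one 0 (x F.∷ ρ)) e)
        (remaining⁻ n 0 1 (y F.∷ x F.∷ ρ) (listed-one 1 (y F.∷ x F.∷ ρ)) e′))

open ClassSizes

-- Ehrenfeucht-Fraïssé games on equivalence relations

module Games where

  -- The depth serves only as a sufficient number of rounds, so an implication may add the two
  -- depths where a maximum would be usual.
  depth : ∀ {n} → Formula L-E n → ℕ
  depth (s ≐ t)    = 0
  depth (rel r ts) = 0
  depth ⊥̇          = 0
  depth (φ ⇒ ψ)    = depth φ + depth ψ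
  depth (∀̇ φ)      = suc (depth φ)

  module Game (em : ExcludedMiddle 0ℓ) (q : ℕ) where

    record Side : Set₁ where
      field
        structure : Structure L-E
      open Classes em structure public
      field
        equiv  : Equivalence~
        unique : ∀ {n x y} → Exactly x n → Exactly y n → x ~ y
        many   : Σ[ f ∈ (Fin q → Carrier) ] ((∀ {i j} → f i ~ f j → i ≡ j) × (∀ i → AtLeast (f i) q))
      open Equivalence~ equiv public

    open Side

    record Position (M N : Side) {p : ℕ} (a : Fin p → Carrier M) (b : Fin p → Carrier N) : Set where
      field
        same-≈    : ∀ i j → (_≈_ M (a i) (a j) → _≈_ N (b i) (b j)) × (_≈_ N (b i) (b j) → _≈_ M (a i) (a j))
        same-~    : ∀ i j → (_~_ M (a i) (a j) → _~_ N (b i) (b j)) × (_~_ N (b i) (b j) → _~_ M (a i) (a j))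
        same-size : ∀ i m → m ≤ q → (AtLeast M (a i) m → AtLeast N (b i) m) × (AtLeast N (b i) m → AtLeast M (a i) m)

    open Position

    flip : ∀ {M N p} {a : Fin p → Carrier M} {b : Fin p → Carrier N} → Position M N a b → Position N M b a
    flip P = record
      { same-≈    = λ i j → swap (same-≈ P i j)
      ; same-~    = λ i j → swap (same-~ P i j)
      ; same-size = λ i m m≤q → swap (same-size P i m m≤q) }

    extended : ∀ M N {p} {a : Fin p → Carrier M} {b : Fin p → Carrier N} {x y} → Position M N a b →
      (∀ j → (_≈_ M x (a j) → _≈_ N y (b j)) × (_≈_ N y (b j) → _≈_ M x (a j))) →
      (∀ j → (_~_ M x (a j) → _~_ N y (b j)) × (_~_ N y (b j) → _~_ M x (a j))) →
      (∀ m → m ≤ q → (AtLeast M x m → AtLeast N y m) × (AtLeast N y m → AtLeast M x m)) →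
      Position M N (x F.∷ a) (y F.∷ b)
    extended M N {a = a} {b} {x} {y} P s≈ s~ size = record { same-≈ = e ; same-~ = r ; same-size = s }
      where
      e : ∀ i j → _
      e zero    zero    = (λ _ → ≈-refl N) , (λ _ → ≈-refl M)
      e zero    (suc j) = s≈ j
      e (suc i) zero    = (λ h → ≈-sym N (proj₁ (s≈ i) (≈-sym M h))) , (λ h → ≈-sym M (proj₂ (s≈ i) (≈-sym N h)))
      e (suc i) (suc j) = same-≈ P i j
      r : ∀ i j → _
      r zero    zero    = (λ _ → ~-refl N) , (λ _ → ~-refl M)
      r zero    (suc j) = s~ j
      r (suc i) zero    = (λ h → ~-sym N (proj₁ (s~ i) (~-sym M h))) , (λ h → ~-sym M (proj₂ (s~ i) (~-sym N h)))
      r (suc i) (suc j) = same-~ P i j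
      s : ∀ i m → m ≤ q → _
      s zero    = size
      s (suc i) = same-size P i

    -- Several pebbles may lie on equal elements. Counting the distinct ones among those with
    -- property Q allows their number to be compared with the size of a class.
    representatives : ∀ (N : Side) {p} (Q : Fin p → Set) (b : Fin p → Carrier N) →
      Σ[ m ∈ ℕ ] Σ[ g ∈ (Fin m → Fin p) ] ((∀ s → Q (g s)) × (∀ {s t} → _≈_ N (b (g s)) (b (g t)) → s ≡ t) ×
        (∀ j → Q j → Σ[ s ∈ Fin m ] _≈_ N (b j) (b (g s))))
    representatives N {zero} Q b = 0 , (λ ()) , (λ ()) , (λ { {()} }) , λ ()
    representatives N {suc p} Q b with m , g , Qg , distinct , cover ← representatives N (Q ∘ suc) (b ∘ suc)
      with em {Q zero × (∀ s → ¬ _≈_ N (b zero) (b (suc (g s))))}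
    ... | yes (q₀ , new) = suc m , zero F.∷ suc ∘ g , (λ { zero → q₀ ; (suc s) → Qg s }) , (λ {s} {t} → dist s t) , cov
      where
      dist : ∀ s t → _≈_ N (b ((zero F.∷ suc ∘ g) s)) (b ((zero F.∷ suc ∘ g) t)) → s ≡ t
      dist zero    zero    h = refl
      dist zero    (suc t) h = contradiction h (new t)
      dist (suc s) zero    h = contradiction (≈-sym N h) (new s)
      dist (suc s) (suc t) h = cong suc (distinct h)
      cov : ∀ j → Q j → Σ[ s ∈ Fin (suc m) ] _≈_ N (b j) (b ((zero F.∷ suc ∘ g) s))
      cov zero    _  = zero , ≈-refl N
      cov (suc j) qj with s , e ← cover j qj = suc s , e
    ... | no old = m , suc ∘ g , Qg , distinct , cov
      where
      cov : ∀ j → Q j → Σ[ s ∈ Fin m ] _≈_ N (b j) (b (suc (g s)))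
      cov (suc j) qj = cover j qj
      cov zero    q₀ with em {Σ[ s ∈ Fin m ] _≈_ N (b zero) (b (suc (g s)))}
      ... | yes h = h
      ... | no ¬h = contradiction (q₀ , λ s e → ¬h (s , e)) old

    module _ (M N : Side) (classes : ∀ n → n < q → Σ[ x ∈ Carrier M ] Exactly M x n → Σ[ y ∈ Carrier N ] Exactly N y n) where

      answer : ∀ {p} {a : Fin p → Carrier M} {b : Fin p → Carrier N} → p < q → Position M N a b →
        ∀ x → Σ[ y ∈ Carrier N ] Position M N (x F.∷ a) (y F.∷ b)
      answer {p} {a} {b} p<q P x with em {Σ[ i ∈ Fin p ] _≈_ M x (a i)}
      ... | yes (i , x≈) = b i , extended M N P
            (λ j → (λ h → proj₁ (same-≈ P i j) (≈-trans M (≈-sym M x≈) h)) , (λ h → ≈-trans M x≈ (proj₂ (same-≈ P i j) h)))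
            (λ j → (λ h → proj₁ (same-~ P i j) (~-resp M x≈ (≈-refl M) h)) , (λ h → ~-resp M (≈-sym M x≈) (≈-refl M) (proj₂ (same-~ P i j) h)))
            (λ m m≤q → (λ h → proj₁ (same-size P i m m≤q) (atLeast-~ M (equiv M) (~-resp M (≈-refl M) x≈ (~-refl M)) h))
                     , (λ h → atLeast-~ M (equiv M) (~-resp M (≈-refl M) (≈-sym M x≈) (~-refl M)) (proj₂ (same-size P i m m≤q) h)))
      ... | no x≉ with em {Σ[ i ∈ Fin p ] _~_ M x (a i)}
      -- A new element of a class that already has pebbles. Besides x, the class of a i contains m
      -- distinct pebbled elements, and m + 1 ≤ q because m ≤ p < q. So the class of b i has at
      -- least m + 1 elements, and one of them is free of pebbles.
      ...   | yes (i , x~) with m , g , Qg , distinct , cover ← representatives N (λ j → _~_ N (b i) (b j)) b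
              with f , f-distinct , ~f ← proj₁ (same-size P i (suc m)
                     (≤-trans (s≤s (injective⇒≤ {f = g} (λ {s} {t} eq → distinct (Eq.subst (λ j → _≈_ N (b (g s)) (b j)) eq (≈-refl N))))) p<q))
                   (x F.∷ a ∘ g , cons-distinct M (λ s e → x≉ (g s , e)) (λ {s} {t} e → distinct (proj₁ (same-≈ P (g s) (g t)) e)) ,
                    λ { zero → ~-sym M x~ ; (suc s) → proj₂ (same-~ P i (g s)) (Qg s) })
              with k , new ← fresh N f (b ∘ g) f-distinct ≤-refl =
              f k , extended M N P
                (λ j → (λ h → contradiction (j , h) x≉) , (λ h → let s , e = cover j (~-resp N (≈-refl N) h (~f k)) in
                         contradiction (≈-trans N h e) (new s)))
                (λ j → (λ h → ~-trans N (~-sym N (~f k)) (proj₁ (same-~ P i j) (~-trans M (~-sym M x~) h)))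
                     , (λ h → ~-trans M x~ (proj₂ (same-~ P i j) (~-trans N (~f k) h))))
                (λ m m≤q → (λ h → atLeast-~ N (equiv N) (~f k) (proj₁ (same-size P i m m≤q) (atLeast-~ M (equiv M) x~ h)))
                         , (λ h → atLeast-~ M (equiv M) (~-sym M x~) (proj₂ (same-size P i m m≤q) (atLeast-~ N (equiv N) (~-sym N (~f k)) h))))
      ...   | no x≁ = let y , y≁ , size = newClass in y , extended M N P
                (λ j → (λ h → contradiction (j , h) x≉) , (λ h → contradiction (~-resp N (≈-refl N) h (~-refl N)) (y≁ j)))
                (λ j → (λ h → contradiction (j , h) x≁) , (λ h → contradiction h (y≁ j))) size
        where
        newClass : Σ[ y ∈ Carrier N ] ((∀ j → ¬ _~_ N y (b j)) ×
                     (∀ m → m ≤ q → (AtLeast M x m → AtLeast N y m) × (AtLeast N y m → AtLeast M x m)))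
        newClass with em {AtLeast M x q}
        -- A new class of size n below q: the other side has a class of this size. If it held a
        -- pebble b j, the class of a j would have size n as well, and by uniqueness it would be the
        -- class of x.
        ... | no ¬big with n , n<q , e ← size-below M x q ¬big with y , e′ ← classes n n<q (x , e) =
              y , (λ j y~ → x≁ (j , unique M e (back j (exactly-~ N (equiv N) y~ e′)))) ,
              λ m _ → (λ h → atLeast-≤ N (exactly-≤ M e h) (proj₁ e′)) , (λ h → atLeast-≤ M (exactly-≤ N e′ h) (proj₁ e))
          where
          back : ∀ j → Exactly N (b j) n → Exactly M (a j) n
          back j (h , ¬h) = proj₂ (same-size P j n (<⇒≤ n<q)) h , ¬h ∘ proj₁ (same-size P j (suc n) n<q)
        -- A new large class: the p pebbles cannot occupy all of the q inequivalent large classes on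
        -- the other side.
        ... | yes big = f (proj₁ free) , (λ j h → proj₂ free (j , h)) ,
              λ m m≤q → (λ _ → atLeast-≤ N m≤q (large (proj₁ free))) , (λ _ → atLeast-≤ M m≤q big)
          where
          f = proj₁ (many N)
          apart = proj₁ (proj₂ (many N))
          large = proj₂ (proj₂ (many N))
          Taken : Fin q → Set
          Taken s = Σ[ j ∈ Fin p ] _~_ N (f s) (b j)
          free : Σ[ s ∈ Fin q ] ¬ Taken s
          free with em {Σ[ s ∈ Fin q ] ¬ Taken s}
          ... | yes h = h
          ... | no ¬h = let s , t , s<t , eq = pigeonhole p<q (λ s → proj₁ (taken s)) in
                contradiction (apart (~-trans N (proj₂ (taken s)) (~-sym N (Eq.subst (λ j → _~_ N (f t) (b j)) (sym eq) (proj₂ (taken t)))))) (<ᶠ⇒≢ s<t)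
            where
            taken : ∀ s → Taken s
            taken s with em {Taken s}
            ... | yes h = h
            ... | no ¬t = contradiction (s , ¬t) ¬h

    module _ (M N : Side)
             (to   : ∀ n → n < q → Σ[ x ∈ Carrier M ] Exactly M x n → Σ[ y ∈ Carrier N ] Exactly N y n)
             (from : ∀ n → n < q → Σ[ y ∈ Carrier N ] Exactly N y n → Σ[ x ∈ Carrier M ] Exactly M x n) where

      indistinguishable : ∀ {p} (φ : Formula L-E p) {a b} → p + depth φ ≤ q → Position M N a b →
        (Sat M φ a → Sat N φ b) × (Sat N φ b → Sat M φ a)
      indistinguishable (var i ≐ var j) _ P = same-≈ P i j
      indistinguishable (rel {k = 2} (0 , tt) (var i ∷ var j ∷ [])) _ P = same-~ P i j
      indistinguishable ⊥̇ _ P = id , id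
      indistinguishable {p} (φ ⇒ ψ) p≤ P =
          (λ h s → proj₁ Iψ (h (proj₂ Iφ s))) , (λ h s → proj₂ Iψ (h (proj₁ Iφ s)))
        where
        Iφ = indistinguishable φ (≤-trans (+-monoʳ-≤ p (m≤m+n (depth φ) (depth ψ))) p≤) P
        Iψ = indistinguishable ψ (≤-trans (+-monoʳ-≤ p (m≤n+m (depth ψ) (depth φ))) p≤) P
      indistinguishable {p} (∀̇ φ) p≤ P =
          (λ h y → let x , P′ = answer N M from p<q (flip P) y in proj₁ (indistinguishable φ p≤′ (flip P′)) (h x))
        , (λ h x → let y , P′ = answer M N to p<q P x in proj₂ (indistinguishable φ p≤′ P′) (h y))
        where
        p≤′ : suc p + depth φ ≤ q
        p≤′ = ≤-trans (≤-reflexive (sym (+-suc p (depth φ)))) p≤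
        p<q : p < q
        p<q = ≤-trans (s≤s (m≤m+n p (depth φ))) p≤′

open Games

-- The interpretation in R

module InterpretationInR where

  relational : (C : Set) (_≈_ : C → C → Set) → C → (∀ {x} → x ≈ x) → (∀ {x y} → x ≈ y → y ≈ x) → (∀ {x y z} → x ≈ y → y ≈ z → x ≈ z) →
    (R : C → C → Set) → (∀ {x y x′ y′} → x ≈ x′ → y ≈ y′ → R x y → R x′ y′) → Structure L-E
  relational C _≈_ c r s t R resp = record
    { Carrier = C ; _≈_ = _≈_ ; point = c ; function = λ { (_ , ()) } ; relation = rel-of
    ; ≈-refl = r ; ≈-sym = s ; ≈-trans = t ; function-cong = λ { (_ , ()) } ; relation-cong = rel-of-cong }
    where
    open Language L-E
    rel-of : ∀ {k} → RelSym k → Vec C k → Set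
    rel-of {2} (0 , _) (x ∷ y ∷ []) = R x y
    rel-of-cong : ∀ {k} (q : RelSym k) {xs ys} → (∀ i → lookup xs i ≈ lookup ys i) → rel-of q xs → rel-of q ys
    rel-of-cong {2} (0 , _) {_ ∷ _ ∷ []} {_ ∷ _ ∷ []} eq h = resp (eq zero) (eq (suc zero)) h

  module _ (em : ExcludedMiddle 0ℓ) where

    -- The finite classes are those of the elements with a key n; such a class exists
    -- for the n in X and has the n + 1 elements elem n i.
    record Keyed (M : Structure L-E) (X : ℕ → Set) : Set₁ where
      open Classes em M
      field
        equiv         : Equivalence~
        Key           : Carrier → ℕ → Set
        elem          : ∀ n → Fin (suc n) → Carrier
        elem-key      : ∀ {n} → X n → ∀ i → Key (elem n i) n
        elem-distinct : ∀ {n} → X n → Distinct (elem n)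
        key-X         : ∀ {x n} → Key x n → X n
        key-elem      : ∀ {x n} → Key x n → Σ[ i ∈ Fin (suc n) ] x ≈ elem n i
        key-~         : ∀ {x y n} → Key x n → x ~ y → Key y n
        ~-key         : ∀ {x y n} → Key x n → Key y n → x ~ y
        keyless       : ∀ {x} → (∀ n → ¬ Key x n) → ∀ m → AtLeast x m

      key-exactly : ∀ {x n} → Key x n → Exactly x (suc n)
      key-exactly {x} {n} k = (elem n , elem-distinct (key-X k) , λ i → ~-key k (elem-key (key-X k) i)) ,
        λ (f , distinct , ~f) → let i , new = fresh f (elem n) distinct ≤-refl
                                    j , eq = key-elem (key-~ k (~f i)) in new j eq

      exactly-key : ∀ {x n} → Exactly x (suc n) → Key x n
      exactly-key {x} {n} e@(_ , ¬more) with em {Σ[ m ∈ ℕ ] Key x m}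
      ... | yes (m , k) = Eq.subst (Key x) (suc-injective (exactly-unique (key-exactly k) e)) k
      ... | no ¬k = contradiction (keyless (λ m k → ¬k (m , k)) (suc (suc n))) ¬more

      open Semantics equiv

      keyed-class⁻ : ∀ n {ρ} → Sat (class n) ρ → X n
      keyed-class⁻ n {ρ} h = key-X (exactly-key (proj₂ (class⁻ n {ρ} h)))

      keyed-class⁺ : ∀ n {ρ} → X n → Sat (class n) ρ
      keyed-class⁺ n {ρ} x = class⁺ n {ρ} (elem n zero , key-exactly (elem-key x zero))

      keyed-unique : ∀ n {ρ} → Sat (uniqueClass n) ρ
      keyed-unique n {ρ} = uniqueClass⁺ n {ρ} λ e e′ → ~-key (exactly-key e) (exactly-key e′)

    module _ (X : ℕ → Set) where

      private
        KeyOf : ℕ × ℕ → ℕ → Set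
        KeyOf (n , i) m = m ≡ n × X n × i ≤ n

        -- Elements without a key have the same keys vacuously, so they form the one infinite class
        -- without a separate clause.
        _∼_ : ℕ × ℕ → ℕ × ℕ → Set
        x ∼ y = ∀ m → (KeyOf x m → KeyOf y m) × (KeyOf y m → KeyOf x m)

      canonical : Structure L-E
      canonical = relational (ℕ × ℕ) _≡_ (0 , 0) refl sym trans _∼_ λ { refl refl → id }

      canonical-keyed : Keyed canonical X
      canonical-keyed = record
        { equiv         = record { ~-refl  = λ m → id , id
                                 ; ~-sym   = λ h m → proj₂ (h m) , proj₁ (h m)
                                 ; ~-trans = λ h h′ m → proj₁ (h′ m) ∘ proj₁ (h m) , proj₂ (h m) ∘ proj₂ (h′ m) }
        ; Key           = KeyOf
        ; elem          = λ n i → n , toℕ i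
        ; elem-key      = λ x i → refl , x , s≤s⁻¹ (toℕ<n i)
        ; elem-distinct = λ _ eq → toℕ-injective (cong proj₂ eq)
        ; key-X         = λ { (refl , x , _) → x }
        ; key-elem      = λ { {n , i} (refl , _ , i≤n) → fromℕ< (s≤s i≤n) , cong (n ,_) (sym (toℕ-fromℕ< (s≤s i≤n))) }
        ; key-~         = λ k h → proj₁ (h _) k
        ; ~-key         = λ { (refl , p) (refl , q) m → (λ { (refl , _) → refl , q }) , (λ { (refl , _) → refl , p }) }
        ; keyless       = λ none m → (λ i → 0 , suc (toℕ i)) , (λ eq → toℕ-injective (suc-injective (cong proj₂ eq))) ,
                            λ i m → (λ k → contradiction k (none m)) , λ { (refl , _ , ()) } }

  -- A pairing that is itself a term of the language of R, with no halving. It is injective because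
  -- (n + i)² and the next square differ by more than n.
  cell : ℕ → ℕ → ℕ
  cell n i = (n + i) * (n + i) + n

  cell-injective : ∀ n i n′ i′ → cell n i ≡ cell n′ i′ → n ≡ n′ × i ≡ i′
  cell-injective n i n′ i′ eq = n≡n′ , +-cancelˡ-≡ n i i′ (trans same-sum (cong (_+ i′) (sym n≡n′)))
    where
    sum-≤ : ∀ n i n′ i′ → cell n i ≡ cell n′ i′ → n + i ≤ n′ + i′
    sum-≤ n i n′ i′ eq with n + i ≤? n′ + i′
    ... | yes p = p
    ... | no ¬p = contradiction eq (>⇒≢ (begin-strict
      (n′ + i′) * (n′ + i′) + n′              ≤⟨ +-monoʳ-≤ ((n′ + i′) * (n′ + i′)) (m≤m+n n′ i′) ⟩
      (n′ + i′) * (n′ + i′) + (n′ + i′)       ≡⟨ +-comm ((n′ + i′) * (n′ + i′)) (n′ + i′) ⟩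
      suc (n′ + i′) * (n′ + i′)               <⟨ *-monoʳ-< (suc (n′ + i′)) (n<1+n (n′ + i′)) ⟩
      suc (n′ + i′) * suc (n′ + i′)           ≤⟨ *-mono-≤ (≰⇒> ¬p) (≰⇒> ¬p) ⟩
      (n + i) * (n + i)                       ≤⟨ m≤m+n _ n ⟩
      (n + i) * (n + i) + n                   ∎))
      where open ≤-Reasoning
    same-sum : n + i ≡ n′ + i′
    same-sum = ≤-antisym (sum-≤ n i n′ i′ eq) (sum-≤ n′ i′ n i (sym eq))
    n≡n′ : n ≡ n′
    n≡n′ = +-cancelˡ-≡ ((n + i) * (n + i)) n n′ (trans eq (cong (λ s → s * s + n′) (sym same-sum)))

  n≤cell : ∀ n i → n ≤ cell n i
  n≤cell n i = m≤n+m n ((n + i) * (n + i))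

  i≤cell : ∀ n i → i ≤ cell n i
  i≤cell n i = ≤-trans (≤-trans (m≤n+m i n) (square (n + i))) (m≤m+n ((n + i) * (n + i)) n)
    where
    square : ∀ m → m ≤ m * m
    square zero    = z≤n
    square (suc m) = m≤m*n (suc m) (suc m)

  cellTerm : ∀ {n} → Fin n → Fin n → Term L-R n
  cellTerm n i = (var n +̇ var i) ·̇ (var n +̇ var i) +̇ var n

  -- x (variable 0) is cell n i (variables 1 and 2) with i ≤ n, in no other way below x
  uniquePart : Formula L-R 3
  uniquePart = ∀̇ (∀̇ (var (# 1) ≤̇ var (# 2) ⇒ var (# 0) ≤̇ var (# 2) ⇒ var (# 2) ≐ cellTerm (# 1) (# 0) ⇒
    (var (# 1) ≐ var (# 3) ∧̇ var (# 0) ≐ var (# 4))))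

  isCell : Formula L-R 3
  isCell = var (# 0) ≐ cellTerm (# 1) (# 2) ∧̇ var (# 1) ≤̇ var (# 0) ∧̇ var (# 2) ≤̇ var (# 0) ∧̇ var (# 2) ≤̇ var (# 1) ∧̇ uniquePart

  module _ (a b : Code 1) where

    -- The guard against nonstandard keys. It demands that every i ≤ n gives a cell whose n and i
    -- can be recovered from it. All numerals lie below a nonstandard n, so a key n of this kind has
    -- infinitely many distinct cells and causes no finite class.
    allCells : Formula L-R 1
    allCells = ∀̇ (∀̇ (var (# 1) ≤̇ var (# 2) ⇒ var (# 0) ≐ cellTerm (# 2) (# 1) ⇒ rename (# 0 F.∷ # 2 F.∷ # 1 F.∷ F.[]) isCell))

    isKey : Formula L-R 1
    isKey = precedes a b ∧̇ allCells

    hasKey : Formula L-R 2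
    hasKey = rename (λ _ → # 1) isKey ∧̇ ∃̇ (rename (# 1 F.∷ # 2 F.∷ # 0 F.∷ F.[]) isCell)

    keyOf₁ keyOf₂ sameKeys : Formula L-R _
    keyOf₁   = rename {n = 3} (# 1 F.∷ # 0 F.∷ F.[]) hasKey
    keyOf₂   = rename {n = 3} (# 2 F.∷ # 0 F.∷ F.[]) hasKey
    sameKeys = ∀̇ ((keyOf₁ ⇒ keyOf₂) ∧̇ (keyOf₂ ⇒ keyOf₁))

  module KeysInR (em : ExcludedMiddle 0ℓ) (a b : Code 1) (M : Structure L-R) (models : Structure.Models M AxiomR) where
    open ModelOfR em M models
    open Rosser em M models

    cellᴹ : Carrier → Carrier → Carrier
    cellᴹ n i = plus (times (plus n i) (plus n i)) n

    cell-standard : ∀ n i → cellᴹ (ν n) (ν i) ≈ ν (cell n i)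
    cell-standard n i = ≈-trans (plus-cong (≈-trans (times-cong (ν-plus n i) (ν-plus n i)) (ν-times (n + i) (n + i))) ≈-refl)
                                (ν-plus ((n + i) * (n + i)) n)

    cell-cong : ∀ {n i n′ i′} → n ≈ n′ → i ≈ i′ → cellᴹ n i ≈ cellᴹ n′ i′
    cell-cong p q = plus-cong (times-cong (plus-cong p q) (plus-cong p q)) p

    Unique IsCell : Carrier → Carrier → Carrier → Set
    Unique x n i = ∀ n′ i′ → n′ ≤ᴹ x → i′ ≤ᴹ x → x ≈ cellᴹ n′ i′ → n′ ≈ n × i′ ≈ i
    IsCell x n i = x ≈ cellᴹ n i × n ≤ᴹ x × i ≤ᴹ x × i ≤ᴹ n × Unique x n i

    IsKey : Carrier → Set
    IsKey n = Precedes a b n × (∀ i x → i ≤ᴹ n → x ≈ cellᴹ n i → IsCell x n i)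

    HasKey : Carrier → Carrier → Set
    HasKey x n = IsKey n × Σ[ i ∈ Carrier ] IsCell x n i

    SameKeys : Carrier → Carrier → Set
    SameKeys x y = ∀ n → (HasKey x n → HasKey y n) × (HasKey y n → HasKey x n)

    private
      conj⁻ : ∀ {n} (φ ψ : Formula L-R n) ρ → Sat (φ ∧̇ ψ) ρ → Sat φ ρ × Sat ψ ρ
      conj⁻ φ ψ ρ = Sat-∧⁻ em φ ψ {ρ}

      unique-sat : ∀ ρ → (Sat uniquePart ρ → Unique (ρ (# 0)) (ρ (# 1)) (ρ (# 2))) × (Unique (ρ (# 0)) (ρ (# 1)) (ρ (# 2)) → Sat uniquePart ρ)
      unique-sat ρ = (λ h n′ i′ p q e → conj⁻ (var (# 1) ≐ var (# 3)) (var (# 0) ≐ var (# 4)) (i′ F.∷ n′ F.∷ ρ) (h n′ i′ p q e))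
                   , (λ h n′ i′ p q e k → k (proj₁ (h n′ i′ p q e)) (proj₂ (h n′ i′ p q e)))

      φ₀ φ₁ φ₂ φ₃ : Formula L-R 3
      φ₀ = var (# 0) ≐ cellTerm (# 1) (# 2)
      φ₁ = var (# 1) ≤̇ var (# 0)
      φ₂ = var (# 2) ≤̇ var (# 0)
      φ₃ = var (# 2) ≤̇ var (# 1)

      cell-sat : ∀ ρ → (Sat isCell ρ → IsCell (ρ (# 0)) (ρ (# 1)) (ρ (# 2))) × (IsCell (ρ (# 0)) (ρ (# 1)) (ρ (# 2)) → Sat isCell ρ)
      cell-sat ρ = (λ h → let h₀ , t₀ = conj⁻ φ₀ (φ₁ ∧̇ φ₂ ∧̇ φ₃ ∧̇ uniquePart) ρ h
                              h₁ , t₁ = conj⁻ φ₁ (φ₂ ∧̇ φ₃ ∧̇ uniquePart) ρ t₀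
                              h₂ , t₂ = conj⁻ φ₂ (φ₃ ∧̇ uniquePart) ρ t₁
                              h₃ , t₃ = conj⁻ φ₃ uniquePart ρ t₂
                          in h₀ , h₁ , h₂ , h₃ , proj₁ (unique-sat ρ) t₃)
                 , (λ (h₀ , h₁ , h₂ , h₃ , u) k → k h₀ λ k → k h₁ λ k → k h₂ λ k → k h₃ (proj₂ (unique-sat ρ) u))

      three : ∀ {n} (ρ : Fin n → Carrier) i j k →
        (Sat (rename (i F.∷ j F.∷ k F.∷ F.[]) isCell) ρ → IsCell (ρ i) (ρ j) (ρ k)) × (IsCell (ρ i) (ρ j) (ρ k) → Sat (rename (i F.∷ j F.∷ k F.∷ F.[]) isCell) ρ)
      three {n} ρ i j k = proj₁ (cell-sat (ρ ∘ π)) ∘ proj₁ (Sat-rename π ρ isCell) , proj₂ (Sat-rename π ρ isCell) ∘ proj₂ (cell-sat (ρ ∘ π))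
        where
        π : Fin 3 → Fin n
        π = i F.∷ j F.∷ k F.∷ F.[]

      allCells-sat : ∀ ρ → (Sat (allCells a b) ρ → ∀ i x → i ≤ᴹ ρ zero → x ≈ cellᴹ (ρ zero) i → IsCell x (ρ zero) i)
                         × ((∀ i x → i ≤ᴹ ρ zero → x ≈ cellᴹ (ρ zero) i → IsCell x (ρ zero) i) → Sat (allCells a b) ρ)
      allCells-sat ρ = (λ h i x p e → proj₁ (three (x F.∷ i F.∷ ρ) (# 0) (# 2) (# 1)) (h i x p e))
                     , (λ h i x p e → proj₂ (three (x F.∷ i F.∷ ρ) (# 0) (# 2) (# 1)) (h i x p e))

      isKey-sat : ∀ ρ → (Sat (isKey a b) ρ → IsKey (ρ zero)) × (IsKey (ρ zero) → Sat (isKey a b) ρ)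
      isKey-sat ρ = (λ h → let p , q = conj⁻ (precedes a b) (allCells a b) ρ h in proj₁ (precedes-sat a b ρ) p , proj₁ (allCells-sat ρ) q)
                  , (λ (p , q) k → k (proj₂ (precedes-sat a b ρ) p) (proj₂ (allCells-sat ρ) q))

      cellFor : Formula L-R 3
      cellFor = rename (# 1 F.∷ # 2 F.∷ # 0 F.∷ F.[]) isCell

    hasKey-sat : ∀ ρ → (Sat (hasKey a b) ρ → HasKey (ρ (# 0)) (ρ (# 1))) × (HasKey (ρ (# 0)) (ρ (# 1)) → Sat (hasKey a b) ρ)
    hasKey-sat ρ = (λ h → let p , q = conj⁻ (rename (λ _ → # 1) (isKey a b)) (∃̇ cellFor) ρ h
                              i , q′ = Sat-∃⁻ em cellFor {ρ} q
                          in proj₁ (isKey-sat _) (proj₁ (Sat-rename (λ _ → # 1) ρ (isKey a b)) p) ,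
                             i , proj₁ (three (i F.∷ ρ) (# 1) (# 2) (# 0)) q′)
                 , (λ (p , i , q) k → k (proj₂ (Sat-rename (λ _ → # 1) ρ (isKey a b)) (proj₂ (isKey-sat _) p))
                     (Sat-∃⁺ em cellFor {ρ} i (proj₂ (three (i F.∷ ρ) (# 1) (# 2) (# 0)) q)))

    sameKeys-sat : ∀ ρ → (Sat (sameKeys a b) ρ → SameKeys (ρ (# 0)) (ρ (# 1))) × (SameKeys (ρ (# 0)) (ρ (# 1)) → Sat (sameKeys a b) ρ)
    sameKeys-sat ρ =
        (λ h n → let p , q = conj⁻ (keyOf₁ a b ⇒ keyOf₂ a b) (keyOf₂ a b ⇒ keyOf₁ a b) (n F.∷ ρ) (h n)
                 in (λ k → out₂ n (p (in₁ n k))) , (λ k → out₁ n (q (in₂ n k))))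
      , (λ h n k → k (λ s → in₂ n (proj₁ (h n) (out₁ n s))) (λ s → in₁ n (proj₂ (h n) (out₂ n s))))
      where
      in₁ : ∀ n → HasKey (ρ (# 0)) n → Sat (keyOf₁ a b) (n F.∷ ρ)
      in₁ n k = proj₂ (Sat-rename _ (n F.∷ ρ) (hasKey a b)) (proj₂ (hasKey-sat _) k)
      out₁ : ∀ n → Sat (keyOf₁ a b) (n F.∷ ρ) → HasKey (ρ (# 0)) n
      out₁ n s = proj₁ (hasKey-sat _) (proj₁ (Sat-rename _ (n F.∷ ρ) (hasKey a b)) s)
      in₂ : ∀ n → HasKey (ρ (# 1)) n → Sat (keyOf₂ a b) (n F.∷ ρ)
      in₂ n k = proj₂ (Sat-rename _ (n F.∷ ρ) (hasKey a b)) (proj₂ (hasKey-sat _) k)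
      out₂ : ∀ n → Sat (keyOf₂ a b) (n F.∷ ρ) → HasKey (ρ (# 1)) n
      out₂ n s = proj₁ (hasKey-sat _) (proj₁ (Sat-rename _ (n F.∷ ρ) (hasKey a b)) s)

    hasKey-resp : ∀ {x n x′ n′} → x ≈ x′ → n ≈ n′ → HasKey x n → HasKey x′ n′
    hasKey-resp {x} {n} {x′} {n′} p q h = proj₁ (hasKey-sat (x′ F.∷ n′ F.∷ F.[])) (Sat-cong env (hasKey a b) (proj₂ (hasKey-sat (x F.∷ n F.∷ F.[])) h))
      where
      env : ∀ i → (x F.∷ n F.∷ F.[]) i ≈ (x′ F.∷ n′ F.∷ F.[]) i
      env zero       = p
      env (suc zero) = q

    sameKeys-resp : ∀ {x y x′ y′} → x ≈ x′ → y ≈ y′ → SameKeys x y → SameKeys x′ y′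
    sameKeys-resp p q h n = (λ k → hasKey-resp q ≈-refl (proj₁ (h n) (hasKey-resp (≈-sym p) ≈-refl k)))
                          , (λ k → hasKey-resp p ≈-refl (proj₂ (h n) (hasKey-resp (≈-sym q) ≈-refl k)))

    hasKey-functional : ∀ {x n n′} → HasKey x n → HasKey x n′ → n′ ≈ n
    hasKey-functional (_ , _ , _ , _ , _ , _ , unique) (_ , i′ , eq , n′≤ , i′≤ , _) = proj₁ (unique _ i′ n′≤ i′≤ eq)

    interpreted : Structure L-E
    interpreted = relational Carrier _≈_ point ≈-refl ≈-sym ≈-trans SameKeys sameKeys-resp

    -- This is the purpose of bounding n and i by x in `isCell`: below a standard x both are
    -- standard, and the equation turns into one between natural numbers.
    cell-standard⁻ : ∀ {x n i} y → x ≈ ν y → n ≤ᴹ x → i ≤ᴹ x → x ≈ cellᴹ n i → Σ[ n′ ∈ ℕ ] Σ[ i′ ∈ ℕ ] (n ≈ ν n′ × i ≈ ν i′ × y ≡ cell n′ i′)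
    cell-standard⁻ {x} {n} {i} y x≈ n≤ i≤ eq
      with n′ , _ , n≈ ← ≤-standard y n (≤ᴹ-resp ≈-refl x≈ n≤) with i′ , _ , i≈ ← ≤-standard y i (≤ᴹ-resp ≈-refl x≈ i≤) =
      n′ , i′ , n≈ , i≈ , ν-injective y (cell n′ i′) (≈-trans (≈-sym x≈) (≈-trans eq (≈-trans (cell-cong n≈ i≈) (cell-standard n′ i′))))

    isCell-standard : ∀ {n i x} → i ≤ n → x ≈ ν (cell n i) → IsCell x (ν n) (ν i)
    isCell-standard {n} {i} {x} i≤n x≈ = ≈-trans x≈ (≈-sym (cell-standard n i)) ,
      ≤ᴹ-resp ≈-refl (≈-sym x≈) (ν-≤ (n≤cell n i)) , ≤ᴹ-resp ≈-refl (≈-sym x≈) (ν-≤ (i≤cell n i)) , ν-≤ i≤n ,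
      λ n′ i′ n′≤ i′≤ eq → let n″ , i″ , n≈ , i≈ , eq″ = cell-standard⁻ (cell n i) x≈ n′≤ i′≤ eq
                               n≡ , i≡ = cell-injective n i n″ i″ eq″
                           in ≈-trans n≈ (≈-reflexive (cong ν (sym n≡))) , ≈-trans i≈ (≈-reflexive (cong ν (sym i≡)))

    isKey-standard : ∀ n → Precedes a b (ν n) → IsKey (ν n)
    isKey-standard n p = p , λ i x i≤n eq → let i′ , i′≤n , i≈ = ≤-standard n i i≤n in
      isCell-resp (≈-sym i≈) (isCell-standard i′≤n (≈-trans eq (≈-trans (cell-cong ≈-refl i≈) (cell-standard n i′))))
      where
      isCell-resp : ∀ {x m i i′} → i ≈ i′ → IsCell x m i → IsCell x m i′
      isCell-resp e (h₀ , h₁ , h₂ , h₃ , u) = ≈-trans h₀ (cell-cong ≈-refl e) , h₁ , ≤ᴹ-resp e ≈-refl h₂ , ≤ᴹ-resp e ≈-refl h₃ ,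
        λ n′ i′ p q r → let e₁ , e₂ = u n′ i′ p q r in e₁ , ≈-trans e₂ e

    private
      -- These cells violate the condition i ≤ n. They supply infinitely many standard elements for
      -- the class of elements without a key.
      no-key : ∀ i n → ¬ HasKey (ν (cell 0 (suc i))) n
      no-key i n (_ , j , eq , n≤ , j≤ , j≤n , _) =
        let n′ , j′ , n≈ , j≈ , eq′ = cell-standard⁻ (cell 0 (suc i)) ≈-refl n≤ j≤ eq
            n≡ , j≡ = cell-injective 0 (suc i) n′ j′ eq′
        in contradiction (ν-≤⁻ {suc i} {0} (≤ᴹ-resp (≈-trans j≈ (≈-reflexive (cong ν (sym j≡)))) (≈-trans n≈ (≈-reflexive (cong ν (sym n≡)))) j≤n)) λ ()

      same-key : ∀ {x y n} → HasKey x n → HasKey y n → SameKeys x y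
      same-key hx hy m = (λ k → hasKey-resp ≈-refl (≈-sym (hasKey-functional hx k)) hy) , (λ k → hasKey-resp ≈-refl (≈-sym (hasKey-functional hy k)) hx)

    open Classes em interpreted using (AtLeast)

    interpreted-keyed : Keyed em interpreted (λ n → Precedes a b (ν n))
    interpreted-keyed = record
      { equiv         = record { ~-refl  = λ n → id , id
                               ; ~-sym   = λ h n → proj₂ (h n) , proj₁ (h n)
                               ; ~-trans = λ h h′ n → proj₁ (h′ n) ∘ proj₁ (h n) , proj₂ (h n) ∘ proj₂ (h′ n) }
      ; Key           = λ x n → HasKey x (ν n)
      ; elem          = λ n i → ν (cell n (toℕ i))
      ; elem-key      = λ {n} p i → isKey-standard n p , ν (toℕ i) , isCell-standard (s≤s⁻¹ (toℕ<n i)) ≈-refl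
      ; elem-distinct = λ {n} _ {i} {j} eq → toℕ-injective (proj₂ (cell-injective n (toℕ i) n (toℕ j) (ν-injective _ _ eq)))
      ; key-X         = λ k → proj₁ (proj₁ k)
      ; key-elem      = λ {x} {n} (_ , i , eq , _ , _ , i≤n , _) → let i′ , i′≤n , i≈ = ≤-standard n i i≤n in
          fromℕ< (s≤s i′≤n) , ≈-trans eq (≈-trans (cell-cong ≈-refl i≈) (≈-trans (cell-standard n i′)
            (≈-reflexive (cong (ν ∘ cell n) (sym (toℕ-fromℕ< (s≤s i′≤n)))))))
      ; key-~         = λ k h → proj₁ (h _) k
      ; ~-key         = same-key
      ; keyless       = many }
      where
      many : ∀ {x} → (∀ n → ¬ HasKey x (ν n)) → ∀ m → AtLeast x m
      many {x} none m with em {Σ[ n ∈ Carrier ] HasKey x n}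
      ... | no ¬k = (λ i → ν (cell 0 (suc (toℕ i)))) ,
            (λ {i} {j} eq → toℕ-injective (suc-injective (proj₂ (cell-injective 0 (suc (toℕ i)) 0 (suc (toℕ j)) (ν-injective _ _ eq))))) ,
            λ i n → (λ k → contradiction (n , k) ¬k) , (λ k → contradiction k (no-key (toℕ i) n))
      -- Here x has a key n that is no numeral. All numerals are below n, as otherwise R4 would make
      -- n a numeral, so the guard provides a cell for every standard i, and these are distinct
      -- members of the class of x.
      ... | yes (n , k@((p , cells) , _)) = (λ i → cellᴹ n (ν (toℕ i))) , (λ {i} {j} → distinct i j) , λ i → same-key k ((p , cells) , ν (toℕ i) , at i)
        where
        above : ∀ i → ν i ≤ᴹ n
        above i with ≤-total-standard i n
        ... | inj₂ h = h
        ... | inj₁ h with j , _ , n≈ ← ≤-standard i n h = contradiction (hasKey-resp ≈-refl n≈ k) (none j)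
        at : ∀ (i : Fin m) → IsCell (cellᴹ n (ν (toℕ i))) n (ν (toℕ i))
        at i = cells (ν (toℕ i)) _ (above (toℕ i)) ≈-refl
        distinct : ∀ i j → cellᴹ n (ν (toℕ i)) ≈ cellᴹ n (ν (toℕ j)) → i ≡ j
        distinct i j eq = let _ , _ , _ , _ , u = at i
                              _ , n≤ , j≤ , _ = at j
                          in toℕ-injective (ν-injective _ _ (≈-sym (proj₂ (u n (ν (toℕ j)) (≤ᴹ-resp ≈-refl (≈-sym eq) n≤) (≤ᴹ-resp ≈-refl (≈-sym eq) j≤) eq))))

  module _ (a b : Code 1) where

    interpretation : Translation L-E L-R
    interpretation = record { dom = ⊤̇ ; eq = var (# 0) ≐ var (# 1) ; relᴵ = rel-of ; funᴵ = λ { (_ , ()) } }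
      where
      open Language L-E
      rel-of : ∀ {k} → RelSym k → Formula L-R k
      rel-of {2} (0 , _) = sameKeys a b

    open Translation interpretation hiding (_≈_)

    module _ (em : ExcludedMiddle 0ℓ) (M : Structure L-R) (models : Structure.Models M AxiomR) where
      open ModelOfR em M models
      open KeysInR em a b M models

      private
        module I = Structure interpreted

        atom-sat : ∀ {n} (α : Formula L-R 2) (x y : Fin n) ρ →
          (Sat (translateAtom α (var x ∷ var y ∷ [])) ρ → Sat α (ρ x F.∷ ρ y F.∷ F.[])) ×
          (Sat α (ρ x F.∷ ρ y F.∷ F.[]) → Sat (translateAtom α (var x ∷ var y ∷ [])) ρ)
        atom-sat {n} α x y ρ = to , from
          where
          α′ vals body : Formula L-R (2 + n)
          α′   = rename (_↑ˡ n) α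
          vals = values (var x ∷ var y ∷ []) (2 ↑ʳ_) (_↑ˡ n)
          body = vals ∧̇ α′
          second : Formula L-R (2 + n)
          second = value (var y) (2 ↑ʳ_) (# 1)
          env : Carrier → Carrier → Fin (2 + n) → Carrier
          env u v = v F.∷ u F.∷ ρ
          pick : ∀ {u v} → ρ x ≈ v → ρ y ≈ u → ∀ i → env u v (i ↑ˡ n) ≈ (ρ x F.∷ ρ y F.∷ F.[]) i
          pick p q zero       = ≈-sym p
          pick p q (suc zero) = ≈-sym q
          to : Sat (∃δ (∃δ body)) ρ → Sat α (ρ x F.∷ ρ y F.∷ F.[])
          to h = let u , h₁ = Sat-∃⁻ em (δ zero ∧̇ ∃δ body) {ρ} h
                     _ , h₂ = Sat-∧⁻ em (δ zero) (∃δ body) {u F.∷ ρ} h₁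
                     v , h₃ = Sat-∃⁻ em (δ zero ∧̇ body) {u F.∷ ρ} h₂
                     _ , h₄ = Sat-∧⁻ em (δ zero) body {env u v} h₃
                     h₅ , h₆ = Sat-∧⁻ em vals α′ {env u v} h₄
                     p , h₇ = Sat-∧⁻ em (value (var x) (2 ↑ʳ_) (# 0)) (second ∧̇ ⊤̇) {env u v} h₅
                     q , _ = Sat-∧⁻ em second ⊤̇ {env u v} h₇
                 in Sat-cong (pick p q) α (proj₁ (Sat-rename (_↑ˡ n) (env u v) α) h₆)
          from : Sat α (ρ x F.∷ ρ y F.∷ F.[]) → Sat (∃δ (∃δ body)) ρ
          from h k = k (ρ y) λ k → k id λ k → k (ρ x) λ k → k id λ k →
            k (λ k → k ≈-refl λ k → k ≈-refl id)
              (proj₂ (Sat-rename (_↑ˡ n) (env (ρ y) (ρ x)) α) (Sat-cong (≈-sym ∘ pick ≈-refl ≈-refl) α h))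

      translate-sat : ∀ {n} (φ : Formula L-E n) ρ → (Sat (translate φ) ρ → I.Sat φ ρ) × (I.Sat φ ρ → Sat (translate φ) ρ)
      translate-sat (var x ≐ var y) ρ = atom-sat (var (# 0) ≐ var (# 1)) x y ρ
      translate-sat (rel {k = 2} (0 , _) (var x ∷ var y ∷ [])) ρ =
          proj₁ (sameKeys-sat _) ∘ proj₁ (atom-sat (sameKeys a b) x y ρ) , proj₂ (atom-sat (sameKeys a b) x y ρ) ∘ proj₂ (sameKeys-sat _)
      translate-sat ⊥̇ ρ = id , id
      translate-sat (φ ⇒ ψ) ρ = (λ h s → proj₁ (translate-sat ψ ρ) (h (proj₂ (translate-sat φ ρ) s)))
                              , (λ h s → proj₂ (translate-sat ψ ρ) (h (proj₁ (translate-sat φ ρ) s)))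
      translate-sat (∀̇ φ) ρ = (λ h x → proj₁ (translate-sat φ (x F.∷ ρ)) (h x id))
                            , (λ h x _ → proj₂ (translate-sat φ (x F.∷ ρ)) (h x))

    interpretable : (em : ExcludedMiddle 0ℓ) (X : Pred (Sentence L-E) 0ℓ) →
      (∀ M (models : Structure.Models M AxiomR) φ → X φ → ∀ ρ → Structure.Sat (KeysInR.interpreted em a b M models) φ ρ) →
      record { lang = L-E ; sentences = X } InterpretableIn R
    interpretable em X valid = interpretation , record
      { dom-nonempty = complete _ λ M mod ρ h → h (Structure.point M) id
      ; eq-refl      = complete _ λ M mod ρ x _ → Structure.≈-refl M
      ; eq-sym       = complete _ λ M mod ρ x _ y _ → Structure.≈-sym M
      ; eq-trans     = complete _ λ M mod ρ x _ y _ z _ → Structure.≈-trans M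
      ; rel-cong     = rel-congruence
      ; fun-cong     = λ { (_ , ()) }
      ; fun-total    = λ { (_ , ()) }
      ; fun-unique   = λ { (_ , ()) }
      ; sound        = λ φ φ∈X → complete (translate φ) λ M mod ρ → proj₂ (translate-sat em M mod φ ρ) (valid M mod φ φ∈X ρ) }
      where
      complete = Henkin.completeness em AxiomR
      congruent : ∀ M → Structure.Models M AxiomR → ∀ ρ → Structure.Sat M (congruence (sameKeys a b)) ρ
      -- `∀δ-closure` quantifies the variable with the largest index first. The ignored arguments
      -- state membership in the trivial domain.
      congruent M mod ρ x₃ _ x₂ _ x₁ _ x₀ _ eqs h =
        let p , eqs′ = Sat-∧⁻ em (var (# 0) ≐ var (# 2)) (var (# 1) ≐ var (# 3) ∧̇ ⊤̇) {env} eqs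
            q , _ = Sat-∧⁻ em (var (# 1) ≐ var (# 3)) ⊤̇ {env} eqs′
        in proj₂ (Sat-rename (2 ↑ʳ_) env (sameKeys a b)) (Sat-cong (λ { zero → p ; (suc zero) → q }) (sameKeys a b)
             (proj₁ (Sat-rename (_↑ˡ 2) env (sameKeys a b)) h))
        where
        open Structure M
        env : Fin 4 → Carrier
        env = x₀ F.∷ x₁ F.∷ x₂ F.∷ x₃ F.∷ ρ
      rel-congruence : ∀ {k} (r : Language.RelSym L-E k) → Theorems AxiomR (congruence (Translation.relᴵ interpretation r))
      rel-congruence {2} (0 , _) = complete _ congruent

open InterpretationInR

-- Recognizing formulas and computing codes of class sentences

module FormulaCodes where

  -- fact 0: n ≤ i; fact 1: not the code of a term; fact 2: not the code of a formula of L-E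
  nonFormulaRules : List Rule
  nonFormulaRules =
      (fact 0 (lit 0) v₀ (lit 0) (lit 0) ⟸ [])
    ∷ (fact 0 (1+ v₀) (1+ v₁) (lit 0) (lit 0) ⟸ fact 0 v₀ v₁ (lit 0) (lit 0) ∷ [])
    ∷ (fact 1 v₀ (1+ v₁ ⊡ v₂) (lit 0) (lit 0) ⟸ [])
    ∷ (fact 1 v₀ (lit 0 ⊡ v₁) (lit 0) (lit 0) ⟸ fact 0 v₀ v₁ (lit 0) (lit 0) ∷ [])
    ∷ (fact 2 v₀ (1+ (1+ (1+ (1+ (1+ v₁)))) ⊡ v₂) (lit 0) (lit 0) ⟸ [])
    ∷ (fact 2 v₀ (lit 0 ⊡ v₁ ⊡ v₂) (lit 0) (lit 0) ⟸ fact 1 v₀ v₁ (lit 0) (lit 0) ∷ [])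
    ∷ (fact 2 v₀ (lit 0 ⊡ v₁ ⊡ v₂) (lit 0) (lit 0) ⟸ fact 1 v₀ v₂ (lit 0) (lit 0) ∷ [])
    ∷ (fact 2 v₀ (lit 1 ⊡ lit 0 ⊡ v₁) (lit 0) (lit 0) ⟸ [])
    ∷ (fact 2 v₀ (lit 1 ⊡ lit 1 ⊡ v₁) (lit 0) (lit 0) ⟸ [])
    ∷ (fact 2 v₀ (lit 1 ⊡ 1+ (1+ (1+ v₁)) ⊡ v₂) (lit 0) (lit 0) ⟸ [])
    ∷ (fact 2 v₀ (lit 1 ⊡ lit 2 ⊡ 1+ v₁ ⊡ v₂) (lit 0) (lit 0) ⟸ [])
    ∷ (fact 2 v₀ (lit 1 ⊡ lit 2 ⊡ lit 0 ⊡ v₁ ⊡ v₂) (lit 0) (lit 0) ⟸ fact 1 v₀ v₁ (lit 0) (lit 0) ∷ [])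
    ∷ (fact 2 v₀ (lit 1 ⊡ lit 2 ⊡ lit 0 ⊡ v₁ ⊡ v₂ ⊡ v₃) (lit 0) (lit 0) ⟸ fact 1 v₀ v₂ (lit 0) (lit 0) ∷ [])
    ∷ (fact 2 v₀ (lit 1 ⊡ lit 2 ⊡ lit 0 ⊡ v₁ ⊡ v₂ ⊡ 1+ v₃) (lit 0) (lit 0) ⟸ [])
    ∷ (fact 2 v₀ (lit 2 ⊡ 1+ v₁) (lit 0) (lit 0) ⟸ [])
    ∷ (fact 2 v₀ (lit 3 ⊡ v₁ ⊡ v₂) (lit 0) (lit 0) ⟸ fact 2 v₀ v₁ (lit 0) (lit 0) ∷ [])
    ∷ (fact 2 v₀ (lit 3 ⊡ v₁ ⊡ v₂) (lit 0) (lit 0) ⟸ fact 2 v₀ v₂ (lit 0) (lit 0) ∷ [])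
    ∷ (fact 2 v₀ (lit 4 ⊡ v₁) (lit 0) (lit 0) ⟸ fact 2 (1+ v₀) v₁ (lit 0) (lit 0) ∷ [])
    ∷ []

  module Refuse = Horn nonFormulaRules

  private
    Term≢ : ℕ → ℕ → Set
    Term≢ n z = (t : Term L-E n) → termCode t ≢ z

    Formula≢ : ℕ → ℕ → Set
    Formula≢ n z = (φ : Formula L-E n) → formulaCode φ ≢ z

    Means : ℕ → Vec ℕ 4 → Set
    Means 0 (n ∷ i ∷ _) = n ≤ i
    Means 1 (n ∷ z ∷ _) = Term≢ n z
    Means _ (n ∷ z ∷ _) = Formula≢ n z

    term-tag : ∀ {n t z} → Term≢ n (suc t ∙ z)
    term-tag (var x) eq = contradiction (∙-injˡ eq) λ ()

    term-range : ∀ {n i} → n ≤ i → Term≢ n (0 ∙ i)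
    term-range n≤i (var x) eq with refl ← ∙-injʳ eq = contradiction (toℕ<n x) (≤⇒≯ n≤i)

    tagged : ∀ {n t z} → ((φ : Formula L-E n) → formulaTag φ ≡ t → formulaRest φ ≢ z) → Formula≢ n (t ∙ z)
    tagged h φ eq = h φ (∙-injˡ eq) (∙-injʳ eq)

    rel-case : ∀ {n z} → ((s t : Term L-E n) → 2 ∙ 0 ∙ termCode s ∙ termCode t ∙ 0 ≢ z) →
               (φ : Formula L-E n) → formulaTag φ ≡ 1 → formulaRest φ ≢ z
    rel-case h (rel {k = 2} (0 , _) (s ∷ t ∷ [])) refl eq = h s t eq

    ≐-case : ∀ {n z} → ((s t : Term L-E n) → termCode s ∙ termCode t ≢ z) →
             (φ : Formula L-E n) → formulaTag φ ≡ 0 → formulaRest φ ≢ z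
    ≐-case h (s ≐ t) refl eq = h s t eq

    ⊥-case : ∀ {n z} → (φ : Formula L-E n) → formulaTag φ ≡ 2 → formulaRest φ ≢ suc z
    ⊥-case ⊥̇ refl ()

    ⇒-case : ∀ {n a b} → Formula≢ n a ⊎ Formula≢ n b → (φ : Formula L-E n) → formulaTag φ ≡ 3 → formulaRest φ ≢ a ∙ b
    ⇒-case (inj₁ h) (φ ⇒ ψ) refl eq = h φ (∙-injˡ eq)
    ⇒-case (inj₂ h) (φ ⇒ ψ) refl eq = h ψ (∙-injʳ eq)

    ∀-case : ∀ {n a} → Formula≢ (suc n) a → (φ : Formula L-E n) → formulaTag φ ≡ 4 → formulaRest φ ≢ a
    ∀-case h (∀̇ φ) refl eq = h φ eq

    tag-case : ∀ {n t z} (φ : Formula L-E n) → formulaTag φ ≡ 5 + t → formulaRest φ ≢ z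
    tag-case (_ ≐ _) ()
    tag-case (rel _ _) ()
    tag-case ⊥̇ ()
    tag-case (_ ⇒ _) ()
    tag-case (∀̇ _) ()

  nonFormula-sound : ∀ {n z} → Refuse.Derivable no-param 2 (n ∷ z ∷ 0 ∷ 0 ∷ []) → (φ : Formula L-E n) → formulaCode φ ≢ z
  nonFormula-sound = Refuse.derivable-sound Means (λ ())
    ( (λ ρ → λ { [] → z≤n })
    ∷ (λ ρ → λ { (p ∷ []) → s≤s p })
    ∷ (λ ρ → λ { [] → term-tag })
    ∷ (λ ρ → λ { (p ∷ []) → term-range p })
    ∷ (λ ρ → λ { [] → tagged tag-case })
    ∷ (λ ρ → λ { (h ∷ []) → tagged (≐-case λ s t eq → h s (∙-injˡ eq)) })
    ∷ (λ ρ → λ { (h ∷ []) → tagged (≐-case λ s t eq → h t (∙-injʳ eq)) })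
    ∷ (λ ρ → λ { [] → tagged (rel-case λ s t eq → contradiction (∙-injˡ eq) λ ()) })
    ∷ (λ ρ → λ { [] → tagged (rel-case λ s t eq → contradiction (∙-injˡ eq) λ ()) })
    ∷ (λ ρ → λ { [] → tagged (rel-case λ s t eq → contradiction (∙-injˡ eq) λ ()) })
    ∷ (λ ρ → λ { [] → tagged (rel-case λ s t eq → contradiction (∙-injˡ (∙-injʳ eq)) λ ()) })
    ∷ (λ ρ → λ { (h ∷ []) → tagged (rel-case λ s t eq → h s (∙-injˡ (∙-injʳ (∙-injʳ eq)))) })
    ∷ (λ ρ → λ { (h ∷ []) → tagged (rel-case λ s t eq → h t (∙-injˡ (∙-injʳ (∙-injʳ (∙-injʳ eq))))) })
    ∷ (λ ρ → λ { [] → tagged (rel-case λ s t eq → contradiction (∙-injʳ (∙-injʳ (∙-injʳ (∙-injʳ eq)))) λ ()) })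
    ∷ (λ ρ → λ { [] → tagged ⊥-case })
    ∷ (λ ρ → λ { (h ∷ []) → tagged (⇒-case (inj₁ h)) })
    ∷ (λ ρ → λ { (h ∷ []) → tagged (⇒-case (inj₂ h)) })
    ∷ (λ ρ → λ { (h ∷ []) → tagged (∀-case h) })
    ∷ [])

  private
    Refused : ℕ → ℕ → ℕ → Set
    Refused t n z = Refuse.Derivable no-param t (n ∷ z ∷ 0 ∷ 0 ∷ [])

    ≤-refused : ∀ {n i} → n ≤ i → Refused 0 n i
    ≤-refused {i = i} z≤n = Refuse.rule (# 0) (valuation (i ∷ [])) []
    ≤-refused {suc n} {suc i} (s≤s p) = Refuse.rule (# 1) (valuation (n ∷ i ∷ [])) (≤-refused p ∷ [])

    term-or-refused : ∀ n z → (Σ[ t ∈ Term L-E n ] termCode t ≡ z) ⊎ Refused 1 n z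
    term-or-refused n z with unpair z
    ... | suc t , y , refl = inj₂ (Refuse.rule (# 2) (valuation (n ∷ t ∷ y ∷ [])) [])
    ... | zero , i , refl with i <? n
    ...   | yes i<n = inj₁ (var (fromℕ< i<n) , cong (0 ∙_) (toℕ-fromℕ< i<n))
    ...   | no i≮n  = inj₂ (Refuse.rule (# 3) (valuation (n ∷ i ∷ [])) (≤-refused (≮⇒≥ i≮n) ∷ []))

    -- The induction is on the bound `f` of the code. The tags 3 and 4 are positive, so the codes of
    -- subformulas are strictly smaller.
    formula-or-refused : ∀ f n z → z < f → (Σ[ φ ∈ Formula L-E n ] formulaCode φ ≡ z) ⊎ Refused 2 n z
    formula-or-refused (suc f) n z (s≤s z≤f) with unpair z
    ... | suc (suc (suc (suc (suc t)))) , y , refl = inj₂ (Refuse.rule (# 4) (valuation (n ∷ t ∷ y ∷ [])) [])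
    ... | 0 , y , refl with u , v , refl ← unpair y with term-or-refused n u | term-or-refused n v
    ...   | inj₂ r | _ = inj₂ (Refuse.rule (# 5) (valuation (n ∷ u ∷ v ∷ [])) (r ∷ []))
    ...   | inj₁ _ | inj₂ r = inj₂ (Refuse.rule (# 6) (valuation (n ∷ u ∷ v ∷ [])) (r ∷ []))
    ...   | inj₁ (s , refl) | inj₁ (t , refl) = inj₁ (s ≐ t , refl)
    formula-or-refused (suc f) n z (s≤s z≤f) | 1 , y , refl with unpair y
    ...   | 0 , x , refl = inj₂ (Refuse.rule (# 7) (valuation (n ∷ x ∷ [])) [])
    ...   | 1 , x , refl = inj₂ (Refuse.rule (# 8) (valuation (n ∷ x ∷ [])) [])
    ...   | suc (suc (suc k)) , x , refl = inj₂ (Refuse.rule (# 9) (valuation (n ∷ k ∷ x ∷ [])) [])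
    ...   | 2 , x , refl with unpair x
    ...     | suc i , ts , refl = inj₂ (Refuse.rule (# 10) (valuation (n ∷ i ∷ ts ∷ [])) [])
    ...     | 0 , ts , refl with u , us , refl ← unpair ts with term-or-refused n u
    ...       | inj₂ r = inj₂ (Refuse.rule (# 11) (valuation (n ∷ u ∷ us ∷ [])) (r ∷ []))
    ...       | inj₁ (s , refl) with v , w , refl ← unpair us with term-or-refused n v
    ...         | inj₂ r = inj₂ (Refuse.rule (# 12) (valuation (n ∷ termCode s ∷ v ∷ w ∷ [])) (r ∷ []))
    ...         | inj₁ (t , refl) with w
    ...           | suc w = inj₂ (Refuse.rule (# 13) (valuation (n ∷ termCode s ∷ termCode t ∷ w ∷ [])) [])
    ...           | 0 = inj₁ (s ~̇ t , refl)
    formula-or-refused (suc f) n z (s≤s z≤f) | 2 , 0 , refl = inj₁ (⊥̇ , refl)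
    formula-or-refused (suc f) n z (s≤s z≤f) | 2 , suc y , refl = inj₂ (Refuse.rule (# 14) (valuation (n ∷ y ∷ [])) [])
    formula-or-refused (suc f) n z (s≤s z≤f) | 3 , y , refl with a , b , refl ← unpair y
      with formula-or-refused f n a (≤-trans (s≤s (m≤m∙n a b)) (≤-trans (n<1+m∙n 2 (a ∙ b)) z≤f))
         | formula-or-refused f n b (≤-trans (s≤s (n≤m∙n a b)) (≤-trans (n<1+m∙n 2 (a ∙ b)) z≤f))
    ...   | inj₂ r | _ = inj₂ (Refuse.rule (# 15) (valuation (n ∷ a ∷ b ∷ [])) (r ∷ []))
    ...   | inj₁ _ | inj₂ r = inj₂ (Refuse.rule (# 16) (valuation (n ∷ a ∷ b ∷ [])) (r ∷ []))
    ...   | inj₁ (φ , refl) | inj₁ (ψ , refl) = inj₁ ((φ ⇒ ψ) , refl)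
    formula-or-refused (suc f) n z (s≤s z≤f) | 4 , a , refl with formula-or-refused f (suc n) a (≤-trans (n<1+m∙n 3 a) z≤f)
    ...   | inj₂ r = inj₂ (Refuse.rule (# 17) (valuation (n ∷ a ∷ [])) (r ∷ []))
    ...   | inj₁ (φ , refl) = inj₁ (∀̇ φ , refl)

  -- A number that codes no sentence is not the code of a theorem either. Deciding theoremhood by a
  -- search needs a certificate for this case too.
  formula-or-nonFormula : ∀ n z → (Σ[ φ ∈ Formula L-E n ] formulaCode φ ≡ z) ⊎ Refuse.Derivable no-param 2 (n ∷ z ∷ 0 ∷ 0 ∷ [])
  formula-or-nonFormula n z = formula-or-refused (suc z) n z ≤-refl

  negation : ℕ → ℕ
  negation x = 3 ∙ x ∙ 2 ∙ 0

  negationFn : ∀ {O n} → Fn O n → Fn O n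
  negationFn f = constant 3 ⊙ f ⊙ constant 2 ⊙ constant 0

  -- The parameters give the code of a quantification and of the atoms `var zero ≐ var i` and
  -- `var zero ~̇ var i`; no other atoms occur in the class sentences. The same recursion thus
  -- computes the codes of these sentences and the codes of their translations.
  module Codes (all eq rel : ℕ → ℕ) where

    distinctCode : ℕ → ℕ → ℕ
    distinctCode ψ zero    = ψ
    distinctCode ψ (suc j) = 3 ∙ negation (eq (suc j)) ∙ distinctCode ψ j

    freshCode : ℕ → ℕ → ℕ
    freshCode k ψ = all (3 ∙ rel (suc k) ∙ distinctCode ψ (suc k))

    -- In `remaining r k o` the number k grows while r decreases, whereas primitive recursion keeps
    -- its parameters fixed. So the constant sum k + r is passed as n, and k is recovered by
    -- subtraction.
    remainingCode : ℕ → ℕ → ℕ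
    remainingCode n zero    = freshCode n (2 ∙ 0)
    remainingCode n (suc r) = negation (freshCode (n ∸ suc r) (negation (remainingCode n r)))

    classCode uniqueCode : ℕ → ℕ
    classCode n  = negation (all (negation (remainingCode n n)))
    uniqueCode n = all (3 ∙ remainingCode n n ∙ all (3 ∙ remainingCode n n ∙ rel 1))

    module _ (F : ∀ {n} → Formula L-E n → ℕ)
             (F-⊥ : ∀ {n} → F {n} ⊥̇ ≡ 2 ∙ 0)
             (F-⇒ : ∀ {n} (φ ψ : Formula L-E n) → F (φ ⇒ ψ) ≡ 3 ∙ F φ ∙ F ψ)
             (F-∀ : ∀ {n} (φ : Formula L-E (suc n)) → F (∀̇ φ) ≡ all (F φ))
             (F-≐ : ∀ {n} (i : Fin (suc n)) → F (var zero ≐ var i) ≡ eq (toℕ i))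
             (F-~ : ∀ {n} (i : Fin (suc n)) → F (var zero ~̇ var i) ≡ rel (toℕ i)) where

      private
        F-¬ : ∀ {n} (φ : Formula L-E n) → F (¬̇ φ) ≡ negation (F φ)
        F-¬ φ = trans (F-⇒ φ ⊥̇) (cong (λ x → 3 ∙ F φ ∙ x) F-⊥)

        F-distinct : ∀ {n} j (ι : Fin j → Fin n) ψ → (∀ i → toℕ (ι i) ≡ toℕ i) → F (distinctFrom j ι ψ) ≡ distinctCode (F ψ) j
        F-distinct zero    ι ψ eqι = refl
        F-distinct (suc j) ι ψ eqι = trans (F-⇒ _ _) (cong₂ (λ x y → 3 ∙ x ∙ y)
          (trans (F-¬ _) (cong negation (trans (F-≐ (suc (ι (fromℕ j)))) (cong (eq ∘ suc) (trans (eqι (fromℕ j)) (toℕ-fromℕ j))))))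
          (F-distinct j (ι ∘ inject₁) ψ (λ i → trans (eqι (inject₁ i)) (toℕ-inject₁ i))))

        F-fresh : ∀ k o ψ → F (forFresh k o ψ) ≡ freshCode k (F ψ)
        F-fresh k o ψ = trans (F-∀ _) (cong all (trans (F-⇒ _ _) (cong₂ (λ x y → 3 ∙ x ∙ y)
          (trans (F-~ (suc (fromℕ k ↑ˡ o))) (cong (rel ∘ suc) (trans (toℕ-↑ˡ (fromℕ k) o) (toℕ-fromℕ k))))
          (F-distinct (suc k) (_↑ˡ o) ψ (λ i → toℕ-↑ˡ i o)))))

        F-remaining : ∀ r k o → F (remaining r k o) ≡ remainingCode (k + r) r
        F-remaining zero    k o = trans (F-fresh k o ⊥̇) (cong₂ freshCode (sym (+-identityʳ k)) F-⊥)
        F-remaining (suc r) k o = trans (F-¬ _) (cong negation (trans (F-fresh k o _) (cong₂ freshCode (sym (m+n∸n≡m k (suc r)))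
          (trans (F-¬ _) (cong negation (trans (F-remaining r (suc k) o) (cong (λ n → remainingCode n r) (sym (+-suc k r)))))))))

      F-class : ∀ n → F (class n) ≡ classCode n
      F-class n = trans (F-¬ _) (cong negation (trans (F-∀ _) (cong all (trans (F-¬ _) (cong negation (F-remaining n 0 0))))))

      F-unique : ∀ n → F (uniqueClass n) ≡ uniqueCode n
      F-unique n = trans (F-∀ _) (cong all (trans (F-⇒ _ _) (cong₂ (λ x y → 3 ∙ x ∙ y) (F-remaining n 0 0)
        (trans (F-∀ _) (cong all (trans (F-⇒ _ _) (cong₂ (λ x y → 3 ∙ x ∙ y) (F-remaining n 0 1) (F-~ (suc zero)))))))))

    module _ {O : Pred ℕ 0ℓ} (allFn : ∀ {n} → (f : Fn O n) → Σ[ g ∈ Fn O n ] (∀ xs → ⟪ g ⟫ xs ≡ all (⟪ f ⟫ xs)))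
             (eqFn : ∀ {n} → (f : Fn O n) → Σ[ g ∈ Fn O n ] (∀ xs → ⟪ g ⟫ xs ≡ eq (⟪ f ⟫ xs)))
             (relFn : ∀ {n} → (f : Fn O n) → Σ[ g ∈ Fn O n ] (∀ xs → ⟪ g ⟫ xs ≡ rel (⟪ f ⟫ xs))) where

      private
        distinctFn : Fn O 2
        distinctFn = computing (λ { (j ∷ ψ ∷ []) → distinctCode ψ j })
          (rec (arg (# 0)) (constant 3 ⊙ negationFn (proj₁ (eqFn (constant 1 ⊕ arg (# 0)))) ⊙ arg (# 1))) go
          where
          go : ∀ xs → _
          go (zero  ∷ ψ ∷ []) = refl
          go (suc j ∷ ψ ∷ []) = cong₂ (λ x y → 3 ∙ negation x ∙ y) (proj₂ (eqFn (constant 1 ⊕ arg (# 0))) _) (go (j ∷ ψ ∷ []))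

        freshFn : Fn O 2
        freshFn = computing (λ { (k ∷ ψ ∷ []) → freshCode k ψ }) (proj₁ (allFn body)) go
          where
          body : Fn O 2
          body = constant 3 ⊙ proj₁ (relFn (constant 1 ⊕ arg (# 0))) ⊙ (distinctFn ⊚ ((constant 1 ⊕ arg (# 0)) ∷ arg (# 1) ∷ []))
          go : ∀ xs → _
          go (k ∷ ψ ∷ []) = trans (proj₂ (allFn body) _) (cong (λ x → all (3 ∙ x ∙ distinctCode ψ (suc k))) (proj₂ (relFn (constant 1 ⊕ arg (# 0))) _))

        remainingFn : Fn O 2
        remainingFn = computing (λ { (r ∷ n ∷ []) → remainingCode n r })
          (rec (freshFn ⊚ (arg (# 0) ∷ (constant 2 ⊙ constant 0) ∷ []))
               (negationFn (freshFn ⊚ ((arg (# 2) ⊖ (constant 1 ⊕ arg (# 0))) ∷ negationFn (arg (# 1)) ∷ [])))) go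
          where
          go : ∀ xs → _
          go (zero  ∷ n ∷ []) = refl
          go (suc r ∷ n ∷ []) = cong (λ x → negation (freshCode (n ∸ suc r) (negation x))) (go (r ∷ n ∷ []))

      classFn : ∀ {n} → Fn O n → Fn O n
      classFn f = computing (classCode ∘ V.head) (negationFn (proj₁ (allFn body))) go ⊚ (f ∷ [])
        where
        body : Fn O 1
        body = negationFn (remainingFn ⊚ (arg (# 0) ∷ arg (# 0) ∷ []))
        go : ∀ xs → _
        go (n ∷ []) = cong negation (proj₂ (allFn body) (n ∷ []))

      uniqueFn : ∀ {n} → Fn O n → Fn O n
      uniqueFn f = computing (uniqueCode ∘ V.head) (proj₁ (allFn outer)) go ⊚ (f ∷ [])
        where
        body inner outer : Fn O 1
        body  = remainingFn ⊚ (arg (# 0) ∷ arg (# 0) ∷ [])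
        inner = constant 3 ⊙ body ⊙ proj₁ (relFn (constant 1))
        outer = constant 3 ⊙ body ⊙ proj₁ (allFn inner)
        go : ∀ xs → _
        go (n ∷ []) = trans (proj₂ (allFn outer) (n ∷ [])) (cong (λ x → all (3 ∙ remainingCode n n ∙ x))
          (trans (proj₂ (allFn inner) (n ∷ [])) (cong (λ x → all (3 ∙ remainingCode n n ∙ x)) (proj₂ (relFn (constant 1)) (n ∷ [])))))

open FormulaCodes

-- Computing codes of translated class sentences

module TranslationCodes where

  module _ {L : Language} where

    mutual
      -- The code of a renamed term depends only on the numbers of the new variables, collected in
      -- `e`. For a fixed formula it is therefore a computable function of these numbers, as `rawFn`
      -- shows.
      rawTerm : ∀ {m} → Term L m → (Fin m → ℕ) → ℕ
      rawTerm (var x)                  e = 0 ∙ e x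
      rawTerm (fun {k = k} (i , _) ts) e = 1 ∙ k ∙ i ∙ rawTerms ts e

      rawTerms : ∀ {m k} → Vec (Term L m) k → (Fin m → ℕ) → ℕ
      rawTerms []       e = 0
      rawTerms (t ∷ ts) e = rawTerm t e ∙ rawTerms ts e

    rawFormula : ∀ {m} → Formula L m → (Fin m → ℕ) → ℕ
    rawFormula (s ≐ t)                  e = 0 ∙ rawTerm s e ∙ rawTerm t e
    rawFormula (rel {k = k} (i , _) ts) e = 1 ∙ k ∙ i ∙ rawTerms ts e
    rawFormula ⊥̇                        e = 2 ∙ 0
    rawFormula (φ ⇒ ψ)                  e = 3 ∙ rawFormula φ e ∙ rawFormula ψ e
    rawFormula (∀̇ φ)                    e = 4 ∙ rawFormula φ (0 F.∷ suc ∘ e)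

    private
      mutual
        rawTerm≡ : ∀ {m n} (ρ : Fin m → Fin n) {e} → (∀ i → toℕ (ρ i) ≡ e i) → ∀ t → termCode (renameᵗ {L} ρ t) ≡ rawTerm t e
        rawTerm≡ ρ eq (var x)    = cong (0 ∙_) (eq x)
        rawTerm≡ ρ eq (fun {k = k} (i , _) ts) = cong (λ x → 1 ∙ k ∙ i ∙ x) (rawTerms≡ ρ eq ts)

        rawTerms≡ : ∀ {m n k} (ρ : Fin m → Fin n) {e} → (∀ i → toℕ (ρ i) ≡ e i) → (ts : Vec (Term L m) k) → termsCode (renameᵗˢ ρ ts) ≡ rawTerms ts e
        rawTerms≡ ρ eq []       = refl
        rawTerms≡ ρ eq (t ∷ ts) = cong₂ _∙_ (rawTerm≡ ρ eq t) (rawTerms≡ ρ eq ts)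

    rawFormula≡ : ∀ {m n} (ρ : Fin m → Fin n) {e} → (∀ i → toℕ (ρ i) ≡ e i) → ∀ φ → formulaCode (rename {L} ρ φ) ≡ rawFormula φ e
    rawFormula≡ ρ eq (s ≐ t) = cong (0 ∙_) (cong₂ _∙_ (rawTerm≡ ρ eq s) (rawTerm≡ ρ eq t))
    rawFormula≡ ρ eq (rel {k = k} (i , _) ts) = cong (λ x → 1 ∙ k ∙ i ∙ x) (rawTerms≡ ρ eq ts)
    rawFormula≡ ρ eq ⊥̇ = refl
    rawFormula≡ ρ eq (φ ⇒ ψ) = cong (3 ∙_) (cong₂ _∙_ (rawFormula≡ ρ eq φ) (rawFormula≡ ρ eq ψ))
    rawFormula≡ ρ {e} eq (∀̇ φ) = cong (4 ∙_) (rawFormula≡ (zero F.∷ suc ∘ ρ) (λ { zero → refl ; (suc i) → cong suc (eq i) }) φ)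

    private
      mutual
        term-cong : ∀ {m} (t : Term L m) {e e′ : Fin m → ℕ} → (∀ i → e i ≡ e′ i) → rawTerm t e ≡ rawTerm t e′
        term-cong (var x) eq = cong (0 ∙_) (eq x)
        term-cong (fun {k = k} (i , _) ts) eq = cong (λ x → 1 ∙ k ∙ i ∙ x) (terms-cong ts eq)

        terms-cong : ∀ {m k} (ts : Vec (Term L m) k) {e e′ : Fin m → ℕ} → (∀ i → e i ≡ e′ i) → rawTerms ts e ≡ rawTerms ts e′
        terms-cong []       eq = refl
        terms-cong (t ∷ ts) eq = cong₂ _∙_ (term-cong t eq) (terms-cong ts eq)

    rawFormula-cong : ∀ {m} (φ : Formula L m) {e e′ : Fin m → ℕ} → (∀ i → e i ≡ e′ i) → rawFormula φ e ≡ rawFormula φ e′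
    rawFormula-cong (s ≐ t) eq = cong (0 ∙_) (cong₂ _∙_ (term-cong s eq) (term-cong t eq))
    rawFormula-cong (rel {k = k} (i , _) ts) eq = cong (λ x → 1 ∙ k ∙ i ∙ x) (terms-cong ts eq)
    rawFormula-cong ⊥̇ eq = refl
    rawFormula-cong (φ ⇒ ψ) eq = cong (3 ∙_) (cong₂ _∙_ (rawFormula-cong φ eq) (rawFormula-cong ψ eq))
    rawFormula-cong (∀̇ φ) eq = cong (4 ∙_) (rawFormula-cong φ (λ { zero → refl ; (suc i) → cong suc (eq i) }))

    module _ {O : Pred ℕ 0ℓ} where

      private
        mutual
          rawTermFn : ∀ {m n} (t : Term L m) (e : Fin m → Fn O n) → Σ[ g ∈ Fn O n ] (∀ xs → ⟪ g ⟫ xs ≡ rawTerm t (λ i → ⟪ e i ⟫ xs))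
          rawTermFn (var x) e = constant 0 ⊙ e x , λ _ → refl
          rawTermFn (fun {k = k} (i , _) ts) e = let g , eq = rawTermsFn ts e in
            constant 1 ⊙ constant k ⊙ constant i ⊙ g , λ xs → cong (λ x → 1 ∙ k ∙ i ∙ x) (eq xs)

          rawTermsFn : ∀ {m n k} (ts : Vec (Term L m) k) (e : Fin m → Fn O n) → Σ[ g ∈ Fn O n ] (∀ xs → ⟪ g ⟫ xs ≡ rawTerms ts (λ i → ⟪ e i ⟫ xs))
          rawTermsFn []       e = constant 0 , λ _ → refl
          rawTermsFn (t ∷ ts) e = let g , eq = rawTermFn t e ; h , eq′ = rawTermsFn ts e in
            g ⊙ h , λ xs → cong₂ _∙_ (eq xs) (eq′ xs)

      rawFn : ∀ {m n} (φ : Formula L m) (e : Fin m → Fn O n) → Σ[ g ∈ Fn O n ] (∀ xs → ⟪ g ⟫ xs ≡ rawFormula φ (λ i → ⟪ e i ⟫ xs))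
      rawFn (s ≐ t) e = let g , eq = rawTermFn s e ; h , eq′ = rawTermFn t e in
        constant 0 ⊙ g ⊙ h , λ xs → cong₂ (λ x y → 0 ∙ x ∙ y) (eq xs) (eq′ xs)
      rawFn (rel {k = k} (i , _) ts) e = let g , eq = rawTermsFn ts e in
        constant 1 ⊙ constant k ⊙ constant i ⊙ g , λ xs → cong (λ x → 1 ∙ k ∙ i ∙ x) (eq xs)
      rawFn ⊥̇ e = constant 2 ⊙ constant 0 , λ _ → refl
      rawFn (φ ⇒ ψ) e = let g , eq = rawFn φ e ; h , eq′ = rawFn ψ e in
        constant 3 ⊙ g ⊙ h , λ xs → cong₂ (λ x y → 3 ∙ x ∙ y) (eq xs) (eq′ xs)
      rawFn (∀̇ φ) e = let g , eq = rawFn φ (constant 0 F.∷ (λ i → constant 1 ⊕ e i)) in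
        constant 4 ⊙ g , λ xs → cong (4 ∙_) (trans (eq xs) (rawFormula-cong φ (λ { zero → refl ; (suc i) → refl })))

  module TranslatedCodes {M : Language} (I : Translation L-E M) where
    open Translation I

    private
      conjunction : ℕ → ℕ → ℕ
      conjunction x y = negation (3 ∙ x ∙ negation y)

      domCode : ℕ
      domCode = rawFormula dom (λ _ → 0)

      existsCode : ℕ → ℕ
      existsCode x = negation (4 ∙ negation (conjunction domCode x))

      equals : ℕ → ℕ → ℕ
      equals i j = rawFormula eq (i F.∷ j F.∷ F.[])

      -- The first argument of the atom is variable 0, so j is the only input. The two new variables
      -- for the values shift 0 and j to 2 and 2 + j, and the innermost constant is the code of
      -- `⊤̇`.
      atomCode : Formula M 2 → ℕ → ℕ
      atomCode α j = existsCode (existsCode (conjunction (conjunction (equals 2 0) (conjunction (equals (2 + j) 1) (3 ∙ (2 ∙ 0) ∙ 2 ∙ 0)))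
        (rawFormula α (0 F.∷ 1 F.∷ F.[]))))

      same : Formula M 2
      same = relᴵ (0 , tt)

      pairing : ∀ {n} (i j : Fin n) (k : Fin 2) → toℕ ((i F.∷ j F.∷ F.[]) k) ≡ (toℕ i F.∷ toℕ j F.∷ F.[]) k
      pairing i j zero       = refl
      pairing i j (suc zero) = refl

      equals≡ : ∀ {n} (i j : Fin n) → formulaCode (i ≈ j) ≡ equals (toℕ i) (toℕ j)
      equals≡ i j = rawFormula≡ (i F.∷ j F.∷ F.[]) (pairing i j) eq

      dom≡ : ∀ {n} → formulaCode (δ {suc n} zero) ≡ domCode
      dom≡ = rawFormula≡ (λ _ → zero) (λ _ → refl) dom

      exists≡ : ∀ {n} (φ : Formula M (suc n)) {x} → formulaCode φ ≡ x → formulaCode (∃δ φ) ≡ existsCode x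
      exists≡ φ eqφ = cong₂ (λ d x → negation (4 ∙ negation (conjunction d x))) dom≡ eqφ

      first : ∀ {n} (k : Fin 2) → toℕ (k ↑ˡ n) ≡ (0 F.∷ 1 F.∷ F.[]) k
      first zero       = refl
      first (suc zero) = refl

      atom≡ : ∀ {n} (α : Formula M 2) (i : Fin (suc n)) → formulaCode (translateAtom α (var zero ∷ var i ∷ [])) ≡ atomCode α (toℕ i)
      atom≡ {n} α i = exists≡ (∃δ body) (exists≡ body (cong₂ conjunction
        (cong₂ conjunction (equals≡ (# 2) (# 0)) (cong (λ x → conjunction x (3 ∙ (2 ∙ 0) ∙ 2 ∙ 0)) (equals≡ (suc (suc i)) (# 1))))
        (rawFormula≡ (_↑ˡ suc n) first α)))
        where
        body : Formula M (3 + n)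
        body = values (var zero ∷ var i ∷ []) (2 ↑ʳ_) (_↑ˡ suc n) ∧̇ rename (_↑ˡ suc n) α

      allCode : ℕ → ℕ
      allCode x = 4 ∙ 3 ∙ domCode ∙ x

    open Codes allCode (atomCode eq) (atomCode same) using (classCode; F-class; classFn)

    translatedCode : ℕ → ℕ
    translatedCode = classCode

    translatedCode≡ : ∀ n → formulaCode (translate (class n)) ≡ translatedCode n
    translatedCode≡ = F-class (λ φ → formulaCode (translate φ)) refl (λ φ ψ → refl)
      (λ φ → cong (λ d → 4 ∙ 3 ∙ d ∙ formulaCode (translate φ)) dom≡) (atom≡ eq) (atom≡ same)

    translatedFn : ∀ {O n} → Fn O n → Fn O n
    translatedFn {O} = classFn
      (λ f → constant 4 ⊙ constant 3 ⊙ constant domCode ⊙ f , λ _ → refl) (atomFn eq) (atomFn same)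
      where
      existsFn : ∀ {n} → Fn O n → Fn O n
      existsFn f = negationFn (constant 4 ⊙ negationFn (negationFn (constant 3 ⊙ constant domCode ⊙ negationFn f)))
      atomFn : ∀ (α : Formula M 2) {n} (f : Fn O n) → Σ[ g ∈ Fn O n ] (∀ xs → ⟪ g ⟫ xs ≡ atomCode α (⟪ f ⟫ xs))
      atomFn α f = let g , g≡ = rawFn eq ((constant 2 ⊕ f) F.∷ constant 1 F.∷ F.[]) in
        existsFn (existsFn (conj (conj (constant (equals 2 0)) (conj g (constant (3 ∙ (2 ∙ 0) ∙ 2 ∙ 0)))) (constant (rawFormula α (0 F.∷ 1 F.∷ F.[]))))) ,
        λ xs → cong (λ x → existsCode (existsCode (conjunction (conjunction (equals 2 0) (conjunction x (3 ∙ (2 ∙ 0) ∙ 2 ∙ 0))) (rawFormula α (0 F.∷ 1 F.∷ F.[])))))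
          (trans (g≡ xs) (rawFormula-cong eq (λ { zero → refl ; (suc zero) → refl })))
        where
        conj : ∀ {n} → Fn O n → Fn O n → Fn O n
        conj f g = negationFn (constant 3 ⊙ f ⊙ negationFn g)

open TranslationCodes

-- The theory, its interpretability in R and its incompleteness property

module TheTheory where

  -- These provable sentences of growing size carry the witness of an axiom, so
  -- that the set of axioms is recursive.
  tautology : ℕ → Sentence L-E
  tautology zero    = ⊥̇ ⇒ ⊥̇
  tautology (suc s) = ⊥̇ ⇒ tautology s

  ex-falso : ∀ {L n} {Γ : List (Formula L n)} {φ} → Γ ⊢ ⊥̇ ⇒ φ
  ex-falso = ⇒-intro (raa (hyp (there (here refl))))

  tautology-provable : ∀ {X} s → Theorems X (tautology s)
  tautology-provable zero    = [] , [] , ex-falso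
  tautology-provable (suc s) = [] , [] , ex-falso

  reflexivity symmetry transitivity : Sentence L-E
  reflexivity  = ∀̇ (var zero ~̇ var zero)
  symmetry     = ∀̇ (∀̇ (var (# 0) ~̇ var (# 1) ⇒ var (# 1) ~̇ var (# 0)))
  transitivity = ∀̇ (∀̇ (∀̇ (var (# 0) ~̇ var (# 1) ⇒ var (# 1) ~̇ var (# 2) ⇒ var (# 0) ~̇ var (# 2))))

  open Codes (4 ∙_) (λ j → 0 ∙ (0 ∙ 0) ∙ (0 ∙ j)) (λ j → 1 ∙ 2 ∙ 0 ∙ (0 ∙ 0) ∙ (0 ∙ j) ∙ 0)
    using (classCode; uniqueCode; F-class; F-unique) renaming (classFn to mkClassFn; uniqueFn to mkUniqueFn) public

  classCode≡ : ∀ n → formulaCode (class n) ≡ classCode n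
  classCode≡ = F-class formulaCode refl (λ _ _ → refl) (λ _ → refl) (λ _ → refl) (λ _ → refl)

  uniqueCode≡ : ∀ n → formulaCode (uniqueClass n) ≡ uniqueCode n
  uniqueCode≡ = F-unique formulaCode refl (λ _ _ → refl) (λ _ → refl) (λ _ → refl) (λ _ → refl)

  classFn uniqueFn : ∀ {O n} → Fn O n → Fn O n
  classFn = mkClassFn (λ f → constant 4 ⊙ f , λ _ → refl) (λ f → constant 0 ⊙ constant (0 ∙ 0) ⊙ constant 0 ⊙ f , λ _ → refl)
    (λ f → constant 1 ⊙ constant 2 ⊙ constant 0 ⊙ constant (0 ∙ 0) ⊙ (constant 0 ⊙ f) ⊙ constant 0 , λ _ → refl)
  uniqueFn = mkUniqueFn (λ f → constant 4 ⊙ f , λ _ → refl) (λ f → constant 0 ⊙ constant (0 ∙ 0) ⊙ constant 0 ⊙ f , λ _ → refl)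
    (λ f → constant 1 ⊙ constant 2 ⊙ constant 0 ⊙ constant (0 ∙ 0) ⊙ (constant 0 ⊙ f) ⊙ constant 0 , λ _ → refl)

  tautologyCode : ℕ → ℕ
  tautologyCode s = formulaCode (tautology s)

  tautologyFn : ∀ {O n} → Fn O n → Fn O n
  tautologyFn f = computing (tautologyCode ∘ V.head) (rec (constant (3 ∙ (2 ∙ 0) ∙ (2 ∙ 0))) (constant 3 ⊙ constant (2 ∙ 0) ⊙ arg (# 1))) go ⊚ (f ∷ [])
    where
    go : ∀ xs → _
    go (zero  ∷ []) = refl
    go (suc s ∷ []) = cong (λ x → 3 ∙ (2 ∙ 0) ∙ x) (go (s ∷ []))

  s≤tautologyCode : ∀ s → s ≤ tautologyCode s
  s≤tautologyCode zero    = z≤n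
  s≤tautologyCode (suc s) = ≤-trans (s≤s (≤-trans (s≤tautologyCode s) (n≤m∙n (2 ∙ 0) _))) (n<1+m∙n 2 _)

  tautologyCode-injective : ∀ s t → tautologyCode s ≡ tautologyCode t → s ≡ t
  tautologyCode-injective s t eq = go s t (formulaCode-injective (tautology s) (tautology t) eq)
    where
    go : ∀ s t → tautology s ≡ tautology t → s ≡ t
    go zero          zero          eq = refl
    go (suc s)       (suc t)       eq = cong suc (go s t (⇒-injʳ eq))
      where
      ⇒-injʳ : ∀ {φ ψ φ′ ψ′ : Sentence L-E} → (φ ⇒ ψ) ≡ (φ′ ⇒ ψ′) → ψ ≡ ψ′
      ⇒-injʳ refl = refl
    go zero          (suc zero)    ()
    go zero          (suc (suc t)) ()
    go (suc zero)    zero          ()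
    go (suc (suc s)) zero          ()

  module Construction (em : ExcludedMiddle 0ℓ) (c : Code 1) where
    open Deciding em
    open Inseparability em

    InA InB : ℕ → Set
    InA = SetA c
    InB = SetB c

    data Axiom : Pred (Sentence L-E) 0ℓ where
      refl-axiom   : Axiom reflexivity
      sym-axiom    : Axiom symmetry
      trans-axiom  : Axiom transitivity
      unique-axiom : ∀ n → Axiom (tautology n ⇒ uniqueClass n)
      A-axiom      : ∀ n s → A-stage c n s → Axiom (tautology (n ∙ s) ⇒ class n)
      B-axiom      : ∀ n s → B-stage c n s → Axiom (tautology (n ∙ s) ⇒ ¬̇ (class n))

    private
      IsAxiomCode : ℕ → Set
      IsAxiomCode z = ((z ≡ formulaCode reflexivity ⊎ z ≡ formulaCode symmetry) ⊎ z ≡ formulaCode transitivity) ⊎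
        (Σ[ n ∈ ℕ ] (n ≤ z × z ≡ 3 ∙ tautologyCode n ∙ uniqueCode n)) ⊎
        (Σ[ n ∈ ℕ ] (n ≤ z × Σ[ s ∈ ℕ ] (s ≤ z × z ≡ 3 ∙ tautologyCode (n ∙ s) ∙ classCode n × A-stage c n s))) ⊎
        (Σ[ n ∈ ℕ ] (n ≤ z × Σ[ s ∈ ℕ ] (s ≤ z × z ≡ 3 ∙ tautologyCode (n ∙ s) ∙ negation (classCode n) × B-stage c n s)))

      padded : ∀ s x → s ≤ 3 ∙ tautologyCode s ∙ x
      padded s x = ≤-trans (s≤tautologyCode s) (≤-trans (m≤m∙n _ x) (n≤m∙n 3 _))

      axiomCode⁺ : ∀ {φ} → Axiom φ → IsAxiomCode (formulaCode φ)
      axiomCode⁺ refl-axiom = inj₁ (inj₁ (inj₁ refl))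
      axiomCode⁺ sym-axiom = inj₁ (inj₁ (inj₂ refl))
      axiomCode⁺ trans-axiom = inj₁ (inj₂ refl)
      axiomCode⁺ (unique-axiom n) = inj₂ (inj₁ (n , padded n _ , cong (λ x → 3 ∙ tautologyCode n ∙ x) (uniqueCode≡ n)))
      axiomCode⁺ (A-axiom n s h) = inj₂ (inj₂ (inj₁ (n , ≤-trans (m≤m∙n n s) (padded (n ∙ s) _) , s , ≤-trans (n≤m∙n n s) (padded (n ∙ s) _) ,
        cong (λ x → 3 ∙ tautologyCode (n ∙ s) ∙ x) (classCode≡ n) , h)))
      axiomCode⁺ (B-axiom n s h) = inj₂ (inj₂ (inj₂ (n , ≤-trans (m≤m∙n n s) (padded (n ∙ s) _) , s , ≤-trans (n≤m∙n n s) (padded (n ∙ s) _) ,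
        cong (λ x → 3 ∙ tautologyCode (n ∙ s) ∙ negation x) (classCode≡ n) , h)))

      axiomCode⁻ : ∀ {z} → IsAxiomCode z → Σ[ φ ∈ Sentence L-E ] (Axiom φ × formulaCode φ ≡ z)
      axiomCode⁻ (inj₁ (inj₁ (inj₁ refl))) = _ , refl-axiom , refl
      axiomCode⁻ (inj₁ (inj₁ (inj₂ refl))) = _ , sym-axiom , refl
      axiomCode⁻ (inj₁ (inj₂ refl)) = _ , trans-axiom , refl
      axiomCode⁻ (inj₂ (inj₁ (n , _ , refl))) = _ , unique-axiom n , cong (λ x → 3 ∙ tautologyCode n ∙ x) (uniqueCode≡ n)
      axiomCode⁻ (inj₂ (inj₂ (inj₁ (n , _ , s , _ , refl , h)))) = _ , A-axiom n s h , cong (λ x → 3 ∙ tautologyCode (n ∙ s) ∙ x) (classCode≡ n)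
      axiomCode⁻ (inj₂ (inj₂ (inj₂ (n , _ , s , _ , refl , h)))) = _ , B-axiom n s h , cong (λ x → 3 ∙ tautologyCode (n ∙ s) ∙ negation x) (classCode≡ n)

    decideAxiom : ∀ {O} → Decides {1} O (λ xs → Σ[ φ ∈ Sentence L-E ] (Axiom φ × formulaCode φ ≡ V.head xs))
    decideAxiom = dec-map (λ { (z ∷ []) → axiomCode⁻ }) (λ { (z ∷ []) (φ , ax , eq) → Eq.subst IsAxiomCode eq (axiomCode⁺ ax) })
      (dec-⊎ (dec-⊎ (dec-⊎ (is reflexivity) (is symmetry)) (is transitivity))
        (dec-⊎ (dec-∃≤ (dec-≡ (arg (# 1)) (constant 3 ⊙ tautologyFn (arg (# 0)) ⊙ uniqueFn (arg (# 0)))) (arg (# 0)))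
          (dec-⊎ (dec-∃≤ (dec-∃≤ (dec-× (dec-≡ (arg (# 2)) (constant 3 ⊙ tautologyFn (arg (# 1) ⊙ arg (# 0)) ⊙ classFn (arg (# 1))))
                                         (dec-∘ (decideA c) (arg (# 0) ∷ arg (# 1) ∷ []))) (arg (# 1))) (arg (# 0)))
                 (dec-∃≤ (dec-∃≤ (dec-× (dec-≡ (arg (# 2)) (constant 3 ⊙ tautologyFn (arg (# 1) ⊙ arg (# 0)) ⊙ negationFn (classFn (arg (# 1)))))
                                         (dec-∘ (decideB c) (arg (# 0) ∷ arg (# 1) ∷ []))) (arg (# 1))) (arg (# 0))))))
      where
      is : ∀ {O} φ → Decides {1} O (λ xs → lookup xs (# 0) ≡ formulaCode φ)
      is φ = dec-≡ (arg (# 0)) (constant (formulaCode φ))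

    open Provability L-E Axiom

    decideParam : ∀ {O} j → Decides {1} O (proofParams j ∘ V.head)
    decideParam zero = fromFn (constant 0) (λ { _ (_ , _ , () , _) }) (λ _ _ → refl)
    decideParam (suc zero) = dec-map (λ { (z ∷ []) eq → 2 , 0 , tt , sym eq }) (λ { (z ∷ []) → only })
      (dec-≡ (arg (# 0)) (constant (2 ∙ 0)))
      where
      only : ∀ {z} → proofParams (suc zero) z → z ≡ 2 ∙ 0
      only (2 , 0 , _ , eq) = sym eq
    decideParam (suc (suc zero)) = decideAxiom

    recursive-language : RecursiveLanguage L-E
    recursive-language =
        decides⇒≤ᵀ (dec-map (λ _ (k , i , p , eq) → k , i , p , trans (sym (∙≡pair k i)) eq) (λ _ (k , i , p , eq) → k , i , p , trans (∙≡pair k i) eq) (decideParam zero))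
      , decides⇒≤ᵀ (dec-map (λ _ (k , i , p , eq) → k , i , p , trans (sym (∙≡pair k i)) eq) (λ _ (k , i , p , eq) → k , i , p , trans (∙≡pair k i) eq) (decideParam (suc zero)))

    gödel-map : ∀ {X : Pred (Sentence L-E) 0ℓ} {O} → Decides {1} O (λ xs → Σ[ φ ∈ Sentence L-E ] (X φ × formulaCode φ ≡ V.head xs)) → gödelNumbers X ≤ᵀ O
    gödel-map d = decides⇒≤ᵀ (dec-map (λ _ (φ , x , eq) → φ , x , trans (sym (formulaCode≡ φ)) eq) (λ _ (φ , x , eq) → φ , x , trans (formulaCode≡ φ) eq) d)

    keyed-models : ∀ {M X} → Keyed em M X → (∀ n → InA n → X n) → (∀ n → InB n → ¬ X n) → Structure.Models M Axiom
    keyed-models K A⊆X B∩X = go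
      where
      open Keyed K
      go : ∀ φ → Axiom φ → ∀ ρ → Structure.Sat _ φ ρ
      go _ refl-axiom ρ x = Classes.Equivalence~.~-refl equiv
      go _ sym-axiom ρ x y = Classes.Equivalence~.~-sym equiv
      go _ trans-axiom ρ x y z = Classes.Equivalence~.~-trans equiv
      go _ (unique-axiom n) ρ _ = keyed-unique n {ρ}
      go _ (A-axiom n s h) ρ _ = keyed-class⁺ n {ρ} (A⊆X n (s , h))
      go _ (B-axiom n s h) ρ _ h′ = B∩X n (s , h) (keyed-class⁻ n {ρ} h′)

    A-theorem : ∀ {n} → InA n → Theorems Axiom (class n)
    A-theorem {n} (s , h) = theorems-⇒ (axiom (A-axiom n s h)) (tautology-provable (n ∙ s))

    -- The canonical structure with classes exactly for the members of A satisfies the axioms,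
    -- because B is disjoint from A.
    theorem-A : ∀ {n} → Theorems Axiom (class n) → InA n
    theorem-A {n} t = Keyed.keyed-class⁻ (canonical-keyed em InA) n {λ ()}
      (Structure.theorem-sound (canonical em InA) em (keyed-models (canonical-keyed em InA) (λ _ → id) (λ n b a → disjoint c a b)) t (λ ()))

    consistent-axioms : ¬ Theorems Axiom ⊥̇
    consistent-axioms t = Structure.theorem-sound (canonical em InA) em (keyed-models (canonical-keyed em InA) (λ _ → id) (λ n b a → disjoint c a b)) t (λ ())

    -- All sets between the axioms and their theorems have the same theorems. One argument thus
    -- covers the deductively closed theory and the one padded to a prescribed degree.
    module Between (U : Pred (Sentence L-E) 0ℓ) (axioms⊆U : ∀ {φ} → Axiom φ → U φ) (U⊆theorems : ∀ {φ} → U φ → Theorems Axiom φ) where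

      theory : Theory
      theory = record { lang = L-E ; sentences = U }

      to-U : ∀ {φ} → Theorems Axiom φ → Theorems U φ
      to-U (Γ , xs , d) = Γ , All.map axioms⊆U xs , d

      from-U : ∀ {φ} → Theorems U φ → Theorems Axiom φ
      from-U (Γ , xs , d) = theorems-closed (All.map U⊆theorems xs) d

      recursivelyAxiomatizable : RecursivelyAxiomatizable theory
      recursivelyAxiomatizable = recursive-language , Axiom , gödel-map decideAxiom , λ φ → mk⇔ to-U from-U

      private
        a b : Code 1
        a = search (decideA c {∅})
        b = search (decideB c {∅})

        a-sound : ∀ {n} → W a n → InA n
        a-sound {n} (s , run) = s , search-sound (decideA c {∅}) {n ∷ []} run

        a-complete : ∀ {n} → InA n → W a n
        a-complete {n} (s , h) = let m , run , _ = search-complete (decideA c {∅}) {n ∷ []} {s} h in m , run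

        b-sound : ∀ {n} → W b n → InB n
        b-sound {n} (s , run) = s , search-sound (decideB c {∅}) {n ∷ []} run

        b-complete : ∀ {n} → InB n → W b n
        b-complete {n} (s , h) = let m , run , _ = search-complete (decideB c {∅}) {n ∷ []} {s} h in m , run

      interpretable-in-R : theory InterpretableIn R
      interpretable-in-R = interpretable a b em U λ M models φ φ∈U → Structure.theorem-sound (KeysInR.interpreted em a b M models) em
        (keyed-models (KeysInR.interpreted-keyed em a b M models)
          (λ n h → Rosser.precedes-yes em M models a b (a-complete h) (λ w → disjoint c h (b-sound w)))
          (λ n h → Rosser.precedes-no em M models a b (b-complete h) (λ w → disjoint c (a-sound w) h)))
        (U⊆theorems φ∈U)

      module _ (nonrecursive : ¬ Recursive (W c)) where

        incomplete : ∀ S → RecursivelyAxiomatizable S → Consistent S → theory InterpretableIn S → Incomplete S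
        incomplete S (recL , X , recX , equivalent) con (I , isI) with em {Incomplete S}
        ... | yes inc = inc
        -- If S were complete, the search for a proof of the translated sentence or of its negation
        -- would always end. As the code of the translation is computable from n, the set of n whose
        -- sentence is provable would be recursive.
        ... | no ¬inc = contradiction (inseparable c A⊆ B∩ (decides⇒≤ᵀ (decides-by-search
                (dec-∘ proved (arg (# 0) ∷ translatedFn (arg (# 1)) ∷ []))
                (dec-∘ proved (arg (# 0) ∷ negationFn (translatedFn (arg (# 1))) ∷ []))
                (λ { {w} {n ∷ []} → yes-sound n }) (λ { {w} {n ∷ []} → no-sound n })
                (λ { (n ∷ []) → yes-complete n }) (λ { (n ∷ []) → no-complete n })))) nonrecursive
          where
          open Translation I using (translate)
          open TranslatedCodes I
          module S = Provability (Theory.lang S) X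
          open IsInterpretation isI using (sound)
          proved : Decides ∅ (λ (xs : Vec ℕ 2) → S.ProvedBy (lookup xs (# 0)) (lookup xs (# 1)))
          proved = S.decideProved em (S.decideParams em recL recX)
          Separator : ℕ → Set
          Separator n = Theory.Proves S (translate (class n))
          -- Translations leave `⊥̇` and `⇒` alone, so the padding stays provable whatever the
          -- interpretation does to atoms and quantifiers.
          translated-tautology : ∀ s → Theory.Proves S (translate (tautology s))
          translated-tautology zero    = [] , [] , ex-falso
          translated-tautology (suc s) = [] , [] , ex-falso
          A⊆ : ∀ n → InA n → Separator n
          A⊆ n (s , h) = theorems-⇒ (sound _ (axioms⊆U (A-axiom n s h))) (translated-tautology (n ∙ s))
          B⊆ : ∀ n → InB n → Theory.Proves S (¬̇ (translate (class n)))
          B⊆ n (s , h) = theorems-⇒ (sound _ (axioms⊆U (B-axiom n s h))) (translated-tautology (n ∙ s))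
          B∩ : ∀ n → InB n → ¬ Separator n
          B∩ n h p = con (theorems-⇒ (B⊆ n h) p)
          yes-sound : ∀ n {w} → S.ProvedBy w (translatedCode n) → Separator n
          yes-sound n {w} p = Equivalence.to (equivalent _) (S.proved⇒theorem (translate (class n)) (Eq.subst (S.ProvedBy w) (sym (translatedCode≡ n)) p))
          no-sound : ∀ n {w} → S.ProvedBy w (negation (translatedCode n)) → ¬ Separator n
          no-sound n {w} p q = con (theorems-⇒ (Equivalence.to (equivalent _) (S.proved⇒theorem (¬̇ (translate (class n)))
            (Eq.subst (S.ProvedBy w ∘ negation) (sym (translatedCode≡ n)) p))) q)
          yes-complete : ∀ n → Separator n → Σ[ w ∈ ℕ ] S.ProvedBy w (translatedCode n)
          yes-complete n p = let w , h = S.theorem⇒proved (Equivalence.from (equivalent _) p) in w , Eq.subst (S.ProvedBy w) (translatedCode≡ n) h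
          no-complete : ∀ n → ¬ Separator n → Σ[ w ∈ ℕ ] S.ProvedBy w (negation (translatedCode n))
          no-complete n ¬p = let w , h = S.theorem⇒proved (Equivalence.from (equivalent _) refuted) in w , Eq.subst (S.ProvedBy w ∘ negation) (translatedCode≡ n) h
            where
            refuted : Theory.Proves S (¬̇ (translate (class n)))
            refuted = case em {Theory.Proves S (¬̇ (translate (class n)))} of λ
              { (yes q) → q ; (no ¬q) → contradiction (translate (class n) , ¬p , ¬q) ¬inc }

        g1 : G1HoldsFor theory
        g1 = recursivelyAxiomatizable , consistent-axioms ∘ from-U , incomplete

open TheTheory

-- The degree of the set of theorems

module TheDegree where

  module Degree (em : ExcludedMiddle 0ℓ) (c : Code 1) (nonrecursive : ¬ Recursive (W c)) where
    open Deciding em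
    open Inseparability em
    open Construction em c
    open Provability L-E Axiom

    -- SetA is infinite, since finite sets are recursive.

    decideMember : ∀ {O} → Decides {3} O (λ xs → MemberOf (lookup xs (# 1)) (lookup xs (# 2)) (lookup xs (# 0)))
    decideMember = dec-∃≤ (dec-≡ (arg (# 0) ⊗ (constant 1 ⊕ (arg (# 1) ⊕ constant 1) ⊗ arg (# 3))) (arg (# 2))) (arg (# 1))

    below : (P : ℕ → Set) → ∀ N → Σ[ ps ∈ List ℕ ] ((∀ {p} → p ∈ ps → p ≤ N × P p) × (∀ {p} → p ≤ N → P p → p ∈ ps))
    below P zero with em {P 0}
    ... | yes p₀ = 0 ∷ [] , (λ { (here refl) → z≤n , p₀ }) , (λ { z≤n _ → here refl })
    ... | no ¬p₀ = [] , (λ ()) , (λ { z≤n p₀ → contradiction p₀ ¬p₀ })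
    below P (suc N) with ps , sound , complete ← below P N with em {P (suc N)}
    ... | yes p = suc N ∷ ps , (λ { (here refl) → ≤-refl , p ; (there q) → let q≤ , pq = sound q in m≤n⇒m≤1+n q≤ , pq }) ,
                  λ q≤ pq → [ (λ q<1+N → there (complete (s≤s⁻¹ q<1+N) pq)) , (λ { refl → here refl }) ]′ (m≤n⇒m<n∨m≡n q≤)
    ... | no ¬p = ps , (λ q → let q≤ , pq = sound q in m≤n⇒m≤1+n q≤ , pq) ,
                  λ q≤ pq → [ (λ q<1+N → complete (s≤s⁻¹ q<1+N) pq) , (λ { refl → contradiction pq ¬p }) ]′ (m≤n⇒m<n∨m≡n q≤)

    -- The truth values of an arbitrary P up to N are packed into two numbers, over which a search
    -- can range.
    setCode : (P : ℕ → Set) → ∀ N → Σ[ a ∈ ℕ ] Σ[ d ∈ ℕ ] (∀ {p} → p ≤ N → (P p → MemberOf a d p) × (MemberOf a d p → P p))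
    setCode P N with ps , sound , complete ← below P N with a , d , to , from ← finite-set-code N ps (λ q → proj₁ (sound q)) =
      a , d , λ p≤N → (λ pp → to (complete p≤N pp)) , (λ m → proj₂ (sound (from p≤N m)))

    A-unbounded : ∀ N → Σ[ n ∈ ℕ ] (N ≤ n × InA n)
    A-unbounded N with em {Σ[ n ∈ ℕ ] (N ≤ n × InA n)}
    ... | yes h = h
    ... | no ¬h with a , d , member ← setCode InA N = contradiction (W≤ᵀSetA c (decides⇒≤ᵀ (dec-map (λ { (z ∷ []) → to }) (λ { (z ∷ []) → from })
          (dec-× (dec-∃≤ (dec-≡ (arg (# 0)) (arg (# 1))) (constant N)) (dec-∘ decideMember (arg (# 0) ∷ constant a ∷ constant d ∷ [])))))) nonrecursive
      where
      to : ∀ {z} → (Σ[ i ∈ ℕ ] (i ≤ N × i ≡ z)) × MemberOf a d z → InA z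
      to ((_ , i≤N , refl) , m) = proj₂ (member i≤N) m
      from : ∀ {z} → InA z → (Σ[ i ∈ ℕ ] (i ≤ N × i ≡ z)) × MemberOf a d z
      from {z} h = (z , z≤N , refl) , proj₁ (member z≤N) h
        where
        z≤N : z ≤ N
        z≤N = <⇒≤ (≰⇒> λ N≤z → ¬h (z , N≤z , h))

    -- Its members are distinct and at least N. For N = q their classes have more than q elements
    -- each and serve as the large classes of the game.
    A-sequence : ℕ → ℕ → ℕ
    A-sequence N zero    = proj₁ (A-unbounded N)
    A-sequence N (suc j) = proj₁ (A-unbounded (suc (A-sequence N j)))

    A-sequence-InA : ∀ N j → InA (A-sequence N j)
    A-sequence-InA N zero    = proj₂ (proj₂ (A-unbounded N))
    A-sequence-InA N (suc j) = proj₂ (proj₂ (A-unbounded (suc (A-sequence N j))))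

    A-sequence-< : ∀ N {i j} → i < j → A-sequence N i < A-sequence N j
    A-sequence-< N {i} {suc j} i<1+j with m≤n⇒m<n∨m≡n (s≤s⁻¹ i<1+j)
    ... | inj₁ i<j  = <-trans (A-sequence-< N i<j) (proj₁ (proj₂ (A-unbounded (suc (A-sequence N j)))))
    ... | inj₂ refl = proj₁ (proj₂ (A-unbounded (suc (A-sequence N j))))

    A-sequence-injective : ∀ N i j → A-sequence N i ≡ A-sequence N j → i ≡ j
    A-sequence-injective N i j eq with <-cmp i j
    ... | tri< i<j _ _ = contradiction eq (<⇒≢ (A-sequence-< N i<j))
    ... | tri≈ _ i≡j _ = i≡j
    ... | tri> _ _ j<i = contradiction (sym eq) (<⇒≢ (A-sequence-< N j<i))

    A-sequence-≥ : ∀ N j → N ≤ A-sequence N j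
    A-sequence-≥ N zero    = proj₁ (proj₂ (A-unbounded N))
    A-sequence-≥ N (suc j) = ≤-trans (A-sequence-≥ N j) (<⇒≤ (A-sequence-< N {j} {suc j} ≤-refl))

    -- The theory together with the truth values of class 0, …, class (q - 1) decides
    -- the sentences of depth q.

    side : ∀ q (M : Structure L-E) → Structure.Models M Axiom → Game.Side em q
    side q M models = record { structure = M ; equiv = equiv ; unique = unique ; many = many }
      where
      open Classes em M
      equiv : Equivalence~
      equiv = record
        { ~-refl  = λ {x} → models _ refl-axiom (λ ()) x
        ; ~-sym   = λ {x} {y} → models _ sym-axiom (λ ()) y x
        ; ~-trans = λ {x} {y} {z} → models _ trans-axiom (λ ()) z y x }
      open Equivalence~ equiv
      open Semantics equiv
      unique : ∀ {n x y} → Exactly x n → Exactly y n → x ~ y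
      unique {zero} {x} (_ , ¬more) _ = contradiction ((λ _ → x) , (λ { {zero} {zero} _ → refl }) , λ _ → ~-refl) ¬more
      unique {suc n} e e′ = uniqueClass⁻ n {λ ()} (theorem-sound em models (theorems-⇒ (axiom (unique-axiom n)) (tautology-provable n)) (λ ())) e e′
      chosen : ∀ j → HasClass (A-sequence q j)
      chosen j = class⁻ (A-sequence q j) {λ ()} (theorem-sound em models (A-theorem (A-sequence-InA q j)) (λ ()))
      many : Σ[ f ∈ (Fin q → Carrier) ] ((∀ {i j} → f i ~ f j → i ≡ j) × (∀ i → AtLeast (f i) q))
      many = (λ i → proj₁ (chosen (toℕ i))) ,
        (λ {i} {j} h → toℕ-injective (A-sequence-injective q (toℕ i) (toℕ j)
          (suc-injective (exactly-unique (exactly-~ equiv h (proj₂ (chosen (toℕ i)))) (proj₂ (chosen (toℕ j))))))) ,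
        λ i → atLeast-≤ (m≤n⇒m≤1+n (A-sequence-≥ q (toℕ i))) (proj₁ (proj₂ (chosen (toℕ i))))

    Agree : (M N : Structure L-E) → ℕ → Set
    Agree M N q = ∀ n → n < q → (Structure.Sat M (class n) (λ ()) → Structure.Sat N (class n) (λ ()))
                             × (Structure.Sat N (class n) (λ ()) → Structure.Sat M (class n) (λ ()))

    agreeing : ∀ (φ : Sentence L-E) M N → Structure.Models M Axiom → Structure.Models N Axiom → Agree M N (depth φ) →
      ∀ {ρ π} → Structure.Sat M φ ρ → Structure.Sat N φ π
    agreeing φ M N mM mN agree {ρ} {π} = proj₁ (indistinguishable M′ N′ (transfer M mM N mN (λ n n<q → proj₁ (agree n n<q)))
        (transfer N mN M mM (λ n n<q → proj₂ (agree n n<q))) φ ≤-refl (record { same-≈ = λ () ; same-~ = λ () ; same-size = λ () }))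
      where
      open Game em (depth φ)
      M′ N′ : Side
      M′ = side (depth φ) M mM
      N′ = side (depth φ) N mN
      transfer : ∀ M (mM : Structure.Models M Axiom) N (mN : Structure.Models N Axiom) →
        (∀ n → n < depth φ → Structure.Sat M (class n) (λ ()) → Structure.Sat N (class n) (λ ())) →
        ∀ n → n < depth φ → Σ[ x ∈ Structure.Carrier M ] Classes.Exactly em M x n → Σ[ y ∈ Structure.Carrier N ] Classes.Exactly em N y n
      -- The game asks for all sizes n < q, while `class n` speaks of size n + 1. Size 0 does not
      -- occur, since each element belongs to its own class.
      transfer M mM N mN f zero _ (x , _ , ¬more) =
        contradiction ((λ _ → x) , (λ { {zero} {zero} _ → refl }) , λ _ → Side.~-refl (side (depth φ) M mM)) ¬more
      transfer M mM N mN f (suc n) n<q h =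
        Classes.Semantics.class⁻ em N (Side.equiv (side (depth φ) N mN)) n (f n (<⇒≤ n<q) (Classes.Semantics.class⁺ em M (Side.equiv (side (depth φ) M mM)) n h))

    literal : (ℕ → Set) → ℕ → Sentence L-E
    literal P n with em {P n}
    ... | yes _ = class n
    ... | no _  = ¬̇ (class n)

    implications : (ℕ → Set) → ℕ → Sentence L-E → Sentence L-E
    implications P zero    φ = φ
    implications P (suc n) φ = literal P n ⇒ implications P n φ

    module _ (M : Structure L-E) where
      open Structure M

      Matches : (ℕ → Set) → ℕ → (Fin 0 → Carrier) → Set
      Matches P q ρ = ∀ n → n < q → (P n → Sat (class n) ρ) × (Sat (class n) ρ → P n)

      literal-sat : ∀ P n {ρ} → (P n → Sat (class n) ρ) → (Sat (class n) ρ → P n) → Sat (literal P n) ρ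
      literal-sat P n f g with em {P n}
      ... | yes p = f p
      ... | no ¬p = λ h → ¬p (g h)

      sat-literal : ∀ P n {ρ} → Sat (literal P n) ρ → (P n → Sat (class n) ρ) × (Sat (class n) ρ → P n)
      sat-literal P n h with em {P n}
      ... | yes p = (λ _ → h) , (λ _ → p)
      ... | no ¬p = (λ p → contradiction p ¬p) , (λ h′ → contradiction h′ h)

      implications⁻ : ∀ P q φ {ρ} → Sat (implications P q φ) ρ → Matches P q ρ → Sat φ ρ
      implications⁻ P zero    φ h m = h
      implications⁻ P (suc q) φ {ρ} h m = implications⁻ P q φ {ρ} (h (literal-sat P q {ρ} (proj₁ (m q ≤-refl)) (proj₂ (m q ≤-refl))))
        (λ n n<q → m n (m<n⇒m<1+n n<q))

      implications⁺ : ∀ P q φ {ρ} → (Matches P q ρ → Sat φ ρ) → Sat (implications P q φ) ρ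
      implications⁺ P zero    φ h = h λ _ ()
      implications⁺ P (suc q) φ {ρ} h l = implications⁺ P q φ {ρ} λ m → h λ n n<1+q →
        [ m n , (λ { refl → sat-literal P q {ρ} l }) ]′ (m≤n⇒m<n∨m≡n (s≤s⁻¹ n<1+q))

    Compatible : ℕ → (ℕ → Set) → Set
    Compatible q P = ∀ n → n ≤ q → (P n → ¬ InB n) × (¬ P n → ¬ InA n)

    -- Compatible truth values are realized: take the canonical structure whose classes follow P up
    -- to q and A beyond. It satisfies the axioms and the chosen literals, hence also `¬̇ φ`.
    refuted-nontheorem : ∀ q P φ → Compatible q P → Theorems Axiom (implications P q (¬̇ φ)) → ¬ Theorems Axiom φ
    refuted-nontheorem q P φ compatible t t′ =
      implications⁻ M P q (¬̇ φ) {λ ()} (theorem-sound em models t (λ ())) matches (theorem-sound em models t′ (λ ()))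
      where
      X : ℕ → Set
      X n = (n ≤ q × P n) ⊎ (¬ n ≤ q × InA n)
      M : Structure L-E
      M = canonical em X
      open Structure M
      A⊆X : ∀ n → InA n → X n
      A⊆X n h with em {n ≤ q} | em {P n}
      ... | yes n≤q | yes p = inj₁ (n≤q , p)
      ... | yes n≤q | no ¬p = contradiction h (proj₂ (compatible n n≤q) ¬p)
      ... | no n≰q  | _     = inj₂ (n≰q , h)
      B∩X : ∀ n → InB n → ¬ X n
      B∩X n h (inj₁ (n≤q , p)) = proj₁ (compatible n n≤q) p h
      B∩X n h (inj₂ (_ , h′))  = disjoint c h′ h
      models : Models Axiom
      models = keyed-models (canonical-keyed em X) A⊆X B∩X
      matches : Matches M P q (λ ())
      matches n n<q = (λ p → Keyed.keyed-class⁺ (canonical-keyed em X) n {λ ()} (inj₁ (<⇒≤ n<q , p))) ,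
        λ h → [ proj₂ , (λ (n≰q , _) → contradiction (<⇒≤ n<q) n≰q) ]′ (Keyed.keyed-class⁻ (canonical-keyed em X) n {λ ()} h)

    -- P consists of the truth values of the class sentences in a countermodel of φ. A model of the
    -- axioms with the same values below the depth of φ is indistinguishable from it by φ, so the
    -- implication is valid, and completeness gives a proof.
    nontheorem-refuted : ∀ φ → ¬ Theorems Axiom φ → Σ[ P ∈ (ℕ → Set) ] ((∀ q → Compatible q P) × Theorems Axiom (implications P (depth φ) (¬̇ φ)))
    nontheorem-refuted φ ¬t with M , models , ¬φ ← Henkin.countermodel em Axiom φ ¬t =
      P , (λ q n _ → (λ p b → B-false n b p) , (λ ¬p a → ¬p (Structure.theorem-sound M em models (A-theorem a) (λ ())))) ,
      Henkin.completeness em Axiom _ λ N modelsN ρ → implications⁺ N P (depth φ) (¬̇ φ) {ρ} λ m s →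
        ¬φ (λ ()) (agreeing φ N M modelsN models (λ n n<q → (λ h → proj₂ (m n n<q) (closed N (class n) h)) , (λ p → closed N (class n) (proj₁ (m n n<q) p))) {ρ} s)
      where
      P : ℕ → Set
      P n = Structure.Sat M (class n) (λ ())
      closed : ∀ N (φ : Sentence L-E) {ρ π} → Structure.Sat N φ ρ → Structure.Sat N φ π
      closed N φ = Structure.Sat-≡ N (λ ()) φ
      B-false : ∀ n → InB n → ¬ P n
      B-false n (s , h) = Structure.theorem-sound M em models (theorems-⇒ (axiom (B-axiom n s h)) (tautology-provable (n ∙ s))) (λ ())

    literal-cong : ∀ {P Q : ℕ → Set} n → (P n → Q n) → (Q n → P n) → literal P n ≡ literal Q n
    literal-cong {P} {Q} n f g with em {P n} | em {Q n}
    ... | yes _ | yes _ = refl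
    ... | yes p | no ¬q = contradiction (f p) ¬q
    ... | no ¬p | yes q = contradiction (g q) ¬p
    ... | no _  | no _  = refl

    implications-cong : ∀ {P Q : ℕ → Set} q φ → (∀ n → n ≤ q → (P n → Q n) × (Q n → P n)) → implications P q φ ≡ implications Q q φ
    implications-cong zero    φ h = refl
    implications-cong (suc q) φ h = cong₂ _⇒_ (literal-cong q (proj₁ (h q (n≤1+n q))) (proj₂ (h q (n≤1+n q))))
      (implications-cong q φ (λ n n≤q → h n (m≤n⇒m≤1+n n≤q)))

    -- The choice of a literal is written as a sum of products with characteristic functions, so
    -- that the recursion is built from arithmetic operations.
    implicationsCode : ℕ → ℕ → ℕ → ℕ → ℕ
    implicationsCode a d zero    z = z
    implicationsCode a d (suc n) z = χ (MemberOf a d n) * (3 ∙ classCode n ∙ implicationsCode a d n z)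
                                   + χ (¬ MemberOf a d n) * (3 ∙ negation (classCode n) ∙ implicationsCode a d n z)

    implicationsCode≡ : ∀ a d q φ → formulaCode (implications (MemberOf a d) q φ) ≡ implicationsCode a d q (formulaCode φ)
    implicationsCode≡ a d zero    φ = refl
    implicationsCode≡ a d (suc n) φ = trans (cong (λ x → 3 ∙ formulaCode (literal (MemberOf a d) n) ∙ x) (implicationsCode≡ a d n φ)) (choose _)
      where
      choose : ∀ x → 3 ∙ formulaCode (literal (MemberOf a d) n) ∙ x
                   ≡ χ (MemberOf a d n) * (3 ∙ classCode n ∙ x) + χ (¬ MemberOf a d n) * (3 ∙ negation (classCode n) ∙ x)
      choose x with em {MemberOf a d n}
      ... | yes p = trans (cong (λ y → 3 ∙ y ∙ x) (classCode≡ n)) (sym (trans (cong (λ k → 1 * _ + k * _) (χ-no (λ ¬p → ¬p p)))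
                      (trans (+-identityʳ _) (*-identityˡ _))))
      ... | no ¬p = trans (cong (λ y → 3 ∙ negation y ∙ x) (classCode≡ n)) (sym (trans (cong (λ k → 0 + k * _) (χ-yes ¬p)) (*-identityˡ _)))

    implicationsFn : ∀ {O} → Fn O 4
    implicationsFn {O} = computing (λ { (q ∷ a ∷ d ∷ z ∷ []) → implicationsCode a d q z }) (rec (arg (# 2))
      (characteristic here? ⊗ (constant 3 ⊙ classFn (arg (# 0)) ⊙ arg (# 1)) ⊕ characteristic (dec-¬ here?) ⊗ (constant 3 ⊙ negationFn (classFn (arg (# 0))) ⊙ arg (# 1)))) go
      where
      here? : Decides {5} O (λ xs → MemberOf (lookup xs (# 2)) (lookup xs (# 3)) (lookup xs (# 0)))
      here? = dec-∘ decideMember (arg (# 0) ∷ arg (# 2) ∷ arg (# 3) ∷ [])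
      go : ∀ xs → _
      go (zero  ∷ a ∷ d ∷ z ∷ []) = refl
      go (suc n ∷ a ∷ d ∷ z ∷ []) = cong (λ x → χ (MemberOf a d n) * (3 ∙ classCode n ∙ x) + χ (¬ MemberOf a d n) * (3 ∙ negation (classCode n) ∙ x))
                                      (go (n ∷ a ∷ d ∷ z ∷ []))

    IsTheorem : ℕ → Set
    IsTheorem z = Σ[ φ ∈ Sentence L-E ] (Theorems Axiom φ × formulaCode φ ≡ z)

    Refusal Refutation NonTheorem : ℕ → ℕ → Set
    Refusal w z    = Holds no-param (Refuse.derivation 0) (factCode 2 (0 ∷ z ∷ 0 ∷ 0 ∷ []) ∷ w ∷ [])
    Refutation w z = Σ[ q ∈ ℕ ] (q ≤ w × Σ[ a ∈ ℕ ] (a ≤ w × Σ[ d ∈ ℕ ] (d ≤ w × Σ[ v ∈ ℕ ] (v ≤ w ×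
                       Compatible q (MemberOf a d) × ProvedBy v (implicationsCode a d q (negation z))))))
    NonTheorem w z = Refusal w z ⊎ Refutation w z

    nonTheorem-sound : ∀ {w z} → NonTheorem w z → ¬ IsTheorem z
    nonTheorem-sound {w} (inj₁ r) (φ , _ , refl) = nonFormula-sound (Refuse.derivation-sound {v = 0 ∷ formulaCode φ ∷ 0 ∷ 0 ∷ []} {w} r) φ refl
    nonTheorem-sound (inj₂ (q , _ , a , _ , d , _ , v , _ , compatible , p)) (φ , t , refl) =
      refuted-nontheorem q (MemberOf a d) φ compatible (proved⇒theorem (implications (MemberOf a d) q (¬̇ φ))
        (Eq.subst (ProvedBy v) (sym (implicationsCode≡ a d q (¬̇ φ))) p)) t

    nonTheorem-complete : ∀ z → ¬ IsTheorem z → Σ[ w ∈ ℕ ] NonTheorem w z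
    nonTheorem-complete z ¬t with formula-or-nonFormula 0 z
    ... | inj₂ r = let w , h = Refuse.derivation-complete r in w , inj₁ h
    ... | inj₁ (φ , refl) = w , inj₂ (q , ≤₁ , a , ≤₂ , d , ≤₃ , v , ≤₄ , compatible′ , Eq.subst (ProvedBy v) (implicationsCode≡ a d q (¬̇ φ)) (proj₂ proof))
      where
      q : ℕ
      q = depth φ
      certificate = nontheorem-refuted φ (λ t → ¬t (φ , t , refl))
      P = proj₁ certificate
      compatible = proj₁ (proj₂ certificate)
      coded = setCode P q
      a = proj₁ coded
      d = proj₁ (proj₂ coded)
      member : ∀ {p} → p ≤ q → (P p → MemberOf a d p) × (MemberOf a d p → P p)
      member = proj₂ (proj₂ coded)
      proof = theorem⇒proved (Eq.subst (Theorems Axiom) (implications-cong q (¬̇ φ) (λ n → member)) (proj₂ (proj₂ certificate)))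
      v = proj₁ proof
      compatible′ : Compatible q (MemberOf a d)
      compatible′ n n≤q = (λ m → proj₁ (compatible q n n≤q) (proj₂ (member n≤q) m)) , (λ ¬m → proj₂ (compatible q n n≤q) (¬m ∘ proj₁ (member n≤q)))
      w : ℕ
      w = (q + a) + (d + v)
      ≤₁ : q ≤ w
      ≤₁ = ≤-trans (m≤m+n q a) (m≤m+n (q + a) (d + v))
      ≤₂ : a ≤ w
      ≤₂ = ≤-trans (m≤n+m a q) (m≤m+n (q + a) (d + v))
      ≤₃ : d ≤ w
      ≤₃ = ≤-trans (m≤m+n d v) (m≤n+m (d + v) (q + a))
      ≤₄ : v ≤ w
      ≤₄ = ≤-trans (m≤n+m v d) (m≤n+m (d + v) (q + a))

    -- The oracle is consulted only about A and B up to q, in the test of compatibility. Proofs and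
    -- refusals are checked recursively.
    theorems≤ᵀ : ∀ {O} → W c ≤ᵀ O → gödelNumbers (Theorems Axiom) ≤ᵀ O
    theorems≤ᵀ {O} red = gödel-map (decides-by-search (decideProved em decideParam)
      (dec-⊎ (dec-∘ (decideBounded em (λ ()) (Refuse.derivation 0)) ((constant 2 ⊙ constant 0 ⊙ arg (# 1) ⊙ constant 0 ⊙ constant 0) ∷ arg (# 0) ∷ []))
        (dec-∃≤ (dec-∃≤ (dec-∃≤ (dec-∃≤ (dec-× decideCompatible
          (dec-∘ (decideProved em decideParam) (arg (# 0) ∷ (implicationsFn ⊚ (arg (# 3) ∷ arg (# 2) ∷ arg (# 1) ∷ negationFn (arg (# 5)) ∷ [])) ∷ [])))
          (arg (# 3))) (arg (# 2))) (arg (# 1))) (arg (# 0))))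
      (λ { {w} {z ∷ []} p → let φ , eq , t = derivable-theorem (Prove.derivation-sound {v = z ∷ 0 ∷ 0 ∷ 0 ∷ []} p) in φ , t , eq })
      (λ { {w} {z ∷ []} → nonTheorem-sound {w} {z} })
      (λ { (z ∷ []) (φ , t , refl) → theorem⇒proved t })
      (λ { (z ∷ []) → nonTheorem-complete z }))
      where
      decideCompatible : Decides {6} O (λ xs → Compatible (lookup xs (# 3)) (MemberOf (lookup xs (# 2)) (lookup xs (# 1))))
      decideCompatible = dec-∀≤ (dec-× (dec-→ member? (dec-¬ (dec-∘ (≤ᵀ⇒decides (SetB≤ᵀ c red)) (arg (# 0) ∷ []))))
                                       (dec-→ (dec-¬ member?) (dec-¬ (dec-∘ (≤ᵀ⇒decides (SetA≤ᵀ c red)) (arg (# 0) ∷ []))))) (arg (# 3))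
        where
        member? : Decides {7} O (λ xs → MemberOf (lookup xs (# 3)) (lookup xs (# 2)) (lookup xs (# 0)))
        member? = dec-∘ decideMember (arg (# 0) ∷ arg (# 3) ∷ arg (# 2) ∷ [])

    -- The sentence `class n` is a theorem exactly for n in A, and its code is computable from n; so
    -- A, and with it `W c`, reduces to the theorems.
    ≤ᵀtheorems : W c ≤ᵀ gödelNumbers (Theorems Axiom)
    ≤ᵀtheorems = W≤ᵀSetA c (decides⇒≤ᵀ (dec-map (λ { (n ∷ []) (φ , t , eq) → theorem-A (Eq.subst (Theorems Axiom) (same n φ eq) t) })
        (λ { (n ∷ []) h → class n , A-theorem h , trans (sym (formulaCode≡ (class n))) (classCode≡ n) })
        (dec-∘ (oracle-decides (gödelNumbers (Theorems Axiom))) (classFn (arg (# 0)) ∷ []))))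
      where
      same : ∀ n φ → ⌜ φ ⌝ ≡ classCode n → φ ≡ class n
      same n φ eq = formulaCode-injective φ (class n) (trans (formulaCode≡ φ) (trans eq (sym (classCode≡ n))))

open TheDegree

-- Axiom sets of arbitrary degree

module Padded (em : ExcludedMiddle 0ℓ) (c : Code 1) (d : Pred ℕ 0ℓ) where
  open Deciding em
  open Construction em c

  PaddedAxiom : Pred (Sentence L-E) 0ℓ
  PaddedAxiom φ = Axiom φ ⊎ Σ[ n ∈ ℕ ] (d n × φ ≡ tautology n)

  padded⊆theorems : ∀ {φ} → PaddedAxiom φ → Theorems Axiom φ
  padded⊆theorems (inj₁ ax)            = axiom ax
  padded⊆theorems (inj₂ (n , _ , refl)) = tautology-provable n

  private
    -- To read d off the axiom set, the added sentences must not be axioms already. The antecedent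
    -- of a tautology is `⊥̇`, with tag 2; that of a padded axiom is a whole tautology, an
    -- implication. The remaining axioms are quantified and receive the default 0.
    antecedentTag : Sentence L-E → ℕ
    antecedentTag (φ ⇒ ψ) = formulaTag φ
    antecedentTag _       = 0

    tautology-antecedent : ∀ n → antecedentTag (tautology n) ≡ 2
    tautology-antecedent zero    = refl
    tautology-antecedent (suc n) = refl

    axiom-antecedent : ∀ {φ} → Axiom φ → antecedentTag φ ≢ 2
    axiom-antecedent (unique-axiom zero)    = λ ()
    axiom-antecedent (unique-axiom (suc n)) = λ ()
    axiom-antecedent (A-axiom n s _) with n ∙ s
    ... | zero  = λ ()
    ... | suc _ = λ ()
    axiom-antecedent (B-axiom n s _) with n ∙ s
    ... | zero  = λ ()
    ... | suc _ = λ ()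

    padded⁻ : ∀ {n} φ → PaddedAxiom φ → ⌜ φ ⌝ ≡ tautologyCode n → d n
    padded⁻ {n} φ ax eq with refl ← formulaCode-injective φ (tautology n) (trans (formulaCode≡ φ) eq) with ax
    ... | inj₁ ax′ = contradiction (tautology-antecedent n) (axiom-antecedent ax′)
    ... | inj₂ (m , dm , eq′) = Eq.subst d (sym (tautologyCode-injective n m (cong formulaCode eq′))) dm

  padded≡ᵀ : gödelNumbers PaddedAxiom ≡ᵀ d
  padded≡ᵀ =
      gödel-map (dec-map (λ { (z ∷ []) (inj₁ (φ , ax , eq)) → φ , inj₁ ax , eq
                           ; (z ∷ []) (inj₂ (n , _ , eq , dn)) → tautology n , inj₂ (n , dn , refl) , sym eq })
                         (λ { (z ∷ []) (φ , inj₁ ax , eq) → inj₁ (φ , ax , eq)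
                           ; (z ∷ []) (_ , inj₂ (n , dn , refl) , eq) →
                               inj₂ (n , ≤-trans (s≤tautologyCode n) (≤-reflexive eq) , sym eq , dn) })
        (dec-⊎ decideAxiom (dec-∃≤ (dec-× (dec-≡ (arg (# 1)) (tautologyFn (arg (# 0)))) (dec-∘ (oracle-decides d) (arg (# 0) ∷ []))) (arg (# 0)))))
    , decides⇒≤ᵀ (dec-map (λ { (n ∷ []) (φ , ax , eq) → padded⁻ φ ax eq })
                          (λ { (n ∷ []) dn → tautology n , inj₂ (n , dn , refl) , sym (formulaCode≡ (tautology n)) })
        (dec-∘ (oracle-decides (gödelNumbers PaddedAxiom)) (tautologyFn (arg (# 0)) ∷ [])))

mainTheorem10 : ExcludedMiddle 0ℓ →
    (d : Pred ℕ 0ℓ) → ∅ <ᵀ d → d <ᵀ (∅ ′) →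
    Σ[ U ∈ Theory ] (G1HoldsFor U × U InterpretableIn R × degree U ≡ᵀ d × (HasREDegree d → DeductivelyClosed U))
mainTheorem10 em d (_ , d≰∅) _ with em {HasREDegree d}
... | yes (c , d≤W , W≤d) = U.theory , U.g1 nonrecursive , U.interpretable-in-R ,
      (theorems≤ᵀ W≤d , ≤ᵀ-trans ≤ᵀtheorems d≤W) , λ _ φ → U.from-U
  where
  nonrecursive : ¬ Recursive (W c)
  nonrecursive W≤∅ = d≰∅ (≤ᵀ-trans W≤∅ d≤W)
  open Construction em c
  open Degree em c nonrecursive
  module U = Between (Theorems Axiom) axiom id
-- The axioms themselves form a recursive set, so the degree of the padded set comes from d alone,
-- and the halting problem can serve as W.
... | no no-re-degree = U.theory , U.g1 diagonal-nonrecursive , U.interpretable-in-R ,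
      padded≡ᵀ , λ re-degree → contradiction re-degree no-re-degree
  where
  open Inseparability em using (diagonal; diagonal-nonrecursive)
  open Construction em diagonal
  open Padded em diagonal d
  module U = Between PaddedAxiom inj₁ padded⊆theorems
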